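{- Let $k\ge 2$ and $\delta>1/2$ be fixed. For every $\varepsilon>0$ there is $n_0$ such that every $k$-uniform hypergraph $G$ on $n\ge n_0$ vertices with $\delta_{k-1}(G)\ge\delta n$ contains at least $(\delta-\varepsilon)^n\, n!$ tight Hamilton cycles. That is, $G$ contains at least $(\delta-o(1))^n n!$ tight Hamilton cycles.
   Context: A $k$-uniform hypergraph $G$ has edges that are $k$-element subsets of $V(G)$. For a $(k-1)$-subset $S\subseteq V(G)$, its degree is the number of vertices $v$ with $S\cup\{v\}\in E(G)$; $\delta_{k-1}(G)$ is the minimum such degree. A tight Hamilton cycle of $G$ is a cyclic ordering of $V(G)$ (considered up to cyclic rotation and reversal) in which every $k$ cyclically consecutive vertices form an edge of $G$.
   Formalization: It is assumed that ε < δ, since for ε > δ+1 and even n the bound (δ−ε)^n n! exceeds the number of all cyclic orderings; δ and ε are taken rational, from which the case of real δ and ε follows by choosing slightly smaller rational values. -}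

module Defs where

open import Data.Nat as ℕ using (ℕ; zero; suc; _∸_)
open import Data.Nat.DivMod using (_mod_)
open import Data.Fin as Fin using (Fin; toℕ)
open import Data.Fin.Subset using (Subset; ⁅_⁆; _∪_; ∣_∣; ⊥)
open import Data.Vec as Vec using (Vec; []; _∷_; lookup)
open import Data.List as List using (List; [_]; concatMap; allFin; upTo; filterᵇ; length; foldr)
open import Data.Bool.ListAction using (all)
open import Data.Bool using (Bool; T; not; _∧_; _∨_)
open import Data.Integer using (+_)
open import Data.Rational as ℚ using (ℚ; _*_; 1ℚ; 0ℚ)
open import Relation.Binary.PropositionalEquality using (_≡_)
open import Relation.Nullary.Decidable using (⌊_⌋)

record Hypergraph (k n : ℕ) : Set where
  field
    isEdge  : Subset n → Bool
    uniform : ∀ (e : Subset n) → T (isEdge e) → ∣ e ∣ ≡ k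
open Hypergraph public

-- Degree of a set S: number of vertices v with S ∪ {v} ∈ E(G).
-- (For |S| = k-1, v ∈ S gives S ∪ {v} = S of size k-1, never an edge.)
degree : ∀ {k n} → Hypergraph k n → Subset n → ℕ
degree {n = n} G S = length (filterᵇ (λ v → isEdge G (S ∪ ⁅ v ⁆)) (allFin n))

_^ℚ_ : ℚ → ℕ → ℚ
q ^ℚ zero  = 1ℚ
q ^ℚ suc m = q * (q ^ℚ m)

toℚ : ℕ → ℚ
toℚ m = (+ m) ℚ./ 1

allVecs : ∀ {n} (m : ℕ) → List (Vec (Fin n) m)
allVecs {n} zero    = [ [] ]
allVecs {n} (suc m) = concatMap (λ x → List.map (x ∷_) (allVecs m)) (allFin n)

injectiveᵇ : ∀ {n m} → Vec (Fin n) m → Bool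
injectiveᵇ {n} {m} v =
  all (λ i → all (λ j → ⌊ i Fin.≟ j ⌋ ∨ not ⌊ lookup v i Fin.≟ lookup v j ⌋) (allFin m)) (allFin m)

window : ∀ (k m : ℕ) → Vec (Fin (suc m)) (suc m) → Fin (suc m) → Subset (suc m)
window k m v i = foldr (λ t acc → ⁅ lookup v ((toℕ i ℕ.+ t) mod suc m) ⁆ ∪ acc) ⊥ (upTo k)

tightᵇ : ∀ {k m} → Hypergraph k (suc m) → Vec (Fin (suc m)) (suc m) → Bool
tightᵇ {k} {m} G v = all (λ i → isEdge G (window k m v i)) (allFin (suc m))

numTightOrderings : ∀ {k n} → Hypergraph k n → ℕ
numTightOrderings {n = zero}  G = 0
numTightOrderings {n = suc m} G =
  length (filterᵇ (λ v → injectiveᵇ v ∧ tightᵇ G v) (allVecs (suc m)))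

-- Number of tight Hamilton cycles: cyclic orderings up to rotation and
-- reversal.  The dihedral group of order 2n acts freely on the orderings
-- (for n ≥ 3), so this is numTightOrderings / 2n.  (Set to 0 for n = 0.)
numTightHamCycles : ∀ {k n} → Hypergraph k n → ℚ
numTightHamCycles {n = zero}  G = 0ℚ
numTightHamCycles {n = suc m} G = (+ numTightOrderings G) ℚ./ (2 ℕ.* suc m)

{-# OPTIONS --safe #-}
module Submission where

open import Defs
open import Data.Nat as ℕ using (ℕ; zero; suc; _≤_; _∸_; _!)
import Data.Nat.Properties as ℕₚ
open import Data.Nat.DivMod using (_%_; _mod_; [m+n]%n≡m%n; m<n⇒m%n≡m)
import Data.Nat.Tactic.RingSolver as ℕ-Solver
import Data.Integer as ℤ
import Data.Integer.Properties as ℤₚ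
open import Data.Rational as ℚ using (ℚ; 0ℚ; 1ℚ; ½; _+_; _*_; -_; _-_; _<_; 1/_; _⊓_) renaming (_≤_ to _≤ℚ_)
import Data.Rational.Properties as ℚₚ
open import Data.Rational.Unnormalised as ℚᵘ using (mkℚᵘ)
import Data.Rational.Unnormalised.Properties as ℚᵘₚ
open import Data.Bool using (Bool; true; false; not; _∧_; _∨_; if_then_else_; T)
import Data.Bool.Properties as Boolₚ
open import Data.Bool.ListAction using (all)
open import Data.Empty using (⊥-elim)
open import Data.Fin as Fin using (Fin; toℕ)
import Data.Fin.Properties as Finₚ
open import Data.Fin.Subset using (Subset; ⁅_⁆; _∪_; ∣_∣) renaming (⊥ to ∅)
import Data.Fin.Subset.Properties as Subsetₚ
open import Data.List using (List; []; _∷_; [_]; _++_; length; map; concatMap; reverse; take; drop; foldr; filterᵇ; replicate; allFin; tabulate; upTo; applyUpTo)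
import Data.List.Properties as Lₚ
open import Data.List.Membership.Propositional using (_∈_)
open import Data.List.Membership.Propositional.Properties using (∈-allFin)
open import Data.List.Relation.Unary.All as All using (All; []; _∷_)
import Data.List.Relation.Unary.All.Properties as Allₚ
open import Data.List.Relation.Unary.AllPairs using (AllPairs; []; _∷_)
open import Data.List.Relation.Unary.Any using (here; there)
import Data.List.Relation.Unary.Sorted.TotalOrder.Properties as Sortedₚ
import Data.List.Sort as Sort
open import Data.List.Relation.Binary.Permutation.Propositional as Perm using (_↭_; ↭-sym; ↭-trans; ↭-refl)
import Data.List.Relation.Binary.Permutation.Propositional.Properties as Permₚ
open import Data.Product using (Σ; ∃; _×_; _,_; proj₁; proj₂)
open import Data.Sum using (_⊎_; inj₁; inj₂)
open import Data.Vec as Vec using (Vec; lookup; toList)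
import Data.Vec.Properties as Vecₚ
open import Function using (_∘_; id)
open import Relation.Binary.Bundles using (DecTotalOrder)
import Relation.Binary.Construct.On as On
open import Relation.Binary.PropositionalEquality hiding ([_])
open import Relation.Nullary using (Dec; yes; no; ¬_; does)
open import Relation.Nullary.Decidable using (⌊_⌋; dec⇒maybe; from-yes)
open import Tactic.RingSolver using (solve-∀)
open import Tactic.RingSolver.Core.AlmostCommutativeRing using (AlmostCommutativeRing; fromCommutativeRing)

-- Fix δ₁ with max(1/2, δ − ε) < δ₁ < δ.  Grow a tight path vertex by vertex inside a random sequence of distinct
-- vertices, and let ρ S y be the number of ways in which a walk from its end S can continue inside the m vertices of y
-- until m₀ of them are left and then succeed, divided by the product of the r(m) ≈ δ₁ m.  Between two random m-sets all
-- degrees of the non-edge graph are at most d = m − r < m/2 up to an exponentially small tail, and for such bipartite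
-- graphs  ∑_u 1 / (r⁻¹ ∑_{v not adjacent to u} ρ(v) + l) ≤ ∑_v 1 / (ρ(v) + l).  Hence the mean of 1 / (ρ + l) hardly
-- increases with m, and typical S and y carry at least c ∏ r(m) walks: no entropy is lost.
-- Two such walks leave a common (k − 1)-tuple in opposite directions.  Their last m₀ vertices contain chunks that
-- connect them to the two ends of a path set aside beforehand, and this path absorbs the vertices left over, which
-- gives δ₁^n n! / n^O(1) tight Hamilton cycles.

-- A bound on the mean of ρ would not do, since few pairs (S, y) could carry it. The convex function
-- 1 / (ρ + l) punishes small ρ and never exceeds 1 / l, so a bound on its mean makes ρ of constant
-- order for most pairs. Its mean can be followed without a factor lost per step because a step
-- forgets the oldest vertex: for S = u ∷ T, the weight after a step to v depends on T, v and the
-- rest of y, but not on u. For fixed T the step is a bipartite graph between candidates u and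
-- candidates v, weighted on the side of v alone. The inequality for such graphs needs d ≤ r, which
-- is how δ₁ ≥ 1/2 enters the count. The price is that u has to range over a second random m-set
-- disjoint from y, so about 2m vertices must be at hand for a walk inside m of them. One walk can
-- fill only half of the vertex set, whence two of them. No logarithm occurs: probabilities are
-- weighted sums of rationals, tails come from factorial moments, and convexity is always an
-- explicit tangent inequality.

ℚ-ring : AlmostCommutativeRing _ _
ℚ-ring = fromCommutativeRing ℚₚ.+-*-commutativeRing (λ x → dec⇒maybe (0ℚ ℚ.≟ x))

-- Ordered fields

*-nonneg : ∀ {x y} → 0ℚ ≤ℚ x → 0ℚ ≤ℚ y → 0ℚ ≤ℚ x * y
*-nonneg {x} {y} p q = ℚₚ.nonNegative⁻¹ (x * y)
  {{ℚₚ.nonNeg*nonNeg⇒nonNeg x {{ℚ.nonNegative p}} y {{ℚ.nonNegative q}}}}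

+-nonneg : ∀ {x y} → 0ℚ ≤ℚ x → 0ℚ ≤ℚ y → 0ℚ ≤ℚ x + y
+-nonneg p q = ℚₚ.+-mono-≤ p q

*-pos : ∀ {x y} → 0ℚ < x → 0ℚ < y → 0ℚ < x * y
*-pos {x} {y} p q = ℚₚ.positive⁻¹ (x * y) {{ℚₚ.pos*pos⇒pos x {{ℚ.positive p}} y {{ℚ.positive q}}}}

+-pos : ∀ {x y} → 0ℚ < x → 0ℚ ≤ℚ y → 0ℚ < x + y
+-pos p q = ℚₚ.+-mono-<-≤ p q

diff≥0 : ∀ {a b} → a ≤ℚ b → 0ℚ ≤ℚ b - a
diff≥0 {a} {b} p = subst (_≤ℚ b - a) (ℚₚ.+-inverseʳ a) (ℚₚ.+-monoˡ-≤ (- a) p)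

diff>0 : ∀ {a b} → a < b → 0ℚ < b - a
diff>0 {a} {b} p = subst (_< b - a) (ℚₚ.+-inverseʳ a) (ℚₚ.+-monoˡ-< (- a) p)

private
  add-diff : ∀ a b → a + (b - a) ≡ b
  add-diff = solve-∀ ℚ-ring

≤-by : ∀ {a b c} → b - a ≡ c → 0ℚ ≤ℚ c → a ≤ℚ b
≤-by {a} {b} {c} e p = subst₂ _≤ℚ_ (ℚₚ.+-identityʳ a) (add-diff a b)
  (ℚₚ.+-monoʳ-≤ a (subst (0ℚ ≤ℚ_) (sym e) p))

<-by : ∀ {a b c} → b - a ≡ c → 0ℚ < c → a < b
<-by {a} {b} {c} e p = subst₂ _<_ (ℚₚ.+-identityʳ a) (add-diff a b)
  (ℚₚ.+-monoʳ-< a (subst (0ℚ <_) (sym e) p))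

*-monoˡ : ∀ {c a b} → 0ℚ ≤ℚ c → a ≤ℚ b → c * a ≤ℚ c * b
*-monoˡ {c} p q = ℚₚ.*-monoˡ-≤-nonNeg c {{ℚ.nonNegative p}} q

*-monoʳ : ∀ {c a b} → 0ℚ ≤ℚ c → a ≤ℚ b → a * c ≤ℚ b * c
*-monoʳ {c} p q = ℚₚ.*-monoʳ-≤-nonNeg c {{ℚ.nonNegative p}} q

*-mono : ∀ {a b c d} → 0ℚ ≤ℚ a → 0ℚ ≤ℚ d → a ≤ℚ b → c ≤ℚ d → a * c ≤ℚ b * d
*-mono p q r s = ℚₚ.≤-trans (*-monoˡ p s) (*-monoʳ q r)

*-cancelˡ : ∀ {c a b} → 0ℚ < c → c * a ≤ℚ c * b → a ≤ℚ b
*-cancelˡ {c} p q = ℚₚ.*-cancelˡ-≤-pos c {{ℚ.positive p}} q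

sq≥0 : ∀ x → 0ℚ ≤ℚ x * x
sq≥0 x with ℚₚ.≤-total 0ℚ x
... | inj₁ p = *-nonneg p p
... | inj₂ p = subst (0ℚ ≤ℚ_) (neg-sq x) (*-nonneg q q)
  where
  q : 0ℚ ≤ℚ - x
  q = ℚₚ.neg-antimono-≤ p
  neg-sq : ∀ x → - x * - x ≡ x * x
  neg-sq = solve-∀ ℚ-ring

0≤1 : 0ℚ ≤ℚ 1ℚ
0≤1 = ℚₚ.nonNegative⁻¹ 1ℚ

0<1 : 0ℚ < 1ℚ
0<1 = ℚₚ.positive⁻¹ 1ℚ

abstract
  -- Total, with value 0 at 0, so that formulas need no nonzero argument; abstract, so that it stays
  -- an atom in the ring identities.
  inv : ℚ → ℚ
  inv x with x ℚ.≟ 0ℚ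
  ... | yes _ = 0ℚ
  ... | no ne = 1/_ x {{ℚ.≢-nonZero ne}}

  *-inv : ∀ {x} → 0ℚ < x → x * inv x ≡ 1ℚ
  *-inv {x} p with x ℚ.≟ 0ℚ
  ... | yes e = ⊥-elim (ℚₚ.<-irrefl (sym e) p)
  ... | no ne = ℚₚ.*-inverseʳ x {{ℚ.≢-nonZero ne}}

  inv>0 : ∀ {x} → 0ℚ < x → 0ℚ < inv x
  inv>0 {x} p with x ℚ.≟ 0ℚ
  ... | yes e = ⊥-elim (ℚₚ.<-irrefl (sym e) p)
  ... | no ne = ℚₚ.positive⁻¹ _ {{ℚₚ.1/pos⇒pos x {{ℚ.positive p}}}}

inv-* : ∀ {x} → 0ℚ < x → inv x * x ≡ 1ℚ
inv-* {x} p = trans (ℚₚ.*-comm (inv x) x) (*-inv p)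

inv≥0 : ∀ {x} → 0ℚ < x → 0ℚ ≤ℚ inv x
inv≥0 p = ℚₚ.<⇒≤ (inv>0 p)

*-cancelˡ-≡ : ∀ {c a b} → 0ℚ < c → c * a ≡ c * b → a ≡ b
*-cancelˡ-≡ p e = ℚₚ.≤-antisym (*-cancelˡ p (ℚₚ.≤-reflexive e)) (*-cancelˡ p (ℚₚ.≤-reflexive (sym e)))

inv-unique : ∀ {x y} → 0ℚ < x → x * y ≡ 1ℚ → y ≡ inv x
inv-unique p e = *-cancelˡ-≡ p (trans e (sym (*-inv p)))

private
  tangent-id : ∀ a i t → i - ((1ℚ + 1ℚ) * t - a * (t * t))
               ≡ i * ((1ℚ - a * t) * (1ℚ - a * t)) + (i * a - 1ℚ) * ((1ℚ + 1ℚ) * t - a * (t * t))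
  tangent-id = solve-∀ ℚ-ring
  one-minus : ∀ x → (1ℚ - 1ℚ) * x ≡ 0ℚ
  one-minus = solve-∀ ℚ-ring

2ℚ : ℚ
2ℚ = 1ℚ + 1ℚ

-- For t ≠ 0 the left side is the tangent of 1 / a at the point 1 / t, and the gap is `inv a` times
-- (1 - a t)². Harmonic mean bounds below arise by adding instances with one common t.
inv-tangent : ∀ {a} t → 0ℚ < a → 2ℚ * t - a * (t * t) ≤ℚ inv a
inv-tangent {a} t p = ≤-by eq (*-nonneg (inv≥0 p) (sq≥0 (1ℚ - a * t)))
  where
  eq : inv a - (2ℚ * t - a * (t * t)) ≡ inv a * ((1ℚ - a * t) * (1ℚ - a * t))
  eq = trans (tangent-id a (inv a) t)
    (trans (cong (λ z → inv a * ((1ℚ - a * t) * (1ℚ - a * t)) + (z - 1ℚ) * (2ℚ * t - a * (t * t))) (inv-* p))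
    (trans (cong ((inv a * ((1ℚ - a * t) * (1ℚ - a * t))) +_) (one-minus (2ℚ * t - a * (t * t))))
      (ℚₚ.+-identityʳ _)))

inv-anti : ∀ {a b} → 0ℚ < a → a ≤ℚ b → inv b ≤ℚ inv a
inv-anti {a} {b} p q = *-cancelˡ p (subst₂ _≤ℚ_ refl (sym (*-inv p))
  (*-cancelˡ 0<b (subst₂ _≤ℚ_ e (sym (ℚₚ.*-identityʳ b)) q)))
  where
  0<b : 0ℚ < b
  0<b = ℚₚ.<-≤-trans p q
  swap : ∀ a b i → b * (a * i) ≡ (b * i) * a
  swap = solve-∀ ℚ-ring
  e : a ≡ b * (a * inv b)
  e = sym (trans (swap a b (inv b)) (trans (cong (_* a) (*-inv 0<b)) (ℚₚ.*-identityˡ a)))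

-- Finite sums

∑ : ∀ {a} {A : Set a} → List A → (A → ℚ) → ℚ
∑ [] f = 0ℚ
∑ (x ∷ xs) f = f x + ∑ xs f

module _ {a} {A : Set a} where

  ∑-cong : ∀ (xs : List A) {f g : A → ℚ} → (∀ x → f x ≡ g x) → ∑ xs f ≡ ∑ xs g
  ∑-cong [] e = refl
  ∑-cong (x ∷ xs) e = cong₂ _+_ (e x) (∑-cong xs e)

  ∑-mono-All : ∀ {xs : List A} {f g : A → ℚ} → All (λ x → f x ≤ℚ g x) xs → ∑ xs f ≤ℚ ∑ xs g
  ∑-mono-All [] = ℚₚ.≤-refl
  ∑-mono-All (p ∷ ps) = ℚₚ.+-mono-≤ p (∑-mono-All ps)

  ∑-cong-All : ∀ {xs : List A} {f g : A → ℚ} → All (λ x → f x ≡ g x) xs → ∑ xs f ≡ ∑ xs g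
  ∑-cong-All [] = refl
  ∑-cong-All (p ∷ ps) = cong₂ _+_ p (∑-cong-All ps)

  ∑-mono : ∀ (xs : List A) {f g : A → ℚ} → (∀ x → f x ≤ℚ g x) → ∑ xs f ≤ℚ ∑ xs g
  ∑-mono [] e = ℚₚ.≤-refl
  ∑-mono (x ∷ xs) e = ℚₚ.+-mono-≤ (e x) (∑-mono xs e)

  ∑-0 : ∀ (xs : List A) → ∑ xs (λ _ → 0ℚ) ≡ 0ℚ
  ∑-0 [] = refl
  ∑-0 (x ∷ xs) = trans (ℚₚ.+-identityˡ _) (∑-0 xs)

  ∑-nonneg : ∀ (xs : List A) {f : A → ℚ} → (∀ x → 0ℚ ≤ℚ f x) → 0ℚ ≤ℚ ∑ xs f
  ∑-nonneg xs {f} p = subst (_≤ℚ ∑ xs f) (∑-0 xs) (∑-mono xs p)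

  private
    interchange : ∀ a b c d → (a + b) + (c + d) ≡ (a + c) + (b + d)
    interchange = solve-∀ ℚ-ring

  ∑-+ : ∀ (xs : List A) (f g : A → ℚ) → ∑ xs (λ x → f x + g x) ≡ ∑ xs f + ∑ xs g
  ∑-+ [] f g = sym (ℚₚ.+-identityˡ 0ℚ)
  ∑-+ (x ∷ xs) f g = trans (cong ((f x + g x) +_) (∑-+ xs f g)) (interchange (f x) (g x) (∑ xs f) (∑ xs g))

  ∑-*ˡ : ∀ (xs : List A) c (f : A → ℚ) → ∑ xs (λ x → c * f x) ≡ c * ∑ xs f
  ∑-*ˡ [] c f = sym (ℚₚ.*-zeroʳ c)
  ∑-*ˡ (x ∷ xs) c f = trans (cong ((c * f x) +_) (∑-*ˡ xs c f)) (sym (ℚₚ.*-distribˡ-+ c (f x) (∑ xs f)))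

  ∑-*ʳ : ∀ (xs : List A) c (f : A → ℚ) → ∑ xs (λ x → f x * c) ≡ ∑ xs f * c
  ∑-*ʳ xs c f = trans (∑-cong xs (λ x → ℚₚ.*-comm (f x) c)) (trans (∑-*ˡ xs c f) (ℚₚ.*-comm c _))

  private
    minus-as-* : ∀ a b → a - b ≡ a + (- 1ℚ) * b
    minus-as-* = solve-∀ ℚ-ring

  ∑-minus : ∀ (xs : List A) (f g : A → ℚ) → ∑ xs (λ x → f x - g x) ≡ ∑ xs f - ∑ xs g
  ∑-minus xs f g = trans (∑-cong xs (λ x → minus-as-* (f x) (g x)))
    (trans (∑-+ xs f _) (trans (cong (∑ xs f +_) (∑-*ˡ xs (- 1ℚ) g)) (sym (minus-as-* (∑ xs f) (∑ xs g)))))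

  ∑-++ : ∀ (xs ys : List A) (f : A → ℚ) → ∑ (xs ++ ys) f ≡ ∑ xs f + ∑ ys f
  ∑-++ [] ys f = sym (ℚₚ.+-identityˡ _)
  ∑-++ (x ∷ xs) ys f = trans (cong (f x +_) (∑-++ xs ys f)) (sym (ℚₚ.+-assoc (f x) _ _))

  ∑-↭ : ∀ {xs ys : List A} (f : A → ℚ) → xs ↭ ys → ∑ xs f ≡ ∑ ys f
  ∑-↭ f Perm.refl = refl
  ∑-↭ f (Perm.prep x p) = cong (f x +_) (∑-↭ f p)
  ∑-↭ f (Perm.swap {xs} {ys} x y p) =
    trans (sym (ℚₚ.+-assoc (f x) (f y) _)) (trans (cong₂ _+_ (ℚₚ.+-comm (f x) (f y)) (∑-↭ f p)) (ℚₚ.+-assoc (f y) (f x) _))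
  ∑-↭ f (Perm.trans p q) = trans (∑-↭ f p) (∑-↭ f q)

∑-map : ∀ {a b} {A : Set a} {B : Set b} (h : A → B) (xs : List A) (f : B → ℚ) → ∑ (map h xs) f ≡ ∑ xs (f ∘ h)
∑-map h [] f = refl
∑-map h (x ∷ xs) f = cong (f (h x) +_) (∑-map h xs f)

∑-concatMap : ∀ {a b} {A : Set a} {B : Set b} (h : A → List B) (xs : List A) (f : B → ℚ) →
  ∑ (concatMap h xs) f ≡ ∑ xs (λ x → ∑ (h x) f)
∑-concatMap h [] f = refl
∑-concatMap h (x ∷ xs) f = trans (∑-++ (h x) (concatMap h xs) f) (cong (∑ (h x) f +_) (∑-concatMap h xs f))

∑-comm : ∀ {a b} {A : Set a} {B : Set b} (xs : List A) (ys : List B) (f : A → B → ℚ) →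
  ∑ xs (λ x → ∑ ys (f x)) ≡ ∑ ys (λ y → ∑ xs (λ x → f x y))
∑-comm [] ys f = sym (∑-0 ys)
∑-comm (x ∷ xs) ys f = trans (cong (∑ ys (f x) +_) (∑-comm xs ys f)) (sym (∑-+ ys (f x) _))

∑-≥-avg : ∀ {a} {A : Set a} (x : A) (xs : List A) (f g : A → ℚ) → ∑ (x ∷ xs) g ≤ℚ ∑ (x ∷ xs) f →
  ∃ λ x → g x ≤ℚ f x
∑-≥-avg x [] f g q = x , subst₂ _≤ℚ_ (ℚₚ.+-identityʳ _) (ℚₚ.+-identityʳ _) q
∑-≥-avg x (y ∷ xs) f g q with g x ℚ.≤? f x
... | yes r = x , r
... | no r = ∑-≥-avg y xs f g (ℚₚ.≮⇒≥ λ s → ℚₚ.<-irrefl refl (ℚₚ.<-≤-trans (ℚₚ.+-mono-< (ℚₚ.≰⇒> r) s) q))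

-- Natural numbers inside ℚ

-- Kept abstract because unfolding toℚ exposes the normalisation of fractions in every goal.
abstract
  fromℕ : ℕ → ℚ
  fromℕ = toℚ

  fromℕ≡toℚ : ∀ m → fromℕ m ≡ toℚ m
  fromℕ≡toℚ m = refl

  fromℕ-0 : fromℕ 0 ≡ 0ℚ
  fromℕ-0 = refl

  fromℕ-1 : fromℕ 1 ≡ 1ℚ
  fromℕ-1 = refl

  toℚᵘ-fromℕ : ∀ m → ℚ.toℚᵘ (fromℕ m) ℚᵘ.≃ mkℚᵘ (ℤ.+ m) 0
  toℚᵘ-fromℕ m = ℚₚ.toℚᵘ-fromℚᵘ (mkℚᵘ (ℤ.+ m) 0)

  fromℕ-+ : ∀ a b → fromℕ (a ℕ.+ b) ≡ fromℕ a + fromℕ b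
  fromℕ-+ a b = ℚₚ.toℚᵘ-injective (ℚᵘₚ.≃-trans (toℚᵘ-fromℕ (a ℕ.+ b))
    (ℚᵘₚ.≃-trans (ℚᵘ.*≡* (cong (ℤ._* ℤ.+ 1) (cong₂ ℤ._+_ (sym (ℤₚ.*-identityʳ (ℤ.+ a))) (sym (ℤₚ.*-identityʳ (ℤ.+ b))))))
    (ℚᵘₚ.≃-sym (ℚᵘₚ.≃-trans (ℚₚ.toℚᵘ-homo-+ (fromℕ a) (fromℕ b)) (ℚᵘₚ.+-cong (toℚᵘ-fromℕ a) (toℚᵘ-fromℕ b))))))

  fromℕ-* : ∀ a b → fromℕ (a ℕ.* b) ≡ fromℕ a * fromℕ b
  fromℕ-* a b = ℚₚ.toℚᵘ-injective (ℚᵘₚ.≃-trans (toℚᵘ-fromℕ (a ℕ.* b))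
    (ℚᵘₚ.≃-trans (ℚᵘ.*≡* (cong (ℤ._* ℤ.+ 1) (ℤₚ.pos-* a b)))
    (ℚᵘₚ.≃-sym (ℚᵘₚ.≃-trans (ℚₚ.toℚᵘ-homo-* (fromℕ a) (fromℕ b)) (ℚᵘₚ.*-cong (toℚᵘ-fromℕ a) (toℚᵘ-fromℕ b))))))

  archimedean : ∀ q → ∃ λ m → q ≤ℚ fromℕ m
  archimedean q@(ℚ.mkℚ n d _) = ℤ.∣ n ∣ , ℚₚ.toℚᵘ-cancel-≤ (ℚᵘₚ.≤-trans le (ℚᵘₚ.≤-reflexive (ℚᵘₚ.≃-sym (toℚᵘ-fromℕ ℤ.∣ n ∣))))
    where
    n≤ : ∀ n → n ℤ.≤ ℤ.+ ℤ.∣ n ∣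
    n≤ (ℤ.+ m) = ℤₚ.≤-refl
    n≤ (ℤ.-[1+ m ]) = ℤ.-≤+
    le : mkℚᵘ n d ℚᵘ.≤ mkℚᵘ (ℤ.+ ℤ.∣ n ∣) 0
    le = ℚᵘ.*≤* (ℤₚ.≤-trans (ℤₚ.≤-reflexive (ℤₚ.*-identityʳ n)) (ℤₚ.≤-trans (n≤ n)
      (subst (ℤ.+ ℤ.∣ n ∣ ℤ.≤_) (ℤₚ.pos-* ℤ.∣ n ∣ (suc d)) (ℤ.+≤+ (ℕₚ.m≤m*n ℤ.∣ n ∣ (suc d))))))

fromℕ-suc : ∀ m → fromℕ (suc m) ≡ 1ℚ + fromℕ m
fromℕ-suc m = trans (fromℕ-+ 1 m) (cong (_+ fromℕ m) fromℕ-1)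

fromℕ≥0 : ∀ m → 0ℚ ≤ℚ fromℕ m
fromℕ≥0 zero = ℚₚ.≤-reflexive (sym fromℕ-0)
fromℕ≥0 (suc m) = subst (0ℚ ≤ℚ_) (sym (fromℕ-suc m)) (+-nonneg 0≤1 (fromℕ≥0 m))

fromℕ>0 : ∀ m → 0ℚ < fromℕ (suc m)
fromℕ>0 m = subst (0ℚ <_) (sym (fromℕ-suc m)) (+-pos 0<1 (fromℕ≥0 m))

fromℕ-mono : ∀ {a b} → a ℕ.≤ b → fromℕ a ≤ℚ fromℕ b
fromℕ-mono {a} {b} p = subst₂ _≤ℚ_ (ℚₚ.+-identityʳ _) (trans (sym (fromℕ-+ a (b ℕ.∸ a))) (cong fromℕ (ℕₚ.m+[n∸m]≡n p)))
  (ℚₚ.+-monoʳ-≤ (fromℕ a) (fromℕ≥0 (b ℕ.∸ a)))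

fromℕ0* : ∀ x → fromℕ 0 * x ≡ 0ℚ
fromℕ0* x = trans (cong (_* x) fromℕ-0) (ℚₚ.*-zeroˡ x)

fromℕ1* : ∀ x → fromℕ 1 * x ≡ x
fromℕ1* x = trans (cong (_* x) fromℕ-1) (ℚₚ.*-identityˡ x)

fromℕ≥1 : ∀ {m} → 1 ℕ.≤ m → 1ℚ ≤ℚ fromℕ m
fromℕ≥1 {m} p = subst (_≤ℚ fromℕ m) fromℕ-1 (fromℕ-mono p)

fromℕ-pos : ∀ {m} → 1 ℕ.≤ m → 0ℚ < fromℕ m
fromℕ-pos p = ℚₚ.<-≤-trans 0<1 (fromℕ≥1 p)

fromℕ-cancel-≤ : ∀ {a b} → fromℕ a ≤ℚ fromℕ b → a ℕ.≤ b
fromℕ-cancel-≤ {a} {b} p with a ℕ.≤? b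
... | yes q = q
... | no q = ⊥-elim (ℚₚ.<-irrefl refl (ℚₚ.<-≤-trans (ℚₚ.<-≤-trans
    (subst₂ _<_ (ℚₚ.+-identityˡ _) (sym (fromℕ-suc b)) (ℚₚ.+-monoˡ-< (fromℕ b) 0<1)) (fromℕ-mono (ℕₚ.≰⇒> q))) p))

∑-const : ∀ {a} {A : Set a} (xs : List A) c → ∑ xs (λ _ → c) ≡ fromℕ (length xs) * c
∑-const [] c = sym (fromℕ0* c)
∑-const (x ∷ xs) c = trans (cong (c +_) (∑-const xs c))
  (trans (distr c (fromℕ (length xs))) (cong (_* c) (sym (fromℕ-suc (length xs)))))
  where
  distr : ∀ c t → c + t * c ≡ (1ℚ + t) * c
  distr = solve-∀ ℚ-ring

-- Indicators

𝟙 : Bool → ℚ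
𝟙 true = 1ℚ
𝟙 false = 0ℚ

𝟙≥0 : ∀ b → 0ℚ ≤ℚ 𝟙 b
𝟙≥0 true = 0≤1
𝟙≥0 false = ℚₚ.≤-refl

𝟙≤1 : ∀ b → 𝟙 b ≤ℚ 1ℚ
𝟙≤1 true = ℚₚ.≤-refl
𝟙≤1 false = 0≤1

𝟙-∧ : ∀ a b → 𝟙 (a ∧ b) ≡ 𝟙 a * 𝟙 b
𝟙-∧ true b = sym (ℚₚ.*-identityˡ (𝟙 b))
𝟙-∧ false b = sym (ℚₚ.*-zeroˡ (𝟙 b))

𝟙-not : ∀ b → 𝟙 (not b) ≡ 1ℚ - 𝟙 b
𝟙-not true = refl
𝟙-not false = refl

𝟙-implies : ∀ {a b} → (a ≡ true → b ≡ true) → 𝟙 a ≤ℚ 𝟙 b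
𝟙-implies {false} {b} f = 𝟙≥0 b
𝟙-implies {true} {b} f rewrite f refl = ℚₚ.≤-refl

module _ {a} {A : Set a} (xs : List A) (w f : A → ℚ) where
  private
    expand : ∀ w x y f → w * (x + y * f) ≡ x * w + y * (w * f)
    expand = solve-∀ ℚ-ring

  ∑-affine : ∀ x y → ∑ xs (λ c → w c * (x + y * f c)) ≡ x * ∑ xs w + y * ∑ xs (λ c → w c * f c)
  ∑-affine x y = trans (∑-cong xs (λ c → expand (w c) x y (f c)))
    (trans (∑-+ xs _ _) (cong₂ _+_ (∑-*ˡ xs x w) (∑-*ˡ xs y (λ c → w c * f c))))

-- Splitting a list at an order statistic

AllPairs-split : ∀ {a ℓ} {A : Set a} {_R_ : A → A → Set ℓ} xs {y ys} → AllPairs _R_ (xs ++ y ∷ ys) →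
  All (_R y) xs × All (y R_) ys
AllPairs-split [] (p ∷ ps) = [] , p
AllPairs-split (x ∷ xs) (p ∷ ps) with Allₚ.++⁻ʳ xs p
... | q ∷ _ = let (r , s) = AllPairs-split xs ps in q ∷ r , s

split-at : ∀ {a} {A : Set a} r (xs : List A) → r ℕ.< length xs →
  ∃ λ ys → ∃ λ z → ∃ λ zs → xs ≡ ys ++ z ∷ zs × length ys ≡ r
split-at zero (x ∷ xs) p = [] , x , xs , refl , refl
split-at (suc r) (x ∷ xs) (ℕ.s≤s p) = let (ys , z , zs , e , l) = split-at r xs p in
  x ∷ ys , z , zs , cong (x ∷_) e , cong suc l

module _ {A : Set} (β : A → ℚ) where
  private
    open Sort (On.decTotalOrder ℚₚ.≤-decTotalOrder β) using (sort; sort-↭; sort-↗)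
    order = DecTotalOrder.totalOrder (On.decTotalOrder ℚₚ.≤-decTotalOrder β)

  -- `z` is kept apart because its value is the threshold; the dual inequality counts it among the
  -- heavy entries.
  threshold-split : ∀ r (xs : List A) → r ℕ.< length xs → ∃ λ low → ∃ λ top → ∃ λ z →
    xs ↭ low ++ z ∷ top × length low ≡ r × All (λ c → β c ≤ℚ β z) low × All (λ c → β z ≤ℚ β c) top
  threshold-split r xs p =
    let (low , z , top , e , l) = split-at r (sort xs) (subst (r ℕ.<_) (sym (Permₚ.↭-length (sort-↭ xs))) p)
        (q , s) = AllPairs-split low (subst (AllPairs _) e (Sortedₚ.Sorted⇒AllPairs order (sort-↗ xs)))
    in low , top , z , subst (xs ↭_) e (↭-sym (sort-↭ xs)) , l , q , s

-- The dual inequality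

-- One row, that is, one vertex u with its set `N` of non-neighbours. The reciprocal is bounded by
-- an expression linear in the indicator of `N`, so that all rows can afterwards be added column by
-- column. Weights are cut at `μ`: the parts `mn` below it enter through convexity, the excesses
-- `ex` through a linear bound. In the application `μ` separates the r lightest columns, of total
-- weight `BR`, from the d heaviest, of total excess `E`.
module RowBound {A : Set} (C : List A) (β mn ex : A → ℚ) (N : A → Bool) (d r l μ BR E : ℚ)
  (0<d : 0ℚ < d) (0<BR : 0ℚ < BR) (0≤E : 0ℚ ≤ℚ E) (l≤μ : l ≤ℚ μ)
  (mn≤μ : ∀ c → mn c ≤ℚ μ) (β-split : ∀ c → β c ≡ mn c + ex c) (ex≥0 : ∀ c → 0ℚ ≤ℚ ex c)
  (∑ex : ∑ C ex ≡ E) (∑β : ∑ C β ≡ d * μ + (BR + E)) (N≤d : ∑ C (𝟙 ∘ N) ≤ℚ d) where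

  B W nu S a D₁ D Zl t : ℚ
  B = ∑ C β
  W = BR + E
  nu = ∑ C (𝟙 ∘ N)
  S = ∑ C (λ c → 𝟙 (N c) * mn c)
  a = ∑ C (λ c → 𝟙 (N c) * ex c)
  D₁ = B - S - l * (d - nu)
  D = D₁ - a
  Zl = inv (B - d * l)
  t = inv D₁

  Z : A → ℚ
  Z c = inv (B - d * mn c)

  private
    0<W : 0ℚ < W
    0<W = +-pos 0<BR 0≤E
    gap : ∀ d m x W → d * m + W - d * x - W ≡ d * (m - x)
    gap = solve-∀ ℚ-ring
    W≤ : ∀ {x} → x ≤ℚ μ → W ≤ℚ B - d * x
    W≤ {x} p = ≤-by (trans (cong (λ B → B - d * x - W) ∑β) (gap d μ x W))
      (*-nonneg (ℚₚ.<⇒≤ 0<d) (diff≥0 p))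
    pad≥0 : 0ℚ ≤ℚ d - nu
    pad≥0 = diff≥0 N≤d
    regroup : ∀ B d nu S l → d * (B - S - l * (d - nu)) ≡ (B * nu + (- d) * S) + (d - nu) * (B - d * l)
    regroup = solve-∀ ℚ-ring
    neg-form : ∀ B d m → B + (- d) * m ≡ B - d * m
    neg-form = solve-∀ ℚ-ring

  Z>0 : ∀ c → 0ℚ < B - d * mn c
  Z>0 c = ℚₚ.<-≤-trans 0<W (W≤ (mn≤μ c))

  -- Pad `N` with d - `nu` phantom columns of the least possible weight l. Then there are exactly d
  -- terms B - d · weight, and `D₁` is their mean.
  items : d * D₁ ≡ ∑ C (λ c → 𝟙 (N c) * (B - d * mn c)) + (d - nu) * (B - d * l)
  items = trans (regroup B d nu S l) (cong (_+ (d - nu) * (B - d * l))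
    (trans (sym (∑-affine C (𝟙 ∘ N) mn B (- d))) (∑-cong C (λ c → cong (𝟙 (N c) *_) (neg-form B d (mn c))))))

  D₁≥W : W ≤ℚ D₁
  D₁≥W = *-cancelˡ 0<d (subst₂ _≤ℚ_ (e1 d W nu) (sym items) (ℚₚ.+-mono-≤
     (subst (_≤ℚ ∑ C (λ c → 𝟙 (N c) * (B - d * mn c))) (∑-*ʳ C W (𝟙 ∘ N))
       (∑-mono C (λ c → *-monoˡ (𝟙≥0 (N c)) (W≤ (mn≤μ c)))))
     (*-monoˡ pad≥0 (W≤ l≤μ))))
    where
    e1 : ∀ d W nu → nu * W + (d - nu) * W ≡ d * W
    e1 = solve-∀ ℚ-ring

  0<D₁ : 0ℚ < D₁
  0<D₁ = ℚₚ.<-≤-trans 0<W D₁≥W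

  a≥0 : 0ℚ ≤ℚ a
  a≥0 = ∑-nonneg C (λ c → *-nonneg (𝟙≥0 (N c)) (ex≥0 c))

  a≤E : a ≤ℚ E
  a≤E = subst (a ≤ℚ_) ∑ex (∑-mono C (λ c → subst (𝟙 (N c) * ex c ≤ℚ_) (ℚₚ.*-identityˡ (ex c))
    (*-monoʳ (ex≥0 c) (𝟙≤1 (N c)))))

  D≥BR : BR ≤ℚ D
  D≥BR = ≤-by (e D₁ a BR E) (+-nonneg (diff≥0 D₁≥W) (diff≥0 a≤E))
    where
    e : ∀ D₁ a BR E → D₁ - a - BR ≡ (D₁ - (BR + E)) + (E - a)
    e = solve-∀ ℚ-ring

  0<D : 0ℚ < D
  0<D = ℚₚ.<-≤-trans 0<BR D≥BR

  -- The reciprocal of a mean is at most the mean of the reciprocals: tangents at the common mean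
  -- `D₁` are added over the d terms of `items`.
  harmonic : t * d ≤ℚ ∑ C (λ c → 𝟙 (N c) * Z c) + (d - nu) * Zl
  harmonic = subst (_≤ℚ ∑ C (λ c → 𝟙 (N c) * Z c) + (d - nu) * Zl) eq
    (ℚₚ.+-mono-≤
      (∑-mono C (λ c → *-monoˡ (𝟙≥0 (N c)) (inv-tangent t (Z>0 c))))
      (*-monoˡ pad≥0 (inv-tangent t (ℚₚ.<-≤-trans 0<W (W≤ l≤μ)))))
    where
    G = ∑ C (λ c → 𝟙 (N c) * (B - d * mn c))
    H = B - d * l
    form : ∀ x y t → 2ℚ * t - x * (t * t) ≡ 2ℚ * t + (- (t * t)) * x
    form = solve-∀ ℚ-ring
    collect : ∀ t nu G d H D → 2ℚ * t * nu + (- (t * t)) * G + (d - nu) * (2ℚ * t - H * (t * t))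
      ≡ 2ℚ * t * d - (G + (d - nu) * H) * (t * t)
    collect = solve-∀ ℚ-ring
    fin : ∀ t d D → 2ℚ * t * d - (d * D) * (t * t) ≡ 2ℚ * t * d - d * t * (D * t)
    fin = solve-∀ ℚ-ring
    fin2 : ∀ t d → 2ℚ * t * d - d * t * 1ℚ ≡ t * d
    fin2 = solve-∀ ℚ-ring
    eq : ∑ C (λ c → 𝟙 (N c) * (2ℚ * t - (B - d * mn c) * (t * t))) + (d - nu) * (2ℚ * t - H * (t * t)) ≡ t * d
    eq = trans (cong (_+ (d - nu) * (2ℚ * t - H * (t * t)))
           (trans (∑-cong C (λ c → cong (𝟙 (N c) *_) (form (B - d * mn c) t t)))
             (∑-affine C (𝟙 ∘ N) (λ c → B - d * mn c) (2ℚ * t) (- (t * t)))))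
         (trans (collect t nu G d H D₁)
         (trans (cong (λ z → 2ℚ * t * d - z * (t * t)) (sym items))
         (trans (fin t d D₁) (trans (cong (λ z → 2ℚ * t * d - d * t * z) (*-inv 0<D₁)) (fin2 t d)))))

  g : ℚ
  g = inv BR * inv W

  -- The exact correction for the excess, from D = `D₁` - a; it has the factor a, which is linear in
  -- `N`.
  invD : inv D ≡ t + a * (inv D * t)
  invD = *-cancelˡ-≡ 0<D (*-cancelˡ-≡ 0<D₁ (trans (cong (D₁ *_) (*-inv 0<D))
    (sym (trans (e2 D₁ D a t (inv D)) (trans (cong₂ (λ x y → D * x + a * (y * x)) (*-inv 0<D₁) (*-inv 0<D)) (e3 D₁ a))))))
    where
    e2 : ∀ x y a t i → x * (y * (t + a * (i * t))) ≡ y * (x * t) + a * ((y * i) * (x * t))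
    e2 = solve-∀ ℚ-ring
    e3 : ∀ x a → (x - a) * 1ℚ + a * (1ℚ * 1ℚ) ≡ x * 1ℚ
    e3 = solve-∀ ℚ-ring

  -- The two denominators in the correction of `invD` are replaced by their lower bounds `BR` and
  -- `W`, which do not depend on `N`; this is the constant `g`.
  row-bound : inv D ≤ℚ Zl + ∑ C (λ c → 𝟙 (N c) * ((Z c - Zl) * inv d + ex c * g))
  row-bound = subst₂ _≤ℚ_ (sym invD) eq (ℚₚ.+-mono-≤ t≤ (*-monoˡ a≥0
      (*-mono (inv≥0 0<D) (inv≥0 0<W) (inv-anti 0<BR D≥BR) (inv-anti 0<W D₁≥W))))
    where
    ZS = ∑ C (λ c → 𝟙 (N c) * Z c)
    t≤ : t ≤ℚ inv d * (ZS + (d - nu) * Zl)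
    t≤ = subst (_≤ℚ inv d * (ZS + (d - nu) * Zl))
      (trans (e (inv d) t d) (trans (cong (t *_) (inv-* 0<d)) (ℚₚ.*-identityʳ t)))
      (*-monoˡ (inv≥0 0<d) harmonic)
      where
      e : ∀ i t d → i * (t * d) ≡ t * (i * d)
      e = solve-∀ ℚ-ring
    split : ∀ n z zl i x g → n * ((z - zl) * i + x * g) ≡ (i * (n * z) + (- (i * zl)) * n) + g * (n * x)
    split = solve-∀ ℚ-ring
    fin : ∀ ZS nu Zl i d a g → i * (ZS + (d - nu) * Zl) + a * g
        ≡ (i * d) * Zl + ((i * ZS + (- (i * Zl)) * nu) + g * a)
    fin = solve-∀ ℚ-ring
    eq : inv d * (ZS + (d - nu) * Zl) + a * g ≡ Zl + ∑ C (λ c → 𝟙 (N c) * ((Z c - Zl) * inv d + ex c * g))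
    eq = trans (fin ZS nu Zl (inv d) d a g) (cong₂ _+_ (trans (cong (_* Zl) (inv-* 0<d)) (ℚₚ.*-identityˡ Zl))
      (sym (trans (∑-cong C (λ c → split (𝟙 (N c)) (Z c) Zl (inv d) (ex c) g))
        (trans (∑-+ C _ _) (cong₂ _+_ (trans (∑-+ C _ _)
           (cong₂ _+_ (∑-*ˡ C (inv d) (λ c → 𝟙 (N c) * Z c)) (∑-*ˡ C (- (inv d * Zl)) (𝟙 ∘ N))))
           (∑-*ˡ C g (λ c → 𝟙 (N c) * ex c)))))))

  κ≥0 : l ≤ℚ μ → ∀ c → l ≤ℚ mn c → 0ℚ ≤ℚ (Z c - Zl) * inv d + ex c * g
  κ≥0 _ c p = +-nonneg (*-nonneg (diff≥0 (inv-anti (Z>0 c) (≤-by (e B d l (mn c)) (*-nonneg (ℚₚ.<⇒≤ 0<d) (diff≥0 p)))))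
      (inv≥0 0<d)) (*-nonneg (ex≥0 c) (*-nonneg (inv≥0 0<BR) (inv≥0 0<W)))
    where
    e : ∀ B d l m → (B - d * l) - (B - d * m) ≡ d * (m - l)
    e = solve-∀ ℚ-ring

-- Taylor's formula for 1 / y at m, of first order, with its exact remainder.
inv-expand : ∀ {y m} → 0ℚ < y → 0ℚ < m →
  inv m + (m - y) * (inv m * inv m) + (m - y) * (m - y) * (inv m * inv m * inv y) ≡ inv y
inv-expand {y} {m} 0<y 0<m = trans (e m y (inv m) (inv y))
  (trans (cong₂ (λ p q → h p q y (inv m) (inv y)) (*-inv 0<m) (*-inv 0<y)) (e' y (inv m) (inv y)))
  where
  h : ℚ → ℚ → ℚ → ℚ → ℚ → ℚ
  h p q y i j = i + (p * i - y * (i * i)) + (p * p * j - 2ℚ * (p * i * q) + y * (i * i) * q)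
  e : ∀ m y i j → i + (m - y) * (i * i) + (m - y) * (m - y) * (i * i * j)
      ≡ i + ((m * i) * i - y * (i * i)) + ((m * i) * (m * i) * j - 2ℚ * ((m * i) * i * (y * j)) + y * (i * i) * (y * j))
  e = solve-∀ ℚ-ring
  e' : ∀ y i j → i + (1ℚ * i - y * (i * i)) + (1ℚ * 1ℚ * j - 2ℚ * (1ℚ * i * 1ℚ) + y * (i * i) * 1ℚ) ≡ j
  e' = solve-∀ ℚ-ring

-- What remains of the dual inequality in the worst case: d rows miss all of `top` and contribute r
-- / Q each, and for every light column c there is a row whose d non-neighbours all have the weight
-- of c, contributing r / `Y` (β c).
module ThresholdBound {A : Set} (low top : List A) (β : A → ℚ) (d r μ : ℚ)
  (0<d : 0ℚ < d) (d≤r : d ≤ℚ r) (β>0 : ∀ c → 0ℚ < β c) (0<μ : 0ℚ < μ)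
  (len-low : ∑ low (λ _ → 1ℚ) ≡ r) (len-top : ∑ top (λ _ → 1ℚ) ≡ d)
  (low≤ : All (λ c → β c ≤ℚ μ) low) (top≥ : All (λ c → μ ≤ℚ β c) top) where

  P Q q p M : ℚ
  P = ∑ top β
  Q = ∑ low β
  q = Q * inv r
  p = P * inv d
  M = P + Q - d * q

  private
    0≤d = ℚₚ.<⇒≤ 0<d
    0<r : 0ℚ < r
    0<r = ℚₚ.<-≤-trans 0<d d≤r
    const : ∀ (xs : List A) x → ∑ xs (λ _ → x) ≡ x * ∑ xs (λ _ → 1ℚ)
    const xs x = trans (∑-cong xs (λ _ → sym (ℚₚ.*-identityʳ x))) (∑-*ˡ xs x (λ _ → 1ℚ))
    unscale : ∀ {r Q} → 0ℚ < r → r * (Q * inv r) ≡ Q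
    unscale {r} {Q} h = trans (e r Q (inv r)) (trans (cong (Q *_) (*-inv h)) (ℚₚ.*-identityʳ Q))
      where
      e : ∀ r Q i → r * (Q * i) ≡ Q * (r * i)
      e = solve-∀ ℚ-ring

  rq : r * q ≡ Q
  rq = unscale 0<r
  dp : d * p ≡ P
  dp = unscale 0<d

  P≥ : d * μ ≤ℚ P
  P≥ = subst (_≤ℚ P) (trans (const top μ) (trans (cong (μ *_) len-top) (ℚₚ.*-comm μ d))) (∑-mono-All top≥)

  Q≤ : Q ≤ℚ r * μ
  Q≤ = subst (Q ≤ℚ_) (trans (const low μ) (trans (cong (μ *_) len-low) (ℚₚ.*-comm μ r))) (∑-mono-All low≤)

  0<Q : 0ℚ < Q
  0<Q = go low len-low
    where
    go : ∀ xs → ∑ xs (λ _ → 1ℚ) ≡ r → 0ℚ < ∑ xs β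
    go [] e = ⊥-elim (ℚₚ.<-irrefl e 0<r)
    go (x ∷ xs) e = +-pos (β>0 x) (∑-nonneg xs (λ c → ℚₚ.<⇒≤ (β>0 c)))

  0<q : 0ℚ < q
  0<q = *-pos 0<Q (inv>0 0<r)

  q≤μ : q ≤ℚ μ
  q≤μ = *-cancelˡ 0<r (subst (_≤ℚ r * μ) (sym rq) Q≤)

  0<P : 0ℚ < P
  0<P = ℚₚ.<-≤-trans (*-pos 0<d 0<μ) P≥

  0<p : 0ℚ < p
  0<p = *-pos 0<P (inv>0 0<d)

  M-form : M ≡ P + (r - d) * q
  M-form = trans (cong (λ z → P + z - d * q) (sym rq)) (e P r q d)
    where
    e : ∀ P r q d → P + r * q - d * q ≡ P + (r - d) * q
    e = solve-∀ ℚ-ring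

  M≥P : P ≤ℚ M
  M≥P = subst₂ _≤ℚ_ (ℚₚ.+-identityʳ P) (sym M-form)
    (ℚₚ.+-monoʳ-≤ P (*-nonneg (diff≥0 d≤r) (ℚₚ.<⇒≤ 0<q)))

  0<M : 0ℚ < M
  0<M = ℚₚ.<-≤-trans 0<P M≥P

  -- Value and derivative of b ↦ r / `Y` b - 1 / b at the mean q of the light weights.
  A₀ A₁ : ℚ
  A₀ = r * inv M - inv q
  A₁ = r * d * (inv M * inv M) + inv q * inv q

  Y : ℚ → ℚ
  Y b = P + Q - d * b

  Y≥Q : ∀ {b} → b ≤ℚ μ → Q ≤ℚ Y b
  Y≥Q {b} h = ≤-by (e P Q d b μ) (+-nonneg (diff≥0 P≥) (*-nonneg 0≤d (diff≥0 h)))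
    where
    e : ∀ P Q d b μ → P + Q - d * b - Q ≡ (P - d * μ) + d * (μ - b)
    e = solve-∀ ℚ-ring

  -- b ↦ r / `Y` b - 1 / b is a difference of convex functions, so its tangent at q needs an
  -- argument. The gap is (b - q)² times a positive factor times M² `Y` b - r d² q² b. That number
  -- is nonnegative because q and b are at most μ, d μ ≤ P ≤ M, and `Y` b ≥ Q = r q.
  tangent-low : ∀ {b} → 0ℚ < b → b ≤ℚ μ → r * inv (Y b) ≤ℚ inv b + (A₀ + A₁ * (b - q))
  tangent-low {b} 0<b b≤μ = ≤-by eq (*-nonneg (*-nonneg (sq≥0 (b - q)) (ℚₚ.<⇒≤ 0<K)) (diff≥0 key))
    where
    y = Y b
    0<y : 0ℚ < y
    0<y = ℚₚ.<-≤-trans 0<Q (Y≥Q b≤μ)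
    i = inv M
    j = inv q
    K = (i * i * inv y) * (j * j * inv b)
    0<K : 0ℚ < K
    0<K = *-pos (*-pos (*-pos (inv>0 0<M) (inv>0 0<M)) (inv>0 0<y)) (*-pos (*-pos (inv>0 0<q) (inv>0 0<q)) (inv>0 0<b))
    key : r * (d * d) * (q * q) * b ≤ℚ M * M * y
    key = ℚₚ.≤-trans (subst₂ _≤ℚ_ (e₁ r d q b) (e₂ r q d μ (dp')) step₁) step₂
      where
      dp' = d * μ
      e₁ : ∀ r d q b → (r * q) * ((d * d) * (q * b)) ≡ r * (d * d) * (q * q) * b
      e₁ = solve-∀ ℚ-ring
      e₂ : ∀ r q d μ z → (r * q) * ((d * d) * (μ * μ)) ≡ (d * μ) * (d * μ) * (r * q)
      e₂ = solve-∀ ℚ-ring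
      0≤q = ℚₚ.<⇒≤ 0<q
      0≤μ = ℚₚ.<⇒≤ 0<μ
      step₁ : (r * q) * ((d * d) * (q * b)) ≤ℚ (r * q) * ((d * d) * (μ * μ))
      step₁ = *-monoˡ (*-nonneg (ℚₚ.<⇒≤ 0<r) 0≤q) (*-monoˡ (*-nonneg 0≤d 0≤d) (*-mono 0≤q 0≤μ q≤μ b≤μ))
      dμ≤M = ℚₚ.≤-trans P≥ M≥P
      0≤dμ = *-nonneg 0≤d 0≤μ
      step₂ : (d * μ) * (d * μ) * (r * q) ≤ℚ M * M * y
      step₂ = *-mono (*-nonneg 0≤dμ 0≤dμ) (ℚₚ.<⇒≤ 0<y) (*-mono 0≤dμ (ℚₚ.<⇒≤ 0<M) dμ≤M dμ≤M)
        (subst (_≤ℚ y) (sym rq) (Y≥Q b≤μ))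
    M-y : M - y ≡ d * (b - q)
    M-y = e P Q d q b
      where
      e : ∀ P Q d q b → P + Q - d * q - (P + Q - d * b) ≡ d * (b - q)
      e = solve-∀ ℚ-ring
    ey : inv y ≡ i + d * (b - q) * (i * i) + d * (b - q) * (d * (b - q)) * (i * i * inv y)
    ey = trans (sym (inv-expand 0<y 0<M)) (cong (λ z → i + z * (i * i) + z * z * (i * i * inv y)) M-y)
    expand : ∀ r d b q i j Y B → (j + (q - b) * (j * j) + (q - b) * (q - b) * (j * j * B) + (r * i - j + (r * d * (i * i) + j * j) * (b - q)))
      - r * (i + d * (b - q) * (i * i) + d * (b - q) * (d * (b - q)) * (i * i * Y))
      ≡ (b - q) * (b - q) * (j * j * B - r * (d * d) * (i * i * Y))
    expand = solve-∀ ℚ-ring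
    clear : ∀ r d b q i j Y B M y → (b - q) * (b - q) * ((i * i * Y) * (j * j * B)) * (M * M * y - r * (d * d) * (q * q) * b)
      ≡ (b - q) * (b - q) * (((M * i) * (M * i) * (y * Y)) * (j * j * B) - (r * (d * d) * (i * i * Y)) * ((q * j) * (q * j) * (b * B)))
    clear = solve-∀ ℚ-ring
    ones : ∀ z x w → z * z * ((1ℚ * 1ℚ * 1ℚ) * x - w * (1ℚ * 1ℚ * 1ℚ)) ≡ z * z * (x - w)
    ones = solve-∀ ℚ-ring
    eq : (inv b + (A₀ + A₁ * (b - q))) - r * inv y ≡ (b - q) * (b - q) * K * (M * M * y - r * (d * d) * (q * q) * b)
    eq = trans (cong₂ (λ x z → (x + (A₀ + A₁ * (b - q))) - r * z) (sym (inv-expand 0<b 0<q)) ey)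
      (trans (expand r d b q i j (inv y) (inv b))
      (sym (trans (clear r d b q i j (inv y) (inv b) M y)
        (trans (cong₂ (λ u v → (b - q) * (b - q) * (u * (j * j * inv b) - (r * (d * d) * (i * i * inv y)) * v))
           (cong₂ _*_ (cong₂ _*_ (*-inv 0<M) (*-inv 0<M)) (*-inv 0<y))
           (cong₂ _*_ (cong₂ _*_ (*-inv 0<q) (*-inv 0<q)) (*-inv 0<b)))
         (ones (b - q) (j * j * inv b) (r * (d * d) * (i * i * inv y)))))))

  -- The linear part of the tangent cancels, since q is the mean of β over `low`.
  low-sum : r * ∑ low (λ c → inv (Y (β c))) ≤ℚ ∑ low (inv ∘ β) + r * A₀
  low-sum = subst₂ _≤ℚ_ (∑-*ˡ low r _) eq
    (∑-mono-All (All.map (λ {c} h → tangent-low (β>0 c) h) low≤))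
    where
    affine : ∀ x a b q → a + b * (x - q) ≡ (a - b * q) * 1ℚ + b * x
    affine = solve-∀ ℚ-ring
    fin : ∀ a b q r → (a - b * q) * r + b * (r * q) ≡ r * a
    fin = solve-∀ ℚ-ring
    eq : ∑ low (λ c → inv (β c) + (A₀ + A₁ * (β c - q))) ≡ ∑ low (inv ∘ β) + r * A₀
    eq = trans (∑-+ low _ _) (cong (∑ low (inv ∘ β) +_)
      (trans (∑-cong low (λ c → affine (β c) A₀ A₁ q))
      (trans (∑-+ low _ _) (trans (cong₂ _+_ (trans (∑-*ˡ low (A₀ - A₁ * q) (λ _ → 1ℚ)) (cong ((A₀ - A₁ * q) *_) len-low))
         (trans (∑-*ˡ low A₁ β) (cong (A₁ *_) (sym rq)))) (fin A₀ A₁ q r)))))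

  top-sum : d * inv p ≤ℚ ∑ top (inv ∘ β)
  top-sum = subst (_≤ℚ ∑ top (inv ∘ β)) eq (∑-mono top (λ c → inv-tangent (inv p) (β>0 c)))
    where
    t = inv p
    form : ∀ x t → 2ℚ * t - x * (t * t) ≡ 2ℚ * t * 1ℚ + (- (t * t)) * x
    form = solve-∀ ℚ-ring
    fin : ∀ t d p → 2ℚ * t * d + (- (t * t)) * (d * p) ≡ 2ℚ * t * d - d * t * (p * t)
    fin = solve-∀ ℚ-ring
    fin2 : ∀ t d → 2ℚ * t * d - d * t * 1ℚ ≡ d * t
    fin2 = solve-∀ ℚ-ring
    eq : ∑ top (λ c → 2ℚ * t - β c * (t * t)) ≡ d * t
    eq = trans (∑-cong top (λ c → form (β c) t)) (trans (∑-+ top _ _)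
      (trans (cong₂ _+_ (trans (∑-*ˡ top (2ℚ * t) (λ _ → 1ℚ)) (cong (2ℚ * t *_) len-top))
         (trans (∑-*ˡ top (- (t * t)) β) (cong ((- (t * t)) *_) (sym dp))))
      (trans (fin t d p) (trans (cong (λ z → 2ℚ * t * d - d * t * z) (*-inv 0<p)) (fin2 t d)))))

  -- Weighted harmonic mean: M = d p + (r - d) q with weights of total r. The weight r - d must be
  -- nonnegative, so this rests on d ≤ r.
  merge : r * r * inv M ≤ℚ d * inv p + (r - d) * inv q
  merge = subst (_≤ℚ d * inv p + (r - d) * inv q) eq
    (ℚₚ.+-mono-≤ (*-monoˡ 0≤d (inv-tangent s 0<p)) (*-monoˡ (diff≥0 d≤r) (inv-tangent s 0<q)))
    where
    s = r * inv M
    e₁ : ∀ d r s p q → d * (2ℚ * s - p * (s * s)) + (r - d) * (2ℚ * s - q * (s * s))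
      ≡ 2ℚ * s * r - (d * p + (r - d) * q) * (s * s)
    e₁ = solve-∀ ℚ-ring
    e₂ : ∀ r i M → 2ℚ * (r * i) * r - M * ((r * i) * (r * i)) ≡ 2ℚ * (r * i) * r - (M * i) * (r * r * i)
    e₂ = solve-∀ ℚ-ring
    e₃ : ∀ r i → 2ℚ * (r * i) * r - 1ℚ * (r * r * i) ≡ r * r * i
    e₃ = solve-∀ ℚ-ring
    eq : d * (2ℚ * s - p * (s * s)) + (r - d) * (2ℚ * s - q * (s * s)) ≡ r * r * inv M
    eq = trans (e₁ d r s p q) (trans (cong (λ z → 2ℚ * s * r - z * (s * s)) (trans (cong (_+ (r - d) * q) dp) (sym M-form)))
      (trans (e₂ r (inv M) M) (trans (cong (λ z → 2ℚ * (r * inv M) * r - z * (r * r * inv M)) (*-inv 0<M)) (e₃ r (inv M)))))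

  threshold-bound : r * (∑ low (λ c → inv (Y (β c))) + d * inv Q) ≤ℚ ∑ low (inv ∘ β) + ∑ top (inv ∘ β)
  threshold-bound = ℚₚ.≤-trans (subst (_≤ℚ ∑ low (inv ∘ β) + r * A₀ + d * inv q) eq₁ (ℚₚ.+-monoˡ-≤ (d * inv q) low-sum))
    (≤-by (e₂ (∑ low (inv ∘ β)) (∑ top (inv ∘ β)) r d (inv M) (inv q) (inv p))
      (+-nonneg (diff≥0 top-sum) (diff≥0 merge)))
    where
    e₂ : ∀ x y r d M q p → (x + y) - (x + r * (r * M - q) + d * q) ≡ (y - d * p) + (d * p + (r - d) * q - r * r * M)
    e₂ = solve-∀ ℚ-ring
    iq : r * inv Q ≡ inv q
    iq = inv-unique 0<q (trans (e q r (inv Q)) (trans (cong (_* inv Q) rq) (*-inv 0<Q)))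
      where
      e : ∀ q r i → q * (r * i) ≡ (r * q) * i
      e = solve-∀ ℚ-ring
    eq₁ : r * ∑ low (λ c → inv (Y (β c))) + d * inv q ≡ r * (∑ low (λ c → inv (Y (β c))) + d * inv Q)
    eq₁ = trans (cong (λ z → r * ∑ low (λ c → inv (Y (β c))) + d * z) (sym iq)) (e r _ d (inv Q))
      where
      e : ∀ r x d i → r * x + d * (r * i) ≡ r * (x + d * i)
      e = solve-∀ ℚ-ring

∑-length : ∀ {a} {A : Set a} (xs : List A) → ∑ xs (λ _ → 1ℚ) ≡ fromℕ (length xs)
∑-length xs = trans (∑-const xs 1ℚ) (ℚₚ.*-identityʳ _)

module _ {A B : Set} (N : A → B → Bool) (U : List A) (C : List B) (ρ : B → ℚ) (l : ℚ) (d' r' : ℕ)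
  (1≤d : 1 ℕ.≤ d') (d≤r : d' ℕ.≤ r') (|U| : length U ≡ r' ℕ.+ d') (|C| : length C ≡ r' ℕ.+ d')
  (0<l : 0ℚ < l) (ρ≥0 : ∀ c → 0ℚ ≤ℚ ρ c)
  (rows : All (λ u → ∑ C (λ c → 𝟙 (N u c)) ≤ℚ fromℕ d') U)
  (cols : All (λ c → ∑ U (λ u → 𝟙 (N u c)) ≤ℚ fromℕ d') C) where

  private
    d r : ℚ
    d = fromℕ d'
    r = fromℕ r'
    β : B → ℚ
    β c = ρ c + l
    0<d : 0ℚ < d
    0<d = fromℕ-pos 1≤d
    d≤r' : d ≤ℚ r
    d≤r' = fromℕ-mono d≤r
    0<r : 0ℚ < r
    0<r = ℚₚ.<-≤-trans 0<d d≤r'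
    β>0 : ∀ c → 0ℚ < β c
    β>0 c = subst (0ℚ <_) (ℚₚ.+-comm l (ρ c)) (+-pos 0<l (ρ≥0 c))
    l≤β : ∀ c → l ≤ℚ β c
    l≤β c = subst (_≤ℚ β c) (ℚₚ.+-identityˡ l) (ℚₚ.+-monoˡ-≤ l (ρ≥0 c))
    |C|>r : r' ℕ.< length C
    |C|>r = subst (r' ℕ.<_) (sym |C|) (ℕₚ.m<m+n r' 1≤d)

  private
   module Split (low top : List B) (μ : ℚ) (C↭ : C ↭ low ++ top) (l≤μ : l ≤ℚ μ)
    (len-low : ∑ low (λ _ → 1ℚ) ≡ r) (len-top : ∑ top (λ _ → 1ℚ) ≡ d)
    (low≤ : All (λ c → β c ≤ℚ μ) low) (top≥ : All (λ c → μ ≤ℚ β c) top) where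

    0<μ : 0ℚ < μ
    0<μ = ℚₚ.<-≤-trans 0<l l≤μ
    mn ex : B → ℚ
    mn c = β c ⊓ μ
    ex c = β c - mn c
    open ThresholdBound low top β d r μ 0<d d≤r' β>0 0<μ len-low len-top low≤ top≥
    E = P - d * μ
    sum-C : ∀ f → ∑ C f ≡ ∑ low f + ∑ top f
    sum-C f = trans (∑-↭ f C↭) (∑-++ low top f)
    mn-low : All (λ c → mn c ≡ β c) low
    mn-low = All.map ℚₚ.p≤q⇒p⊓q≡p low≤
    mn-top : All (λ c → mn c ≡ μ) top
    mn-top = All.map ℚₚ.p≥q⇒p⊓q≡q top≥
    ∑ex : ∑ C ex ≡ E
    ∑ex = trans (sum-C ex) (trans (cong₂ _+_
        (trans (∑-cong-All {xs = low} {g = λ _ → 0ℚ} (All.map (λ {c} e → trans (cong (λ x → β c - x) e) (ℚₚ.+-inverseʳ (β c))) mn-low)) (∑-0 low))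
        (trans (∑-cong-All {xs = top} {g = λ c → β c - μ * 1ℚ} (All.map (λ {c} e → cong (λ x → β c - x) (trans e (sym (ℚₚ.*-identityʳ μ)))) mn-top))
          (trans (∑-minus top β (λ _ → μ * 1ℚ)) (cong (λ z → P - z) (trans (∑-*ˡ top μ (λ _ → 1ℚ)) (trans (cong (μ *_) len-top) (ℚₚ.*-comm μ d)))))))
      (ℚₚ.+-identityˡ E))
    ∑β : ∑ C β ≡ d * μ + (Q + E)
    ∑β = trans (sum-C β) (e Q P d μ)
      where
      e : ∀ Q P d μ → Q + P ≡ d * μ + (Q + (P - d * μ))
      e = solve-∀ ℚ-ring
    l≤mn : ∀ c → l ≤ℚ mn c
    l≤mn c = ℚₚ.⊓-glb (l≤β c) l≤μ
    ex≥0 : ∀ c → 0ℚ ≤ℚ ex c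
    ex≥0 c = diff≥0 (ℚₚ.p⊓q≤p (β c) μ)
    β-split : ∀ c → β c ≡ mn c + ex c
    β-split c = e (β c) (mn c)
      where
      e : ∀ x y → x ≡ y + (x - y)
      e = solve-∀ ℚ-ring
    module Row (u : A) (h : ∑ C (λ c → 𝟙 (N u c)) ≤ℚ d) =
      RowBound C β mn ex (N u) d r l μ Q E 0<d 0<Q (diff≥0 P≥) l≤μ (λ c → ℚₚ.p⊓q≤q (β c) μ) β-split ex≥0 ∑ex ∑β h
    B₀ = ∑ C β
    Z : B → ℚ
    Z c = inv (B₀ - d * mn c)
    Zl = inv (B₀ - d * l)
    g = inv Q * inv (Q + E)
    κ : B → ℚ
    κ c = (Z c - Zl) * inv d + ex c * g
    X : A → ℚ
    X u = inv r * ∑ C (λ c → 𝟙 (not (N u c)) * ρ c) + l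
    -- Passage to non-neighbours: subtract them from the sum over all r + d columns. Replacing ρ by
    -- β - l leaves over exactly the padding term l (d - `nu`).
    X-D : ∀ u (h : ∑ C (λ c → 𝟙 (N u c)) ≤ℚ d) → r * X u ≡ Row.D u h
    X-D u h = trans (e₁ r (inv r) _ l) (trans (cong (λ z → z * ∑ C (λ c → 𝟙 (not (N u c)) * ρ c) + r * l) (*-inv 0<r))
      (trans (cong (λ z → 1ℚ * z + r * l) sumρ) (e₃ B₀ (Row.S u h) (Row.a u h) (Row.nu u h) l r d)))
      where
      e₁ : ∀ r i s l → r * (i * s + l) ≡ (r * i) * s + r * l
      e₁ = solve-∀ ℚ-ring
      e₂ : ∀ n ρ l m → (1ℚ - n) * ρ ≡ ((ρ + l) + (- l) * 1ℚ) + ((- 1ℚ) * (n * m + n * ((ρ + l) - m)) + l * n)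
      e₂ = solve-∀ ℚ-ring
      e₃ : ∀ B S a nu l r d → 1ℚ * ((B + (- l) * (r + d)) + ((- 1ℚ) * (S + a) + l * nu)) + r * l ≡ B - S - l * (d - nu) - a
      e₃ = solve-∀ ℚ-ring
      sumρ : ∑ C (λ c → 𝟙 (not (N u c)) * ρ c) ≡ (B₀ + (- l) * (r + d)) + ((- 1ℚ) * (Row.S u h + Row.a u h) + l * Row.nu u h)
      sumρ = trans (∑-cong C (λ c → trans (cong (_* ρ c) (𝟙-not (N u c))) (e₂ (𝟙 (N u c)) (ρ c) l (mn c))))
        (trans (∑-+ C _ _) (cong₂ _+_
          (trans (∑-+ C _ _) (cong (B₀ +_) (trans (∑-*ˡ C (- l) (λ _ → 1ℚ)) (cong ((- l) *_) (trans (∑-length C) (trans (cong fromℕ |C|) (fromℕ-+ r' d')))))))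
          (trans (∑-+ C _ _) (cong₂ _+_ (trans (∑-*ˡ C (- 1ℚ) _) (cong ((- 1ℚ) *_) (∑-+ C _ _))) (∑-*ˡ C l _)))))
    row : ∀ {u} → ∑ C (λ c → 𝟙 (N u c)) ≤ℚ d → inv (X u) ≤ℚ r * (Zl + ∑ C (λ c → 𝟙 (N u c) * κ c))
    row {u} h = subst (_≤ℚ r * (Zl + ∑ C (λ c → 𝟙 (N u c) * κ c))) eq (*-monoˡ (ℚₚ.<⇒≤ 0<r) (Row.row-bound u h))
      where
      0<X : 0ℚ < X u
      0<X = subst (0ℚ <_) (ℚₚ.+-comm l _) (+-pos 0<l (*-nonneg (inv≥0 0<r) (∑-nonneg C (λ c → *-nonneg (𝟙≥0 (not (N u c))) (ρ≥0 c)))))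
      e : ∀ x r i → x * (r * i) ≡ (r * x) * i
      e = solve-∀ ℚ-ring
      eq : r * inv (Row.D u h) ≡ inv (X u)
      eq = inv-unique 0<X (trans (e (X u) r _) (trans (cong (_* inv (Row.D u h)) (X-D u h)) (*-inv (Row.0<D u h))))
    Z-anti : ∀ c → Zl ≤ℚ Z c
    Z-anti c = inv-anti 0<item (≤-by (e B₀ d l (mn c)) (*-nonneg (ℚₚ.<⇒≤ 0<d) (diff≥0 (l≤mn c))))
      where
      e : ∀ B d l m → (B - d * l) - (B - d * m) ≡ d * (m - l)
      e = solve-∀ ℚ-ring
      e' : ∀ d m W x → d * m + W - d * x ≡ W + d * (m - x)
      e' = solve-∀ ℚ-ring
      0<item : 0ℚ < B₀ - d * mn c
      0<item = subst (0ℚ <_) (sym (trans (cong (λ x → x - d * mn c) ∑β) (e' d μ (Q + E) (mn c))))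
        (+-pos (+-pos 0<Q (diff≥0 P≥)) (*-nonneg (ℚₚ.<⇒≤ 0<d) (diff≥0 (ℚₚ.p⊓q≤q (β c) μ))))
    0<W : 0ℚ < Q + E
    0<W = +-pos 0<Q (diff≥0 P≥)
    κ≥0 : ∀ c → 0ℚ ≤ℚ κ c
    κ≥0 c = +-nonneg (*-nonneg (diff≥0 (Z-anti c)) (inv≥0 0<d))
      (*-nonneg (ex≥0 c) (*-nonneg (inv≥0 0<Q) (inv≥0 0<W)))
    total : ∑ U (inv ∘ X) ≤ℚ r * ((r + d) * Zl + ∑ C (λ c → κ c * d))
    total = ℚₚ.≤-trans (∑-mono-All (All.map row rows)) (ℚₚ.≤-trans (ℚₚ.≤-reflexive eq)
      (*-monoˡ (ℚₚ.<⇒≤ 0<r) (ℚₚ.+-monoʳ-≤ ((r + d) * Zl) (∑-mono-All (All.map (λ {c} h → *-monoˡ (κ≥0 c) h) cols)))))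
      where
      eq : ∑ U (λ u → r * (Zl + ∑ C (λ c → 𝟙 (N u c) * κ c))) ≡ r * ((r + d) * Zl + ∑ C (λ c → κ c * ∑ U (λ u → 𝟙 (N u c))))
      eq = trans (∑-*ˡ U r _) (cong (r *_) (trans (∑-+ U _ _) (cong₂ _+_
        (trans (∑-const U Zl) (cong (_* Zl) (trans (cong fromℕ |U|) (fromℕ-+ r' d'))))
        (trans (∑-comm U C _) (∑-cong C (λ c → trans (∑-*ʳ U (κ c) _) (ℚₚ.*-comm _ (κ c))))))))
    ∑Z : ∑ C Z ≡ ∑ low (λ c → inv (Y (β c))) + d * inv (Q + E)
    ∑Z = trans (sum-C Z) (cong₂ _+_
       (∑-cong-All (All.map (λ {c} e → cong₂ (λ b m → inv (b - d * m)) (trans (sum-C β) (ℚₚ.+-comm Q P)) e) mn-low))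
       (trans (∑-cong-All {xs = top} {g = λ _ → inv (Q + E) * 1ℚ} (All.map (λ {c} e → trans (cong inv (trans (cong₂ (λ b m → b - d * m) ∑β e) (e₁ d μ (Q + E)))) (sym (ℚₚ.*-identityʳ _))) mn-top))
         (trans (∑-*ˡ top (inv (Q + E)) (λ _ → 1ℚ)) (trans (cong (inv (Q + E) *_) len-top) (ℚₚ.*-comm _ d)))))
      where
      e₁ : ∀ d m W → d * m + W - d * m ≡ W
      e₁ = solve-∀ ℚ-ring
    -- The terms `Zl` cancel. Every `Z` on `top` equals `inv (Q + E)`, and adding the share `E * g`
    -- of the excess turns this into `inv Q`.
    telescoped : (r + d) * Zl + ∑ C (λ c → κ c * d) ≡ ∑ low (λ c → inv (Y (β c))) + d * inv Q
    telescoped = trans (cong ((r + d) * Zl +_) (trans (∑-cong C (λ c → e₁ (Z c) Zl (inv d) d (ex c) g))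
        (trans (∑-+ C _ _) (cong₂ _+_ (trans (∑-*ˡ C (inv d * d) _) (trans (cong₂ _*_ (inv-* 0<d) (trans (∑-minus C Z (λ _ → Zl * 1ℚ))
            (cong₂ _-_ ∑Z (trans (∑-*ˡ C Zl (λ _ → 1ℚ)) (cong (Zl *_) (trans (∑-length C) (trans (cong fromℕ |C|) (fromℕ-+ r' d'))))))))
            refl))
           (trans (∑-*ˡ C (g * d) ex) (cong ((g * d) *_) ∑ex))))))
        (trans (e₂ r d Zl (∑ low (λ c → inv (Y (β c)))) (inv Q) (inv (Q + E)) Q E)
          (cong (λ z → ∑ low (λ c → inv (Y (β c))) + d * z) collapse))
      where
      e₁ : ∀ z zl i d x g → ((z - zl) * i + x * g) * d ≡ (i * d) * (z - zl * 1ℚ) + (g * d) * x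
      e₁ = solve-∀ ℚ-ring
      e₂ : ∀ r d Zl s q w Q E → (r + d) * Zl + (1ℚ * ((s + d * w) - Zl * (r + d)) + ((q * w) * d) * E) ≡ s + d * (w + q * w * E)
      e₂ = solve-∀ ℚ-ring
      collapse : inv (Q + E) + inv Q * inv (Q + E) * E ≡ inv Q
      collapse = *-cancelˡ-≡ 0<Q (trans (e₃ Q E (inv Q) (inv (Q + E))) (trans (cong (λ z → Q * inv (Q + E) + z * (inv (Q + E) * E)) (*-inv 0<Q))
         (trans (e₄ Q E (inv (Q + E))) (trans (*-inv 0<W) (sym (*-inv 0<Q))))))
        where
        e₃ : ∀ Q E i w → Q * (w + i * w * E) ≡ Q * w + (Q * i) * (w * E)
        e₃ = solve-∀ ℚ-ring
        e₄ : ∀ Q E w → Q * w + 1ℚ * (w * E) ≡ (Q + E) * w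
        e₄ = solve-∀ ℚ-ring
    result : ∑ U (inv ∘ X) ≤ℚ ∑ C (inv ∘ β)
    result = ℚₚ.≤-trans total (subst₂ _≤ℚ_ (cong (r *_) (sym telescoped)) (sym (sum-C (inv ∘ β))) threshold-bound)

  -- The row bounds are linear in `N` with nonnegative coefficients `κ`, so their sum only grows if
  -- every column sum is raised to d. `threshold-bound` settles that case, with the columns split
  -- after the r lightest.
  dual-inequality : ∑ U (λ u → inv (inv (fromℕ r') * ∑ C (λ c → 𝟙 (not (N u c)) * ρ c) + l)) ≤ℚ ∑ C (λ c → inv (ρ c + l))
  dual-inequality with threshold-split β r' C |C|>r
  ... | low , top , z , C↭ , |low| , low≤ , top≥ = Split.result low (z ∷ top) (β z) C↭ (l≤β z) (trans (∑-length low) (cong fromℕ |low|))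
      (trans (∑-length (z ∷ top)) (cong fromℕ (ℕₚ.+-cancelˡ-≡ r' _ _ (trans (cong (ℕ._+ length (z ∷ top)) (sym |low|))
        (trans (sym (Lₚ.length-++ low)) (trans (sym (Permₚ.↭-length C↭)) |C|))))))
      low≤ (ℚₚ.≤-refl ∷ top≥)

-- Sums over all sequences of vertices, and repeated entries

eqᵇ : ∀ {n} → Fin n → Fin n → Bool
eqᵇ u v = does (u Fin.≟ v)

eqᵇ-sym : ∀ {n} (u v : Fin n) → eqᵇ u v ≡ eqᵇ v u
eqᵇ-sym u v with u Fin.≟ v | v Fin.≟ u
... | yes _ | yes _ = refl
... | no _  | no _  = refl
... | yes p | no q  = ⊥-elim (q (sym p))
... | no p  | yes q = ⊥-elim (p (sym q))

∑-tabulate-suc : ∀ n (f : Fin (suc n) → ℚ) → ∑ (allFin (suc n)) f ≡ f Fin.zero + ∑ (allFin n) (f ∘ Fin.suc)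
∑-tabulate-suc n f = cong (f Fin.zero +_) (trans (cong (λ z → ∑ z f) (sym (Lₚ.map-tabulate id Fin.suc)))
  (∑-map Fin.suc (allFin n) f))

∑-eqᵇ : ∀ n (u : Fin n) → ∑ (allFin n) (λ v → 𝟙 (eqᵇ v u)) ≡ 1ℚ
∑-eqᵇ (suc n) Fin.zero = trans (∑-tabulate-suc n (λ v → 𝟙 (eqᵇ v Fin.zero))) (trans (cong (1ℚ +_) (∑-0 (allFin n))) (ℚₚ.+-identityʳ 1ℚ))
∑-eqᵇ (suc n) (Fin.suc u) = trans (∑-tabulate-suc n (λ v → 𝟙 (eqᵇ v (Fin.suc u)))) (trans (ℚₚ.+-identityˡ _) (∑-eqᵇ n u))

picks : ∀ {a} {A : Set a} → List A → List (A × List A)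
picks [] = []
picks (v ∷ y) = (v , y) ∷ map (λ p → proj₁ p , v ∷ proj₂ p) (picks y)

picks-↭ : ∀ {a} {A : Set a} (y : List A) → All (λ p → y ↭ proj₁ p ∷ proj₂ p) (picks y)
picks-↭ [] = []
picks-↭ (v ∷ y) = ↭-refl ∷ Allₚ.map⁺ (All.map (λ {p} h → ↭-trans (Perm.prep v h) (Perm.swap v (proj₁ p) ↭-refl)) (picks-↭ y))

picks-length : ∀ {a} {A : Set a} (y : List A) → length (picks y) ≡ length y
picks-length [] = refl
picks-length (v ∷ y) = cong suc (trans (Lₚ.length-map _ (picks y)) (picks-length y))

∑-picks : ∀ {a} {A : Set a} (y : List A) (f : A → ℚ) → ∑ (picks y) (f ∘ proj₁) ≡ ∑ y f
∑-picks [] f = refl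
∑-picks (v ∷ y) f = cong (f v +_) (trans (∑-map _ (picks y) _) (∑-picks y f))

module Sequences (n : ℕ) where

  V : Set
  V = Fin n

  Vs : List V
  Vs = allFin n

  nℚ : ℚ
  nℚ = fromℕ n

  |Vs| : length Vs ≡ n
  |Vs| = Lₚ.length-tabulate {n = n} (λ v → v)

  ∑Vs-1 : ∑ Vs (λ _ → 1ℚ) ≡ nℚ
  ∑Vs-1 = trans (∑-const Vs 1ℚ) (trans (ℚₚ.*-identityʳ (fromℕ (length Vs))) (cong fromℕ |Vs|))

  ∑Vs-const : ∀ c → ∑ Vs (λ _ → c) ≡ nℚ * c
  ∑Vs-const c = trans (∑-const Vs c) (cong (λ z → fromℕ z * c) |Vs|)

  nℚ^≥0 : ∀ j → 0ℚ ≤ℚ nℚ ^ℚ j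
  nℚ^≥0 zero = 0≤1
  nℚ^≥0 (suc j) = *-nonneg (fromℕ≥0 n) (nℚ^≥0 j)

  -- Ranges over all n^j sequences, including those with repeated entries; distinctness is imposed
  -- by weights.
  ∑ⁿ : ℕ → (List V → ℚ) → ℚ
  ∑ⁿ zero Φ = Φ []
  ∑ⁿ (suc j) Φ = ∑ Vs (λ v → ∑ⁿ j (λ x → Φ (v ∷ x)))

  ∑ⁿ-mono : ∀ j {Φ Ψ : List V → ℚ} → (∀ x → length x ≡ j → Φ x ≤ℚ Ψ x) → ∑ⁿ j Φ ≤ℚ ∑ⁿ j Ψ
  ∑ⁿ-mono zero h = h [] refl
  ∑ⁿ-mono (suc j) h = ∑-mono Vs (λ v → ∑ⁿ-mono j (λ x e → h (v ∷ x) (cong suc e)))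

  ∑ⁿ-cong : ∀ j {Φ Ψ : List V → ℚ} → (∀ x → length x ≡ j → Φ x ≡ Ψ x) → ∑ⁿ j Φ ≡ ∑ⁿ j Ψ
  ∑ⁿ-cong zero h = h [] refl
  ∑ⁿ-cong (suc j) h = ∑-cong Vs (λ v → ∑ⁿ-cong j (λ x e → h (v ∷ x) (cong suc e)))

  ∑ⁿ-comm-∑ : ∀ j {a} {A : Set a} (xs : List A) (f : A → List V → ℚ) →
    ∑ⁿ j (λ x → ∑ xs (λ a → f a x)) ≡ ∑ xs (λ a → ∑ⁿ j (f a))
  ∑ⁿ-comm-∑ zero xs f = refl
  ∑ⁿ-comm-∑ (suc j) xs f = trans (∑-cong Vs (λ v → ∑ⁿ-comm-∑ j xs (λ a x → f a (v ∷ x)))) (∑-comm Vs xs _)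

  ∑ⁿ-comm : ∀ i j (f : List V → List V → ℚ) → ∑ⁿ i (λ x → ∑ⁿ j (f x)) ≡ ∑ⁿ j (λ y → ∑ⁿ i (λ x → f x y))
  ∑ⁿ-comm zero j f = refl
  ∑ⁿ-comm (suc i) j f = trans (∑-cong Vs (λ v → ∑ⁿ-comm i j (λ x → f (v ∷ x))))
    (sym (∑ⁿ-comm-∑ j Vs (λ v y → ∑ⁿ i (λ x → f (v ∷ x) y))))

  ∑ⁿ-+ : ∀ j (f g : List V → ℚ) → ∑ⁿ j (λ x → f x + g x) ≡ ∑ⁿ j f + ∑ⁿ j g
  ∑ⁿ-+ zero f g = refl
  ∑ⁿ-+ (suc j) f g = trans (∑-cong Vs (λ v → ∑ⁿ-+ j (f ∘ (v ∷_)) (g ∘ (v ∷_)))) (∑-+ Vs _ _)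

  ∑ⁿ-*ˡ : ∀ j c (f : List V → ℚ) → ∑ⁿ j (λ x → c * f x) ≡ c * ∑ⁿ j f
  ∑ⁿ-*ˡ zero c f = refl
  ∑ⁿ-*ˡ (suc j) c f = trans (∑-cong Vs (λ v → ∑ⁿ-*ˡ j c (f ∘ (v ∷_)))) (∑-*ˡ Vs c _)

  ∑ⁿ-*ʳ : ∀ j c (f : List V → ℚ) → ∑ⁿ j (λ x → f x * c) ≡ ∑ⁿ j f * c
  ∑ⁿ-*ʳ j c f = trans (∑ⁿ-cong j (λ x _ → ℚₚ.*-comm (f x) c)) (trans (∑ⁿ-*ˡ j c f) (ℚₚ.*-comm c _))

  ∑ⁿ-minus : ∀ j (f g : List V → ℚ) → ∑ⁿ j (λ x → f x - g x) ≡ ∑ⁿ j f - ∑ⁿ j g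
  ∑ⁿ-minus zero f g = refl
  ∑ⁿ-minus (suc j) f g = trans (∑-cong Vs (λ v → ∑ⁿ-minus j (f ∘ (v ∷_)) (g ∘ (v ∷_)))) (∑-minus Vs _ _)

  ∑ⁿ-const : ∀ j c → ∑ⁿ j (λ _ → c) ≡ (nℚ ^ℚ j) * c
  ∑ⁿ-const zero c = sym (ℚₚ.*-identityˡ c)
  ∑ⁿ-const (suc j) c = trans (∑-cong Vs (λ _ → ∑ⁿ-const j c)) (trans (∑Vs-const _) (sym (ℚₚ.*-assoc nℚ (nℚ ^ℚ j) c)))

  ∑ⁿ-nonneg : ∀ j {f : List V → ℚ} → (∀ x → 0ℚ ≤ℚ f x) → 0ℚ ≤ℚ ∑ⁿ j f
  ∑ⁿ-nonneg j {f} h = subst (_≤ℚ ∑ⁿ j f) (trans (∑ⁿ-const j 0ℚ) (ℚₚ.*-zeroʳ (nℚ ^ℚ j))) (∑ⁿ-mono j (λ x _ → h x))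

  ∑ⁿ-++ : ∀ i j (Φ : List V → ℚ) → ∑ⁿ (i ℕ.+ j) Φ ≡ ∑ⁿ i (λ x → ∑ⁿ j (λ y → Φ (x ++ y)))
  ∑ⁿ-++ zero j Φ = refl
  ∑ⁿ-++ (suc i) j Φ = ∑-cong Vs (λ v → ∑ⁿ-++ i j (Φ ∘ (v ∷_)))

  ∑ⁿ-snoc : ∀ j (Φ : List V → ℚ) → ∑ⁿ (suc j) Φ ≡ ∑ⁿ j (λ x → ∑ Vs (λ v → Φ (x ++ [ v ])))
  ∑ⁿ-snoc zero Φ = refl
  ∑ⁿ-snoc (suc j) Φ = ∑-cong Vs (λ v → ∑ⁿ-snoc j (Φ ∘ (v ∷_)))

  ∑ⁿ-reverse : ∀ j (Φ : List V → ℚ) → ∑ⁿ j (Φ ∘ reverse) ≡ ∑ⁿ j Φ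
  ∑ⁿ-reverse zero Φ = refl
  ∑ⁿ-reverse (suc j) Φ = trans (∑-cong Vs (λ v → trans (∑ⁿ-cong j (λ x _ → cong Φ (Lₚ.unfold-reverse v x)))
      (∑ⁿ-reverse j (λ x → Φ (x ++ [ v ])))))
    (trans (sym (∑ⁿ-comm-∑ j Vs (λ v x → Φ (x ++ [ v ])))) (sym (∑ⁿ-snoc j Φ)))

  -- By symmetry each of the m + 1 positions of the removed entry contributes the same, so the entry
  -- may be summed first.
  ∑ⁿ-picks : ∀ m (g : V → List V → ℚ) →
    ∑ⁿ (suc m) (λ y → ∑ (picks y) (λ p → g (proj₁ p) (proj₂ p))) ≡ fromℕ (suc m) * ∑ Vs (λ v → ∑ⁿ m (g v))
  ∑ⁿ-picks zero g = trans (∑-cong Vs (λ v → ℚₚ.+-identityʳ (g v []))) (sym (fromℕ1* (∑ Vs (λ v → g v []))))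
  ∑ⁿ-picks (suc m) g = trans (∑-cong Vs (λ v → trans (∑ⁿ-cong (suc m) (λ y _ → cong (g v y +_) (∑-map (λ p → proj₁ p , v ∷ proj₂ p) (picks y) (λ p → g (proj₁ p) (proj₂ p)))))
       (trans (∑ⁿ-+ (suc m) (g v) (λ y → ∑ (picks y) (λ p → g (proj₁ p) (v ∷ proj₂ p)))) (cong (∑ⁿ (suc m) (g v) +_) (∑ⁿ-picks m (λ u y → g u (v ∷ y)))))))
     (trans (∑-+ Vs _ _) (trans (cong (S +_) (trans (∑-*ˡ Vs (fromℕ (suc m)) _) (cong (fromℕ (suc m) *_) (∑-comm Vs Vs _))))
       (trans (e S (fromℕ (suc m))) (cong (_* S) (sym (fromℕ-suc (suc m)))))))
    where
    S = ∑ Vs (λ v → ∑ⁿ (suc m) (g v))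
    e : ∀ s t → s + t * s ≡ (1ℚ + t) * s
    e = solve-∀ ℚ-ring

  ∑ⁿ-≥-avg : 0 ℕ.< n → ∀ j c (f : List V → ℚ) → (nℚ ^ℚ j) * c ≤ℚ ∑ⁿ j f → ∃ λ x → length x ≡ j × c ≤ℚ f x
  ∑ⁿ-≥-avg 0<n zero c f h = [] , refl , subst (_≤ℚ f []) (ℚₚ.*-identityˡ c) h
  ∑ⁿ-≥-avg 0<n (suc j) c f h =
    let (v , p) = pick n refl
        (x , e , q) = ∑ⁿ-≥-avg 0<n j c (f ∘ (v ∷_)) p
    in v ∷ x , cong suc e , q
    where
    h' : ∑ Vs (λ _ → (nℚ ^ℚ j) * c) ≤ℚ ∑ Vs (λ v → ∑ⁿ j (f ∘ (v ∷_)))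
    h' = subst (_≤ℚ ∑ⁿ (suc j) f) (trans (ℚₚ.*-assoc nℚ (nℚ ^ℚ j) c) (sym (∑Vs-const _))) h
    go : ∀ xs → 0 ℕ.< length xs → ∑ xs (λ _ → (nℚ ^ℚ j) * c) ≤ℚ ∑ xs (λ v → ∑ⁿ j (f ∘ (v ∷_))) →
      ∃ λ v → (nℚ ^ℚ j) * c ≤ℚ ∑ⁿ j (f ∘ (v ∷_))
    go (x ∷ xs) _ q = ∑-≥-avg x xs _ _ q
    pick : ∀ m → m ≡ n → ∃ λ v → (nℚ ^ℚ j) * c ≤ℚ ∑ⁿ j (f ∘ (v ∷_))
    pick m _ = go Vs (subst (0 ℕ.<_) (sym |Vs|) 0<n) h'

  mem : V → List V → Bool
  mem v [] = false
  mem v (u ∷ l) = eqᵇ v u ∨ mem v l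

  distinct : List V → Bool
  distinct [] = true
  distinct (v ∷ l) = not (mem v l) ∧ distinct l

  mem-↭ : ∀ v {l l'} → l ↭ l' → mem v l ≡ mem v l'
  mem-↭ v Perm.refl = refl
  mem-↭ v (Perm.prep x p) = cong (eqᵇ v x ∨_) (mem-↭ v p)
  mem-↭ v (Perm.swap x y p) rewrite mem-↭ v p with eqᵇ v x | eqᵇ v y
  ... | true | true = refl
  ... | true | false = refl
  ... | false | true = refl
  ... | false | false = refl
  mem-↭ v (Perm.trans p q) = trans (mem-↭ v p) (mem-↭ v q)

  distinct-↭ : ∀ {l l'} → l ↭ l' → distinct l ≡ distinct l'
  distinct-↭ Perm.refl = refl
  distinct-↭ (Perm.prep x p) = cong₂ (λ a b → not a ∧ b) (mem-↭ x p) (distinct-↭ p)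
  distinct-↭ (Perm.swap {xs} {ys} x y p) rewrite mem-↭ x p | mem-↭ y p | distinct-↭ p | eqᵇ-sym x y
    with eqᵇ y x | mem x ys | mem y ys
  ... | true | true | true = refl
  ... | true | true | false = refl
  ... | true | false | true = refl
  ... | true | false | false = refl
  ... | false | true | true = refl
  ... | false | true | false = refl
  ... | false | false | true = refl
  ... | false | false | false = refl
  distinct-↭ (Perm.trans p q) = trans (distinct-↭ p) (distinct-↭ q)

  distinct-++ʳ : ∀ x {l} → distinct (x ++ l) ≡ true → distinct l ≡ true
  distinct-++ʳ [] h = h
  distinct-++ʳ (v ∷ x) {l} h with mem v (x ++ l)
  ... | false = distinct-++ʳ x h

  ∑-mem≤ : ∀ l → ∑ Vs (λ v → 𝟙 (mem v l)) ≤ℚ fromℕ (length l)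
  ∑-mem≤ [] = ℚₚ.≤-reflexive (trans (∑-0 Vs) (sym fromℕ-0))
  ∑-mem≤ (u ∷ l) = ℚₚ.≤-trans (∑-mono Vs (λ v → or≤ (eqᵇ v u) (mem v l)))
    (subst₂ _≤ℚ_ (sym (∑-+ Vs _ _)) (sym (fromℕ-suc (length l)))
      (ℚₚ.+-mono-≤ (ℚₚ.≤-reflexive (∑-eqᵇ n u)) (∑-mem≤ l)))
    where
    or≤ : ∀ a b → 𝟙 (a ∨ b) ≤ℚ 𝟙 a + 𝟙 b
    or≤ true b = subst (_≤ℚ 1ℚ + 𝟙 b) (ℚₚ.+-identityʳ 1ℚ) (ℚₚ.+-monoʳ-≤ 1ℚ (𝟙≥0 b))
    or≤ false b = ℚₚ.≤-reflexive (sym (ℚₚ.+-identityˡ (𝟙 b)))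

  ∑-mem : ∀ l → distinct l ≡ true → ∑ Vs (λ v → 𝟙 (mem v l)) ≡ fromℕ (length l)
  ∑-mem [] h = trans (∑-0 Vs) (sym fromℕ-0)
  ∑-mem (u ∷ l) h with mem u l in eq
  ... | false = trans (∑-cong Vs or) (trans (∑-+ Vs _ _) (trans (cong₂ _+_ (∑-eqᵇ n u) (∑-mem l h)) (sym (fromℕ-suc (length l)))))
    where
    or : ∀ v → 𝟙 (eqᵇ v u ∨ mem v l) ≡ 𝟙 (eqᵇ v u) + 𝟙 (mem v l)
    or v with v Fin.≟ u
    ... | no _ = sym (ℚₚ.+-identityˡ _)
    ... | yes refl = sym (trans (cong (λ b → 1ℚ + 𝟙 b) eq) (ℚₚ.+-identityʳ 1ℚ))

  private
    square-step : ∀ j L → j ℕ.* (j ℕ.+ L) ℕ.+ (j ℕ.+ L) ℕ.≤ suc j ℕ.* (suc j ℕ.+ L)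
    square-step j L = subst (ℕ._≤ suc j ℕ.* (suc j ℕ.+ L)) (ℕₚ.+-comm (j ℕ.+ L) (j ℕ.* (j ℕ.+ L)))
      (ℕₚ.*-monoʳ-≤ (suc j) (ℕₚ.n≤1+n (j ℕ.+ L)))

  -- Union bound: each of the j new entries meets one of at most j + |L| others with probability at
  -- most (j + |L|) / n.
  collisions : ∀ j L → distinct L ≡ true →
    nℚ * ∑ⁿ j (λ x → 𝟙 (not (distinct (x ++ L)))) ≤ℚ fromℕ (j ℕ.* (j ℕ.+ length L)) * (nℚ ^ℚ j)
  collisions zero L h rewrite h = ℚₚ.≤-reflexive (trans (ℚₚ.*-zeroʳ nℚ) (sym (fromℕ0* 1ℚ)))
  collisions (suc j) L h = ℚₚ.≤-trans (*-monoˡ (fromℕ≥0 n) step) (ℚₚ.≤-trans (ℚₚ.≤-reflexive (e₁ nℚ D M (nℚ ^ℚ j)))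
     (ℚₚ.≤-trans (ℚₚ.+-monoˡ-≤ (M * (nℚ * (nℚ ^ℚ j))) (*-monoˡ (fromℕ≥0 n) (collisions j L h)))
     (ℚₚ.≤-trans (ℚₚ.≤-reflexive (trans (e₂ nℚ K M (nℚ ^ℚ j)) (cong (_* (nℚ * (nℚ ^ℚ j))) (sym (fromℕ-+ (j ℕ.* (j ℕ.+ length L)) (j ℕ.+ length L))))))
       (*-monoʳ (nℚ^≥0 (suc j)) (fromℕ-mono (square-step j (length L)))))))
    where
    D = ∑ⁿ j (λ x → 𝟙 (not (distinct (x ++ L))))
    M = fromℕ (j ℕ.+ length L)
    K = fromℕ (j ℕ.* (j ℕ.+ length L))
    e₁ : ∀ n D M N → n * (n * D + M * N) ≡ n * (n * D) + M * (n * N)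
    e₁ = solve-∀ ℚ-ring
    e₂ : ∀ n K M N → n * (K * N) + M * (n * N) ≡ (K + M) * (n * N)
    e₂ = solve-∀ ℚ-ring
    nand : ∀ a b → 𝟙 (not (not a ∧ b)) ≤ℚ 𝟙 (not b) + 𝟙 a
    nand true true = ℚₚ.≤-reflexive (sym (ℚₚ.+-identityˡ 1ℚ))
    nand true false = subst (_≤ℚ 1ℚ + 1ℚ) (ℚₚ.+-identityʳ 1ℚ) (ℚₚ.+-monoʳ-≤ 1ℚ 0≤1)
    nand false b = ℚₚ.≤-reflexive (sym (ℚₚ.+-identityʳ (𝟙 (not b))))
    step : ∑ Vs (λ v → ∑ⁿ j (λ x → 𝟙 (not (distinct (v ∷ x ++ L))))) ≤ℚ nℚ * D + M * (nℚ ^ℚ j)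
    step = ℚₚ.≤-trans (∑-mono Vs (λ v → ∑ⁿ-mono j (λ x _ → nand (mem v (x ++ L)) (distinct (x ++ L)))))
      (ℚₚ.≤-trans (ℚₚ.≤-reflexive (trans (∑-cong Vs (λ v → ∑ⁿ-+ j _ _)) (trans (∑-+ Vs _ _)
         (cong₂ _+_ (∑Vs-const D) (sym (∑ⁿ-comm-∑ j Vs (λ v x → 𝟙 (mem v (x ++ L)))))))))
      (ℚₚ.+-monoʳ-≤ (nℚ * D) (ℚₚ.≤-trans (∑ⁿ-mono j (λ x e → subst (∑ Vs (λ v → 𝟙 (mem v (x ++ L))) ≤ℚ_)
          (cong fromℕ (trans (Lₚ.length-++ x) (cong (ℕ._+ length L) e))) (∑-mem≤ (x ++ L))))
          (ℚₚ.≤-reflexive (trans (∑ⁿ-const j M) (ℚₚ.*-comm _ M))))))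

inv-mult : ∀ {x y} → 0ℚ < x → 0ℚ < y → inv (x * y) ≡ inv x * inv y
inv-mult {x} {y} p q = sym (inv-unique (*-pos p q) (trans (e x y (inv x) (inv y)) (cong₂ _*_ (*-inv p) (*-inv q))))
  where
  e : ∀ x y i j → (x * y) * (i * j) ≡ (x * i) * (y * j)
  e = solve-∀ ℚ-ring

inv-1 : inv 1ℚ ≡ 1ℚ
inv-1 = sym (inv-unique 0<1 refl)

^ℚ-nonneg : ∀ {c} j → 0ℚ ≤ℚ c → 0ℚ ≤ℚ c ^ℚ j
^ℚ-nonneg zero p = 0≤1
^ℚ-nonneg (suc j) p = *-nonneg p (^ℚ-nonneg j p)

-- Falling factorials and counts

falling : ℕ → ℕ → ℕ
falling m zero = 1
falling zero (suc j) = 0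
falling (suc m) (suc j) = suc m ℕ.* falling m j

-- Pascal's rule for falling factorials; the left side is `falling (suc m) (suc j)`. It is the
-- recursion that a factorial moment obeys when one marked entry is added.
falling-step : ∀ m j → suc m ℕ.* falling m j ≡ falling m (suc j) ℕ.+ suc j ℕ.* falling m j
falling-step zero zero = refl
falling-step zero (suc j) = sym (ℕₚ.*-zeroʳ (suc j))
falling-step (suc m) zero = trans (ℕₚ.*-identityʳ (suc (suc m))) (trans (ℕₚ.+-comm 1 (suc m)) (cong (ℕ._+ 1) (sym (ℕₚ.*-identityʳ (suc m)))))
falling-step (suc m) (suc j) = toℕ-eq
  where
  open ≡-Reasoning
  a = falling m j
  toℕ-eq : suc (suc m) ℕ.* (suc m ℕ.* a) ≡ suc m ℕ.* falling m (suc j) ℕ.+ suc (suc j) ℕ.* (suc m ℕ.* a)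
  toℕ-eq = begin
    suc m ℕ.* a ℕ.+ suc m ℕ.* (suc m ℕ.* a)                                   ≡⟨ cong (λ z → suc m ℕ.* a ℕ.+ suc m ℕ.* z) (falling-step m j) ⟩
    suc m ℕ.* a ℕ.+ suc m ℕ.* (falling m (suc j) ℕ.+ suc j ℕ.* a)             ≡⟨ cong (suc m ℕ.* a ℕ.+_) (ℕₚ.*-distribˡ-+ (suc m) (falling m (suc j)) _) ⟩
    suc m ℕ.* a ℕ.+ (suc m ℕ.* falling m (suc j) ℕ.+ suc m ℕ.* (suc j ℕ.* a)) ≡⟨ sym (ℕₚ.+-assoc (suc m ℕ.* a) (suc m ℕ.* falling m (suc j)) _) ⟩
    suc m ℕ.* a ℕ.+ suc m ℕ.* falling m (suc j) ℕ.+ suc m ℕ.* (suc j ℕ.* a)   ≡⟨ cong₂ ℕ._+_ (ℕₚ.+-comm (suc m ℕ.* a) _)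
        (trans (sym (ℕₚ.*-assoc (suc m) (suc j) a)) (trans (cong (ℕ._* a) (ℕₚ.*-comm (suc m) (suc j))) (ℕₚ.*-assoc (suc j) (suc m) a))) ⟩
    suc m ℕ.* falling m (suc j) ℕ.+ suc m ℕ.* a ℕ.+ suc j ℕ.* (suc m ℕ.* a)   ≡⟨ ℕₚ.+-assoc (suc m ℕ.* falling m (suc j)) (suc m ℕ.* a) _ ⟩
    suc m ℕ.* falling m (suc j) ℕ.+ (suc m ℕ.* a ℕ.+ suc j ℕ.* (suc m ℕ.* a)) ∎

falling-mono : ∀ {a b} j → a ℕ.≤ b → falling a j ℕ.≤ falling b j
falling-mono zero p = ℕₚ.≤-refl
falling-mono {zero} (suc j) p = ℕ.z≤n
falling-mono {suc a} {suc b} (suc j) (ℕ.s≤s p) = ℕₚ.*-mono-≤ (ℕ.s≤s p) (falling-mono j p)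

falling>0 : ∀ {m j} → j ℕ.≤ m → 1 ℕ.≤ falling m j
falling>0 {m} {zero} p = ℕₚ.≤-refl
falling>0 {suc m} {suc j} (ℕ.s≤s p) = ℕₚ.*-mono-≤ {1} {suc m} (ℕ.s≤s ℕ.z≤n) (falling>0 p)

-- Factor by factor: each factor of `falling m j` is at most m, each factor of `falling t j` at
-- least t - j.
falling-ratio : ∀ m t j c θ → 0ℚ ≤ℚ c → 0ℚ ≤ℚ θ → j ℕ.≤ t → fromℕ m * c ≤ℚ θ * fromℕ (t ℕ.∸ j) →
  fromℕ (falling m j) * (c ^ℚ j) ≤ℚ (θ ^ℚ j) * fromℕ (falling t j)
falling-ratio m t zero c θ 0≤c 0≤θ p h = ℚₚ.≤-reflexive (ℚₚ.*-comm (fromℕ 1) 1ℚ)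
falling-ratio zero t (suc j) c θ 0≤c 0≤θ p h = subst (_≤ℚ (θ ^ℚ suc j) * fromℕ (falling t (suc j))) (sym (fromℕ0* (c ^ℚ suc j)))
  (*-nonneg (^ℚ-nonneg (suc j) 0≤θ) (fromℕ≥0 (falling t (suc j))))
falling-ratio (suc m) (suc t) (suc j) c θ 0≤c 0≤θ (ℕ.s≤s p) h =
  subst₂ _≤ℚ_ (trans (e (fromℕ (suc m)) c (fromℕ (falling m j)) (c ^ℚ j)) (cong (_* (c ^ℚ suc j)) (sym (fromℕ-* (suc m) (falling m j)))))
    (trans (e' θ (fromℕ (suc t)) (θ ^ℚ j) (fromℕ (falling t j))) (cong ((θ ^ℚ suc j) *_) (sym (fromℕ-* (suc t) (falling t j)))))
    (*-mono (*-nonneg (fromℕ≥0 (suc m)) 0≤c) (*-nonneg (^ℚ-nonneg j 0≤θ) (fromℕ≥0 (falling t j)))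
      (ℚₚ.≤-trans h (*-monoˡ 0≤θ (fromℕ-mono (ℕₚ.≤-trans (ℕₚ.m∸n≤m t j) (ℕₚ.n≤1+n t)))))
      (falling-ratio m t j c θ 0≤c 0≤θ p (ℚₚ.≤-trans (*-monoʳ 0≤c (fromℕ-mono (ℕₚ.n≤1+n m))) h)))
  where
  e : ∀ m c f cj → (m * c) * (f * cj) ≡ (m * f) * (c * cj)
  e = solve-∀ ℚ-ring
  e' : ∀ θ t f g → (θ * t) * (f * g) ≡ (θ * f) * (t * g)
  e' = solve-∀ ℚ-ring

-- Serves to treat exceptional events: either there is none, or their number is at least 1 and can
-- pay for a crude bound.
all-or-some : ∀ {A : Set} (b : A → Bool) (xs : List A) → All (λ x → b x ≡ false) xs ⊎ 1ℚ ≤ℚ ∑ xs (𝟙 ∘ b)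
all-or-some b [] = inj₁ []
all-or-some b (x ∷ xs) with b x in eq | all-or-some b xs
... | true | _ = inj₂ (subst (_≤ℚ 1ℚ + ∑ xs (𝟙 ∘ b)) (ℚₚ.+-identityʳ 1ℚ) (ℚₚ.+-monoʳ-≤ 1ℚ (∑-nonneg xs (λ x → 𝟙≥0 (b x)))))
... | false | inj₁ p = inj₁ (eq ∷ p)
... | false | inj₂ p = inj₂ (subst (1ℚ ≤ℚ_) (sym (ℚₚ.+-identityˡ _)) p)

countᵇ : ∀ {A : Set} → (A → Bool) → List A → ℕ
countᵇ μ [] = 0
countᵇ μ (v ∷ y) = (if μ v then 1 else 0) ℕ.+ countᵇ μ y

∑-countᵇ : ∀ {A : Set} (μ : A → Bool) y → ∑ y (𝟙 ∘ μ) ≡ fromℕ (countᵇ μ y)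
∑-countᵇ μ [] = sym fromℕ-0
∑-countᵇ μ (v ∷ y) with μ v
... | true = trans (cong (1ℚ +_) (∑-countᵇ μ y)) (sym (fromℕ-suc (countᵇ μ y)))
... | false = trans (ℚₚ.+-identityˡ _) (∑-countᵇ μ y)

∧-true : ∀ {a b} → a ≡ true → b ≡ true → a ∧ b ≡ true
∧-true refl refl = refl

∧-true⁻ : ∀ {a b} → a ∧ b ≡ true → a ≡ true × b ≡ true
∧-true⁻ {true} {true} _ = refl , refl

-- Tight paths as lists

take-++ˡ : ∀ {a} {A : Set a} (U : List A) e X → take (length U ℕ.+ e) (U ++ X) ≡ U ++ take e X
take-++ˡ [] e X = refl
take-++ˡ (u ∷ U) e X = cong (u ∷_) (take-++ˡ U e X)

take-++≤ : ∀ {a} {A : Set a} k (U X : List A) → k ℕ.≤ length U → take k (U ++ X) ≡ take k U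
take-++≤ zero U X p = refl
take-++≤ (suc k) (u ∷ U) X (ℕ.s≤s p) = cong (u ∷_) (take-++≤ k U X p)

take-all : ∀ {a} {A : Set a} (U X : List A) → take (length U) (U ++ X) ≡ U
take-all [] X = refl
take-all (u ∷ U) X = cong (u ∷_) (take-all U X)

module TightLists {A : Set} where

  headWindow : ℕ → (List A → Bool) → List A → Bool
  headWindow k P L = if k ℕ.≤ᵇ length L then P (take k L) else true

  tight : ℕ → (List A → Bool) → List A → Bool
  tight k P [] = true
  tight k P (x ∷ L) = headWindow k P (x ∷ L) ∧ tight k P L

  module _ (k : ℕ) (P : List A → Bool) where

    ≤ᵇ-true : ∀ {a b} → a ℕ.≤ b → (a ℕ.≤ᵇ b) ≡ true
    ≤ᵇ-true {a} {b} p = Boolₚ.T-≡ .Function.Equivalence.to (ℕₚ.≤⇒≤ᵇ p)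

    ≤ᵇ-false : ∀ {a b} → b ℕ.< a → (a ℕ.≤ᵇ b) ≡ false
    ≤ᵇ-false {a} {b} p with a ℕ.≤ᵇ b in eq
    ... | false = refl
    ... | true = ⊥-elim (ℕₚ.<⇒≱ p (ℕₚ.≤ᵇ⇒≤ a b (subst T (sym eq) _)))

    head-long : ∀ L → k ℕ.≤ length L → headWindow k P L ≡ P (take k L)
    head-long L p rewrite ≤ᵇ-true p = refl

    head-short : ∀ L → length L ℕ.< k → headWindow k P L ≡ true
    head-short L p rewrite ≤ᵇ-false p = refl

    head-full : ∀ W X → length W ≡ k → headWindow k P (W ++ X) ≡ P W
    head-full W X refl = trans (head-long (W ++ X) (subst (length W ℕ.≤_) (sym (Lₚ.length-++ W)) (ℕₚ.m≤m+n _ _))) (cong P (take-all W X))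

    head-prefix : ∀ U X → k ℕ.≤ length U → headWindow k P (U ++ X) ≡ headWindow k P U
    head-prefix U X p = trans (head-long (U ++ X) (subst (k ℕ.≤_) (sym (Lₚ.length-++ U)) (ℕₚ.≤-trans p (ℕₚ.m≤m+n _ _))))
      (trans (cong P (take-++≤ k U X p)) (sym (head-long U p)))

    tight-short : ∀ L → length L ℕ.< k → tight k P L ≡ true
    tight-short [] p = refl
    tight-short (x ∷ L) p = ∧-true (head-short (x ∷ L) p) (tight-short L (ℕₚ.<-trans (ℕₚ.n<1+n _) p))

    tight-suffix : ∀ U {W} → tight k P (U ++ W) ≡ true → tight k P W ≡ true
    tight-suffix [] h = h
    tight-suffix (x ∷ U) h = tight-suffix U (proj₂ (∧-true⁻ h))

    tight-prefix : ∀ U {W} → tight k P (U ++ W) ≡ true → tight k P U ≡ true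
    tight-prefix [] h = refl
    tight-prefix (x ∷ U) {W} h with ∧-true⁻ {headWindow k P (x ∷ U ++ W)} h | k ℕ.≤? length (x ∷ U)
    ... | a , b | yes p = ∧-true (trans (sym (head-prefix (x ∷ U) W p)) a) (tight-prefix U b)
    ... | a , b | no p = ∧-true (head-short (x ∷ U) (ℕₚ.≰⇒> p)) (tight-prefix U b)

    -- The overlap has at least k - 1 entries, so every window of k entries lies inside U ++ p or
    -- inside p ++ W.
    tight-glue : ∀ U p W → k ℕ.≤ suc (length p) → tight k P (U ++ p) ≡ true → tight k P (p ++ W) ≡ true →
      tight k P (U ++ p ++ W) ≡ true
    tight-glue [] p W h a b = b
    tight-glue (x ∷ U) p W h a b = let (a₁ , a₂) = ∧-true⁻ {headWindow k P (x ∷ U ++ p)} a in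
      ∧-true (trans (trans (cong (λ z → headWindow k P (x ∷ z)) (sym (Lₚ.++-assoc U p W))) (head-prefix (x ∷ U ++ p) W
        (ℕₚ.≤-trans h (ℕ.s≤s (subst (length p ℕ.≤_) (sym (Lₚ.length-++ U)) (ℕₚ.m≤n+m _ _)))))) a₁) (tight-glue U p W h a₂ b)

    tight-window : ∀ W → length W ≡ k → P W ≡ true → tight k P W ≡ true
    tight-window [] e h = refl
    tight-window (x ∷ W) e h = ∧-true (trans (cong (λ z → headWindow k P (x ∷ z)) (sym (Lₚ.++-identityʳ W))) (trans (head-full (x ∷ W) [] e) h))
      (tight-short W (subst (length W ℕ.<_) e (ℕₚ.n<1+n _)))

    tight-window⁻ : ∀ W X → 1 ℕ.≤ k → length W ≡ k → tight k P (W ++ X) ≡ true → P W ≡ true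
    tight-window⁻ (x ∷ W) X _ e h = trans (sym (head-full (x ∷ W) X e)) (proj₁ (∧-true⁻ {headWindow k P (x ∷ W ++ X)} h))
    tight-window⁻ [] X p refl h = ⊥-elim (ℕₚ.1+n≰n p)

  module _ (s : ℕ) (P : List A → Bool) where

    tight-shift : ∀ a y W → length a ≡ s → P (a ++ [ y ]) ≡ true → tight (suc s) P (drop 1 (a ++ [ y ]) ++ W) ≡ true →
      tight (suc s) P (a ++ y ∷ W) ≡ true
    tight-shift [] y W e h t = ∧-true (trans (head-full (suc s) P (y ∷ []) W (cong suc e)) h) t
    tight-shift (x ∷ a) y W e h t = ∧-true (trans (trans (cong (λ z → headWindow (suc s) P (x ∷ z)) (sym (Lₚ.++-assoc a [ y ] W)))
       (head-full (suc s) P (x ∷ a ++ [ y ]) W (trans (cong suc (trans (Lₚ.length-++ a) (ℕₚ.+-comm (length a) 1))) (cong suc e)))) h)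
       (subst (λ z → tight (suc s) P z ≡ true) (Lₚ.++-assoc a [ y ] W) t)

    -- A window through w is w together with s consecutive entries of A ++ X, so tightness in the
    -- link of w is enough. With |A| ≤ s and |X| = s no window of s + 1 entries avoids w.
    tight-insert : (∀ {l l'} → l ↭ l' → P l ≡ P l') → ∀ A X w → length A ℕ.≤ s → length X ≡ s →
      tight s (P ∘ (w ∷_)) (A ++ X) ≡ true → tight s (P ∘ (w ∷_)) X ≡ true → P (w ∷ X) ≡ true → tight (suc s) P (A ++ w ∷ X) ≡ true
    tight-insert P-↭ [] X w p e h h' h'' = tight-window (suc s) P (w ∷ X) (cong suc e) h''
    tight-insert P-↭ (x ∷ A) X w p e h h' h'' = ∧-true
      (trans (head-long (suc s) P (x ∷ A ++ w ∷ X) len₁) (trans (trans (P-↭ (Perm.↭-reflexive take₁)) (trans (P-↭ (Permₚ.shift w (x ∷ A) (take e' X)))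
         (cong (λ z → P (w ∷ z)) (sym take₂)))) (trans (sym (head-long s (P ∘ (w ∷_)) (x ∷ A ++ X) len₂)) (proj₁ (∧-true⁻ {headWindow s (P ∘ (w ∷_)) (x ∷ A ++ X)} h)))))
      (tight-insert P-↭ A X w (ℕₚ.≤-trans (ℕₚ.n≤1+n _) p) e (proj₂ (∧-true⁻ {headWindow s (P ∘ (w ∷_)) (x ∷ A ++ X)} h)) h' h'')
      where
      e' = s ℕ.∸ length (x ∷ A)
      s-eq : length (x ∷ A) ℕ.+ e' ≡ s
      s-eq = ℕₚ.m+[n∸m]≡n p
      len₂ : s ℕ.≤ length (x ∷ A ++ X)
      len₂ = subst₂ ℕ._≤_ e (sym (Lₚ.length-++ (x ∷ A))) (ℕₚ.m≤n+m _ _)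
      len₁ : suc s ℕ.≤ length (x ∷ A ++ w ∷ X)
      len₁ = subst₂ ℕ._≤_ (cong suc e) (sym (Lₚ.length-++ (x ∷ A))) (ℕₚ.m≤n+m (suc (length X)) (length (x ∷ A)))
      take₂ : take s (x ∷ A ++ X) ≡ x ∷ A ++ take e' X
      take₂ = trans (cong (λ z → take z (x ∷ A ++ X)) (sym s-eq)) (take-++ˡ (x ∷ A) e' X)
      take₁ : take (suc s) (x ∷ A ++ w ∷ X) ≡ x ∷ A ++ w ∷ take e' X
      take₁ = trans (cong (λ z → take z (x ∷ A ++ w ∷ X)) (trans (cong suc (sym s-eq)) (sym (ℕₚ.+-suc (length (x ∷ A)) e')))) (take-++ˡ (x ∷ A) (suc e') (w ∷ X))

open TightLists public

-- Powers

^ℚ-+ : ∀ x a b → x ^ℚ (a ℕ.+ b) ≡ (x ^ℚ a) * (x ^ℚ b)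
^ℚ-+ x zero b = sym (ℚₚ.*-identityˡ _)
^ℚ-+ x (suc a) b = trans (cong (x *_) (^ℚ-+ x a b)) (sym (ℚₚ.*-assoc x _ _))

^ℚ-distrib : ∀ x y j → (x * y) ^ℚ j ≡ (x ^ℚ j) * (y ^ℚ j)
^ℚ-distrib x y zero = refl
^ℚ-distrib x y (suc j) = trans (cong ((x * y) *_) (^ℚ-distrib x y j)) (e x y (x ^ℚ j) (y ^ℚ j))
  where
  e : ∀ x y a b → (x * y) * (a * b) ≡ (x * a) * (y * b)
  e = solve-∀ ℚ-ring

^ℚ-mono : ∀ {x y} j → 0ℚ ≤ℚ x → x ≤ℚ y → x ^ℚ j ≤ℚ y ^ℚ j
^ℚ-mono zero p q = ℚₚ.≤-refl
^ℚ-mono (suc j) p q = *-mono p (^ℚ-nonneg j (ℚₚ.≤-trans p q)) q (^ℚ-mono j p q)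

^ℚ-pos : ∀ {x} j → 0ℚ < x → 0ℚ < x ^ℚ j
^ℚ-pos zero p = 0<1
^ℚ-pos (suc j) p = *-pos p (^ℚ-pos j p)

-- Jensen's inequality for powers in tangent form, at the point s. Multiplying the bound for one
-- exponent by x overshoots the next tangent by (j + 1) s^j (x - s)².
power-tangent : ∀ j {s x} → 0ℚ ≤ℚ s → 0ℚ ≤ℚ x → fromℕ (suc j) * (s ^ℚ j) * x - fromℕ j * (s ^ℚ suc j) ≤ℚ x ^ℚ suc j
power-tangent zero {s} {x} p q = ℚₚ.≤-reflexive (trans (cong₂ (λ a b → a * 1ℚ * x - b * (s * 1ℚ)) fromℕ-1 fromℕ-0) (e x s))
  where
  e : ∀ x s → 1ℚ * 1ℚ * x - 0ℚ * (s * 1ℚ) ≡ x * 1ℚ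
  e = solve-∀ ℚ-ring
power-tangent (suc j) {s} {x} p q = ℚₚ.≤-trans (≤-by (trans (cong (λ t → x * (u * a * x - fromℕ j * (s * a)) - (t * (s * a) * x - u * (s * (s * a)))) (fromℕ-suc (suc j)))
    (trans (cong (λ u → x * (u * a * x - fromℕ j * (s * a)) - ((1ℚ + u) * (s * a) * x - u * (s * (s * a)))) (fromℕ-suc j)) (trans (e x s a (fromℕ j))
      (cong (λ u → u * a * ((x - s) * (x - s))) (sym (fromℕ-suc j))))))
    (*-nonneg (*-nonneg (fromℕ≥0 (suc j)) (^ℚ-nonneg j p)) (sq≥0 (x - s)))) (*-monoˡ q (power-tangent j p q))
  where
  a = s ^ℚ j
  u = fromℕ (suc j)
  e : ∀ x s a t → x * ((1ℚ + t) * a * x - t * (s * a)) - ((1ℚ + (1ℚ + t)) * (s * a) * x - (1ℚ + t) * (s * (s * a)))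
      ≡ (1ℚ + t) * a * ((x - s) * (x - s))
  e = solve-∀ ℚ-ring

-- Length of w₀ X₁ w₁ ... X_L w_L with single vertices wᵢ and blocks Xᵢ of s + 1 vertices.
interleavedLength : ℕ → ℕ → ℕ
interleavedLength s zero = 1
interleavedLength s (suc L) = suc (suc s ℕ.+ interleavedLength s L)

interleavedLength-≡ : ∀ s L → interleavedLength s L ≡ L ℕ.* suc s ℕ.+ suc L
interleavedLength-≡ s zero = refl
interleavedLength-≡ s (suc L) = trans (cong (λ z → suc (suc s ℕ.+ z)) (interleavedLength-≡ s L))
  (trans (cong suc (sym (ℕₚ.+-assoc (suc s) (L ℕ.* suc s) (suc L)))) (sym (ℕₚ.+-suc (suc s ℕ.+ L ℕ.* suc s) (suc L))))

connLength : ℕ → ℕ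
connLength zero = 0
connLength (suc s) = interleavedLength s (connLength s)

-- With L = `connLength s`: the exponent L + 1 counts the inserted vertices, 2δ - 1 is the density
-- of a common neighbourhood of the two ends, and δ^(s L) is paid for lengthening a connection in
-- the link from L to L (s + 1) vertices.
connDensity : ℚ → ℕ → ℚ
connDensity δ zero = 1ℚ
connDensity δ (suc s) = ((2ℚ * δ - 1ℚ) * ((δ ^ℚ (s ℕ.* connLength s)) * connDensity δ s)) ^ℚ suc (connLength s)

module Walks {A : Set} (P : List A → Bool) where

  -- `S` is the current end of the path with its oldest vertex first. The new vertex stands in front
  -- of `S` because `P` is applied up to permutation.
  walk : List A → List A → Bool
  walk S [] = true
  walk S (v ∷ vs) = P (v ∷ S) ∧ walk (drop 1 S ++ [ v ]) vs

  endpoint : List A → List A → List A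
  endpoint S [] = S
  endpoint S (v ∷ vs) = endpoint (drop 1 S ++ [ v ]) vs

∑-member : ∀ {a} {A : Set a} {xs : List A} {x} (f : A → ℚ) → (∀ x → 0ℚ ≤ℚ f x) → x ∈ xs → f x ≤ℚ ∑ xs f
∑-member {xs = _ ∷ xs} f h (here refl) = subst (_≤ℚ f _ + ∑ xs f) (ℚₚ.+-identityʳ (f _)) (ℚₚ.+-monoʳ-≤ (f _) (∑-nonneg xs h))
∑-member {xs = y ∷ xs} {x} f h (there p) = subst (_≤ℚ f y + ∑ xs f) (ℚₚ.+-identityˡ (f x)) (ℚₚ.+-mono-≤ (h y) (∑-member f h p))

module _ {A : Set} where

  ++-group₃ : ∀ (u e c a : List A) → u ++ e ++ c ++ a ≡ (u ++ e ++ c) ++ a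
  ++-group₃ u e c a = trans (cong (u ++_) (sym (Lₚ.++-assoc e c a))) (sym (Lₚ.++-assoc u (e ++ c) a))

  regroup-left : ∀ (u e c u₃ b rc rw S : List A) →
    (((u ++ e ++ c) ++ u₃) ++ b ++ rc) ++ rw ++ S ≡ (u ++ e) ++ c ++ (u₃ ++ b) ++ rc ++ rw ++ S
  regroup-left u e c u₃ b rc rw S = begin
    (((u ++ e ++ c) ++ u₃) ++ b ++ rc) ++ rw ++ S ≡⟨ ++-group₃ ((u ++ e ++ c) ++ u₃) b rc (rw ++ S) ⟨
    ((u ++ e ++ c) ++ u₃) ++ b ++ rc ++ rw ++ S ≡⟨ Lₚ.++-assoc (u ++ e ++ c) u₃ (b ++ rc ++ rw ++ S) ⟩
    (u ++ e ++ c) ++ u₃ ++ b ++ rc ++ rw ++ S ≡⟨ cong₂ _++_ (sym (Lₚ.++-assoc u e c)) (sym (Lₚ.++-assoc u₃ b (rc ++ rw ++ S))) ⟩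
    ((u ++ e) ++ c) ++ (u₃ ++ b) ++ rc ++ rw ++ S ≡⟨ Lₚ.++-assoc (u ++ e) c ((u₃ ++ b) ++ rc ++ rw ++ S) ⟩
    (u ++ e) ++ c ++ (u₃ ++ b) ++ rc ++ rw ++ S ∎
    where open ≡-Reasoning

  regroup-right : ∀ (S v c m rc rw S' : List A) →
    (S ++ v) ++ c ++ m ++ rc ++ rw ++ S' ≡ (S ++ v ++ (c ++ m ++ rc) ++ rw) ++ S'
  regroup-right S v c m rc rw S' = begin
    (S ++ v) ++ c ++ m ++ rc ++ rw ++ S' ≡⟨ Lₚ.++-assoc S v (c ++ m ++ rc ++ rw ++ S') ⟩
    S ++ v ++ c ++ m ++ rc ++ rw ++ S' ≡⟨ cong (λ z → S ++ v ++ z) (++-group₃ c m rc (rw ++ S')) ⟩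
    S ++ v ++ (c ++ m ++ rc) ++ rw ++ S' ≡⟨ cong (λ z → S ++ z) (++-group₃ v (c ++ m ++ rc) rw S') ⟩
    S ++ (v ++ (c ++ m ++ rc) ++ rw) ++ S' ≡⟨ Lₚ.++-assoc S (v ++ (c ++ m ++ rc) ++ rw) S' ⟨
    (S ++ v ++ (c ++ m ++ rc) ++ rw) ++ S' ∎
    where open ≡-Reasoning

tight-reverse : ∀ {A : Set} s (P : List A → Bool) → (∀ {l l'} → l ↭ l' → P l ≡ P l') → ∀ L →
  tight (suc s) P L ≡ true → tight (suc s) P (reverse L) ≡ true
tight-reverse s P P-↭ [] h = refl
tight-reverse s P P-↭ (x ∷ L) h with s ℕ.≤? length L
... | no short = tight-short (suc s) P (reverse (x ∷ L)) (subst (ℕ._< suc s) (sym (Lₚ.length-reverse (x ∷ L))) (ℕ.s≤s (ℕₚ.≰⇒> short)))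
... | yes long = subst (λ z → tight (suc s) P z ≡ true) (sym eq)
  (tight-glue (suc s) P (reverse (drop s L)) (reverse p) [ x ] (ℕₚ.≤-reflexive (cong suc (sym |rp|)))
    (subst (λ z → tight (suc s) P z ≡ true) (trans (cong reverse (sym (Lₚ.take++drop≡id s L))) (Lₚ.reverse-++ p (drop s L)))
      (tight-reverse s P P-↭ L (proj₂ (∧-true⁻ {headWindow (suc s) P (x ∷ L)} h))))
    (tight-window (suc s) P (reverse p ++ [ x ]) (trans (Lₚ.length-++ (reverse p)) (trans (ℕₚ.+-comm (length (reverse p)) 1) (cong suc |rp|)))
      (trans (P-↭ (↭-trans (Permₚ.++-comm (reverse p) [ x ]) (Perm.prep x (Permₚ.↭-reverse p))))
        (trans (sym (head-long (suc s) P (x ∷ L) (ℕ.s≤s long))) (proj₁ (∧-true⁻ {headWindow (suc s) P (x ∷ L)} h))))))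
  where
  p = take s L
  |rp| : length (reverse p) ≡ s
  |rp| = trans (Lₚ.length-reverse p) (trans (Lₚ.length-take s L) (ℕₚ.m≤n⇒m⊓n≡m long))
  eq : reverse (x ∷ L) ≡ reverse (drop s L) ++ reverse p ++ [ x ]
  eq = trans (Lₚ.unfold-reverse x L) (trans (cong (_++ [ x ]) (trans (cong reverse (sym (Lₚ.take++drop≡id s L))) (Lₚ.reverse-++ p (drop s L))))
    (Lₚ.++-assoc (reverse (drop s L)) (reverse p) [ x ]))

-- Stated from the two recursion equations of `someHit`, so that it serves both targets. The first
-- chunk that hits is taken out; the chunks before and after it form the remainder that is to be
-- absorbed.
someHit-chunk : ∀ {n} ℓ (hits : List (Fin n) → Bool) (someHit : ℕ → List (Fin n) → Bool) →
  (∀ y → someHit zero y ≡ false) → (∀ i y → someHit (suc i) y ≡ hits (take ℓ y) ∨ someHit i (drop ℓ y)) →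
  ∀ i y → length y ≡ suc i ℕ.* ℓ → someHit (suc i) y ≡ true →
  ∃ λ c → ∃ λ r → y ↭ c ++ r × length c ≡ ℓ × length r ≡ i ℕ.* ℓ × hits c ≡ true
someHit-chunk ℓ hits someHit h₀ hs i y ey h with hits (take ℓ y) in hit | trans (sym (hs i y)) h
... | true | _ = take ℓ y , drop ℓ y , Perm.↭-reflexive (sym (Lₚ.take++drop≡id ℓ y))
    , trans (Lₚ.length-take ℓ y) (trans (cong (ℓ ℕ.⊓_) ey) (ℕₚ.m≤n⇒m⊓n≡m (ℕₚ.m≤m+n ℓ (i ℕ.* ℓ))))
    , trans (Lₚ.length-drop ℓ y) (trans (cong (ℕ._∸ ℓ) ey) (ℕₚ.m+n∸m≡n ℓ (i ℕ.* ℓ))) , hit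
... | false | h' with i
... | zero = ⊥-elim (Boolₚ.not-¬ refl (trans (sym h') (h₀ (drop ℓ y))))
... | suc i' =
  let (c , r , p , ec , er , hc) = someHit-chunk ℓ hits someHit h₀ hs i' (drop ℓ y)
        (trans (Lₚ.length-drop ℓ y) (trans (cong (ℕ._∸ ℓ) ey) (ℕₚ.m+n∸m≡n ℓ (suc i' ℕ.* ℓ)))) h'
  in c , take ℓ y ++ r
   , ↭-trans (Perm.↭-reflexive (sym (Lₚ.take++drop≡id ℓ y))) (↭-trans (Permₚ.++⁺ˡ (take ℓ y) p) (Permₚ.shifts (take ℓ y) c))
   , ec
   , trans (Lₚ.length-++ (take ℓ y)) (cong₂ ℕ._+_ (trans (Lₚ.length-take ℓ y) (trans (cong (ℓ ℕ.⊓_) ey) (ℕₚ.m≤n⇒m⊓n≡m (ℕₚ.m≤m+n ℓ (suc i' ℕ.* ℓ))))) er)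
   , hc

reorder : ∀ {A : Set} (S v c a r r' G c' w : List A) → S ++ v ++ (c ++ (a ++ (r ++ r') ++ G) ++ c') ++ w
  ↭ ((S ++ w ++ c' ++ r') ++ v ++ c ++ r) ++ G ++ a
reorder S v c a r r' G c' w = begin
  S ++ v ++ (c ++ (a ++ (r ++ r') ++ G) ++ c') ++ w ≡⟨ cong (λ x → S ++ v ++ x) (trans (Lₚ.++-assoc c ((a ++ (r ++ r') ++ G) ++ c') w) (cong (c ++_) (Lₚ.++-assoc (a ++ (r ++ r') ++ G) c' w))) ⟩
  S ++ v ++ c ++ (a ++ (r ++ r') ++ G) ++ c' ++ w ↭⟨ Permₚ.++⁺ˡ S (Permₚ.++⁺ˡ v (Permₚ.++⁺ˡ c (Permₚ.++⁺ inner (Permₚ.++-comm c' w)))) ⟩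
  S ++ v ++ c ++ (r ++ r' ++ G ++ a) ++ w ++ c' ≡⟨ cong (λ x → S ++ v ++ c ++ x) (Lₚ.++-assoc r (r' ++ G ++ a) (w ++ c')) ⟩
  S ++ v ++ c ++ r ++ (r' ++ G ++ a) ++ w ++ c' ↭⟨ Permₚ.++⁺ˡ S (Permₚ.++⁺ˡ v (Permₚ.++⁺ˡ c (Permₚ.++⁺ˡ r (Permₚ.++-comm (r' ++ G ++ a) (w ++ c'))))) ⟩
  S ++ v ++ c ++ r ++ (w ++ c') ++ r' ++ G ++ a ≡⟨ cong (S ++_) (sym (trans (Lₚ.++-assoc v (c ++ r) x) (cong (v ++_) (Lₚ.++-assoc c r x)))) ⟩
  S ++ (v ++ c ++ r) ++ (w ++ c') ++ r' ++ G ++ a ≡⟨ cong (λ x → S ++ (v ++ c ++ r) ++ x) (trans (sym (Lₚ.++-assoc (w ++ c') r' (G ++ a))) (cong (_++ G ++ a) (Lₚ.++-assoc w c' r'))) ⟩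
  S ++ (v ++ c ++ r) ++ (w ++ c' ++ r') ++ G ++ a ↭⟨ Permₚ.++⁺ˡ S (Permₚ.shifts (v ++ c ++ r) (w ++ c' ++ r')) ⟩
  S ++ (w ++ c' ++ r') ++ (v ++ c ++ r) ++ G ++ a ≡⟨ sym (trans (Lₚ.++-assoc (S ++ w ++ c' ++ r') (v ++ c ++ r) (G ++ a)) (Lₚ.++-assoc S (w ++ c' ++ r') _)) ⟩
  ((S ++ w ++ c' ++ r') ++ v ++ c ++ r) ++ G ++ a ∎
  where
  open Perm.PermutationReasoning
  x = (w ++ c') ++ r' ++ G ++ a
  inner : a ++ (r ++ r') ++ G ↭ r ++ r' ++ G ++ a
  inner = ↭-trans (Permₚ.++-comm a ((r ++ r') ++ G)) (Perm.↭-reflexive (trans (Lₚ.++-assoc (r ++ r') G a) (Lₚ.++-assoc r r' (G ++ a))))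

-- Vertex sets of lists

setOf : ∀ {n} → List (Fin n) → Subset n
setOf = foldr (λ v e → ⁅ v ⁆ ∪ e) ∅

setOf-↭ : ∀ {n} {l l' : List (Fin n)} → l ↭ l' → setOf l ≡ setOf l'
setOf-↭ Perm.refl = refl
setOf-↭ (Perm.prep v p) = cong (⁅ v ⁆ ∪_) (setOf-↭ p)
setOf-↭ (Perm.swap {xs} {ys} u v p) = trans (cong (λ e → ⁅ u ⁆ ∪ (⁅ v ⁆ ∪ e)) (setOf-↭ p))
  (trans (sym (Subsetₚ.∪-assoc ⁅ u ⁆ ⁅ v ⁆ (setOf ys))) (trans (cong (_∪ setOf ys) (Subsetₚ.∪-comm ⁅ u ⁆ ⁅ v ⁆)) (Subsetₚ.∪-assoc ⁅ v ⁆ ⁅ u ⁆ (setOf ys))))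
setOf-↭ (Perm.trans p q) = trans (setOf-↭ p) (setOf-↭ q)

setOf-map : ∀ {n} {A : Set} (f : A → Fin n) xs → setOf (map f xs) ≡ foldr (λ x e → ⁅ f x ⁆ ∪ e) ∅ xs
setOf-map f [] = refl
setOf-map f (x ∷ xs) = cong (⁅ f x ⁆ ∪_) (setOf-map f xs)

lookup-∅ : ∀ {n} (v : Fin n) → lookup ∅ v ≡ false
lookup-∅ v = Vecₚ.lookup-replicate v false

lookup-⁅⁆ : ∀ {n} (u v : Fin n) → lookup ⁅ u ⁆ v ≡ eqᵇ v u
lookup-⁅⁆ Fin.zero Fin.zero = refl
lookup-⁅⁆ Fin.zero (Fin.suc v) = lookup-∅ v
lookup-⁅⁆ (Fin.suc u) Fin.zero = refl
lookup-⁅⁆ (Fin.suc u) (Fin.suc v) = lookup-⁅⁆ u v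

∣⁅v⁆∪p∣ : ∀ {n} (v : Fin n) (p : Subset n) → lookup p v ≡ false → ∣ ⁅ v ⁆ ∪ p ∣ ≡ suc ∣ p ∣
∣⁅v⁆∪p∣ Fin.zero (false Vec.∷ p) h = cong (suc ∘ ∣_∣) (Subsetₚ.∪-identityˡ p)
∣⁅v⁆∪p∣ (Fin.suc v) (true Vec.∷ p) h = cong suc (∣⁅v⁆∪p∣ v p h)
∣⁅v⁆∪p∣ (Fin.suc v) (false Vec.∷ p) h = ∣⁅v⁆∪p∣ v p h

module _ {n : ℕ} where
  open Sequences n

  lookup-setOf : ∀ l v → lookup (setOf l) v ≡ mem v l
  lookup-setOf [] v = lookup-∅ v
  lookup-setOf (u ∷ l) v = trans (Vecₚ.lookup-zipWith _∨_ v ⁅ u ⁆ (setOf l)) (cong₂ _∨_ (lookup-⁅⁆ u v) (lookup-setOf l v))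

  ∣setOf∣ : ∀ l → distinct l ≡ true → ∣ setOf l ∣ ≡ length l
  ∣setOf∣ [] h = trans (Subsetₚ.∣⊥∣≡0 n) refl
  ∣setOf∣ (v ∷ l) h with mem v l in eq
  ... | false = trans (∣⁅v⁆∪p∣ v (setOf l) (trans (lookup-setOf l v) eq)) (cong suc (∣setOf∣ l h))

  mem-lookup : ∀ {m v} (x : Vec V m) j → v ≡ lookup x j → mem v (toList x) ≡ true
  mem-lookup (u Vec.∷ x) Fin.zero refl with u Fin.≟ u
  ... | yes _ = refl
  ... | no ¬p = ⊥-elim (¬p refl)
  mem-lookup {v = v} (u Vec.∷ x) (Fin.suc j) e = trans (cong (eqᵇ v u ∨_) (mem-lookup x j e)) (Boolₚ.∨-zeroʳ (eqᵇ v u))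

  distinct-lookup : ∀ {m} (x : Vec V m) → distinct (toList x) ≡ true → ∀ i j → lookup x i ≡ lookup x j → i ≡ j
  distinct-lookup (v Vec.∷ x) h i j e with mem v (toList x) in eq
  distinct-lookup (v Vec.∷ x) h Fin.zero Fin.zero e | false = refl
  distinct-lookup (v Vec.∷ x) h Fin.zero (Fin.suc j) e | false = ⊥-elim (Boolₚ.not-¬ refl (trans (sym (mem-lookup x j e)) eq))
  distinct-lookup (v Vec.∷ x) h (Fin.suc i) Fin.zero e | false = ⊥-elim (Boolₚ.not-¬ refl (trans (sym (mem-lookup x i (sym e))) eq))
  distinct-lookup (v Vec.∷ x) h (Fin.suc i) (Fin.suc j) e | false = cong Fin.suc (distinct-lookup x h i j e)

all-true : ∀ {A : Set} (p : A → Bool) xs → (∀ x → p x ≡ true) → all p xs ≡ true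
all-true p [] h = refl
all-true p (x ∷ xs) h = ∧-true (h x) (all-true p xs h)

injectiveᵇ-true : ∀ {n m} (x : Vec (Fin n) m) → Sequences.distinct n (toList x) ≡ true → injectiveᵇ x ≡ true
injectiveᵇ-true {n} {m} x h = all-true (λ i → all (λ j → ⌊ i Fin.≟ j ⌋ ∨ not ⌊ lookup x i Fin.≟ lookup x j ⌋) (allFin m)) (allFin m)
  (λ i → all-true (λ j → ⌊ i Fin.≟ j ⌋ ∨ not ⌊ lookup x i Fin.≟ lookup x j ⌋) (allFin m) (λ j → pair i j))
  where
  pair : ∀ i j → ⌊ i Fin.≟ j ⌋ ∨ not ⌊ lookup x i Fin.≟ lookup x j ⌋ ≡ true
  pair i j with i Fin.≟ j | lookup x i Fin.≟ lookup x j
  ... | yes _ | _ = refl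
  ... | no _ | no _ = refl
  ... | no i≢j | yes e = ⊥-elim (i≢j (distinct-lookup x h i j e))

-- Cyclic windows

module _ {A : Set} where

  applyUpTo-+ : ∀ (f : ℕ → A) a b → applyUpTo f (a ℕ.+ b) ≡ applyUpTo f a ++ applyUpTo (λ t → f (a ℕ.+ t)) b
  applyUpTo-+ f zero b = refl
  applyUpTo-+ f (suc a) b = cong (f 0 ∷_) (applyUpTo-+ (f ∘ suc) a b)

  applyUpTo-cong : ∀ {f g : ℕ → A} n → (∀ t → f t ≡ g t) → applyUpTo f n ≡ applyUpTo g n
  applyUpTo-cong zero h = refl
  applyUpTo-cong (suc n) h = cong₂ _∷_ (h 0) (applyUpTo-cong n (λ t → h (suc t)))

  applyUpTo-toList : ∀ {n} (g : ℕ → A) (x : Vec A n) → (∀ j → g (toℕ j) ≡ lookup x j) → applyUpTo g n ≡ toList x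
  applyUpTo-toList g Vec.[] h = refl
  applyUpTo-toList g (v Vec.∷ x) h = cong₂ _∷_ (h Fin.zero) (applyUpTo-toList (g ∘ suc) x (λ j → h (Fin.suc j)))

module Cyclic {n-1 : ℕ} (x : Vec (Fin (suc n-1)) (suc n-1)) where
  private
    n = suc n-1
    X = toList x
  open Sequences n

  entry : ℕ → V
  entry t = lookup x (t mod n)

  entry-period : ∀ t → entry (n ℕ.+ t) ≡ entry t
  entry-period t = cong (lookup x) (Finₚ.toℕ-injective (trans (Finₚ.toℕ-fromℕ< _) (trans (trans (cong (_% n) (ℕₚ.+-comm n t)) ([m+n]%n≡m%n t n)) (sym (Finₚ.toℕ-fromℕ< _)))))

  entry-lookup : ∀ j → entry (toℕ j) ≡ lookup x j
  entry-lookup j = cong (lookup x) (Finₚ.toℕ-injective (trans (Finₚ.toℕ-fromℕ< _) (m<n⇒m%n≡m (Finₚ.toℕ<n j))))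

  list : applyUpTo entry n ≡ X
  list = applyUpTo-toList entry x entry-lookup

  window-at : ℕ → ℕ → List V
  window-at k i = applyUpTo (λ t → entry (i ℕ.+ t)) k

  -- The window is an initial piece of the n entries read from position i on, and these are a
  -- rotation of the whole list.
  window-distinct : ∀ k i → k ℕ.≤ n → i ℕ.≤ n → distinct X ≡ true → distinct (window-at k i) ≡ true
  window-distinct k i k≤n i≤n h = distinct-++ʳ (applyUpTo (λ t → entry (i ℕ.+ (k ℕ.+ t))) (n ℕ.∸ k))
    (trans (distinct-↭ (↭-trans (Permₚ.++-comm (applyUpTo (λ t → entry (i ℕ.+ (k ℕ.+ t))) (n ℕ.∸ k)) (window-at k i)) (Perm.↭-reflexive (sym (applyUpTo-+ (λ t → entry (i ℕ.+ t)) k (n ℕ.∸ k))))))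
    (trans (cong (λ m → distinct (window-at m i)) (trans (ℕₚ.m+[n∸m]≡n k≤n) (sym (ℕₚ.m∸n+n≡m i≤n))))
    (trans (distinct-↭ (↭-trans (Perm.↭-reflexive (trans (applyUpTo-+ (λ t → entry (i ℕ.+ t)) (n ℕ.∸ i) i)
        (cong (window-at (n ℕ.∸ i) i ++_) (applyUpTo-cong i wrap)))) (Permₚ.++-comm (window-at (n ℕ.∸ i) i) (applyUpTo entry i))))
    (trans (cong distinct (trans (sym (applyUpTo-+ entry i (n ℕ.∸ i))) (trans (cong (applyUpTo entry) (ℕₚ.m+[n∸m]≡n i≤n)) list))) h))))
    where
    wrap : ∀ t → entry (i ℕ.+ (n ℕ.∸ i ℕ.+ t)) ≡ entry t
    wrap t = trans (cong entry (trans (sym (ℕₚ.+-assoc i (n ℕ.∸ i) t)) (cong (ℕ._+ t) (ℕₚ.m+[n∸m]≡n i≤n)))) (entry-period t)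

  unrolled : ∀ s → s ℕ.≤ n → X ++ take s X ≡ applyUpTo entry (n ℕ.+ s)
  unrolled s s≤n = sym (trans (applyUpTo-+ entry n s) (cong₂ _++_ list (trans (applyUpTo-cong s entry-period) (sym prefix))))
    where
    prefix : take s X ≡ applyUpTo entry s
    prefix = trans (cong (take s) (trans (sym list) (trans (cong (applyUpTo entry) (sym (ℕₚ.m+[n∸m]≡n s≤n))) (applyUpTo-+ entry s (n ℕ.∸ s)))))
      (trans (cong (λ j → take j (applyUpTo entry s ++ applyUpTo (λ t → entry (s ℕ.+ t)) (n ℕ.∸ s))) (sym (Lₚ.length-applyUpTo entry s))) (take-all (applyUpTo entry s) _))

  -- Appending the first s entries unrolls the cycle to length n + s, where each of the n cyclic
  -- windows is an ordinary one.
  tight-cycle-window : ∀ s P → suc s ℕ.≤ n → tight (suc s) P (X ++ take s X) ≡ true → ∀ i → i ℕ.< n → P (window-at (suc s) i) ≡ true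
  tight-cycle-window s P k≤n h i i<n = tight-window⁻ (suc s) P (window-at (suc s) i) (applyUpTo (λ t → entry (i ℕ.+ (suc s ℕ.+ t))) (n ℕ.+ s ℕ.∸ (i ℕ.+ suc s))) (ℕ.s≤s ℕ.z≤n) (Lₚ.length-applyUpTo (λ t → entry (i ℕ.+ t)) (suc s))
    (tight-suffix (suc s) P (applyUpTo entry i) (subst (λ z → tight (suc s) P z ≡ true) split h))
    where
    fits : i ℕ.+ suc s ℕ.≤ n ℕ.+ s
    fits = ℕₚ.≤-trans (ℕₚ.≤-reflexive (ℕₚ.+-suc i s)) (ℕₚ.+-monoˡ-≤ s i<n)
    split : X ++ take s X ≡ applyUpTo entry i ++ window-at (suc s) i ++ applyUpTo (λ t → entry (i ℕ.+ (suc s ℕ.+ t))) (n ℕ.+ s ℕ.∸ (i ℕ.+ suc s))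
    split = trans (unrolled s (ℕₚ.≤-trans (ℕₚ.n≤1+n s) k≤n)) (trans (cong (applyUpTo entry) (trans (sym (ℕₚ.m+[n∸m]≡n fits)) (ℕₚ.+-assoc i (suc s) _)))
      (trans (applyUpTo-+ entry i (suc s ℕ.+ (n ℕ.+ s ℕ.∸ (i ℕ.+ suc s)))) (cong (applyUpTo entry i ++_) (applyUpTo-+ (λ t → entry (i ℕ.+ t)) (suc s) (n ℕ.+ s ℕ.∸ (i ℕ.+ suc s))))))

-- Degenerate lists count as edges, so that the minimum degree condition holds for all lists.

edge : ∀ {k n} → Hypergraph k n → List (Fin n) → Bool
edge {n = n} G l = not (Sequences.distinct n l) ∨ isEdge G (setOf l)

edge-↭ : ∀ {k n} (G : Hypergraph k n) {l l'} → l ↭ l' → edge G l ≡ edge G l'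
edge-↭ {n = n} G p = cong₂ (λ a b → not a ∨ b) (Sequences.distinct-↭ n p) (cong (isEdge G) (setOf-↭ p))

length-filterᵇ : ∀ {A : Set} (p : A → Bool) xs → fromℕ (length (filterᵇ p xs)) ≡ ∑ xs (𝟙 ∘ p)
length-filterᵇ p [] = fromℕ-0
length-filterᵇ p (x ∷ xs) with p x
... | true = trans (fromℕ-suc (length (filterᵇ p xs))) (cong (1ℚ +_) (length-filterᵇ p xs))
... | false = trans (length-filterᵇ p xs) (sym (ℚₚ.+-identityˡ _))

-- A degenerate list stays degenerate under every extension, so all n vertices count; this case is
-- where δ ≤ 1 is used.
edge-degree : ∀ {k n s} (G : Hypergraph k n) δ → δ ≤ℚ 1ℚ → (∀ S → ∣ S ∣ ≡ s → δ * fromℕ n ≤ℚ fromℕ (degree G S)) →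
  ∀ l → length l ≡ s → δ * fromℕ n ≤ℚ ∑ (allFin n) (λ v → 𝟙 (edge G (v ∷ l)))
edge-degree {n = n} G δ δ≤1 h l e with Sequences.distinct n l in dl
... | true = ℚₚ.≤-trans (h (setOf l) (trans (∣setOf∣ l dl) e)) (ℚₚ.≤-trans (ℚₚ.≤-reflexive (length-filterᵇ (λ v → isEdge G (setOf l ∪ ⁅ v ⁆)) (allFin n)))
    (∑-mono (allFin n) (λ v → 𝟙-implies (λ p → trans (cong (not (not (Sequences.mem n v l) ∧ true) ∨_) (trans (cong (isEdge G) (Subsetₚ.∪-comm ⁅ v ⁆ (setOf l))) p)) (Boolₚ.∨-zeroʳ _)))))
... | false = ℚₚ.≤-trans (*-monoʳ (fromℕ≥0 n) δ≤1) (ℚₚ.≤-reflexive (trans (ℚₚ.*-identityˡ (fromℕ n)) (trans (sym (Sequences.∑Vs-1 n))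
    (∑-cong (allFin n) (λ v → cong (λ b → 𝟙 (not b ∨ isEdge G (setOf (v ∷ l)))) (sym (Boolₚ.∧-zeroʳ (not (Sequences.mem n v l)))))))))

∑-allVecs : ∀ {n} m (f : List (Fin n) → ℚ) → ∑ (allVecs m) (f ∘ toList) ≡ Sequences.∑ⁿ n m f
∑-allVecs zero f = ℚₚ.+-identityʳ (f [])
∑-allVecs {n} (suc m) f = trans (∑-concatMap (λ v → map (v Vec.∷_) (allVecs m)) (allFin n) (f ∘ toList))
  (∑-cong (allFin n) (λ v → trans (∑-map (v Vec.∷_) (allVecs m) (f ∘ toList)) (∑-allVecs m (f ∘ (v ∷_)))))

hamiltonian : ∀ {s n} → Hypergraph (suc s) n → List (Fin n) → Bool
hamiltonian {s} {n} G X = Sequences.distinct n X ∧ tight (suc s) (edge G) (X ++ take s X)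

hamiltonian-tight : ∀ {s n-1} (G : Hypergraph (suc s) (suc n-1)) → suc s ℕ.≤ suc n-1 → ∀ x →
  hamiltonian G (toList x) ≡ true → injectiveᵇ x ∧ tightᵇ G x ≡ true
hamiltonian-tight {s} {n-1} G k≤n x h = ∧-true (injectiveᵇ-true x d) (all-true (λ i → isEdge G (window (suc s) n-1 x i)) (allFin (suc n-1)) at)
  where
  open Cyclic x
  d = proj₁ (∧-true⁻ {Sequences.distinct (suc n-1) (toList x)} h)
  at : ∀ i → isEdge G (window (suc s) n-1 x i) ≡ true
  at i = trans (cong (isEdge G) (sym (trans (cong setOf (sym (Lₚ.map-upTo (λ t → entry (toℕ i ℕ.+ t)) (suc s)))) (setOf-map (λ t → entry (toℕ i ℕ.+ t)) (upTo (suc s))))))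
    (trans (cong (λ b → not b ∨ isEdge G (setOf (window-at (suc s) (toℕ i)))) (sym (window-distinct (suc s) (toℕ i) k≤n (ℕₚ.<⇒≤ (Finₚ.toℕ<n i)) d)))
      (tight-cycle-window s (edge G) k≤n (proj₂ (∧-true⁻ {Sequences.distinct (suc n-1) (toList x)} h)) (toℕ i) (Finₚ.toℕ<n i)))

orderings-bound : ∀ {s n-1} (G : Hypergraph (suc s) (suc n-1)) → suc s ℕ.≤ suc n-1 →
  Sequences.∑ⁿ (suc n-1) (suc n-1) (𝟙 ∘ hamiltonian G) ≤ℚ fromℕ (numTightOrderings G)
orderings-bound {s} {n-1} G k≤n = subst₂ _≤ℚ_ (∑-allVecs (suc n-1) (𝟙 ∘ hamiltonian G)) (sym (length-filterᵇ (λ x → injectiveᵇ x ∧ tightᵇ G x) (allVecs (suc n-1))))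
  (∑-mono (allVecs (suc n-1)) (λ x → 𝟙-implies (hamiltonian-tight G k≤n x)))

distinct-map-suc : ∀ n (l : List (Fin n)) → Sequences.distinct (suc n) (map Fin.suc l) ≡ Sequences.distinct n l
distinct-map-suc n [] = refl
distinct-map-suc n (v ∷ l) = cong₂ (λ a b → not a ∧ b) (mem-map-suc v l) (distinct-map-suc n l)
  where
  mem-map-suc : ∀ v l → Sequences.mem (suc n) (Fin.suc v) (map Fin.suc l) ≡ Sequences.mem n v l
  mem-map-suc v [] = refl
  mem-map-suc v (u ∷ l) = cong (eqᵇ v u ∨_) (mem-map-suc v l)

distinct-allFin : ∀ n → Sequences.distinct n (allFin n) ≡ true
distinct-allFin zero = refl
distinct-allFin (suc n) = ∧-true (cong not zero∉) (trans (cong (Sequences.distinct (suc n)) (sym (Lₚ.map-tabulate id Fin.suc))) (trans (distinct-map-suc n (allFin n)) (distinct-allFin n)))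
  where
  zero∉-map : ∀ (l : List (Fin n)) → Sequences.mem (suc n) Fin.zero (map Fin.suc l) ≡ false
  zero∉-map [] = refl
  zero∉-map (v ∷ l) = zero∉-map l
  zero∉ : Sequences.mem (suc n) Fin.zero (tabulate Fin.suc) ≡ false
  zero∉ = trans (cong (Sequences.mem (suc n) Fin.zero) (sym (Lₚ.map-tabulate id Fin.suc))) (zero∉-map (allFin n))

distinct-list : ∀ n s → s ℕ.≤ n → ∃ λ l → length l ≡ s × Sequences.distinct n l ≡ true
distinct-list n s s≤n = drop (n ℕ.∸ s) (allFin n)
  , trans (Lₚ.length-drop (n ℕ.∸ s) (allFin n)) (trans (cong (ℕ._∸ (n ℕ.∸ s)) (Lₚ.length-tabulate {n = n} id)) (ℕₚ.m∸[m∸n]≡n s≤n))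
  , Sequences.distinct-++ʳ n (take (n ℕ.∸ s) (allFin n)) (trans (cong (Sequences.distinct n) (Lₚ.take++drop≡id (n ℕ.∸ s) (allFin n))) (distinct-allFin n))

minDegree≤1 : ∀ {k n s} (G : Hypergraph k n) δ → s ℕ.≤ n → 0 ℕ.< n → (∀ S → ∣ S ∣ ≡ s → δ * fromℕ n ≤ℚ fromℕ (degree G S)) → δ ≤ℚ 1ℚ
minDegree≤1 {n = n} {s} G δ s≤n 0<n h = divide-n (let (l , e , d) = distinct-list n s s≤n in
    ℚₚ.≤-trans (h (setOf l) (trans (∣setOf∣ l d) e)) (ℚₚ.≤-trans (ℚₚ.≤-reflexive (length-filterᵇ (λ v → isEdge G (setOf l ∪ ⁅ v ⁆)) (allFin n)))
      (ℚₚ.≤-trans (∑-mono (allFin n) (λ v → 𝟙≤1 (isEdge G (setOf l ∪ ⁅ v ⁆)))) (ℚₚ.≤-reflexive (Sequences.∑Vs-1 n)))))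
  where
  divide-n : δ * fromℕ n ≤ℚ fromℕ n → δ ≤ℚ 1ℚ
  divide-n p = *-cancelˡ {fromℕ n} (fromℕ-pos 0<n) (subst₂ _≤ℚ_ (ℚₚ.*-comm δ (fromℕ n)) (sym (ℚₚ.*-identityʳ (fromℕ n))) p)

⅛ 1/16 1/32 : ℚ
⅛ = (ℤ.+ 1) ℚ./ 8
1/16 = (ℤ.+ 1) ℚ./ 16
1/32 = (ℤ.+ 1) ℚ./ 32

-- Chosen such that 2m · `tailBound m` is exactly 1 / (m - 1) - 1 / m for m ≥ 1: the errors of the
-- successive steps then telescope.
tailBound : ℕ → ℚ
tailBound zero = 0ℚ
tailBound (suc m) = inv (2ℚ * fromℕ (suc m)) * (inv (fromℕ m) - inv (fromℕ (suc m)))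

-- Constants that depend on k, δ and δ₁ only

record Constants (κ : ℕ) (δ δ₁ : ℚ) : Set where
  s : ℕ
  s = suc κ
  ℓ : ℕ
  ℓ = connLength s
  field
    c₀ : ℚ
    0<c₀ : 0ℚ < c₀
    c₀≤1 : c₀ ≤ℚ 1ℚ
    2c₀≤absorb : 2ℚ * c₀ ≤ℚ (2ℚ * δ - 1ℚ) ^ℚ (s ℕ.+ s)
    2c₀≤conn : 2ℚ * c₀ ≤ℚ connDensity δ s
    -- A walk stops with q₁ + 1 chunks of ℓ vertices left. One chunk makes the connection, the other
    -- q₁ have to be absorbed, so the two sides leave g = 2 q₁ ℓ vertices. `q` is the number of
    -- absorbers prepared for each of them.
    q₁ q : ℕ
  m₀ : ℕ
  m₀ = suc q₁ ℕ.* ℓ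
  h : ℕ
  h = q₁ ℕ.* ℓ
  g : ℕ
  g = h ℕ.+ h
  |Q|max : ℕ
  |Q|max = g ℕ.* (q ℕ.* (ℓ ℕ.+ (s ℕ.+ s))) ℕ.+ s
  field
    1≤m₀ : 1 ℕ.≤ m₀
    m₀-large : inv (fromℕ m₀) ≤ℚ 1/16
    few-misses : (1ℚ - c₀) ^ℚ suc q₁ ≤ℚ 1/32
    few-bad : fromℕ m₀ * (fromℕ g * ((1ℚ - c₀) ^ℚ q) * 2ℚ) ≤ℚ 1/32
    -- With m vertices left: the number of non-neighbours that is tolerated, its complement, and the
    -- order of the factorial moment that bounds the exceptions.
    d r tailSize : ℕ → ℕ
    d≥1 : ∀ m → m₀ ℕ.< m → 1 ℕ.≤ d m
    d≤r : ∀ m → m₀ ℕ.< m → d m ℕ.≤ r m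
    r+d : ∀ m → m₀ ℕ.< m → r m ℕ.+ d m ≡ m
    r-large : ∀ m → δ₁ * fromℕ m ≤ℚ fromℕ (r m)
    c γ θ : ℚ
    0≤c : 0ℚ ≤ℚ c
    0≤γ : 0ℚ ≤ℚ γ
    0≤θ : 0ℚ ≤ℚ θ
    tailSize≤γm : ∀ m → fromℕ (tailSize m) ≤ℚ γ * fromℕ m
    tailSize≤m : ∀ m → tailSize m ℕ.≤ m
    tailSize≤d : ∀ m → tailSize m ℕ.≤ suc (d m)
    tail-ratio : ∀ m → fromℕ m * c ≤ℚ θ * fromℕ (suc (d m) ℕ.∸ tailSize m)
    tail-small : ∀ m → m₀ ℕ.< m → θ ^ℚ tailSize m ≤ℚ tailBound m
    M : ℕ
    M-bound : ℓ ℕ.+ (s ℕ.+ s) ℕ.+ (m₀ ℕ.+ (s ℕ.+ |Q|max)) ℕ.≤ M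

∸-fromℕ : ∀ a b → fromℕ a - fromℕ b ≤ℚ fromℕ (a ℕ.∸ b)
∸-fromℕ a b = ≤-by (trans (ring (fromℕ (a ℕ.∸ b)) (fromℕ a) (fromℕ b)) (cong (_- fromℕ a) (sym (fromℕ-+ b (a ℕ.∸ b)))))
    (diff≥0 (fromℕ-mono {a} {b ℕ.+ (a ℕ.∸ b)} (ℕₚ.m≤n+m∸n a b)))
  where
  ring : ∀ x a b → x - (a - b) ≡ b + x - a
  ring = solve-∀ ℚ-ring

balanced : ∀ R → ∃ λ A → ∃ λ B → A ℕ.+ B ≡ R × A ℕ.≤ B × B ℕ.≤ suc A
balanced zero = 0 , 0 , refl , ℕ.z≤n , ℕ.z≤n
balanced (suc R) = let (A , B , e , A≤B , B≤) = balanced R in B , suc A , trans (ℕₚ.+-suc B A) (cong suc (trans (ℕₚ.+-comm B A) e)) , B≤ , ℕ.s≤s A≤B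

^ℚ-≥1 : ∀ {x} j → 1ℚ ≤ℚ x → 1ℚ ≤ℚ x ^ℚ j
^ℚ-≥1 zero h = ℚₚ.≤-refl
^ℚ-≥1 {x} (suc j) h = subst (_≤ℚ x ^ℚ suc j) (ℚₚ.*-identityˡ 1ℚ) (*-mono 0≤1 (ℚₚ.≤-trans 0≤1 (^ℚ-≥1 j h)) h (^ℚ-≥1 j h))

^ℚ-≤1 : ∀ {x} j → 0ℚ ≤ℚ x → x ≤ℚ 1ℚ → x ^ℚ j ≤ℚ 1ℚ
^ℚ-≤1 zero p h = ℚₚ.≤-refl
^ℚ-≤1 {x} (suc j) p h = subst (x ^ℚ suc j ≤ℚ_) (ℚₚ.*-identityˡ 1ℚ) (*-mono p 0≤1 h (^ℚ-≤1 j p h))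

^ℚ-increasing : ∀ {x a b} → 1ℚ ≤ℚ x → a ℕ.≤ b → x ^ℚ a ≤ℚ x ^ℚ b
^ℚ-increasing {x} {a} {b} h a≤b = subst₂ _≤ℚ_ (ℚₚ.*-identityʳ (x ^ℚ a)) (trans (sym (^ℚ-+ x a (b ℕ.∸ a))) (cong (x ^ℚ_) (ℕₚ.m+[n∸m]≡n a≤b)))
  (*-monoˡ (^ℚ-nonneg a (ℚₚ.≤-trans 0≤1 h)) (^ℚ-≥1 (b ℕ.∸ a) h))

^ℚ-decreasing : ∀ {x a b} → 0ℚ ≤ℚ x → x ≤ℚ 1ℚ → a ℕ.≤ b → x ^ℚ b ≤ℚ x ^ℚ a
^ℚ-decreasing {x} {a} {b} p h a≤b = subst₂ _≤ℚ_ (trans (sym (^ℚ-+ x a (b ℕ.∸ a))) (cong (x ^ℚ_) (ℕₚ.m+[n∸m]≡n a≤b))) (ℚₚ.*-identityʳ (x ^ℚ a))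
  (*-monoˡ (^ℚ-nonneg a p) (^ℚ-≤1 (b ℕ.∸ a) p h))

factorial-growth : ∀ q m N → q ℕ.+ m ℕ.≤ N → fromℕ ((q ℕ.+ m) !) ≤ℚ fromℕ (m !) * (fromℕ N ^ℚ q)
factorial-growth zero m N h = ℚₚ.≤-reflexive (sym (ℚₚ.*-identityʳ _))
factorial-growth (suc q) m N h = ℚₚ.≤-trans (ℚₚ.≤-reflexive (fromℕ-* (suc (q ℕ.+ m)) ((q ℕ.+ m) !)))
  (ℚₚ.≤-trans (*-mono (fromℕ≥0 (suc (q ℕ.+ m))) (*-nonneg (fromℕ≥0 (m !)) (^ℚ-nonneg q (fromℕ≥0 N))) (fromℕ-mono h) (factorial-growth q m N (ℕₚ.≤-trans (ℕₚ.n≤1+n _) h)))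
    (ℚₚ.≤-reflexive (ring (fromℕ N) (fromℕ (m !)) (fromℕ N ^ℚ q))))
  where
  ring : ∀ N f x → N * (f * x) ≡ f * (N * x)
  ring = solve-∀ ℚ-ring

module Graph (n : ℕ) where

  open Sequences n

  ∑ⁿ-member : ∀ j (f : List V → ℚ) → (∀ x → 0ℚ ≤ℚ f x) → ∀ x → length x ≡ j → f x ≤ℚ ∑ⁿ j f
  ∑ⁿ-member zero f h [] e = ℚₚ.≤-refl
  ∑ⁿ-member (suc j) f h (v ∷ x) e = ℚₚ.≤-trans (∑ⁿ-member j (f ∘ (v ∷_)) (λ x → h (v ∷ x)) x (ℕₚ.suc-injective e))
    (∑-member (λ v → ∑ⁿ j (f ∘ (v ∷_))) (λ v → ∑ⁿ-nonneg j (λ x → h (v ∷ x))) (∈-allFin v))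

  -- Uniformly random sequences of distinct vertices avoiding Q

  module Sampling (Q : List V) (distinct-Q : distinct Q ≡ true)
    (N' : ℕ) (|Q|+N' : length Q ℕ.+ N' ≡ n) where

    ff : ℕ → ℚ
    ff zero = 1ℚ
    ff (suc j) = ff j * fromℕ (N' ℕ.∸ j)

    private
      ∸>0 : ∀ {j} → j ℕ.< N' → 0ℚ < fromℕ (N' ℕ.∸ j)
      ∸>0 {j} p = fromℕ-pos ((ℕₚ.m<n⇒0<n∸m p))

    ff>0 : ∀ j → j ℕ.≤ N' → 0ℚ < ff j
    ff>0 zero p = 0<1
    ff>0 (suc j) p = *-pos (ff>0 j (ℕₚ.≤-trans (ℕₚ.n≤1+n j) p)) (∸>0 p)

    -- The probability that the random sequence begins with `l`. It is invariant under permutations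
    -- of `l`, and this exchangeability carries most of the computations below.
    ω : List V → ℚ
    ω l = 𝟙 (distinct (l ++ Q)) * inv (ff (length l))

    ω-↭ : ∀ {l l'} → l ↭ l' → ω l ≡ ω l'
    ω-↭ p = cong₂ (λ b j → 𝟙 b * inv (ff j)) (distinct-↭ (Permₚ.++⁺ʳ Q p)) (Permₚ.↭-length p)

    ω≥0 : ∀ l → length l ℕ.≤ N' → 0ℚ ≤ℚ ω l
    ω≥0 l p = *-nonneg (𝟙≥0 (distinct (l ++ Q))) (inv≥0 (ff>0 (length l) p))

    ω-[] : ω [] ≡ 1ℚ
    ω-[] = trans (cong₂ (λ b x → 𝟙 b * x) distinct-Q inv-1) (ℚₚ.*-identityˡ 1ℚ)

    private
      free : ∀ l → length l ℕ.< N' → distinct (l ++ Q) ≡ true →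
        ∑ Vs (λ v → 𝟙 (not (mem v (l ++ Q)))) ≡ fromℕ (N' ℕ.∸ length l)
      free l p h = trans (∑-cong Vs (λ v → 𝟙-not (mem v (l ++ Q)))) (trans (∑-minus Vs _ _)
        (trans (cong₂ _-_ ∑Vs-1 (trans (∑-mem (l ++ Q) h) (cong fromℕ (Lₚ.length-++ l))))
        (trans (cong (λ z → fromℕ z - fromℕ (length l ℕ.+ length Q)) n-eq)
          (trans (cong (λ z → z - fromℕ (length l ℕ.+ length Q)) (fromℕ-+ (length l ℕ.+ length Q) (N' ℕ.∸ length l)))
            (e (fromℕ (length l ℕ.+ length Q)) _)))))
        where
        e : ∀ a b → (a + b) - a ≡ b
        e = solve-∀ ℚ-ring
        n-eq : n ≡ length l ℕ.+ length Q ℕ.+ (N' ℕ.∸ length l)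
        n-eq = trans (sym |Q|+N') (trans (cong (length Q ℕ.+_) (sym (ℕₚ.m+[n∸m]≡n (ℕₚ.<⇒≤ p))))
          (trans (sym (ℕₚ.+-assoc (length Q) (length l) _)) (cong (ℕ._+ (N' ℕ.∸ length l)) (ℕₚ.+-comm (length Q) (length l)))))

      inv-ff : ∀ j → j ℕ.< N' → inv (ff (suc j)) ≡ inv (ff j) * inv (fromℕ (N' ℕ.∸ j))
      inv-ff j p = inv-mult (ff>0 j (ℕₚ.<⇒≤ p)) (∸>0 p)

      ω-∷ : ∀ v l → length l ℕ.< N' → ω (v ∷ l) ≡ 𝟙 (not (mem v (l ++ Q))) * (ω l * inv (fromℕ (N' ℕ.∸ length l)))
      ω-∷ v l p = trans (cong₂ _*_ (𝟙-∧ (not (mem v (l ++ Q))) (distinct (l ++ Q))) (inv-ff (length l) p))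
        (e (𝟙 (not (mem v (l ++ Q)))) (𝟙 (distinct (l ++ Q))) (inv (ff (length l))) _)
        where
        e : ∀ a b c d → a * b * (c * d) ≡ a * (b * c * d)
        e = solve-∀ ℚ-ring

    ω-marginal : ∀ l → length l ℕ.< N' → ∑ Vs (λ v → ω (v ∷ l)) ≡ ω l
    ω-marginal l p = trans (∑-cong Vs (λ v → ω-∷ v l p)) (trans (∑-*ʳ Vs _ _) go)
      where
      i = inv (fromℕ (N' ℕ.∸ length l))
      e : ∀ x w i → x * (w * i) ≡ (x * i) * w
      e = solve-∀ ℚ-ring
      z : ∀ b → b ≡ false → ∀ x i → x * ((𝟙 b * i) * i) ≡ 𝟙 b * i
      z b refl x i = trans (ℚₚ.*-comm x _) (trans (cong (_* x) (trans (cong (_* i) (ℚₚ.*-zeroˡ i)) (ℚₚ.*-zeroˡ i)))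
        (trans (ℚₚ.*-zeroˡ x) (sym (ℚₚ.*-zeroˡ i))))
      go : ∑ Vs (λ v → 𝟙 (not (mem v (l ++ Q)))) * (ω l * i) ≡ ω l
      go with distinct (l ++ Q) in eq
      ... | true = trans (cong (_* ((1ℚ * inv (ff (length l))) * i)) (free l p eq))
        (trans (e (fromℕ (N' ℕ.∸ length l)) (1ℚ * inv (ff (length l))) i) (trans (cong (_* (1ℚ * inv (ff (length l)))) (*-inv (∸>0 p))) (ℚₚ.*-identityˡ _)))
      ... | false = trans (cong (∑ Vs (λ v → 𝟙 (not (mem v (l ++ Q)))) *_) (trans (cong (_* i) (ℚₚ.*-zeroˡ (inv (ff (length l))))) (ℚₚ.*-zeroˡ i)))
        (trans (ℚₚ.*-zeroʳ (∑ Vs (λ v → 𝟙 (not (mem v (l ++ Q)))))) (sym (ℚₚ.*-zeroˡ (inv (ff (length l))))))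

    ω-marginalⁿ : ∀ j l → length l ℕ.+ j ℕ.≤ N' → ∑ⁿ j (λ x → ω (x ++ l)) ≡ ω l
    ω-marginalⁿ zero l p = refl
    ω-marginalⁿ (suc j) l p = trans (sym (∑ⁿ-comm-∑ j Vs (λ v x → ω (v ∷ x ++ l))))
      (trans (∑ⁿ-cong j (λ x e → ω-marginal (x ++ l) (subst (ℕ._≤ N')
          (trans (ℕₚ.+-suc (length l) j) (cong suc (trans (ℕₚ.+-comm (length l) j) (trans (cong (ℕ._+ length l) (sym e)) (sym (Lₚ.length-++ x)))))) p)))
        (ω-marginalⁿ j l (ℕₚ.≤-trans (ℕₚ.+-monoʳ-≤ (length l) (ℕₚ.n≤1+n j)) p)))

    -- By exchangeability each entry of x is distributed like a single new vertex next to `L`; the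
    -- other m entries are summed out.
    ω-pick-one : ∀ m L (h : V → ℚ) → length L ℕ.+ suc m ℕ.≤ N' →
      ∑ⁿ (suc m) (λ x → ω (x ++ L) * ∑ x h) ≡ fromℕ (suc m) * ∑ Vs (λ u → ω (u ∷ L) * h u)
    ω-pick-one m L h p = trans (∑ⁿ-cong (suc m) (λ x _ → pull x)) (trans (∑ⁿ-picks m (λ u x → ω (x ++ u ∷ L) * h u))
      (cong (fromℕ (suc m) *_) (∑-cong Vs (λ u → trans (∑ⁿ-*ʳ m (h u) (λ x → ω (x ++ u ∷ L)))
        (cong (_* h u) (ω-marginalⁿ m (u ∷ L) (subst (ℕ._≤ N') (ℕₚ.+-suc (length L) m) p)))))))
      where
      pull : ∀ x → ω (x ++ L) * ∑ x h ≡ ∑ (picks x) (λ q → ω (proj₂ q ++ proj₁ q ∷ L) * h (proj₁ q))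
      pull x = trans (cong (ω (x ++ L) *_) (sym (∑-picks x h))) (trans (sym (∑-*ˡ (picks x) (ω (x ++ L)) (h ∘ proj₁)))
        (∑-cong-All (All.map (λ {q} s → cong (_* h (proj₁ q)) (ω-↭ (↭-trans (Permₚ.++⁺ʳ L s)
           (↭-sym (Permₚ.shift (proj₁ q) (proj₂ q) L))))) (picks-↭ x))))

    ω-pick-split : ∀ m L (g : V → List V → ℚ) →
      ∑ⁿ (suc m) (λ y → ω (L ++ y) * ∑ (picks y) (λ p → g (proj₁ p) (proj₂ p)))
        ≡ fromℕ (suc m) * ∑ Vs (λ v → ∑ⁿ m (λ y → ω (L ++ v ∷ y) * g v y))
    ω-pick-split m L g = trans (∑ⁿ-cong (suc m) (λ y _ → trans (sym (∑-*ˡ (picks y) (ω (L ++ y)) _))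
        (∑-cong-All (All.map (λ {q} s → cong (_* g (proj₁ q) (proj₂ q)) (ω-↭ (Permₚ.++⁺ˡ L s))) (picks-↭ y)))))
      (∑ⁿ-picks m (λ v y → ω (L ++ v ∷ y) * g v y))

    -- Hypergeometric tail bound through factorial moments

    module Tail (μ : V → Bool) (c : ℚ) (J : ℕ) (0≤c : 0ℚ ≤ℚ c) (J≤N' : J ℕ.≤ N')
      (sparse : ∀ i → i ℕ.< J → ∑ Vs (𝟙 ∘ μ) ≤ℚ c * fromℕ (N' ℕ.∸ i)) where

      -- Number of ordered j-tuples of distinct positions that carry marked vertices, in a form that
      -- allows induction over the entries of `y`.
      moment : ℕ → List V → ℚ
      moment zero y = 1ℚ
      moment (suc j) [] = 0ℚ
      moment (suc j) (v ∷ y) = moment (suc j) y + 𝟙 (μ v) * (fromℕ (suc j) * moment j y)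

      moment-falling : ∀ j y → moment j y ≡ fromℕ (falling (countᵇ μ y) j)
      moment-falling zero y = sym fromℕ-1
      moment-falling (suc j) [] = sym fromℕ-0
      moment-falling (suc j) (v ∷ y) with μ v
      ... | true = trans (cong₂ (λ a b → a + 1ℚ * (fromℕ (suc j) * b)) (moment-falling (suc j) y) (moment-falling j y))
        (trans (cong (fromℕ (falling (countᵇ μ y) (suc j)) +_) (trans (ℚₚ.*-identityˡ _) (sym (fromℕ-* (suc j) (falling (countᵇ μ y) j)))))
          (trans (sym (fromℕ-+ (falling (countᵇ μ y) (suc j)) (suc j ℕ.* falling (countᵇ μ y) j))) (cong fromℕ (sym (falling-step (countᵇ μ y) j)))))
      ... | false = trans (cong (moment (suc j) y +_) (ℚₚ.*-zeroˡ (fromℕ (suc j) * moment j y))) (trans (ℚₚ.+-identityʳ _) (moment-falling (suc j) y))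

      marked-step : ∀ l → length l ℕ.< J → ∑ Vs (λ v → 𝟙 (μ v) * ω (v ∷ l)) ≤ℚ c * ω l
      marked-step l p = ℚₚ.≤-trans (∑-mono Vs (λ v → *-monoˡ (𝟙≥0 (μ v)) (ℚₚ.≤-trans (ℚₚ.≤-reflexive (ω-∷ v l q))
            (subst ((𝟙 (not (mem v (l ++ Q))) * (ω l * i)) ≤ℚ_) (ℚₚ.*-identityˡ (ω l * i)) (*-monoʳ 0≤ωi (𝟙≤1 (not (mem v (l ++ Q)))))))))
         (ℚₚ.≤-trans (ℚₚ.≤-reflexive (∑-*ʳ Vs (ω l * i) (𝟙 ∘ μ))) (ℚₚ.≤-trans (*-monoʳ 0≤ωi (sparse (length l) p))
           (ℚₚ.≤-reflexive (trans (e c (fromℕ (N' ℕ.∸ length l)) (ω l) i) (trans (cong (c * ω l *_) (*-inv (∸>0 q))) (ℚₚ.*-identityʳ _))))))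
        where
        q : length l ℕ.< N'
        q = ℕₚ.<-≤-trans p J≤N'
        i = inv (fromℕ (N' ℕ.∸ length l))
        0≤ωi : 0ℚ ≤ℚ ω l * i
        0≤ωi = *-nonneg (ω≥0 l (ℕₚ.<⇒≤ q)) (inv≥0 (∸>0 q))
        e : ∀ c t w i → (c * t) * (w * i) ≡ c * w * (t * i)
        e = solve-∀ ℚ-ring

      -- Given what has been exposed, the next vertex is marked with probability at most c. Hence
      -- each of the `falling m j` tuples of positions is fully marked with probability at most c^j;
      -- `J` limits how many vertices are ever exposed.
      moment-bound : ∀ m j l → length l ℕ.+ m ℕ.≤ N' → length l ℕ.+ j ℕ.≤ J →
        ∑ⁿ m (λ y → ω (y ++ l) * moment j y) ≤ℚ fromℕ (falling m j) * (c ^ℚ j) * ω l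
      moment-bound m zero l p q = ℚₚ.≤-reflexive (trans (∑ⁿ-cong m (λ y _ → ℚₚ.*-identityʳ (ω (y ++ l))))
        (trans (ω-marginalⁿ m l p) (sym (trans (cong (_* ω l) (fromℕ1* 1ℚ)) (ℚₚ.*-identityˡ (ω l))))))
      moment-bound zero (suc j) l p q = ℚₚ.≤-reflexive (trans (ℚₚ.*-zeroʳ (ω l))
        (sym (trans (cong (_* ω l) (fromℕ0* (c ^ℚ suc j))) (ℚₚ.*-zeroˡ (ω l)))))
      moment-bound (suc m) (suc j) l p q = ℚₚ.≤-trans (ℚₚ.≤-reflexive split) (ℚₚ.≤-trans (ℚₚ.+-mono-≤ part₁ part₂) (ℚₚ.≤-reflexive fin))
        where
        p' : length l ℕ.+ m ℕ.< N'
        p' = subst (ℕ._≤ N') (ℕₚ.+-suc (length l) m) p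
        q' : length l ℕ.+ j ℕ.< J
        q' = subst (ℕ._≤ J) (ℕₚ.+-suc (length l) j) q
        A B : ℚ
        A = ∑ⁿ m (λ y → ω (y ++ l) * moment (suc j) y)
        B = ∑ Vs (λ v → 𝟙 (μ v) * (fromℕ (suc j) * ∑ⁿ m (λ y → ω (y ++ v ∷ l) * moment j y)))
        d₁ : ∀ w a x s b → w * (a + x * (s * b)) ≡ a * w + x * s * (w * b)
        d₁ = solve-∀ ℚ-ring
        split : ∑ Vs (λ v → ∑ⁿ m (λ y → ω (v ∷ y ++ l) * moment (suc j) (v ∷ y))) ≡ A + B
        split = trans (∑-cong Vs (λ v → trans (∑ⁿ-cong m (λ y _ → d₁ (ω (v ∷ y ++ l)) (moment (suc j) y) (𝟙 (μ v)) (fromℕ (suc j)) (moment j y)))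
              (∑ⁿ-+ m _ _))) (trans (∑-+ Vs _ _) (cong₂ _+_
           (trans (sym (∑ⁿ-comm-∑ m Vs (λ v y → moment (suc j) y * ω (v ∷ y ++ l)))) (∑ⁿ-cong m (λ y e → trans (∑-*ˡ Vs (moment (suc j) y) (λ v → ω (v ∷ y ++ l)))
              (trans (cong (moment (suc j) y *_) (ω-marginal (y ++ l) (subst (ℕ._< N') (trans (ℕₚ.+-comm (length l) m) (trans (cong (ℕ._+ length l) (sym e)) (sym (Lₚ.length-++ y)))) p')))
                 (ℚₚ.*-comm (moment (suc j) y) (ω (y ++ l)))))))
           (∑-cong Vs (λ v → trans (∑ⁿ-*ˡ m (𝟙 (μ v) * fromℕ (suc j)) (λ y → ω (v ∷ y ++ l) * moment j y))
              (trans (ℚₚ.*-assoc (𝟙 (μ v)) (fromℕ (suc j)) _) (cong (λ z → 𝟙 (μ v) * (fromℕ (suc j) * z))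
                (∑ⁿ-cong m (λ y _ → cong (_* moment j y) (ω-↭ (↭-sym (Permₚ.shift v y l)))))))))))
        part₁ : A ≤ℚ fromℕ (falling m (suc j)) * (c ^ℚ suc j) * ω l
        part₁ = moment-bound m (suc j) l (ℕₚ.<⇒≤ p') q
        K = fromℕ (suc j) * (fromℕ (falling m j) * (c ^ℚ j))
        0≤K : 0ℚ ≤ℚ K
        0≤K = *-nonneg (fromℕ≥0 (suc j)) (*-nonneg (fromℕ≥0 (falling m j)) (^ℚ-nonneg j 0≤c))
        d₂ : ∀ x s f w → x * (s * (f * w)) ≡ (s * f) * (x * w)
        d₂ = solve-∀ ℚ-ring
        part₂ : B ≤ℚ K * (c * ω l)
        part₂ = ℚₚ.≤-trans (∑-mono Vs (λ v → *-monoˡ (𝟙≥0 (μ v)) (*-monoˡ (fromℕ≥0 (suc j)) (moment-bound m j (v ∷ l) p' q'))))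
          (ℚₚ.≤-trans (ℚₚ.≤-reflexive (trans (∑-cong Vs (λ v → d₂ (𝟙 (μ v)) (fromℕ (suc j)) (fromℕ (falling m j) * (c ^ℚ j)) (ω (v ∷ l)))) (∑-*ˡ Vs K _)))
            (*-monoˡ 0≤K (marked-step l (ℕₚ.≤-<-trans (ℕₚ.m≤m+n (length l) j) q'))))
        d₃ : ∀ f s g x c w → f * (c * x) * w + s * (g * x) * (c * w) ≡ (f + s * g) * (c * x) * w
        d₃ = solve-∀ ℚ-ring
        fin : fromℕ (falling m (suc j)) * (c ^ℚ suc j) * ω l + K * (c * ω l) ≡ fromℕ (falling (suc m) (suc j)) * (c ^ℚ suc j) * ω l
        fin = trans (d₃ (fromℕ (falling m (suc j))) (fromℕ (suc j)) (fromℕ (falling m j)) (c ^ℚ j) c (ω l))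
          (cong (λ z → z * (c ^ℚ suc j) * ω l) (trans (cong (fromℕ (falling m (suc j)) +_) (sym (fromℕ-* (suc j) (falling m j))))
            (trans (sym (fromℕ-+ (falling m (suc j)) (suc j ℕ.* falling m j))) (cong fromℕ (sym (falling-step m j))))))

      -- Markov's inequality for the factorial moment of order j, which is at least `falling t j` on
      -- the event in question.
      tail-bound : ∀ m t j θ l → length l ℕ.+ m ℕ.≤ N' → length l ℕ.+ j ℕ.≤ J → j ℕ.≤ t → 0ℚ ≤ℚ θ → fromℕ m * c ≤ℚ θ * fromℕ (t ℕ.∸ j) →
        ∑ⁿ m (λ y → ω (y ++ l) * 𝟙 (t ℕ.≤ᵇ countᵇ μ y)) ≤ℚ (θ ^ℚ j) * ω l
      tail-bound m t j θ l p q j≤t 0≤θ h = *-cancelˡ 0<f (ℚₚ.≤-trans (ℚₚ.≤-reflexive (trans (sym (∑ⁿ-*ˡ m f _)) (∑ⁿ-cong m (λ y _ → e₁ f (ω (y ++ l)) _))))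
          (ℚₚ.≤-trans (∑ⁿ-mono m (λ y ly → *-monoˡ (ω≥0 (y ++ l) (subst (ℕ._≤ N') (trans (ℕₚ.+-comm (length l) m) (trans (cong (ℕ._+ length l) (sym ly)) (sym (Lₚ.length-++ y)))) p)) (markov y)))
          (ℚₚ.≤-trans (moment-bound m j l p q) (ℚₚ.≤-trans (*-monoʳ (ω≥0 l (ℕₚ.≤-trans (ℕₚ.m≤m+n (length l) m) p)) (falling-ratio m t j c θ 0≤c 0≤θ j≤t h))
            (ℚₚ.≤-reflexive (e₂ (θ ^ℚ j) f (ω l)))))))
        where
        f = fromℕ (falling t j)
        0<f : 0ℚ < f
        0<f = fromℕ-pos ((falling>0 j≤t))
        e₁ : ∀ f w x → f * (w * x) ≡ w * (f * x)
        e₁ = solve-∀ ℚ-ring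
        e₂ : ∀ x f w → x * f * w ≡ f * (x * w)
        e₂ = solve-∀ ℚ-ring
        markov : ∀ y → f * 𝟙 (t ℕ.≤ᵇ countᵇ μ y) ≤ℚ moment j y
        markov y with t ℕ.≤ᵇ countᵇ μ y in eq
        ... | true = subst₂ _≤ℚ_ (sym (ℚₚ.*-identityʳ f)) (sym (moment-falling j y))
              (fromℕ-mono (falling-mono j (ℕₚ.≤ᵇ⇒≤ t (countᵇ μ y) (subst T (sym eq) _))))
        ... | false = subst₂ _≤ℚ_ (sym (ℚₚ.*-zeroʳ f)) (sym (moment-falling j y)) (fromℕ≥0 (falling (countᵇ μ y) j))

  -- One step of the walk: averages of 1 / (ρ + lam) do not increase, up to a tail probability

  module Climb (Q : List V) (distinct-Q : distinct Q ≡ true) (N' : ℕ) (|Q|+N' : length Q ℕ.+ N' ≡ n)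
    (κ : ℕ) (P : List V → Bool) (P-↭ : ∀ {l l'} → l ↭ l' → P l ≡ P l')
    (m₀ : ℕ) (d r : ℕ → ℕ) (d≥1 : ∀ m → m₀ ℕ.< m → 1 ℕ.≤ d m) (d≤r : ∀ m → m₀ ℕ.< m → d m ℕ.≤ r m)
    (r+d : ∀ m → m₀ ℕ.< m → r m ℕ.+ d m ≡ m)
    (lam : ℚ) (0<lam : 0ℚ < lam) (p : ℕ → ℚ) where

    open Sampling Q distinct-Q N' |Q|+N'

    private
      ∑³ : ℕ → ℕ → ℕ → (List V → List V → List V → ℚ) → ℚ
      ∑³ i j k f = ∑ⁿ i (λ T → ∑ⁿ j (λ y → ∑ⁿ k (λ x → f T x y)))

      ∑³-cong : ∀ i j k {f g : List V → List V → List V → ℚ} → (∀ T x y → f T x y ≡ g T x y) → ∑³ i j k f ≡ ∑³ i j k g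
      ∑³-cong i j k h = ∑ⁿ-cong i (λ T _ → ∑ⁿ-cong j (λ y _ → ∑ⁿ-cong k (λ x _ → h T x y)))

      ∑³-+ : ∀ i j k (f g : List V → List V → List V → ℚ) → ∑³ i j k (λ T x y → f T x y + g T x y) ≡ ∑³ i j k f + ∑³ i j k g
      ∑³-+ i j k f g = trans (∑ⁿ-cong i (λ T _ → trans (∑ⁿ-cong j (λ y _ → ∑ⁿ-+ k (λ x → f T x y) (λ x → g T x y)))
        (∑ⁿ-+ j (λ y → ∑ⁿ k (λ x → f T x y)) (λ y → ∑ⁿ k (λ x → g T x y)))))
        (∑ⁿ-+ i (λ T → ∑ⁿ j (λ y → ∑ⁿ k (λ x → f T x y))) (λ T → ∑ⁿ j (λ y → ∑ⁿ k (λ x → g T x y))))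

      ∑³-*ˡ : ∀ i j k c (f : List V → List V → List V → ℚ) → ∑³ i j k (λ T x y → c * f T x y) ≡ c * ∑³ i j k f
      ∑³-*ˡ i j k c f = trans (∑ⁿ-cong i (λ T _ → trans (∑ⁿ-cong j (λ y _ → ∑ⁿ-*ˡ k c (λ x → f T x y)))
        (∑ⁿ-*ˡ j c (λ y → ∑ⁿ k (λ x → f T x y))))) (∑ⁿ-*ˡ i c (λ T → ∑ⁿ j (λ y → ∑ⁿ k (λ x → f T x y))))

      ∑³-linear : ∀ i j k (w c a b : List V → List V → List V → ℚ) K → ∑³ i j k (λ T x y → w T x y * (c T x y + K * (a T x y + b T x y)))
        ≡ ∑³ i j k (λ T x y → w T x y * c T x y) + K * (∑³ i j k (λ T x y → w T x y * a T x y) + ∑³ i j k (λ T x y → w T x y * b T x y))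
      ∑³-linear i j k w c a b K = trans (∑³-cong i j k (λ T x y → dist (w T x y) (c T x y) K (a T x y) (b T x y)))
        (trans (∑³-+ i j k wc (λ T x y → K * (wa T x y + wb T x y)))
          (cong (∑³ i j k wc +_) (trans (∑³-*ˡ i j k K (λ T x y → wa T x y + wb T x y)) (cong (K *_) (∑³-+ i j k wa wb)))))
        where
        wc wa wb : List V → List V → List V → ℚ
        wc T x y = w T x y * c T x y
        wa T x y = w T x y * a T x y
        wb T x y = w T x y * b T x y
        dist : ∀ w c k a b → w * (c + k * (a + b)) ≡ w * c + k * (w * a + w * b)
        dist = solve-∀ ℚ-ring

    overfull : ℕ → List V → List V → Bool
    overfull m S y = suc (d m) ℕ.≤ᵇ countᵇ (λ v → not (P (v ∷ S))) y

    module _ (F : List V → List V → ℚ) (F≥0 : ∀ S y → 0ℚ ≤ℚ F S y)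
      (tail : ∀ m S → m₀ ℕ.< m → length S ≡ suc κ → κ ℕ.+ (m ℕ.+ m) ℕ.≤ N' →
        ∑ⁿ m (λ y → ω (y ++ S) * 𝟙 (overfull m S y)) ≤ℚ p m * ω S) where

      -- For S = u ∷ T the recursive factor `ρ j (T ++ [ v ])` does not contain u; only the
      -- indicator `P (v ∷ u ∷ T)` does. This separation is what the dual inequality exploits.
      ρ : ℕ → List V → List V → ℚ
      ρ zero S y = F S y
      ρ (suc j) S y = inv (fromℕ (r (suc j ℕ.+ m₀))) *
        ∑ (picks y) (λ q → 𝟙 (P (proj₁ q ∷ S)) * ρ j (drop 1 S ++ [ proj₁ q ]) (proj₂ q))

      private
        m₀< : ∀ j → m₀ ℕ.< suc j ℕ.+ m₀
        m₀< j = ℕ.s≤s (ℕₚ.m≤n+m m₀ j)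

      r>0 : ∀ j → 0ℚ < fromℕ (r (suc j ℕ.+ m₀))
      r>0 j = fromℕ-pos ((ℕₚ.≤-trans (d≥1 _ (m₀< j)) (d≤r _ (m₀< j))))

      ρ≥0 : ∀ j S y → 0ℚ ≤ℚ ρ j S y
      ρ≥0 zero S y = F≥0 S y
      ρ≥0 (suc j) S y = *-nonneg (inv≥0 (r>0 j)) (∑-nonneg (picks y) (λ q → *-nonneg (𝟙≥0 (P (proj₁ q ∷ S))) (ρ≥0 j (drop 1 S ++ [ proj₁ q ]) (proj₂ q))))

      Θ : ℕ → List V → List V → ℚ
      Θ j S y = inv (ρ j S y + lam)

      ρ+lam>0 : ∀ j S y → 0ℚ < ρ j S y + lam
      ρ+lam>0 j S y = subst (0ℚ <_) (ℚₚ.+-comm lam _) (+-pos 0<lam (ρ≥0 j S y))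

      Θ≤ : ∀ j S y → Θ j S y ≤ℚ inv lam
      Θ≤ j S y = inv-anti 0<lam (subst (_≤ℚ ρ j S y + lam) (ℚₚ.+-identityˡ lam) (ℚₚ.+-monoˡ-≤ lam (ρ≥0 j S y)))

      Θ≥0 : ∀ j S y → 0ℚ ≤ℚ Θ j S y
      Θ≥0 j S y = inv≥0 (ρ+lam>0 j S y)

      energy : ℕ → ℚ
      energy j = ∑ⁿ (suc κ) (λ S → ∑ⁿ (j ℕ.+ m₀) (λ y → ω (S ++ y) * Θ j S y))

      module Step (j : ℕ) (room : κ ℕ.+ ((suc j ℕ.+ m₀) ℕ.+ (suc j ℕ.+ m₀)) ℕ.≤ N') where

        m : ℕ
        m = suc j ℕ.+ m₀
        K : ℚ
        K = fromℕ m * inv lam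
        0≤K : 0ℚ ≤ℚ K
        0≤K = *-nonneg (fromℕ≥0 m) (inv≥0 0<lam)

        rowsum : List V → List V → List V → ℚ
        rowsum T x y = ∑ x (λ u → Θ (suc j) (u ∷ T) y)
        colsum : List V → List V → ℚ
        colsum T y = ∑ (picks y) (λ q → Θ j (T ++ [ proj₁ q ]) (proj₂ q))
        badness : List V → List V → List V → ℚ
        badness T x y = ∑ x (λ u → 𝟙 (overfull m (u ∷ T) y))

        badness≥0 : ∀ T x y → 0ℚ ≤ℚ badness T x y
        badness≥0 T x y = ∑-nonneg x (λ u → 𝟙≥0 (overfull m (u ∷ T) y))

        not-overfull : ∀ S y → overfull m S y ≡ false → ∑ y (λ v → 𝟙 (not (P (v ∷ S)))) ≤ℚ fromℕ (d m)
        not-overfull S y h = subst (_≤ℚ fromℕ (d m)) (sym (∑-countᵇ (λ v → not (P (v ∷ S))) y)) (fromℕ-mono {countᵇ (λ v → not (P (v ∷ S))) y} {d m} (ℕₚ.≮⇒≥ λ lt → subst T h (ℕₚ.≤⇒≤ᵇ {suc (d m)} {countᵇ (λ v → not (P (v ∷ S))) y} lt)))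

        crude-bound : ∀ T x y → length x ≡ m → 1ℚ ≤ℚ badness T x y + badness T y x →
          rowsum T x y ≤ℚ colsum T y + K * (badness T x y + badness T y x)
        crude-bound T x y |x| h = ℚₚ.≤-trans (∑-mono x (λ u → Θ≤ (suc j) (u ∷ T) y))
          (ℚₚ.≤-trans (ℚₚ.≤-reflexive (trans (∑-const x (inv lam)) (trans (cong (λ z → fromℕ z * inv lam) |x|) (sym (ℚₚ.+-identityˡ K)))))
            (ℚₚ.+-mono-≤ (∑-nonneg (picks y) (λ q → Θ≥0 j (T ++ [ proj₁ q ]) (proj₂ q)))
              (subst (_≤ℚ K * (badness T x y + badness T y x)) (ℚₚ.*-identityʳ K) (*-monoˡ 0≤K h))))

        -- Join u in x to v in y if u, v and T form an edge. If no vertex has more than `d m`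
        -- non-neighbours on the other side, this is the dual inequality. Otherwise `badness` is at
        -- least 1 in one direction, and K times it exceeds the trivial bound of m terms, each at
        -- most 1 / lam.
        pointwise : ∀ T x y → length x ≡ m → length y ≡ m →
          rowsum T x y ≤ℚ colsum T y + K * (badness T x y + badness T y x)
        pointwise T x y |x| |y| with all-or-some (λ u → overfull m (u ∷ T) y) x | all-or-some (λ v → overfull m (v ∷ T) x) y
        ... | inj₁ rows | inj₁ cols = ℚₚ.≤-trans (subst (_≤ℚ colsum T y) (∑-cong x (λ u → cong (λ z → inv (inv (fromℕ (r m)) * z + lam))
               (∑-cong (picks y) (λ q → cong (λ b → 𝟙 b * ρ j (T ++ [ proj₁ q ]) (proj₂ q)) (Boolₚ.not-involutive (P (proj₁ q ∷ u ∷ T)))))))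
             (dual-inequality (λ u q → not (P (proj₁ q ∷ u ∷ T))) x (picks y) (λ q → ρ j (T ++ [ proj₁ q ]) (proj₂ q)) lam (d m) (r m)
               (d≥1 m (m₀< j)) (d≤r m (m₀< j)) (trans |x| (sym (r+d m (m₀< j)))) (trans (trans (picks-length y) |y|) (sym (r+d m (m₀< j))))
               0<lam (λ q → ρ≥0 j (T ++ [ proj₁ q ]) (proj₂ q))
               (All.map (λ {u} h → subst (_≤ℚ fromℕ (d m)) (sym (∑-picks y (λ v → 𝟙 (not (P (v ∷ u ∷ T)))))) (not-overfull (u ∷ T) y h)) rows)
               (picked y (All.map (λ {v} h → subst (_≤ℚ fromℕ (d m)) (∑-cong x (λ u → cong (𝟙 ∘ not) (P-↭ (Perm.swap u v ↭-refl)))) (not-overfull (v ∷ T) x h)) cols))))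
           (≤-by (e (colsum T y) (K * (badness T x y + badness T y x))) (*-nonneg 0≤K (+-nonneg (badness≥0 T x y) (badness≥0 T y x))))
          where
          e : ∀ a b → (a + b) - a ≡ b
          e = solve-∀ ℚ-ring
          picked : ∀ {C : V → Set} y → All C y → All (C ∘ proj₁) (picks y)
          picked [] [] = []
          picked (v ∷ y) (c ∷ cs) = c ∷ Allₚ.map⁺ (picked y cs)
        ... | inj₂ some | _ = crude (ℚₚ.≤-trans some (subst (_≤ℚ badness T x y + badness T y x) (ℚₚ.+-identityʳ _)
                (ℚₚ.+-monoʳ-≤ (badness T x y) (badness≥0 T y x))))
          where crude = crude-bound T x y |x|
        ... | inj₁ _ | inj₂ some = crude-bound T x y |x| (ℚₚ.≤-trans some (subst (_≤ℚ badness T x y + badness T y x) (ℚₚ.+-identityˡ _)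
                (ℚₚ.+-monoˡ-≤ (badness T y x) (badness≥0 T x y))))

        room-x : ∀ {T y : List V} → length T ≡ κ → length y ≡ m → length (T ++ y) ℕ.+ m ℕ.≤ N'
        room-x {T} {y} eT ey = subst (ℕ._≤ N') (sym (trans (cong (ℕ._+ m) (trans (Lₚ.length-++ T) (cong₂ ℕ._+_ eT ey))) (ℕₚ.+-assoc κ m m))) room

        -- Expectation over disjoint random T, y, x: x holds the candidates for the oldest vertex of
        -- the end, y the vertices among which the walk continues.
        average : (List V → List V → List V → ℚ) → ℚ
        average f = ∑ⁿ κ (λ T → ∑ⁿ m (λ y → ∑ⁿ m (λ x → ω (x ++ (T ++ y)) * f T x y)))

        average-rows : ∀ (h : List V → List V → ℚ) → average (λ T x y → ∑ x (λ u → h (u ∷ T) y))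
          ≡ fromℕ m * ∑ⁿ (suc κ) (λ S → ∑ⁿ m (λ y → ω (S ++ y) * h S y))
        average-rows h = trans (∑ⁿ-cong κ (λ T eT → trans (∑ⁿ-cong m (λ y ey → ω-pick-one (j ℕ.+ m₀) (T ++ y) (λ u → h (u ∷ T) y) (room-x {T} {y} eT ey)))
              (trans (∑ⁿ-*ˡ m (fromℕ m) (λ y → ∑ Vs (λ u → ω (u ∷ T ++ y) * h (u ∷ T) y))) (cong (fromℕ m *_) (∑ⁿ-comm-∑ m Vs (λ u y → ω (u ∷ T ++ y) * h (u ∷ T) y))))))
            (trans (∑ⁿ-*ˡ κ (fromℕ m) (λ T → ∑ Vs (λ u → ∑ⁿ m (λ y → ω (u ∷ T ++ y) * h (u ∷ T) y)))) (cong (fromℕ m *_) (∑ⁿ-comm-∑ κ Vs (λ u T → ∑ⁿ m (λ y → ω (u ∷ T ++ y) * h (u ∷ T) y)))))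

        average-cols : average (λ T x y → colsum T y) ≡ fromℕ m * energy j
        average-cols = trans (∑ⁿ-cong κ (λ T eT → trans (∑ⁿ-cong m (λ y ey → trans (∑ⁿ-*ʳ m (colsum T y) (λ x → ω (x ++ (T ++ y))))
               (cong (_* colsum T y) (ω-marginalⁿ m (T ++ y) (room-x {T} {y} eT ey)))))
             (trans (ω-pick-split (j ℕ.+ m₀) T (λ v y → Θ j (T ++ [ v ]) y))
               (cong (fromℕ m *_) (∑-cong Vs (λ v → ∑ⁿ-cong (j ℕ.+ m₀) (λ y _ → cong (λ z → ω z * Θ j (T ++ [ v ]) y) (sym (Lₚ.++-assoc T [ v ] y)))))))))
          (trans (∑ⁿ-*ˡ κ (fromℕ m) (λ T → ∑ Vs (λ v → ∑ⁿ (j ℕ.+ m₀) (λ y → ω ((T ++ [ v ]) ++ y) * Θ j (T ++ [ v ]) y)))) (cong (fromℕ m *_) (sym (∑ⁿ-snoc κ (λ S → ∑ⁿ (j ℕ.+ m₀) (λ y → ω (S ++ y) * Θ j S y))))))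

        average-bad : average badness ≤ℚ fromℕ m * p m
        average-bad = subst (_≤ℚ fromℕ m * p m) (sym (average-rows (λ S y → 𝟙 (overfull m S y)))) (*-monoˡ (fromℕ≥0 m)
          (ℚₚ.≤-trans (∑ⁿ-mono (suc κ) (λ S eS → ℚₚ.≤-trans (ℚₚ.≤-reflexive (∑ⁿ-cong m (λ y _ → cong (_* 𝟙 (overfull m S y)) (ω-↭ (Permₚ.++-comm S y)))))
               (tail m S (m₀< j) eS room)))
            (ℚₚ.≤-reflexive (trans (∑ⁿ-*ˡ (suc κ) (p m) ω) (trans (cong (p m *_) total) (ℚₚ.*-identityʳ (p m)))))))
          where
          total : ∑ⁿ (suc κ) ω ≡ 1ℚ
          total = trans (∑ⁿ-cong (suc κ) (λ S _ → cong ω (sym (Lₚ.++-identityʳ S)))) (trans (ω-marginalⁿ (suc κ) []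
            (ℕₚ.≤-trans (ℕₚ.≤-reflexive (ℕₚ.+-comm 1 κ)) (ℕₚ.≤-trans (ℕₚ.+-monoʳ-≤ κ {1} {m ℕ.+ m} (ℕ.s≤s ℕ.z≤n)) room))) ω-[])

        average-bad' : average (λ T x y → badness T y x) ≤ℚ fromℕ m * p m
        average-bad' = subst (_≤ℚ fromℕ m * p m) (∑ⁿ-cong κ (λ T _ → trans (∑ⁿ-comm m m (λ y x → ω (x ++ (T ++ y)) * badness T x y)) (∑ⁿ-cong m (λ y _ → ∑ⁿ-cong m (λ x _ →
            cong (_* badness T y x) (ω-↭ (swap3 x T y))))))) average-bad
          where
          swap3 : ∀ (x T y : List V) → y ++ (T ++ x) ↭ x ++ (T ++ y)
          swap3 x T y = ↭-trans (Permₚ.++⁺ˡ y (Permₚ.++-comm T x)) (↭-trans (Permₚ.++-comm y (x ++ T)) (Perm.↭-reflexive (Lₚ.++-assoc x T y)))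

        -- By exchangeability the average row sum is m times the energy at j + 1 and the average
        -- column sum m times the energy at j. The two kinds of badness have mean at most m · `p m`
        -- each, and the common factor m is cancelled.
        step : energy (suc j) ≤ℚ energy j + inv lam * (2ℚ * (fromℕ m * p m))
        step = *-cancelˡ 0<m (subst₂ _≤ℚ_ (average-rows (Θ (suc j))) eq (ℚₚ.≤-trans
            (∑ⁿ-mono κ (λ T eT → ∑ⁿ-mono m (λ y ey → ∑ⁿ-mono m (λ x ex → *-monoˡ (ω≥0 (x ++ (T ++ y)) (fits x T y ex eT ey)) (pointwise T x y ex ey)))))
            (ℚₚ.≤-trans (ℚₚ.≤-reflexive expand) (ℚₚ.+-monoʳ-≤ (average (λ T x y → colsum T y)) (*-monoˡ 0≤K (ℚₚ.+-mono-≤ average-bad average-bad'))))))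
          where
          0<m : 0ℚ < fromℕ m
          0<m = fromℕ>0 (j ℕ.+ m₀)
          fits : ∀ x T y → length x ≡ m → length T ≡ κ → length y ≡ m → length (x ++ (T ++ y)) ℕ.≤ N'
          fits x T y ex eT ey = subst (ℕ._≤ N') (trans (ℕₚ.+-comm (length (T ++ y)) m) (trans (cong (ℕ._+ length (T ++ y)) (sym ex)) (sym (Lₚ.length-++ x)))) (room-x {T} {y} eT ey)
          expand : average (λ T x y → colsum T y + K * (badness T x y + badness T y x))
            ≡ average (λ T x y → colsum T y) + K * (average badness + average (λ T x y → badness T y x))
          expand = ∑³-linear κ m m (λ T x y → ω (x ++ (T ++ y))) (λ T x y → colsum T y) badness (λ T x y → badness T y x) K
          e : ∀ m x i p → m * x + (m * i) * (m * p + m * p) ≡ m * (x + i * ((1ℚ + 1ℚ) * (m * p)))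
          e = solve-∀ ℚ-ring
          eq : average (λ T x y → colsum T y) + K * (fromℕ m * p m + fromℕ m * p m) ≡ fromℕ m * (energy j + inv lam * (2ℚ * (fromℕ m * p m)))
          eq = trans (cong (_+ K * (fromℕ m * p m + fromℕ m * p m)) average-cols) (e (fromℕ m) (energy j) (inv lam) (p m))

    -- Lower bounds for the walks on one side

    module Side (1≤m₀ : 1 ℕ.≤ m₀)
      (p-small : ∀ j → 2ℚ * (fromℕ (suc j ℕ.+ m₀) * p (suc j ℕ.+ m₀)) ≤ℚ inv (fromℕ (j ℕ.+ m₀)) - inv (fromℕ (suc j ℕ.+ m₀)))
      (tail : ∀ m S → m₀ ℕ.< m → length S ≡ suc κ → κ ℕ.+ (m ℕ.+ m) ℕ.≤ N' →
        ∑ⁿ m (λ y → ω (y ++ S) * 𝟙 (overfull m S y)) ≤ℚ p m * ω S) where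

      -- Accumulates m / r(m): a step is weighted by 1 / r(m), and picking its vertex out of the
      -- random m-set rather than drawing a new one costs a factor m.
      coef : ℕ → ℚ
      coef zero = 1ℚ
      coef (suc j) = fromℕ (suc j ℕ.+ m₀) * inv (fromℕ (r (suc j ℕ.+ m₀))) * coef j

      open Walks P

      module _ (success : List V → List V → Bool) (η₀ : ℚ)
        (failure : ∑ⁿ (suc κ) (λ S → ∑ⁿ m₀ (λ y → ω (S ++ y) * (1ℚ - 𝟙 (success S y)))) ≤ℚ η₀)
        (room₀ : suc κ ℕ.+ m₀ ℕ.≤ N') where

        F : List V → List V → ℚ
        F S y = 𝟙 (success S y)

        F≥0 : ∀ S y → 0ℚ ≤ℚ F S y
        F≥0 S y = 𝟙≥0 (success S y)

        weight : ℕ → List V → List V → ℚ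
        weight = ρ F F≥0 tail

        weight≥0 : ∀ j S y → 0ℚ ≤ℚ weight j S y
        weight≥0 = ρ≥0 F F≥0 tail

        θ : ℕ → List V → List V → ℚ
        θ = Θ F F≥0 tail

        total : ∀ i j → i ℕ.+ j ℕ.≤ N' → ∑ⁿ i (λ S → ∑ⁿ j (λ y → ω (S ++ y))) ≡ 1ℚ
        total i j h = trans (sym (∑ⁿ-++ i j ω)) (trans (∑ⁿ-cong (i ℕ.+ j) (λ S _ → cong ω (sym (Lₚ.++-identityʳ S)))) (trans (ω-marginalⁿ (i ℕ.+ j) [] h) ω-[]))

        0<1+lam : 0ℚ < 1ℚ + lam
        0<1+lam = +-pos 0<1 (ℚₚ.<⇒≤ 0<lam)

        -- A success contributes 1 / (1 + lam), a failure 1 / lam.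
        energy-base : energy F F≥0 tail 0 ≤ℚ inv (1ℚ + lam) + inv lam * η₀
        energy-base = ℚₚ.≤-trans (∑ⁿ-mono (suc κ) (λ S eS → ∑ⁿ-mono m₀ (λ y ey → ℚₚ.≤-trans (*-monoˡ (ω≥0 (S ++ y) (fits S y eS ey)) (point (success S y)))
              (ℚₚ.≤-reflexive (ring (ω (S ++ y)) (inv (1ℚ + lam)) (inv lam) (1ℚ - F S y))))))
          (ℚₚ.≤-trans (ℚₚ.≤-reflexive (trans (∑ⁿ-cong (suc κ) (λ S _ → trans (∑ⁿ-+ m₀ (λ y → inv (1ℚ + lam) * ω (S ++ y)) (λ y → inv lam * (ω (S ++ y) * (1ℚ - F S y))))
                (cong₂ _+_ (∑ⁿ-*ˡ m₀ (inv (1ℚ + lam)) (λ y → ω (S ++ y))) (∑ⁿ-*ˡ m₀ (inv lam) (λ y → ω (S ++ y) * (1ℚ - F S y))))))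
              (trans (∑ⁿ-+ (suc κ) (λ S → inv (1ℚ + lam) * ∑ⁿ m₀ (λ y → ω (S ++ y))) (λ S → inv lam * ∑ⁿ m₀ (λ y → ω (S ++ y) * (1ℚ - F S y))))
                (cong₂ _+_ (trans (∑ⁿ-*ˡ (suc κ) (inv (1ℚ + lam)) (λ S → ∑ⁿ m₀ (λ y → ω (S ++ y)))) (trans (cong (inv (1ℚ + lam) *_) (total (suc κ) m₀ room₀)) (ℚₚ.*-identityʳ (inv (1ℚ + lam)))))
                  (∑ⁿ-*ˡ (suc κ) (inv lam) (λ S → ∑ⁿ m₀ (λ y → ω (S ++ y) * (1ℚ - F S y))))))))
            (ℚₚ.+-monoʳ-≤ (inv (1ℚ + lam)) (*-monoˡ (inv≥0 0<lam) failure)))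
          where
          fits : ∀ S y → length S ≡ suc κ → length y ≡ m₀ → length (S ++ y) ℕ.≤ N'
          fits S y eS ey = subst (ℕ._≤ N') (sym (trans (Lₚ.length-++ S) (cong₂ ℕ._+_ eS ey))) room₀
          ring : ∀ w a b f → w * (a + b * f) ≡ a * w + b * (w * f)
          ring = solve-∀ ℚ-ring
          point : ∀ b → inv (𝟙 b + lam) ≤ℚ inv (1ℚ + lam) + inv lam * (1ℚ - 𝟙 b)
          point true = ℚₚ.≤-reflexive (sym (trans (cong (inv (1ℚ + lam) +_) (trans (cong (inv lam *_) (ℚₚ.+-inverseʳ 1ℚ)) (ℚₚ.*-zeroʳ (inv lam)))) (ℚₚ.+-identityʳ _)))
          point false = ≤-by (e (inv (1ℚ + lam)) (inv lam) (inv (0ℚ + lam)) (cong inv (ℚₚ.+-identityˡ lam))) (inv≥0 0<1+lam)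
            where
            ring' : ∀ a b → a + b * (1ℚ - 0ℚ) - b ≡ a
            ring' = solve-∀ ℚ-ring
            e : ∀ a b c → c ≡ b → a + b * (1ℚ - 0ℚ) - c ≡ a
            e a b c refl = ring' a b

        energy-climb : ∀ j → κ ℕ.+ ((j ℕ.+ m₀) ℕ.+ (j ℕ.+ m₀)) ℕ.≤ N' →
          energy F F≥0 tail j ≤ℚ energy F F≥0 tail 0 + inv lam * (inv (fromℕ m₀) - inv (fromℕ (j ℕ.+ m₀)))
        energy-climb zero h = ℚₚ.≤-reflexive (sym (trans (cong (λ z → energy F F≥0 tail 0 + inv lam * z) (ℚₚ.+-inverseʳ (inv (fromℕ m₀))))
          (trans (cong (energy F F≥0 tail 0 +_) (ℚₚ.*-zeroʳ (inv lam))) (ℚₚ.+-identityʳ _))))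
        energy-climb (suc j) h = ℚₚ.≤-trans (Step.step F F≥0 tail j h) (ℚₚ.≤-trans (ℚₚ.+-mono-≤ (energy-climb j h') (*-monoˡ (inv≥0 0<lam) (p-small j)))
          (ℚₚ.≤-reflexive (ring (energy F F≥0 tail 0) (inv lam) (inv (fromℕ m₀)) (inv (fromℕ (j ℕ.+ m₀))) (inv (fromℕ (suc j ℕ.+ m₀))))))
          where
          h' : κ ℕ.+ ((j ℕ.+ m₀) ℕ.+ (j ℕ.+ m₀)) ℕ.≤ N'
          h' = ℕₚ.≤-trans (ℕₚ.+-monoʳ-≤ κ (ℕₚ.+-mono-≤ (ℕₚ.n≤1+n (j ℕ.+ m₀)) (ℕₚ.n≤1+n (j ℕ.+ m₀)))) h
          ring : ∀ x i a b c → x + i * (a - b) + i * (b - c) ≡ x + i * (a - c)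
          ring = solve-∀ ℚ-ring

        -- Equals weight / (weight + lam): a version of the weight that stays in [0, 1] and, times
        -- lam, below the weight. An upper bound on the energy is a lower bound on its mean.
        τ : ℕ → List V → List V → ℚ
        τ j S y = 1ℚ - lam * θ j S y

        lamθ≤1 : ∀ j S y → lam * θ j S y ≤ℚ 1ℚ
        lamθ≤1 j S y = subst (lam * θ j S y ≤ℚ_) (*-inv 0<lam) (*-monoˡ (ℚₚ.<⇒≤ 0<lam) (Θ≤ F F≥0 tail j S y))

        τ≥0 : ∀ j S y → 0ℚ ≤ℚ τ j S y
        τ≥0 j S y = diff≥0 (lamθ≤1 j S y)

        τ≤1 : ∀ j S y → τ j S y ≤ℚ 1ℚ
        τ≤1 j S y = ≤-by (ring (lam * θ j S y)) (*-nonneg (ℚₚ.<⇒≤ 0<lam) (Θ≥0 F F≥0 tail j S y))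
          where
          ring : ∀ x → 1ℚ - (1ℚ - x) ≡ x
          ring = solve-∀ ℚ-ring

        lamτ≤weight : ∀ j S y → lam * τ j S y ≤ℚ weight j S y
        lamτ≤weight j S y = *-cancelˡ 0<u (≤-by (trans (ring w lam (inv (w + lam))) (trans (cong (λ z → (w + lam) * w - lam * (w + lam) + lam * lam * z) (*-inv 0<u)) (ring' w lam)))
            (sq≥0 w))
          where
          w = weight j S y
          0<u : 0ℚ < w + lam
          0<u = ρ+lam>0 F F≥0 tail j S y
          ring : ∀ w l i → (w + l) * w - (w + l) * (l * (1ℚ - l * i)) ≡ (w + l) * w - l * (w + l) + l * l * ((w + l) * i)
          ring = solve-∀ ℚ-ring
          ring' : ∀ w l → (w + l) * w - l * (w + l) + l * l * 1ℚ ≡ w * w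
          ring' = solve-∀ ℚ-ring

        mean-τ : ∀ j → κ ℕ.+ ((j ℕ.+ m₀) ℕ.+ (j ℕ.+ m₀)) ℕ.≤ N' → suc κ ℕ.+ (j ℕ.+ m₀) ℕ.≤ N' →
          1ℚ - (lam + (η₀ + inv (fromℕ m₀))) ≤ℚ ∑ⁿ (suc κ) (λ S → ∑ⁿ (j ℕ.+ m₀) (λ y → ω (S ++ y) * τ j S y))
        mean-τ j h room = ℚₚ.≤-trans (≤-by (ring lam (η₀ + i₀) (energy F F≥0 tail j)) (diff≥0 lam-energy)) (ℚₚ.≤-reflexive (sym expand))
          where
          i₀ = inv (fromℕ m₀)
          i₁ = inv (fromℕ (j ℕ.+ m₀))
          m = j ℕ.+ m₀
          ring : ∀ l e x → (1ℚ - l * x) - (1ℚ - (l + e)) ≡ (l + e) - l * x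
          ring = solve-∀ ℚ-ring
          0<m₀ : 0ℚ < fromℕ m₀
          0<m₀ = fromℕ-pos 1≤m₀
          0≤i₁ : 0ℚ ≤ℚ i₁
          0≤i₁ = inv≥0 (ℚₚ.<-≤-trans 0<m₀ (fromℕ-mono (ℕₚ.m≤n+m m₀ j)))
          inv≤1 : inv (1ℚ + lam) ≤ℚ 1ℚ
          inv≤1 = subst (inv (1ℚ + lam) ≤ℚ_) inv-1 (inv-anti 0<1 (subst (_≤ℚ 1ℚ + lam) (ℚₚ.+-identityʳ 1ℚ) (ℚₚ.+-monoʳ-≤ 1ℚ (ℚₚ.<⇒≤ 0<lam))))
          lam-energy : lam * energy F F≥0 tail j ≤ℚ lam + (η₀ + i₀)
          lam-energy = ℚₚ.≤-trans (*-monoˡ (ℚₚ.<⇒≤ 0<lam) (ℚₚ.≤-trans (energy-climb j h) (ℚₚ.+-monoˡ-≤ (inv lam * (i₀ - i₁)) energy-base)))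
            (ℚₚ.≤-trans (ℚₚ.≤-reflexive (trans (ring₁ lam (inv (1ℚ + lam)) (inv lam) η₀ i₀ i₁) (cong (λ z → lam * inv (1ℚ + lam) + z * (η₀ + i₀ - i₁)) (*-inv 0<lam))))
              (≤-by (ring₂ lam (inv (1ℚ + lam)) η₀ i₀ i₁) (+-nonneg (*-nonneg (ℚₚ.<⇒≤ 0<lam) (diff≥0 inv≤1)) 0≤i₁)))
            where
            ring₁ : ∀ l a i e x y → l * (a + i * e + i * (x - y)) ≡ l * a + (l * i) * (e + x - y)
            ring₁ = solve-∀ ℚ-ring
            ring₂ : ∀ l a e x y → l + (e + x) - (l * a + 1ℚ * (e + x - y)) ≡ l * (1ℚ - a) + y
            ring₂ = solve-∀ ℚ-ring
          ring₃ : ∀ w l t → w * (1ℚ - l * t) ≡ w - l * (w * t)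
          ring₃ = solve-∀ ℚ-ring
          expand : ∑ⁿ (suc κ) (λ S → ∑ⁿ m (λ y → ω (S ++ y) * τ j S y)) ≡ 1ℚ - lam * energy F F≥0 tail j
          expand = trans (∑ⁿ-cong (suc κ) (λ S _ → trans (∑ⁿ-cong m (λ y _ → ring₃ (ω (S ++ y)) lam (θ j S y)))
                (trans (∑ⁿ-minus m (λ y → ω (S ++ y)) (λ y → lam * (ω (S ++ y) * θ j S y))) (cong (λ z → ∑ⁿ m (λ y → ω (S ++ y)) - z) (∑ⁿ-*ˡ m lam (λ y → ω (S ++ y) * θ j S y))))))
              (trans (∑ⁿ-minus (suc κ) (λ S → ∑ⁿ m (λ y → ω (S ++ y))) (λ S → lam * ∑ⁿ m (λ y → ω (S ++ y) * θ j S y)))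
                (cong₂ _-_ (total (suc κ) m room) (∑ⁿ-*ˡ (suc κ) lam (λ S → ∑ⁿ m (λ y → ω (S ++ y) * θ j S y)))))

        -- Exchangeability turns the choice of a vertex out of y into the draw of a new one, once
        -- per step. `X` records all vertices placed so far, those of the other walk included, while
        -- `S` is only the end from which this walk continues.
        unroll : ∀ j X S → ∑ⁿ (j ℕ.+ m₀) (λ y → ω (X ++ y) * weight j S y)
          ≡ coef j * ∑ⁿ j (λ v → ∑ⁿ m₀ (λ y → ω (X ++ v ++ y) * 𝟙 (walk S v ∧ success (endpoint S v) y)))
        unroll zero X S = sym (ℚₚ.*-identityˡ _)
        unroll (suc j) X S = trans (∑ⁿ-cong m (λ y _ → ring (ω (X ++ y)) ir (∑ (picks y) (λ q → g (proj₁ q) (proj₂ q)))))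
          (trans (∑ⁿ-*ˡ m ir (λ y → ω (X ++ y) * ∑ (picks y) (λ q → g (proj₁ q) (proj₂ q))))
          (trans (cong (ir *_) (trans (ω-pick-split (j ℕ.+ m₀) X g) (cong (fromℕ m *_) (trans (∑-cong Vs first-step) (∑-*ˡ Vs (coef j) outer)))))
            (ring₃ ir (fromℕ m) (coef j) (∑ Vs outer))))
          where
          m = suc j ℕ.+ m₀
          ir = inv (fromℕ (r m))
          next : V → List V
          next v = drop 1 S ++ [ v ]
          g : V → List V → ℚ
          g v y = 𝟙 (P (v ∷ S)) * weight j (next v) y
          inner : V → List V → List V → ℚ
          inner v vs y = 𝟙 (walk (next v) vs ∧ success (endpoint (next v) vs) y)
          outer : V → ℚ
          outer v = ∑ⁿ j (λ vs → ∑ⁿ m₀ (λ y → ω (X ++ (v ∷ vs) ++ y) * 𝟙 (walk S (v ∷ vs) ∧ success (endpoint S (v ∷ vs)) y)))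
          ring : ∀ w i s → w * (i * s) ≡ i * (w * s)
          ring = solve-∀ ℚ-ring
          ring₃ : ∀ i m c s → i * (m * (c * s)) ≡ m * i * c * s
          ring₃ = solve-∀ ℚ-ring
          absorb-step : ∀ v vs y → 𝟙 (P (v ∷ S)) * (ω (X ++ v ∷ vs ++ y) * inner v vs y)
            ≡ ω (X ++ (v ∷ vs) ++ y) * 𝟙 (walk S (v ∷ vs) ∧ success (endpoint S (v ∷ vs)) y)
          absorb-step v vs y = trans (ring (𝟙 (P (v ∷ S))) (ω (X ++ v ∷ vs ++ y)) (inner v vs y)) (cong (ω (X ++ v ∷ vs ++ y) *_)
            (trans (sym (𝟙-∧ (P (v ∷ S)) (walk (next v) vs ∧ success (endpoint (next v) vs) y)))
              (cong 𝟙 (sym (Boolₚ.∧-assoc (P (v ∷ S)) (walk (next v) vs) (success (endpoint (next v) vs) y))))))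
          first-step : ∀ v → ∑ⁿ (j ℕ.+ m₀) (λ y → ω (X ++ v ∷ y) * g v y) ≡ coef j * outer v
          first-step v = trans (∑ⁿ-cong (j ℕ.+ m₀) (λ y _ → ring (ω (X ++ v ∷ y)) (𝟙 (P (v ∷ S))) (weight j (next v) y)))
            (trans (∑ⁿ-*ˡ (j ℕ.+ m₀) (𝟙 (P (v ∷ S))) (λ y → ω (X ++ v ∷ y) * weight j (next v) y))
            (trans (cong (𝟙 (P (v ∷ S)) *_) (trans (∑ⁿ-cong (j ℕ.+ m₀) (λ y _ → cong (λ z → ω z * weight j (next v) y) (sym (Lₚ.++-assoc X [ v ] y))))
              (trans (unroll j (X ++ [ v ]) (next v)) (cong (coef j *_)
                (∑ⁿ-cong j (λ vs _ → ∑ⁿ-cong m₀ (λ y _ → cong (λ z → ω z * inner v vs y) (Lₚ.++-assoc X [ v ] (vs ++ y)))))))))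
            (trans (ring (𝟙 (P (v ∷ S))) (coef j) (∑ⁿ j (λ vs → ∑ⁿ m₀ (λ y → ω (X ++ v ∷ vs ++ y) * inner v vs y))))
              (cong (coef j *_) (trans (sym (∑ⁿ-*ˡ j (𝟙 (P (v ∷ S))) (λ vs → ∑ⁿ m₀ (λ y → ω (X ++ v ∷ vs ++ y) * inner v vs y))))
                (∑ⁿ-cong j (λ vs _ → trans (sym (∑ⁿ-*ˡ m₀ (𝟙 (P (v ∷ S))) (λ y → ω (X ++ v ∷ vs ++ y) * inner v vs y)))
                  (∑ⁿ-cong m₀ (λ y _ → absorb-step v vs y)))))))))

      -- Two walks from a common end, and the number of Hamilton cycles

      module Cycles (success₁ success₂ : List V → List V → Bool) (η₀ : ℚ)
        (failure₁ : ∑ⁿ (suc κ) (λ S → ∑ⁿ m₀ (λ y → ω (S ++ y) * (1ℚ - 𝟙 (success₁ S y)))) ≤ℚ η₀)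
        (failure₂ : ∑ⁿ (suc κ) (λ S → ∑ⁿ m₀ (λ y → ω (S ++ y) * (1ℚ - 𝟙 (success₂ S y)))) ≤ℚ η₀)
        (j₁ j₂ : ℕ) (size : suc κ ℕ.+ ((j₁ ℕ.+ m₀) ℕ.+ (j₂ ℕ.+ m₀)) ≡ N')
        (half₁ : κ ℕ.+ ((j₁ ℕ.+ m₀) ℕ.+ (j₁ ℕ.+ m₀)) ℕ.≤ N') (half₂ : κ ℕ.+ ((j₂ ℕ.+ m₀) ℕ.+ (j₂ ℕ.+ m₀)) ℕ.≤ N')
        (small : 2ℚ * (2ℚ * (lam + (η₀ + inv (fromℕ m₀)))) ≤ℚ 1ℚ) where

        s m₁ m₂ : ℕ
        s = suc κ
        m₁ = j₁ ℕ.+ m₀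
        m₂ = j₂ ℕ.+ m₀

        room₁ : s ℕ.+ m₁ ℕ.≤ N'
        room₁ = subst (s ℕ.+ m₁ ℕ.≤_) size (ℕₚ.+-monoʳ-≤ s (ℕₚ.m≤m+n m₁ m₂))
        room₂ : s ℕ.+ m₂ ℕ.≤ N'
        room₂ = subst (s ℕ.+ m₂ ℕ.≤_) size (ℕₚ.+-monoʳ-≤ s (ℕₚ.m≤n+m m₂ m₁))
        room₀ : s ℕ.+ m₀ ℕ.≤ N'
        room₀ = ℕₚ.≤-trans (ℕₚ.+-monoʳ-≤ s (ℕₚ.m≤n+m m₀ j₁)) room₁

        w₁ w₂ τ₁ τ₂ : List V → List V → ℚ
        w₁ = weight success₁ η₀ failure₁ room₀ j₁
        w₂ = weight success₂ η₀ failure₂ room₀ j₂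
        τ₁ = τ success₁ η₀ failure₁ room₀ j₁
        τ₂ = τ success₂ η₀ failure₂ room₀ j₂

        Joint : (List V → List V → List V → ℚ) → ℚ
        Joint f = ∑ⁿ s (λ S → ∑ⁿ m₁ (λ y → ∑ⁿ m₂ (λ z → ω (S ++ y ++ z) * f S y z)))

        private
          length₂ : ∀ {i j} (S y : List V) → length S ≡ i → length y ≡ j → length (S ++ y) ≡ i ℕ.+ j
          length₂ S y e e' = trans (Lₚ.length-++ S) (cong₂ ℕ._+_ e e')

        marginal-z : ∀ S y → length S ≡ s → length y ≡ m₁ → ∑ⁿ m₂ (λ z → ω (S ++ y ++ z)) ≡ ω (S ++ y)
        marginal-z S y eS ey = trans (∑ⁿ-cong m₂ (λ z _ → ω-↭ (↭-trans (Perm.↭-reflexive (sym (Lₚ.++-assoc S y z))) (Permₚ.++-comm (S ++ y) z))))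
          (ω-marginalⁿ m₂ (S ++ y) (ℕₚ.≤-reflexive (trans (cong (ℕ._+ m₂) (length₂ S y eS ey)) (trans (ℕₚ.+-assoc s m₁ m₂) size))))

        marginal-y : ∀ S z → length S ≡ s → length z ≡ m₂ → ∑ⁿ m₁ (λ y → ω (S ++ y ++ z)) ≡ ω (S ++ z)
        marginal-y S z eS ez = trans (∑ⁿ-cong m₁ (λ y _ → ω-↭ (Permₚ.shifts S y)))
          (ω-marginalⁿ m₁ (S ++ z) (ℕₚ.≤-reflexive (trans (cong (ℕ._+ m₁) (length₂ S z eS ez)) (trans (ℕₚ.+-assoc s m₂ m₁) (trans (cong (s ℕ.+_) (ℕₚ.+-comm m₂ m₁)) size)))))

        mean₁ : Joint (λ S y z → τ₁ S y) ≡ ∑ⁿ s (λ S → ∑ⁿ m₁ (λ y → ω (S ++ y) * τ₁ S y))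
        mean₁ = ∑ⁿ-cong s (λ S eS → ∑ⁿ-cong m₁ (λ y ey → trans (∑ⁿ-*ʳ m₂ (τ₁ S y) (λ z → ω (S ++ y ++ z))) (cong (_* τ₁ S y) (marginal-z S y eS ey))))

        -- The law of `S` is invariant under reversal, so a walk started from `reverse S` has the
        -- same mean as one started from `S`.
        mean₂ : Joint (λ S y z → τ₂ (reverse S) z) ≡ ∑ⁿ s (λ S → ∑ⁿ m₂ (λ z → ω (S ++ z) * τ₂ S z))
        mean₂ = trans (∑ⁿ-cong s (λ S eS → trans (∑ⁿ-comm m₁ m₂ (λ y z → ω (S ++ y ++ z) * τ₂ (reverse S) z)) (∑ⁿ-cong m₂ (λ z ez →
            trans (∑ⁿ-*ʳ m₁ (τ₂ (reverse S) z) (λ y → ω (S ++ y ++ z))) (cong (_* τ₂ (reverse S) z) (trans (marginal-y S z eS ez) (ω-↭ (Permₚ.++⁺ʳ z (↭-sym (Permₚ.↭-reverse S))))))))))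
          (∑ⁿ-reverse s (λ S → ∑ⁿ m₂ (λ z → ω (S ++ z) * τ₂ S z)))

        one : Joint (λ _ _ _ → 1ℚ) ≡ 1ℚ
        one = trans (∑ⁿ-cong s (λ S eS → ∑ⁿ-cong m₁ (λ y ey → trans (∑ⁿ-cong m₂ (λ z _ → ℚₚ.*-identityʳ (ω (S ++ y ++ z)))) (marginal-z S y eS ey))))
          (total success₁ η₀ failure₁ room₀ s m₁ room₁)

        private
          fits : ∀ S y z → length S ≡ s → length y ≡ m₁ → length z ≡ m₂ → length (S ++ y ++ z) ℕ.≤ N'
          fits S y z eS ey ez = ℕₚ.≤-reflexive (trans (length₂ S (y ++ z) eS (length₂ y z ey ez)) size)

        Joint-mono : ∀ {f g} → (∀ S y z → f S y z ≤ℚ g S y z) → Joint f ≤ℚ Joint g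
        Joint-mono h = ∑ⁿ-mono s (λ S eS → ∑ⁿ-mono m₁ (λ y ey → ∑ⁿ-mono m₂ (λ z ez → *-monoˡ (ω≥0 (S ++ y ++ z) (fits S y z eS ey ez)) (h S y z))))

        Joint-+ : ∀ (f g : List V → List V → List V → ℚ) → Joint (λ S y z → f S y z + g S y z) ≡ Joint f + Joint g
        Joint-+ f g = trans (∑ⁿ-cong s (λ S _ → trans (∑ⁿ-cong m₁ (λ y _ → trans (∑ⁿ-cong m₂ (λ z _ → ℚₚ.*-distribˡ-+ (ω (S ++ y ++ z)) (f S y z) (g S y z)))
            (∑ⁿ-+ m₂ (λ z → ω (S ++ y ++ z) * f S y z) (λ z → ω (S ++ y ++ z) * g S y z))))
            (∑ⁿ-+ m₁ (λ y → ∑ⁿ m₂ (λ z → ω (S ++ y ++ z) * f S y z)) (λ y → ∑ⁿ m₂ (λ z → ω (S ++ y ++ z) * g S y z)))))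
          (∑ⁿ-+ s (λ S → ∑ⁿ m₁ (λ y → ∑ⁿ m₂ (λ z → ω (S ++ y ++ z) * f S y z))) (λ S → ∑ⁿ m₁ (λ y → ∑ⁿ m₂ (λ z → ω (S ++ y ++ z) * g S y z))))

        Joint-*ˡ : ∀ c (f : List V → List V → List V → ℚ) → Joint (λ S y z → c * f S y z) ≡ c * Joint f
        Joint-*ˡ c f = trans (∑ⁿ-cong s (λ S _ → trans (∑ⁿ-cong m₁ (λ y _ → trans (∑ⁿ-cong m₂ (λ z _ → ring (ω (S ++ y ++ z)) c (f S y z)))
            (∑ⁿ-*ˡ m₂ c (λ z → ω (S ++ y ++ z) * f S y z))))
            (∑ⁿ-*ˡ m₁ c (λ y → ∑ⁿ m₂ (λ z → ω (S ++ y ++ z) * f S y z)))))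
          (∑ⁿ-*ˡ s c (λ S → ∑ⁿ m₁ (λ y → ∑ⁿ m₂ (λ z → ω (S ++ y ++ z) * f S y z))))
          where
          ring : ∀ w c f → w * (c * f) ≡ c * (w * f)
          ring = solve-∀ ℚ-ring

        -- Both τ lie in [0, 1], so τ₁ τ₂ ≥ τ₁ + τ₂ - 1. By `small` each mean is at least 3/4, which
        -- leaves 1/2 and explains the factor 2.
        joint : lam * lam ≤ℚ 2ℚ * Joint (λ S y z → w₁ S y * w₂ (reverse S) z)
        joint = ℚₚ.≤-trans (≤-by (ring₁ (lam * lam) (Joint (λ S y z → τ₁ S y)) (Joint (λ S y z → τ₂ (reverse S) z)) (lam + (η₀ + inv (fromℕ m₀))))
              (*-nonneg (*-nonneg 0≤lam 0≤lam) (+-nonneg (+-nonneg (*-nonneg (ℚₚ.<⇒≤ (+-pos 0<1 0≤1)) (diff≥0 A≥)) (*-nonneg (ℚₚ.<⇒≤ (+-pos 0<1 0≤1)) (diff≥0 B≥))) (diff≥0 small))))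
            (*-monoˡ (ℚₚ.<⇒≤ (+-pos 0<1 0≤1)) (subst (_≤ℚ Joint (λ S y z → w₁ S y * w₂ (reverse S) z)) linear (Joint-mono pointwise)))
          where
          0≤lam = ℚₚ.<⇒≤ 0<lam
          A≥ : 1ℚ - (lam + (η₀ + inv (fromℕ m₀))) ≤ℚ Joint (λ S y z → τ₁ S y)
          A≥ = subst (1ℚ - (lam + (η₀ + inv (fromℕ m₀))) ≤ℚ_) (sym mean₁) (mean-τ success₁ η₀ failure₁ room₀ j₁ half₁ room₁)
          B≥ : 1ℚ - (lam + (η₀ + inv (fromℕ m₀))) ≤ℚ Joint (λ S y z → τ₂ (reverse S) z)
          B≥ = subst (1ℚ - (lam + (η₀ + inv (fromℕ m₀))) ≤ℚ_) (sym mean₂) (mean-τ success₂ η₀ failure₂ room₀ j₂ half₂ room₂)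
          ring₁ : ∀ L A B x → (1ℚ + 1ℚ) * (L * (A + (B + - 1ℚ * 1ℚ))) - L
            ≡ L * ((1ℚ + 1ℚ) * (A - (1ℚ - x)) + (1ℚ + 1ℚ) * (B - (1ℚ - x)) + (1ℚ - (1ℚ + 1ℚ) * ((1ℚ + 1ℚ) * x)))
          ring₁ = solve-∀ ℚ-ring
          ring₂ : ∀ l a b → l * a * (l * b) - l * l * (a + (b + - 1ℚ * 1ℚ)) ≡ l * l * ((1ℚ - a) * (1ℚ - b))
          ring₂ = solve-∀ ℚ-ring
          pointwise : ∀ S y z → lam * lam * (τ₁ S y + (τ₂ (reverse S) z + - 1ℚ * 1ℚ)) ≤ℚ w₁ S y * w₂ (reverse S) z
          pointwise S y z = ℚₚ.≤-trans (≤-by (ring₂ lam (τ₁ S y) (τ₂ (reverse S) z)) (*-nonneg (*-nonneg 0≤lam 0≤lam)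
                (*-nonneg (diff≥0 (τ≤1 success₁ η₀ failure₁ room₀ j₁ S y)) (diff≥0 (τ≤1 success₂ η₀ failure₂ room₀ j₂ (reverse S) z)))))
            (*-mono (*-nonneg 0≤lam (τ≥0 success₁ η₀ failure₁ room₀ j₁ S y)) (weight≥0 success₂ η₀ failure₂ room₀ j₂ (reverse S) z)
              (lamτ≤weight success₁ η₀ failure₁ room₀ j₁ S y) (lamτ≤weight success₂ η₀ failure₂ room₀ j₂ (reverse S) z))
          linear : Joint (λ S y z → lam * lam * (τ₁ S y + (τ₂ (reverse S) z + - 1ℚ * 1ℚ)))
            ≡ lam * lam * (Joint (λ S y z → τ₁ S y) + (Joint (λ S y z → τ₂ (reverse S) z) + - 1ℚ * 1ℚ))
          linear = trans (Joint-*ˡ (lam * lam) (λ S y z → τ₁ S y + (τ₂ (reverse S) z + - 1ℚ * 1ℚ))) (cong (lam * lam *_)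
            (trans (Joint-+ (λ S y z → τ₁ S y) (λ S y z → τ₂ (reverse S) z + - 1ℚ * 1ℚ)) (cong (Joint (λ S y z → τ₁ S y) +_)
              (trans (Joint-+ (λ S y z → τ₂ (reverse S) z) (λ S y z → - 1ℚ * 1ℚ)) (cong (Joint (λ S y z → τ₂ (reverse S) z) +_)
                (trans (Joint-*ˡ (- 1ℚ) (λ _ _ _ → 1ℚ)) (cong (- 1ℚ *_) one)))))))

        good₁ good₂ : List V → List V → List V → Bool
        good₁ S v y = walk S v ∧ success₁ (endpoint S v) y
        good₂ S v y = walk S v ∧ success₂ (endpoint S v) y

        -- The order of exposure, not the order along the cycle; `ω` does not distinguish them.
        layout : List V → List V → List V → List V → List V → List V
        layout S w z v y = (S ++ w ++ z) ++ v ++ y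

        Paths : (List V → List V → List V → List V → List V → ℚ) → ℚ
        Paths f = ∑ⁿ s (λ S → ∑ⁿ j₂ (λ w → ∑ⁿ m₀ (λ z → ∑ⁿ j₁ (λ v → ∑ⁿ m₀ (λ y → f S w z v y)))))

        unrolled : Joint (λ S y z → w₁ S y * w₂ (reverse S) z)
          ≡ coef j₁ * coef j₂ * Paths (λ S w z v y → ω (layout S w z v y) * 𝟙 (good₁ S v y) * 𝟙 (good₂ (reverse S) w z))
        unrolled = trans (∑ⁿ-cong s per-S) (∑ⁿ-*ˡ s (coef j₁ * coef j₂) (λ S → ∑ⁿ j₂ (λ w → ∑ⁿ m₀ (λ z → ∑ⁿ j₁ (λ v → ∑ⁿ m₀ (λ y →
            ω (layout S w z v y) * 𝟙 (good₁ S v y) * 𝟙 (good₂ (reverse S) w z)))))))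
          where
          ring₁ : ∀ w a b → w * (a * b) ≡ a * (w * b)
          ring₁ = solve-∀ ℚ-ring
          ring₂ : ∀ a w b → a * (w * b) ≡ w * a * b
          ring₂ = solve-∀ ℚ-ring
          per-z : ∀ S → ∀ w z → ∑ⁿ m₁ (λ y → ω ((S ++ y) ++ w ++ z) * w₁ S y * 𝟙 (good₂ (reverse S) w z))
            ≡ coef j₁ * ∑ⁿ j₁ (λ v → ∑ⁿ m₀ (λ y → ω (layout S w z v y) * 𝟙 (good₁ S v y) * 𝟙 (good₂ (reverse S) w z)))
          per-z S w z = trans (∑ⁿ-*ʳ m₁ (𝟙 (good₂ (reverse S) w z)) (λ y → ω ((S ++ y) ++ w ++ z) * w₁ S y))
            (trans (cong (_* 𝟙 (good₂ (reverse S) w z)) (trans (∑ⁿ-cong m₁ (λ y _ → cong (_* w₁ S y) (ω-↭ (shift-end S y (w ++ z)))))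
              (unroll success₁ η₀ failure₁ room₀ j₁ (S ++ w ++ z) S)))
            (trans (ℚₚ.*-assoc (coef j₁) _ (𝟙 (good₂ (reverse S) w z))) (cong (coef j₁ *_)
              (sym (trans (∑ⁿ-cong j₁ (λ v _ → ∑ⁿ-*ʳ m₀ (𝟙 (good₂ (reverse S) w z)) (λ y → ω (layout S w z v y) * 𝟙 (good₁ S v y))))
                (∑ⁿ-*ʳ j₁ (𝟙 (good₂ (reverse S) w z)) (λ v → ∑ⁿ m₀ (λ y → ω (layout S w z v y) * 𝟙 (good₁ S v y)))))))))
            where
            shift-end : ∀ (S y x : List V) → (S ++ y) ++ x ↭ (S ++ x) ++ y
            shift-end S y x = ↭-trans (Perm.↭-reflexive (Lₚ.++-assoc S y x)) (↭-trans (Permₚ.++⁺ˡ S (Permₚ.++-comm y x)) (Perm.↭-reflexive (sym (Lₚ.++-assoc S x y))))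
          per-S : ∀ S → length S ≡ s → ∑ⁿ m₁ (λ y → ∑ⁿ m₂ (λ z → ω (S ++ y ++ z) * (w₁ S y * w₂ (reverse S) z)))
            ≡ coef j₁ * coef j₂ * ∑ⁿ j₂ (λ w → ∑ⁿ m₀ (λ z → ∑ⁿ j₁ (λ v → ∑ⁿ m₀ (λ y → ω (layout S w z v y) * 𝟙 (good₁ S v y) * 𝟙 (good₂ (reverse S) w z)))))
          per-S S _ = trans (∑ⁿ-cong m₁ (λ y _ → trans (∑ⁿ-cong m₂ (λ z _ → trans (cong (λ l → ω l * (w₁ S y * w₂ (reverse S) z)) (sym (Lₚ.++-assoc S y z))) (ring₁ (ω ((S ++ y) ++ z)) (w₁ S y) (w₂ (reverse S) z))))
                (trans (∑ⁿ-*ˡ m₂ (w₁ S y) (λ z → ω ((S ++ y) ++ z) * w₂ (reverse S) z)) (trans (cong (w₁ S y *_) (unroll success₂ η₀ failure₂ room₀ j₂ (S ++ y) (reverse S)))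
                  (trans (ring₁ (w₁ S y) (coef j₂) _) (cong (coef j₂ *_) (trans (sym (∑ⁿ-*ˡ j₂ (w₁ S y) (λ w → ∑ⁿ m₀ (λ z → ω ((S ++ y) ++ w ++ z) * 𝟙 (good₂ (reverse S) w z)))))
                    (∑ⁿ-cong j₂ (λ w _ → trans (sym (∑ⁿ-*ˡ m₀ (w₁ S y) (λ z → ω ((S ++ y) ++ w ++ z) * 𝟙 (good₂ (reverse S) w z))))
                      (∑ⁿ-cong m₀ (λ z _ → ring₂ (w₁ S y) (ω ((S ++ y) ++ w ++ z)) (𝟙 (good₂ (reverse S) w z)))))))))))))
            (trans (∑ⁿ-*ˡ m₁ (coef j₂) (λ y → ∑ⁿ j₂ (λ w → ∑ⁿ m₀ (λ z → ω ((S ++ y) ++ w ++ z) * w₁ S y * 𝟙 (good₂ (reverse S) w z)))))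
            (trans (cong (coef j₂ *_) (trans (∑ⁿ-comm m₁ j₂ (λ y w → ∑ⁿ m₀ (λ z → ω ((S ++ y) ++ w ++ z) * w₁ S y * 𝟙 (good₂ (reverse S) w z))))
                (trans (∑ⁿ-cong j₂ (λ w _ → trans (∑ⁿ-comm m₁ m₀ (λ y z → ω ((S ++ y) ++ w ++ z) * w₁ S y * 𝟙 (good₂ (reverse S) w z)))
                   (trans (∑ⁿ-cong m₀ (λ z _ → per-z S w z)) (∑ⁿ-*ˡ m₀ (coef j₁) (λ z → ∑ⁿ j₁ (λ v → ∑ⁿ m₀ (λ y → ω (layout S w z v y) * 𝟙 (good₁ S v y) * 𝟙 (good₂ (reverse S) w z))))))))
                  (∑ⁿ-*ˡ j₂ (coef j₁) (λ w → ∑ⁿ m₀ (λ z → ∑ⁿ j₁ (λ v → ∑ⁿ m₀ (λ y → ω (layout S w z v y) * 𝟙 (good₁ S v y) * 𝟙 (good₂ (reverse S) w z)))))))))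
              (ring₃ (coef j₂) (coef j₁) (∑ⁿ j₂ (λ w → ∑ⁿ m₀ (λ z → ∑ⁿ j₁ (λ v → ∑ⁿ m₀ (λ y → ω (layout S w z v y) * 𝟙 (good₁ S v y) * 𝟙 (good₂ (reverse S) w z)))))))))
            where
            ring₃ : ∀ b a x → b * (a * x) ≡ a * b * x
            ring₃ = solve-∀ ℚ-ring

        coef≥0 : ∀ j → 0ℚ ≤ℚ coef j
        coef≥0 zero = 0≤1
        coef≥0 (suc j) = *-nonneg (*-nonneg (fromℕ≥0 (suc j ℕ.+ m₀)) (inv≥0 (fromℕ-pos ((ℕₚ.≤-trans (d≥1 _ h) (d≤r _ h)))))) (coef≥0 j)
          where
          h : m₀ ℕ.< suc j ℕ.+ m₀
          h = ℕ.s≤s (ℕₚ.m≤n+m m₀ j)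

        module Counting (mid : ℕ) (Ham : List V → Bool)
          (complete : ∀ S w z v y → length S ≡ s → length w ≡ j₂ → length z ≡ m₀ → length v ≡ j₁ → length y ≡ m₀ →
            distinct (layout S w z v y ++ Q) ≡ true → good₁ S v y ≡ true → good₂ (reverse S) w z ≡ true →
            ∃ λ x → length x ≡ mid × Ham (S ++ v ++ x ++ reverse w) ≡ true) where

          orderings : ℚ
          orderings = ∑ⁿ (s ℕ.+ (j₁ ℕ.+ (mid ℕ.+ j₂))) (𝟙 ∘ Ham)

          H : List V → List V → List V → ℚ
          H S v w = ∑ⁿ mid (λ x → 𝟙 (Ham (S ++ v ++ x ++ reverse w)))

          ∑H : ∑ⁿ s (λ S → ∑ⁿ j₂ (λ w → ∑ⁿ j₁ (λ v → H S v w))) ≡ orderings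
          ∑H = sym (trans (∑ⁿ-++ s (j₁ ℕ.+ (mid ℕ.+ j₂)) (𝟙 ∘ Ham)) (∑ⁿ-cong s (λ S _ → trans (∑ⁿ-++ j₁ (mid ℕ.+ j₂) (λ x → 𝟙 (Ham (S ++ x))))
            (trans (∑ⁿ-cong j₁ (λ v _ → trans (∑ⁿ-++ mid j₂ (λ x → 𝟙 (Ham (S ++ v ++ x)))) (trans (∑ⁿ-cong mid (λ x _ → sym (∑ⁿ-reverse j₂ (λ w → 𝟙 (Ham (S ++ v ++ x ++ w))))))
              (∑ⁿ-comm mid j₂ (λ x w → 𝟙 (Ham (S ++ v ++ x ++ reverse w)))))))
              (∑ⁿ-comm j₁ j₂ (λ v w → H S v w))))))

          0<ff : 0ℚ < ff N'
          0<ff = ff>0 N' ℕₚ.≤-refl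

          pointwise : ∀ S w z v y → length S ≡ s → length w ≡ j₂ → length z ≡ m₀ → length v ≡ j₁ → length y ≡ m₀ →
            ω (layout S w z v y) * 𝟙 (good₁ S v y) * 𝟙 (good₂ (reverse S) w z) ≤ℚ inv (ff N') * H S v w
          pointwise S w z v y eS ew ez ev ey = ℚₚ.≤-trans (ℚₚ.≤-reflexive (trans (cong (λ k → 𝟙 (distinct (layout S w z v y ++ Q)) * inv (ff k) * 𝟙 (good₁ S v y) * 𝟙 (good₂ (reverse S) w z)) len)
              (ring (𝟙 (distinct (layout S w z v y ++ Q))) (inv (ff N')) (𝟙 (good₁ S v y)) (𝟙 (good₂ (reverse S) w z)))))
            (*-monoˡ (inv≥0 0<ff) bound)
            where
            ring : ∀ a i b c → a * i * b * c ≡ i * (a * (b * c))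
            ring = solve-∀ ℚ-ring
            H≥0 : 0ℚ ≤ℚ H S v w
            H≥0 = ∑ⁿ-nonneg mid (λ x → 𝟙≥0 (Ham (S ++ v ++ x ++ reverse w)))
            bound : 𝟙 (distinct (layout S w z v y ++ Q)) * (𝟙 (good₁ S v y) * 𝟙 (good₂ (reverse S) w z)) ≤ℚ H S v w
            bound with distinct (layout S w z v y ++ Q) in e₁ | good₁ S v y in e₂ | good₂ (reverse S) w z in e₃
            ... | true | true | true = let (x , ex , h) = complete S w z v y eS ew ez ev ey e₁ e₂ e₃ in
                  subst (λ b → 𝟙 b ≤ℚ H S v w) h (∑ⁿ-member mid (λ x → 𝟙 (Ham (S ++ v ++ x ++ reverse w))) (λ x → 𝟙≥0 (Ham (S ++ v ++ x ++ reverse w))) x ex)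
            ... | true | true | false = H≥0
            ... | true | false | true = H≥0
            ... | true | false | false = H≥0
            ... | false | true | true = H≥0
            ... | false | true | false = H≥0
            ... | false | false | true = H≥0
            ... | false | false | false = H≥0
            arith : ∀ s j₂ m₀ j₁ → s ℕ.+ (j₂ ℕ.+ m₀) ℕ.+ (j₁ ℕ.+ m₀) ≡ s ℕ.+ ((j₁ ℕ.+ m₀) ℕ.+ (j₂ ℕ.+ m₀))
            arith s j₂ m₀ j₁ = trans (ℕₚ.+-assoc s (j₂ ℕ.+ m₀) (j₁ ℕ.+ m₀)) (cong (s ℕ.+_) (ℕₚ.+-comm (j₂ ℕ.+ m₀) (j₁ ℕ.+ m₀)))
            len : length (layout S w z v y) ≡ N'
            len = trans (length₂ (S ++ w ++ z) (v ++ y) (length₂ S (w ++ z) eS (length₂ w z ew ez)) (length₂ v y ev ey)) (trans (arith s j₂ m₀ j₁) size)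

          -- A pair of good walks determines S, v, w, and for these at least one completion exists.
          -- The end pieces y and z are only used to find it; forgetting them costs at most n^m₀
          -- each.
          count : lam * lam * ff N' ≤ℚ 2ℚ * (coef j₁ * coef j₂) * ((nℚ ^ℚ m₀) * (nℚ ^ℚ m₀) * orderings)
          count = ℚₚ.≤-trans (*-monoʳ (ℚₚ.<⇒≤ 0<ff) (ℚₚ.≤-trans joint (*-monoˡ 0≤2 (ℚₚ.≤-trans (ℚₚ.≤-reflexive unrolled) (*-monoˡ (*-nonneg (coef≥0 j₁) (coef≥0 j₂)) paths)))))
            (ℚₚ.≤-reflexive (trans (ring (coef j₁ * coef j₂) (inv (ff N')) ((nℚ ^ℚ m₀) * (nℚ ^ℚ m₀) * orderings) (ff N'))
              (trans (cong (λ z → 2ℚ * (coef j₁ * coef j₂) * (z * ((nℚ ^ℚ m₀) * (nℚ ^ℚ m₀) * orderings))) (*-inv 0<ff)) (cong (2ℚ * (coef j₁ * coef j₂) *_) (ℚₚ.*-identityˡ _)))))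
            where
            0≤2 : 0ℚ ≤ℚ 2ℚ
            0≤2 = ℚₚ.<⇒≤ (+-pos 0<1 0≤1)
            ring : ∀ c i x f → (1ℚ + 1ℚ) * (c * (i * x)) * f ≡ (1ℚ + 1ℚ) * c * ((f * i) * x)
            ring = solve-∀ ℚ-ring
            M = nℚ ^ℚ m₀
            paths : Paths (λ S w z v y → ω (layout S w z v y) * 𝟙 (good₁ S v y) * 𝟙 (good₂ (reverse S) w z)) ≤ℚ inv (ff N') * (M * M * orderings)
            paths = ℚₚ.≤-trans (∑ⁿ-mono s (λ S eS → ∑ⁿ-mono j₂ (λ w ew → ∑ⁿ-mono m₀ (λ z ez → ∑ⁿ-mono j₁ (λ v ev → ∑ⁿ-mono m₀ (λ y ey → pointwise S w z v y eS ew ez ev ey))))))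
              (ℚₚ.≤-reflexive (trans (∑ⁿ-cong s (λ S _ → trans (∑ⁿ-cong j₂ (λ w _ → trans (∑ⁿ-const m₀ (∑ⁿ j₁ (λ v → ∑ⁿ m₀ (λ y → inv (ff N') * H S v w))))
                    (trans (cong (M *_) (trans (∑ⁿ-cong j₁ (λ v _ → trans (∑ⁿ-const m₀ (inv (ff N') * H S v w)) (ring' M (inv (ff N')) (H S v w)))) (∑ⁿ-*ˡ j₁ (M * inv (ff N')) (λ v → H S v w))))
                      (ring'' M (inv (ff N')) (∑ⁿ j₁ (λ v → H S v w))))))
                    (∑ⁿ-*ˡ j₂ (inv (ff N') * (M * M)) (λ w → ∑ⁿ j₁ (λ v → H S v w)))))
                  (trans (∑ⁿ-*ˡ s (inv (ff N') * (M * M)) (λ S → ∑ⁿ j₂ (λ w → ∑ⁿ j₁ (λ v → H S v w)))) (trans (cong (inv (ff N') * (M * M) *_) ∑H) (ℚₚ.*-assoc (inv (ff N')) (M * M) orderings)))))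
              where
              ring' : ∀ M i h → M * (i * h) ≡ M * i * h
              ring' = solve-∀ ℚ-ring
              ring'' : ∀ M i x → M * (M * i * x) ≡ i * (M * M) * x
              ring'' = solve-∀ ℚ-ring

  -- By `collisions` the sequences that repeat an entry or meet `W` account for at most t n^j, half
  -- of the assumed total.
  distinct-density : 0 ℕ.< n → ∀ j W (f : List V → ℚ) t F → distinct W ≡ true → (∀ x → 0ℚ ≤ℚ f x) → (∀ x → f x ≤ℚ F) →
    2ℚ * t * (nℚ ^ℚ j) ≤ℚ ∑ⁿ j f → fromℕ (j ℕ.* (j ℕ.+ length W)) * F ≤ℚ t * nℚ →
    (nℚ ^ℚ j) * t ≤ℚ ∑ⁿ j (λ x → 𝟙 (distinct (x ++ W)) * f x)
  distinct-density 0<n j W f t F dW f≥0 f≤F dense few = ℚₚ.≤-trans (≤-by (e (∑ⁿ j f) F N t (nℚ ^ℚ j)) (+-nonneg (diff≥0 dense) (diff≥0 lost)))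
      (subst (_≤ℚ ∑ⁿ j (λ x → 𝟙 (distinct (x ++ W)) * f x)) (trans (∑ⁿ-minus j f (λ x → F * 𝟙 (not (distinct (x ++ W))))) (cong (λ z → ∑ⁿ j f - z) (∑ⁿ-*ˡ j F (λ x → 𝟙 (not (distinct (x ++ W)))))))
        (∑ⁿ-mono j (λ x _ → pointwise x)))
    where
    e : ∀ S F N t M → S - F * N - M * t ≡ (S - (1ℚ + 1ℚ) * t * M) + (t * M - F * N)
    e = solve-∀ ℚ-ring
    0≤F : 0ℚ ≤ℚ F
    0≤F = ℚₚ.≤-trans (f≥0 []) (f≤F [])
    0<nℚ : 0ℚ < nℚ
    0<nℚ = fromℕ-pos 0<n
    N = ∑ⁿ j (λ x → 𝟙 (not (distinct (x ++ W))))
    lost : F * N ≤ℚ t * (nℚ ^ℚ j)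
    lost = *-cancelˡ 0<nℚ (ℚₚ.≤-trans (ℚₚ.≤-reflexive (e₁ nℚ F N)) (ℚₚ.≤-trans (*-monoˡ 0≤F (collisions j W dW))
      (ℚₚ.≤-trans (ℚₚ.≤-reflexive (e₂ F (fromℕ (j ℕ.* (j ℕ.+ length W))) (nℚ ^ℚ j))) (ℚₚ.≤-trans (*-monoʳ (nℚ^≥0 j) few) (ℚₚ.≤-reflexive (e₃ t nℚ (nℚ ^ℚ j)))))))
      where
      e₁ : ∀ n F N → n * (F * N) ≡ F * (n * N)
      e₁ = solve-∀ ℚ-ring
      e₂ : ∀ F K M → F * (K * M) ≡ (K * F) * M
      e₂ = solve-∀ ℚ-ring
      e₃ : ∀ t n M → (t * n) * M ≡ n * (t * M)
      e₃ = solve-∀ ℚ-ring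
    pointwise : ∀ x → f x - F * 𝟙 (not (distinct (x ++ W))) ≤ℚ 𝟙 (distinct (x ++ W)) * f x
    pointwise x with distinct (x ++ W)
    ... | true = ℚₚ.≤-reflexive (e' (f x) F)
      where
      e' : ∀ x F → x - F * 0ℚ ≡ 1ℚ * x
      e' = solve-∀ ℚ-ring
    ... | false = ≤-by (e' (f x) F) (diff≥0 (f≤F x))
      where
      e' : ∀ x F → 0ℚ * x - (x - F * 1ℚ) ≡ F - x
      e' = solve-∀ ℚ-ring

  avoid : 0 ℕ.< n → ∀ j W (f : List V → ℚ) t F → distinct W ≡ true → 0ℚ < t → (∀ x → 0ℚ ≤ℚ f x) → (∀ x → f x ≤ℚ F) →
    2ℚ * t * (nℚ ^ℚ j) ≤ℚ ∑ⁿ j f → fromℕ (j ℕ.* (j ℕ.+ length W)) * F ≤ℚ t * nℚ →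
    ∃ λ x → length x ≡ j × distinct (x ++ W) ≡ true × t ≤ℚ f x
  avoid 0<n j W f t F dW 0<t f≥0 f≤F dense few =
    let (x , e , h) = ∑ⁿ-≥-avg 0<n j t (λ x → 𝟙 (distinct (x ++ W)) * f x) (distinct-density 0<n j W f t F dW f≥0 f≤F dense few)
    in x , e , conclude x h
    where
    conclude : ∀ x → t ≤ℚ 𝟙 (distinct (x ++ W)) * f x → distinct (x ++ W) ≡ true × t ≤ℚ f x
    conclude x h with distinct (x ++ W)
    ... | true = refl , subst (t ≤ℚ_) (ℚₚ.*-identityˡ (f x)) h
    ... | false = ⊥-elim (ℚₚ.<-irrefl refl (ℚₚ.<-≤-trans 0<t (subst (t ≤ℚ_) (ℚₚ.*-zeroˡ (f x)) h)))

  -- Connecting paths by induction on the uniformity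

  module Connecting (δ : ℚ) (0<δ : 0ℚ < δ) (0<2δ-1 : 0ℚ < 2ℚ * δ - 1ℚ) where
    record Dirac (s : ℕ) (P : List V → Bool) : Set where
      field
        P-↭ : ∀ {l l'} → l ↭ l' → P l ≡ P l'
        codegree : ∀ l → length l ≡ s → δ * nℚ ≤ℚ ∑ Vs (λ v → 𝟙 (P (v ∷ l)))
    open Dirac

    common : ∀ {s P} → Dirac s P → ∀ {s' P'} → Dirac s' P' → ∀ a b → length a ≡ s → length b ≡ s' →
      (2ℚ * δ - 1ℚ) * nℚ ≤ℚ ∑ Vs (λ v → 𝟙 (P (v ∷ a)) * 𝟙 (P' (v ∷ b)))
    common {s} {P} D {s'} {P'} D' a b ea eb = ℚₚ.≤-trans (≤-by (e δ nℚ (∑ Vs (λ v → 𝟙 (P (v ∷ a)))) (∑ Vs (λ v → 𝟙 (P' (v ∷ b))))) (+-nonneg (diff≥0 (codegree D a ea)) (diff≥0 (codegree D' b eb))))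
      (subst (_≤ℚ ∑ Vs (λ v → 𝟙 (P (v ∷ a)) * 𝟙 (P' (v ∷ b)))) (trans (∑-minus Vs (λ v → 𝟙 (P (v ∷ a)) + 𝟙 (P' (v ∷ b))) (λ _ → 1ℚ)) (cong₂ _-_ (∑-+ Vs (λ v → 𝟙 (P (v ∷ a))) (λ v → 𝟙 (P' (v ∷ b)))) ∑Vs-1))
        (∑-mono Vs (λ v → both (P (v ∷ a)) (P' (v ∷ b)))))
      where
      e : ∀ δ n x y → (x + y) - n - ((1ℚ + 1ℚ) * δ - 1ℚ) * n ≡ (x - δ * n) + (y - δ * n)
      e = solve-∀ ℚ-ring
      both : ∀ p q → 𝟙 p + 𝟙 q - 1ℚ ≤ℚ 𝟙 p * 𝟙 q
      both true q = ℚₚ.≤-reflexive (e' (𝟙 q))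
        where
        e' : ∀ x → 1ℚ + x - 1ℚ ≡ 1ℚ * x
        e' = solve-∀ ℚ-ring
      both false q = subst₂ _≤ℚ_ (e' (𝟙 q)) (sym (ℚₚ.*-zeroˡ (𝟙 q))) (ℚₚ.+-monoˡ-≤ (- 1ℚ) (𝟙≤1 q))
        where
        e' : ∀ x → x + - 1ℚ ≡ 0ℚ + x - 1ℚ
        e' = solve-∀ ℚ-ring

    link : ∀ {s P} w → Dirac (suc s) P → Dirac s (P ∘ (w ∷_))
    P-↭ (link w D) p = P-↭ D (Perm.prep w p)
    codegree (link {s} {P} w D) l e = subst (δ * nℚ ≤ℚ_) (∑-cong Vs (λ v → cong 𝟙 (P-↭ D (Perm.swap v w ↭-refl)))) (codegree D (w ∷ l) (cong suc e))

    connectors : ℕ → (List V → Bool) → ℕ → List V → List V → ℚ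
    connectors s P ℓ a b = ∑ⁿ ℓ (λ x → 𝟙 (tight (suc s) P (a ++ x ++ b)))

    -- Leave `a` by j arbitrary steps, each with at least δ n continuations, and connect from the
    -- new end. This adjusts the length, which the block structure below prescribes.
    lengthen : ∀ s P → Dirac s P → ∀ ℓ c → 0ℚ ≤ℚ c → (∀ a b → length a ≡ s → length b ≡ s → c * (nℚ ^ℚ ℓ) ≤ℚ connectors s P ℓ a b) →
      ∀ j a b → length a ≡ s → length b ≡ s → (δ ^ℚ j) * c * (nℚ ^ℚ (j ℕ.+ ℓ)) ≤ℚ connectors s P (j ℕ.+ ℓ) a b
    lengthen s P D ℓ c 0≤c base zero a b ea eb = subst (_≤ℚ connectors s P ℓ a b) (cong (_* (nℚ ^ℚ ℓ)) (sym (ℚₚ.*-identityˡ c))) (base a b ea eb)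
    lengthen s P D ℓ c 0≤c base (suc j) a b ea eb = ℚₚ.≤-trans (subst (_≤ℚ ∑ Vs (λ y → 𝟙 (P (y ∷ a))) * K) (e δ nℚ (δ ^ℚ j) c (nℚ ^ℚ (j ℕ.+ ℓ)))
        (*-monoʳ 0≤K (codegree D a ea)))
      (ℚₚ.≤-trans (ℚₚ.≤-reflexive (sym (∑-*ʳ Vs K (λ y → 𝟙 (P (y ∷ a)))))) (∑-mono Vs (λ y → ℚₚ.≤-trans
        (*-monoˡ (𝟙≥0 (P (y ∷ a))) (lengthen s P D ℓ c 0≤c base j (drop 1 (a ++ [ y ])) b (shift-length a y ea) eb))
        (ℚₚ.≤-trans (ℚₚ.≤-reflexive (sym (∑ⁿ-*ˡ (j ℕ.+ ℓ) (𝟙 (P (y ∷ a))) _)))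
          (∑ⁿ-mono (j ℕ.+ ℓ) (λ x _ → subst (_≤ℚ 𝟙 (tight (suc s) P (a ++ y ∷ x ++ b))) (𝟙-∧ (P (y ∷ a)) _)
            (𝟙-implies (λ h → let (h₁ , h₂) = ∧-true⁻ {P (y ∷ a)} h in
              tight-shift s P a y (x ++ b) ea (trans (P-↭ D (Permₚ.++-comm a [ y ])) h₁) h₂))))))))
      where
      K = (δ ^ℚ j) * c * (nℚ ^ℚ (j ℕ.+ ℓ))
      0≤K : 0ℚ ≤ℚ K
      0≤K = *-nonneg (*-nonneg (^ℚ-nonneg j (ℚₚ.<⇒≤ 0<δ)) 0≤c) (nℚ^≥0 (j ℕ.+ ℓ))
      e : ∀ d n dj c m → (d * n) * (dj * c * m) ≡ (d * dj) * c * (n * m)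
      e = solve-∀ ℚ-ring
      shift-length : ∀ (a : List V) y → length a ≡ s → length (drop 1 (a ++ [ y ])) ≡ s
      shift-length [] y e = e
      shift-length (x ∷ a) y e = trans (Lₚ.length-++ a) (trans (ℕₚ.+-comm (length a) 1) e)

    link-tight : ℕ → (List V → Bool) → List V → ℚ
    link-tight s P l = ∑ Vs (λ w → 𝟙 (tight (suc s) (P ∘ (w ∷_)) l))

    link-tight≥0 : ∀ s P l → 0ℚ ≤ℚ link-tight s P l
    link-tight≥0 s P l = ∑-nonneg Vs (λ w → 𝟙≥0 (tight (suc s) (P ∘ (w ∷_)) l))

    insert-between : ∀ s P → Dirac (suc s) P → ∀ A X w → length A ≡ suc s → length X ≡ suc s →
      tight (suc s) (P ∘ (w ∷_)) (A ++ X) ≡ true → tight (suc (suc s)) P (A ++ w ∷ X) ≡ true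
    insert-between s P D A X w eA eX h = tight-insert (suc s) P (P-↭ D) A X w (ℕₚ.≤-reflexive eA) eX h (tight-suffix (suc s) Pw A h)
      (tight-window⁻ (suc s) Pw X [] (ℕ.s≤s ℕ.z≤n) eX (subst (λ z → tight (suc s) Pw z ≡ true) (sym (Lₚ.++-identityʳ X)) (tight-suffix (suc s) Pw A h)))
      where Pw = P ∘ (w ∷_)

    -- Put a common neighbour w between consecutive blocks of k−1 vertices of a path that is tight in the links of all these w.
    interleave : ∀ s P → Dirac (suc s) P → ∀ L A b → length A ≡ suc s → length b ≡ suc s →
      ∑ⁿ (L ℕ.* suc s) (λ x → link-tight s P (A ++ x ++ b) ^ℚ suc L) ≤ℚ connectors (suc s) P (interleavedLength s L) A b
    interleave s P D zero A b eA eb = subst (_≤ℚ connectors (suc s) P 1 A b) (sym (ℚₚ.*-identityʳ _))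
      (∑-mono Vs (λ w → 𝟙-implies (insert-between s P D A b w eA eb)))
    interleave s P D (suc L) A b eA eb = ℚₚ.≤-trans (ℚₚ.≤-reflexive (∑ⁿ-++ (suc s) (L ℕ.* suc s) (λ x → link-tight s P (A ++ x ++ b) ^ℚ suc (suc L)))) (ℚₚ.≤-trans
        (∑ⁿ-mono (suc s) (λ X eX → ℚₚ.≤-trans (∑ⁿ-mono (L ℕ.* suc s) (λ x _ → *-mono (link-tight≥0 s P (A ++ (X ++ x) ++ b)) (^ℚ-nonneg (suc L) (link-tight≥0 s P (X ++ x ++ b)))
              (∑-mono Vs (λ w → 𝟙-implies (λ h → tight-prefix (suc s) (P ∘ (w ∷_)) (A ++ X) {x ++ b} (subst (λ z → tight (suc s) (P ∘ (w ∷_)) z ≡ true) (assoc₁ X x) h))))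
              (^ℚ-mono (suc L) (link-tight≥0 s P (A ++ (X ++ x) ++ b)) (∑-mono Vs (λ w → 𝟙-implies (λ h → tight-suffix (suc s) (P ∘ (w ∷_)) A
                 (subst (λ z → tight (suc s) (P ∘ (w ∷_)) (A ++ z) ≡ true) (Lₚ.++-assoc X x b) h)))))))
           (ℚₚ.≤-trans (ℚₚ.≤-reflexive (∑ⁿ-*ˡ (L ℕ.* suc s) (link-tight s P (A ++ X)) (λ x → link-tight s P (X ++ x ++ b) ^ℚ suc L)))
             (ℚₚ.≤-trans (*-monoˡ (link-tight≥0 s P (A ++ X)) (interleave s P D L X b eX eb)) (one-step X eX)))))
        (ℚₚ.≤-reflexive (trans (∑ⁿ-comm-∑ (suc s) Vs (λ w X → ∑ⁿ ℓ (λ z → 𝟙 (tight (suc (suc s)) P (A ++ (w ∷ X ++ z) ++ b))))) (∑-cong Vs (λ w → sym (∑ⁿ-++ (suc s) ℓ (λ z → 𝟙 (tight (suc (suc s)) P (A ++ (w ∷ z) ++ b)))))))))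
      where
      ℓ = interleavedLength s L
      assoc₁ : ∀ (X x : List V) → A ++ (X ++ x) ++ b ≡ (A ++ X) ++ x ++ b
      assoc₁ X x = trans (cong (A ++_) (Lₚ.++-assoc X x b)) (sym (Lₚ.++-assoc A X (x ++ b)))
      one-step : ∀ X → length X ≡ suc s → link-tight s P (A ++ X) * connectors (suc s) P ℓ X b
        ≤ℚ ∑ Vs (λ w → ∑ⁿ ℓ (λ z → 𝟙 (tight (suc (suc s)) P (A ++ (w ∷ X ++ z) ++ b))))
      one-step X eX = ℚₚ.≤-trans (ℚₚ.≤-reflexive (sym (∑-*ʳ Vs (connectors (suc s) P ℓ X b) _))) (∑-mono Vs (λ w →
        ℚₚ.≤-trans (ℚₚ.≤-reflexive (sym (∑ⁿ-*ˡ ℓ (𝟙 (tight (suc s) (P ∘ (w ∷_)) (A ++ X))) _))) (∑ⁿ-mono ℓ (λ z _ →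
          subst (_≤ℚ 𝟙 (tight (suc (suc s)) P (A ++ (w ∷ X ++ z) ++ b))) (𝟙-∧ (tight (suc s) (P ∘ (w ∷_)) (A ++ X)) (tight (suc (suc s)) P (X ++ z ++ b))) (𝟙-implies (λ h → let (h₁ , h₂) = ∧-true⁻ {tight (suc s) (P ∘ (w ∷_)) (A ++ X)} h in
            subst (λ y → tight (suc (suc s)) P y ≡ true) (reassoc w X z)
              (tight-glue (suc (suc s)) P (A ++ [ w ]) X (z ++ b) (ℕₚ.≤-reflexive (cong suc (sym eX)))
                (subst (λ y → tight (suc (suc s)) P y ≡ true) (sym (Lₚ.++-assoc A [ w ] X)) (insert-between s P D A X w eA eX h₁)) h₂)))))))
        where
        reassoc : ∀ w (X z : List V) → (A ++ [ w ]) ++ X ++ z ++ b ≡ A ++ (w ∷ X ++ z) ++ b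
        reassoc w X z = trans (Lₚ.++-assoc A [ w ] (X ++ z ++ b)) (cong (λ y → A ++ w ∷ y) (sym (Lₚ.++-assoc X z b)))

    connDensity>0 : ∀ s → 0ℚ < connDensity δ s
    connDensity>0 zero = 0<1
    connDensity>0 (suc s) = ^ℚ-pos (suc (connLength s)) (*-pos 0<2δ-1 (*-pos (^ℚ-pos (s ℕ.* connLength s) 0<δ) (connDensity>0 s)))

    unsnoc : ∀ s (b : List V) → length b ≡ suc s → ∃ λ b' → ∃ λ z → b ≡ b' ++ [ z ] × length b' ≡ s
    unsnoc zero (z ∷ []) e = [] , z , refl , refl
    unsnoc (suc s) (y ∷ b) e = let (b' , z , e₁ , e₂) = unsnoc s b (ℕₚ.suc-injective e) in y ∷ b' , z , cong (y ∷_) e₁ , cong suc e₂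

    -- Let w be a common neighbour of a and b. In the link of w, of uniformity one less, the
    -- induction hypothesis joins a without its first vertex to b without its last one; restoring
    -- both vertices keeps tightness since w ∪ a and w ∪ b are edges. Many pairs (x, w) arise in
    -- this way, so by convexity there are many x with L + 1 such vertices w chosen independently,
    -- and `interleave` turns these into connections.
    connecting : ∀ s P → Dirac s P → ∀ a b → length a ≡ s → length b ≡ s →
      connDensity δ s * (nℚ ^ℚ connLength s) ≤ℚ connectors s P (connLength s) a b
    connecting zero P D [] [] refl refl = ℚₚ.≤-refl
    connecting (suc s) P D a@(a₀ ∷ a') b ea eb = ℚₚ.≤-trans (ℚₚ.≤-reflexive scale) (ℚₚ.≤-trans jensen
        (ℚₚ.≤-trans (∑ⁿ-mono ℓ (λ x _ → ^ℚ-mono (suc L) (Dx≥0 x) (Dx≤ x))) (interleave s P D L a b ea eb)))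
      where
      L = connLength s
      ℓ = L ℕ.* suc s
      c : ℚ
      c = (δ ^ℚ (s ℕ.* L)) * connDensity δ s
      c₃ : ℚ
      c₃ = (2ℚ * δ - 1ℚ) * c
      0≤c : 0ℚ ≤ℚ c
      0≤c = *-nonneg (^ℚ-nonneg (s ℕ.* L) (ℚₚ.<⇒≤ 0<δ)) (ℚₚ.<⇒≤ (connDensity>0 s))
      ea' : length a' ≡ s
      ea' = ℕₚ.suc-injective ea
      b' = proj₁ (unsnoc s b eb)
      z = proj₁ (proj₂ (unsnoc s b eb))
      b-eq : b ≡ b' ++ [ z ]
      b-eq = proj₁ (proj₂ (proj₂ (unsnoc s b eb)))
      eb' : length b' ≡ s
      eb' = proj₂ (proj₂ (proj₂ (unsnoc s b eb)))
      g : V → List V → ℚ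
      g w x = 𝟙 (P (w ∷ a)) * 𝟙 (P (w ∷ b)) * 𝟙 (tight (suc s) (P ∘ (w ∷_)) (a' ++ x ++ b'))
      g≥0 : ∀ w x → 0ℚ ≤ℚ g w x
      g≥0 w x = *-nonneg (*-nonneg (𝟙≥0 (P (w ∷ a))) (𝟙≥0 (P (w ∷ b)))) (𝟙≥0 (tight (suc s) (P ∘ (w ∷_)) (a' ++ x ++ b')))
      Dx : List V → ℚ
      Dx x = ∑ Vs (λ w → g w x)
      Dx≥0 : ∀ x → 0ℚ ≤ℚ Dx x
      Dx≥0 x = ∑-nonneg Vs (λ w → g≥0 w x)
      Dx≤ : ∀ x → Dx x ≤ℚ link-tight s P (a ++ x ++ b)
      Dx≤ x = ∑-mono Vs (λ w → subst (_≤ℚ 𝟙 (tight (suc s) (P ∘ (w ∷_)) (a ++ x ++ b)))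
        (trans (𝟙-∧ (P (w ∷ a) ∧ P (w ∷ b)) _) (cong (_* 𝟙 (tight (suc s) (P ∘ (w ∷_)) (a' ++ x ++ b'))) (𝟙-∧ (P (w ∷ a)) (P (w ∷ b)))))
        (𝟙-implies (λ h → let (h₁₂ , h₃) = ∧-true⁻ {P (w ∷ a) ∧ P (w ∷ b)} h
                              (h₁ , h₂) = ∧-true⁻ {P (w ∷ a)} h₁₂
                          in ∧-true (trans (head-full (suc s) (P ∘ (w ∷_)) a (x ++ b) ea) h₁)
                            (subst (λ y → tight (suc s) (P ∘ (w ∷_)) y ≡ true) (trans (Lₚ.++-assoc a' x (b' ++ [ z ])) (cong (λ y → a' ++ x ++ y) (sym b-eq)))
                              (tight-glue (suc s) (P ∘ (w ∷_)) (a' ++ x) b' [ z ] (ℕₚ.≤-reflexive (cong suc (sym eb')))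
                                (subst (λ y → tight (suc s) (P ∘ (w ∷_)) y ≡ true) (sym (Lₚ.++-assoc a' x b')) h₃)
                                (tight-window (suc s) (P ∘ (w ∷_)) (b' ++ [ z ]) (trans (cong length (sym b-eq)) eb) (trans (cong (λ y → P (w ∷ y)) (sym b-eq)) h₂)))))))
      -- Lengthening by s L steps gives L + s L vertices, which is L full blocks of s + 1.
      ℓ-eq : s ℕ.* L ℕ.+ L ≡ ℓ
      ℓ-eq = trans (ℕₚ.+-comm (s ℕ.* L) L) (ℕₚ.*-comm (suc s) L)
      first-moment : c₃ * nℚ * (nℚ ^ℚ ℓ) ≤ℚ ∑ⁿ ℓ Dx
      first-moment = ℚₚ.≤-trans (subst (_≤ℚ ∑ Vs (λ w → 𝟙 (P (w ∷ a)) * 𝟙 (P (w ∷ b))) * (c * (nℚ ^ℚ ℓ))) (e (2ℚ * δ - 1ℚ) nℚ c (nℚ ^ℚ ℓ))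
          (*-monoʳ (*-nonneg 0≤c (nℚ^≥0 ℓ)) (common D D a b ea eb)))
        (ℚₚ.≤-trans (ℚₚ.≤-reflexive (sym (∑-*ʳ Vs (c * (nℚ ^ℚ ℓ)) _))) (ℚₚ.≤-trans (∑-mono Vs (λ w → *-monoˡ (*-nonneg (𝟙≥0 (P (w ∷ a))) (𝟙≥0 (P (w ∷ b))))
            (subst (λ m → c * (nℚ ^ℚ m) ≤ℚ connectors s (P ∘ (w ∷_)) m a' b') ℓ-eq
              (lengthen s (P ∘ (w ∷_)) (link w D) L (connDensity δ s) (ℚₚ.<⇒≤ (connDensity>0 s)) (connecting s (P ∘ (w ∷_)) (link w D)) (s ℕ.* L) a' b' ea' eb'))))
          (ℚₚ.≤-reflexive (trans (∑-cong Vs (λ w → sym (∑ⁿ-*ˡ ℓ (𝟙 (P (w ∷ a)) * 𝟙 (P (w ∷ b))) _))) (sym (∑ⁿ-comm-∑ ℓ Vs g))))))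
        where
        e : ∀ t n c m → (t * n) * (c * m) ≡ t * c * n * m
        e = solve-∀ ℚ-ring
      σ : ℚ
      σ = c₃ * nℚ
      0≤σ : 0ℚ ≤ℚ σ
      0≤σ = *-nonneg (*-nonneg (ℚₚ.<⇒≤ 0<2δ-1) 0≤c) (fromℕ≥0 n)
      -- The tangents are taken at `σ`, a lower bound for the mean of `Dx`, so that the mean itself
      -- need not be formed.
      jensen : (σ ^ℚ suc L) * (nℚ ^ℚ ℓ) ≤ℚ ∑ⁿ ℓ (λ x → Dx x ^ℚ suc L)
      jensen = ℚₚ.≤-trans (≤-by (trans (cong (λ t → t * (σ ^ℚ L) * ∑ⁿ ℓ Dx - fromℕ L * (σ ^ℚ suc L) * (nℚ ^ℚ ℓ) - (σ ^ℚ suc L) * (nℚ ^ℚ ℓ)) (fromℕ-suc L))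
             (trans (e (fromℕ L) σ (σ ^ℚ L) (∑ⁿ ℓ Dx) (nℚ ^ℚ ℓ)) (cong (λ t → t * (σ ^ℚ L) * (∑ⁿ ℓ Dx - σ * (nℚ ^ℚ ℓ))) (sym (fromℕ-suc L)))))
           (*-nonneg (*-nonneg (fromℕ≥0 (suc L)) (^ℚ-nonneg L 0≤σ)) (diff≥0 first-moment)))
        (subst (_≤ℚ ∑ⁿ ℓ (λ x → Dx x ^ℚ suc L)) (trans (∑ⁿ-minus ℓ _ _) (cong₂ _-_ (∑ⁿ-*ˡ ℓ (fromℕ (suc L) * (σ ^ℚ L)) Dx)
            (trans (∑ⁿ-const ℓ _) (ℚₚ.*-comm (nℚ ^ℚ ℓ) (fromℕ L * (σ ^ℚ suc L))))))
          (∑ⁿ-mono ℓ (λ x _ → power-tangent L 0≤σ (Dx≥0 x))))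
        where
        e : ∀ t s a D N → (1ℚ + t) * a * D - t * (s * a) * N - (s * a) * N ≡ (1ℚ + t) * a * (D - s * N)
        e = solve-∀ ℚ-ring
      scale : connDensity δ (suc s) * (nℚ ^ℚ connLength (suc s)) ≡ (σ ^ℚ suc L) * (nℚ ^ℚ ℓ)
      scale = trans (cong ((c₃ ^ℚ suc L) *_) (trans (cong (nℚ ^ℚ_) (interleavedLength-≡ s L)) (^ℚ-+ nℚ ℓ (suc L))))
        (trans (e (c₃ ^ℚ suc L) (nℚ ^ℚ ℓ) (nℚ ^ℚ suc L)) (cong (_* (nℚ ^ℚ ℓ)) (sym (^ℚ-distrib c₃ nℚ (suc L)))))
        where
        e : ∀ x y z → x * (y * z) ≡ x * z * y
        e = solve-∀ ℚ-ring

    -- The absorbing path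

    module Absorbing (κ : ℕ) (P : List V → Bool) (D : Dirac (suc κ) P) where

      s ℓ : ℕ
      s = suc κ
      ℓ = connLength s

      tightP : List V → Bool
      tightP = tight (suc s) P

      linkTight : V → List V → Bool
      linkTight v = tight s (P ∘ (v ∷_))

      -- For A of 2s vertices with halves p and q, both p q and p v q are then tight paths, with the
      -- same first and last s vertices; the link condition covers the windows through v.
      absorbs : List V → V → Bool
      absorbs A v = tightP A ∧ linkTight v A

      -- Near the end of a list there are too few vertices to apply the codegree condition. A
      -- padding takes their place, and the window condition is vacuous there.
      fit : ∀ k (R : List V → Bool) (pad : List V) A' → length pad ≡ k →
        ∃ λ l → length l ≡ k × (∀ x → R (x ∷ l) ≡ true → headWindow (suc k) R (x ∷ A') ≡ true)
      fit k R pad A' e with k ℕ.≤? length A'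
      ... | yes p = take k A' , trans (Lₚ.length-take k A') (ℕₚ.m≤n⇒m⊓n≡m p) , λ x h → trans (head-long (suc k) R (x ∷ A') (ℕ.s≤s p)) h
      ... | no p = pad , e , λ x _ → head-short (suc k) R (x ∷ A') (ℕ.s≤s (ℕₚ.≰⇒> p))

      -- A is built from its last vertex to its first. A new vertex x has to form an edge with the
      -- next s vertices, and one with v and the next s - 1; two neighbourhoods of size δ n share at
      -- least (2δ - 1) n vertices.
      absorber-density : ∀ v j → ((2ℚ * δ - 1ℚ) * nℚ) ^ℚ j ≤ℚ ∑ⁿ j (λ A → 𝟙 (absorbs A v))
      absorber-density v zero = ℚₚ.≤-refl
      absorber-density v (suc j) = ℚₚ.≤-trans (*-monoˡ (*-nonneg (ℚₚ.<⇒≤ 0<2δ-1) (fromℕ≥0 n)) (absorber-density v j))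
        (ℚₚ.≤-trans (ℚₚ.≤-reflexive (sym (∑ⁿ-*ˡ j ((2ℚ * δ - 1ℚ) * nℚ) (λ A → 𝟙 (absorbs A v))))) (ℚₚ.≤-trans
          (∑ⁿ-mono j (λ A _ → one A)) (ℚₚ.≤-reflexive (∑ⁿ-comm-∑ j Vs (λ x A → 𝟙 (absorbs (x ∷ A) v))))))
        where
        one : ∀ A → (2ℚ * δ - 1ℚ) * nℚ * 𝟙 (absorbs A v) ≤ℚ ∑ Vs (λ x → 𝟙 (absorbs (x ∷ A) v))
        one A = let (l₁ , e₁ , i₁) = fit s P (replicate s v) A (Lₚ.length-replicate s)
                    (l₂ , e₂ , i₂) = fit κ (P ∘ (v ∷_)) (replicate κ v) A (Lₚ.length-replicate κ)
          in ℚₚ.≤-trans (*-monoʳ (𝟙≥0 (absorbs A v)) (common D D l₁ (v ∷ l₂) e₁ (cong suc e₂)))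
            (ℚₚ.≤-trans (ℚₚ.≤-reflexive (sym (∑-*ʳ Vs (𝟙 (absorbs A v)) (λ x → 𝟙 (P (x ∷ l₁)) * 𝟙 (P (x ∷ v ∷ l₂))))))
              (∑-mono Vs (λ x → subst (_≤ℚ 𝟙 (absorbs (x ∷ A) v)) (trans (𝟙-∧ (P (x ∷ l₁) ∧ P (x ∷ v ∷ l₂)) (absorbs A v)) (cong (_* 𝟙 (absorbs A v)) (𝟙-∧ (P (x ∷ l₁)) (P (x ∷ v ∷ l₂)))))
                (𝟙-implies (λ h → let (h₁₂ , h₃) = ∧-true⁻ {P (x ∷ l₁) ∧ P (x ∷ v ∷ l₂)} h
                                      (h₁ , h₂) = ∧-true⁻ {P (x ∷ l₁)} h₁₂
                                      (h₄ , h₅) = ∧-true⁻ {tightP A} h₃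
                  in ∧-true (∧-true (i₁ x h₁) h₄) (∧-true (i₂ x (trans (P-↭ D (Perm.swap v x ↭-refl)) h₂)) h₅))))))

      EndsWith : List V → List V → Set
      EndsWith b L = ∃ λ U → L ≡ U ++ b

      blockLength : ℕ
      blockLength = ℓ ℕ.+ (s ℕ.+ s)

      module _ (0<n : 0 ℕ.< n) (M : ℕ) (c₀ : ℚ) (0<c₀ : 0ℚ < c₀) (c₀≤1 : c₀ ≤ℚ 1ℚ)
        (2c₀≤absorb : 2ℚ * c₀ ≤ℚ (2ℚ * δ - 1ℚ) ^ℚ (s ℕ.+ s)) (2c₀≤conn : 2ℚ * c₀ ≤ℚ connDensity δ s)
        (blockLength≤M : blockLength ℕ.≤ M) (M-small : fromℕ (M ℕ.* (M ℕ.+ M)) ≤ℚ c₀ * nℚ) where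

        private
          few : ∀ j (W : List V) → j ℕ.≤ M → length W ℕ.≤ M → fromℕ (j ℕ.* (j ℕ.+ length W)) ≤ℚ c₀ * nℚ
          few j W p q = ℚₚ.≤-trans (fromℕ-mono (ℕₚ.*-mono-≤ p (ℕₚ.+-mono-≤ p q))) M-small
          ∑𝟙≥0 : ∀ (b : V → Bool) → 0ℚ ≤ℚ ∑ Vs (𝟙 ∘ b)
          ∑𝟙≥0 b = ∑-nonneg Vs (λ v → 𝟙≥0 (b v))

        find-connector : ∀ b p W → length b ≡ s → length p ≡ s → distinct W ≡ true → length W ℕ.≤ M →
          ∃ λ C → length C ≡ ℓ × distinct (C ++ W) ≡ true × tightP (b ++ C ++ p) ≡ true
        find-connector b p W eb ep dW |W| =
          let (C , e , h , t) = avoid 0<n ℓ W (λ x → 𝟙 (tightP (b ++ x ++ p))) c₀ 1ℚ dW 0<c₀ (λ x → 𝟙≥0 (tightP (b ++ x ++ p))) (λ x → 𝟙≤1 (tightP (b ++ x ++ p)))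
                (ℚₚ.≤-trans (*-monoʳ (nℚ^≥0 ℓ) 2c₀≤conn) (connecting s P D b p eb ep))
                (subst (_≤ℚ c₀ * nℚ) (sym (ℚₚ.*-identityʳ _)) (few ℓ W (ℕₚ.≤-trans (ℕₚ.m≤m+n ℓ (s ℕ.+ s)) blockLength≤M) |W|))
          in C , e , h , positive (tightP (b ++ C ++ p)) t
          where
          positive : ∀ b → c₀ ≤ℚ 𝟙 b → b ≡ true
          positive true _ = refl
          positive false h = ⊥-elim (ℚₚ.<-irrefl refl (ℚₚ.<-≤-trans 0<c₀ h))

        -- Double counting: over all sequences of 2s vertices, the mean number of vertices in `bd`
        -- that are served is at least 2 c₀ times the size of `bd`. Half of this survives the
        -- exclusion of repeated entries and of `W`. Serving at least one vertex already forces A to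
        -- be tight.
        find-absorber : ∀ W bd → distinct W ≡ true → length W ℕ.≤ M → 0ℚ < ∑ Vs (𝟙 ∘ bd) →
          ∃ λ A → length A ≡ s ℕ.+ s × distinct (A ++ W) ≡ true × tightP A ≡ true ×
            ∑ Vs (λ v → 𝟙 (bd v ∧ not (absorbs A v))) ≤ℚ (1ℚ - c₀) * ∑ Vs (𝟙 ∘ bd)
        find-absorber W bd dW |W| 0<B =
          let (A , e , h , t) = avoid 0<n (s ℕ.+ s) W f (c₀ * B) B dW (*-pos 0<c₀ 0<B) (λ x → ∑-nonneg Vs (λ v → *-nonneg (𝟙≥0 (bd v)) (𝟙≥0 (absorbs x v))))
                (λ x → ∑-mono Vs (λ v → subst (𝟙 (bd v) * 𝟙 (absorbs x v) ≤ℚ_) (ℚₚ.*-identityʳ (𝟙 (bd v))) (*-monoˡ (𝟙≥0 (bd v)) (𝟙≤1 (absorbs x v)))))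
                dense (ℚₚ.≤-trans (*-monoʳ (ℚₚ.<⇒≤ 0<B) (few (s ℕ.+ s) W (ℕₚ.≤-trans (ℕₚ.m≤n+m (s ℕ.+ s) ℓ) blockLength≤M) |W|)) (ℚₚ.≤-reflexive (e₂ c₀ nℚ B)))
          in A , e , h , tight-A A t , remaining A t
          where
          B = ∑ Vs (𝟙 ∘ bd)
          f : List V → ℚ
          f A = ∑ Vs (λ v → 𝟙 (bd v) * 𝟙 (absorbs A v))
          e₂ : ∀ c n B → c * n * B ≡ c * B * n
          e₂ = solve-∀ ℚ-ring
          dense : 2ℚ * (c₀ * B) * (nℚ ^ℚ (s ℕ.+ s)) ≤ℚ ∑ⁿ (s ℕ.+ s) f
          dense = ℚₚ.≤-trans (ℚₚ.≤-reflexive (e₃ c₀ B (nℚ ^ℚ (s ℕ.+ s)))) (ℚₚ.≤-trans (*-monoˡ (ℚₚ.<⇒≤ 0<B) (*-monoʳ (nℚ^≥0 (s ℕ.+ s)) 2c₀≤absorb))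
            (ℚₚ.≤-trans (ℚₚ.≤-reflexive (trans (cong (B *_) (sym (^ℚ-distrib (2ℚ * δ - 1ℚ) nℚ (s ℕ.+ s)))) (sym (∑-*ʳ Vs (((2ℚ * δ - 1ℚ) * nℚ) ^ℚ (s ℕ.+ s)) (𝟙 ∘ bd)))))
              (ℚₚ.≤-trans (∑-mono Vs (λ v → *-monoˡ (𝟙≥0 (bd v)) (absorber-density v (s ℕ.+ s))))
                (ℚₚ.≤-reflexive (trans (∑-cong Vs (λ v → sym (∑ⁿ-*ˡ (s ℕ.+ s) (𝟙 (bd v)) (λ A → 𝟙 (absorbs A v))))) (sym (∑ⁿ-comm-∑ (s ℕ.+ s) Vs (λ v A → 𝟙 (bd v) * 𝟙 (absorbs A v)))))))))
            where
            e₃ : ∀ c B N → (1ℚ + 1ℚ) * (c * B) * N ≡ B * ((1ℚ + 1ℚ) * c * N)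
            e₃ = solve-∀ ℚ-ring
          tight-A : ∀ A → c₀ * B ≤ℚ f A → tightP A ≡ true
          tight-A A t with tightP A
          ... | true = refl
          ... | false = ⊥-elim (ℚₚ.<-irrefl refl (ℚₚ.<-≤-trans (*-pos 0<c₀ 0<B) (ℚₚ.≤-trans t (ℚₚ.≤-reflexive
                  (trans (∑-cong Vs (λ v → ℚₚ.*-zeroʳ (𝟙 (bd v)))) (∑-0 Vs))))))
          remaining : ∀ A → c₀ * B ≤ℚ f A → ∑ Vs (λ v → 𝟙 (bd v ∧ not (absorbs A v))) ≤ℚ (1ℚ - c₀) * B
          remaining A t = ℚₚ.≤-trans (ℚₚ.≤-reflexive (trans (∑-cong Vs (λ v → trans (𝟙-∧ (bd v) (not (absorbs A v))) (trans (cong (𝟙 (bd v) *_) (𝟙-not (absorbs A v))) (e₄ (𝟙 (bd v)) (𝟙 (absorbs A v))))))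
              (∑-minus Vs (𝟙 ∘ bd) (λ v → 𝟙 (bd v) * 𝟙 (absorbs A v))))) (≤-by (e₅ c₀ B (f A)) (diff≥0 t))
            where
            e₄ : ∀ a b → a * (1ℚ - b) ≡ a - a * b
            e₄ = solve-∀ ℚ-ring
            e₅ : ∀ c B x → (1ℚ - c) * B - (B - x) ≡ x - c * B
            e₅ = solve-∀ ℚ-ring

        -- Each absorber serves a c₀-fraction of the vertices that the previous ones do not serve.
        record Group (q : ℕ) (b W : List V) (bd : V → Bool) : Set where
          field
            G b' : List V
            rest : V → Bool
            |b'| : length b' ≡ s
            |G| : length G ℕ.≤ q ℕ.* blockLength
            distinct-G : distinct (G ++ W) ≡ true
            tight-G : tightP (b ++ G) ≡ true
            ends-G : EndsWith b' (b ++ G)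
            few-rest : ∑ Vs (𝟙 ∘ rest) ≤ℚ ((1ℚ - c₀) ^ℚ q) * ∑ Vs (𝟙 ∘ bd)
            absorb : ∀ v → bd v ≡ true → rest v ≡ false → ∃ λ L → L ↭ v ∷ G × tightP (b ++ L) ≡ true × EndsWith b' (b ++ L)

        halves : ∀ {A : List V} → length A ≡ s ℕ.+ s → A ≡ take s A ++ drop s A × length (take s A) ≡ s × length (drop s A) ≡ s
        halves {A} e = sym (Lₚ.take++drop≡id s A) , trans (Lₚ.length-take s A) (trans (cong (s ℕ.⊓_) e) (ℕₚ.m≤n⇒m⊓n≡m (ℕₚ.m≤m+n s s))) ,
          trans (Lₚ.length-drop s A) (trans (cong (ℕ._∸ s) e) (ℕₚ.m+n∸m≡n s s))

        tight-↝ : ∀ {L L'} → L ≡ L' → tightP L ≡ true → tightP L' ≡ true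
        tight-↝ refl h = h

        true≢false : true ≢ false
        true≢false ()

        module Join (q : ℕ) (b W : List V) (bd : V → Bool) (A C : List V) (eA : length A ≡ s ℕ.+ s) (eC : length C ≡ ℓ)
          (tA : tightP A ≡ true) (tC : tightP (b ++ C ++ take s A) ≡ true)
          (fewA : ∑ Vs (λ v → 𝟙 (bd v ∧ not (absorbs A v))) ≤ℚ (1ℚ - c₀) * ∑ Vs (𝟙 ∘ bd))
          (R : Group q (drop s A) (C ++ A ++ W) (λ v → bd v ∧ not (absorbs A v))) where

          p₁ q₁ W₁ : List V
          p₁ = take s A
          q₁ = drop s A
          W₁ = C ++ A ++ W
          A≡ : A ≡ p₁ ++ q₁
          A≡ = proj₁ (halves {A} eA)
          ep : length p₁ ≡ s
          ep = proj₁ (proj₂ (halves {A} eA))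
          eq : length q₁ ≡ s
          eq = proj₂ (proj₂ (halves {A} eA))
          module R = Group R
          s≤ : ∀ (x : List V) → length x ≡ s → suc s ℕ.≤ suc (length x)
          s≤ x e = ℕₚ.≤-reflexive (cong suc (sym e))
          assemble : ∀ mid T → tightP (p₁ ++ mid ++ q₁) ≡ true → tightP (q₁ ++ T) ≡ true → tightP (b ++ (C ++ p₁ ++ mid ++ q₁) ++ T) ≡ true
          assemble mid T h₁ h₂ = tight-↝ (shape mid T) (tight-glue (suc s) P (b ++ C ++ p₁ ++ mid) q₁ T (s≤ q₁ eq)
            (tight-↝ (shape' mid) (tight-glue (suc s) P (b ++ C) p₁ (mid ++ q₁) (s≤ p₁ ep) (tight-↝ (sym (Lₚ.++-assoc b C p₁)) tC) h₁)) h₂)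
            where
            shape' : ∀ mid → (b ++ C) ++ p₁ ++ mid ++ q₁ ≡ (b ++ C ++ p₁ ++ mid) ++ q₁
            shape' mid = trans (Lₚ.++-assoc b C _) (trans (cong (λ z → b ++ C ++ z) (sym (Lₚ.++-assoc p₁ mid q₁)))
              (trans (cong (b ++_) (sym (Lₚ.++-assoc C (p₁ ++ mid) q₁))) (sym (Lₚ.++-assoc b (C ++ p₁ ++ mid) q₁))))
            shape : ∀ mid T → (b ++ C ++ p₁ ++ mid) ++ q₁ ++ T ≡ b ++ (C ++ p₁ ++ mid ++ q₁) ++ T
            shape mid T = trans (sym (Lₚ.++-assoc (b ++ C ++ p₁ ++ mid) q₁ T)) (trans (cong (_++ T) (sym (shape' mid)))
              (trans (cong (_++ T) (Lₚ.++-assoc b C _)) (Lₚ.++-assoc b (C ++ p₁ ++ mid ++ q₁) T)))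
          ends : ∀ mid T → EndsWith R.b' (q₁ ++ T) → EndsWith R.b' (b ++ (C ++ p₁ ++ mid ++ q₁) ++ T)
          ends mid T (U , e) = b ++ C ++ p₁ ++ mid ++ U , trans (cong (b ++_) (trans (Lₚ.++-assoc C (p₁ ++ mid ++ q₁) T) (cong (C ++_)
             (trans (Lₚ.++-assoc p₁ (mid ++ q₁) T) (cong (p₁ ++_) (trans (Lₚ.++-assoc mid q₁ T) (trans (cong (mid ++_) e) (sym (Lₚ.++-assoc mid U R.b')))))))))
             (sym (trans (Lₚ.++-assoc b _ R.b') (cong (b ++_) (trans (Lₚ.++-assoc C _ R.b') (cong (C ++_) (Lₚ.++-assoc p₁ (mid ++ U) R.b'))))))
          tA' : tightP (p₁ ++ [] ++ q₁) ≡ true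
          tA' = tight-↝ A≡ tA
          G₀ : List V
          G₀ = (C ++ p₁ ++ q₁) ++ R.G
          A-eq : p₁ ++ q₁ ≡ A
          A-eq = sym A≡
          perm-W : G₀ ++ W ↭ R.G ++ W₁
          perm-W = ↭-trans (Permₚ.++⁺ʳ W (Permₚ.++-comm (C ++ p₁ ++ q₁) R.G)) (Perm.↭-reflexive (trans (Lₚ.++-assoc R.G (C ++ p₁ ++ q₁) W)
            (cong (R.G ++_) (trans (Lₚ.++-assoc C (p₁ ++ q₁) W) (cong (λ z → C ++ z ++ W) A-eq)))))
          len : length G₀ ℕ.≤ blockLength ℕ.+ q ℕ.* blockLength
          len = subst (ℕ._≤ blockLength ℕ.+ q ℕ.* blockLength) (sym (trans (Lₚ.length-++ (C ++ p₁ ++ q₁)) (cong (ℕ._+ length R.G)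
            (trans (Lₚ.length-++ C) (cong₂ ℕ._+_ eC (trans (cong length A-eq) eA)))))) (ℕₚ.+-monoʳ-≤ blockLength R.|G|)
          -- The new absorber takes v if it can; otherwise v belongs to the reduced `bd` and is left
          -- to the rest of the group.
          absorb' : ∀ v → bd v ≡ true → R.rest v ≡ false → ∃ λ L → L ↭ v ∷ G₀ × tightP (b ++ L) ≡ true × EndsWith R.b' (b ++ L)
          absorb' v h h' with absorbs A v in ab
          ... | true = (C ++ p₁ ++ [ v ] ++ q₁) ++ R.G
                     , ↭-trans (Permₚ.++⁺ʳ R.G (↭-trans (Perm.↭-reflexive (sym (Lₚ.++-assoc C p₁ (v ∷ q₁)))) (↭-trans (Permₚ.shift v (C ++ p₁) q₁)
                         (Perm.↭-reflexive (cong (v ∷_) (Lₚ.++-assoc C p₁ q₁)))))) ↭-refl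
                     , assemble [ v ] R.G (insert-between κ P D p₁ q₁ v ep eq (subst (λ z → tight s (P ∘ (v ∷_)) z ≡ true) A≡ (proj₂ (∧-true⁻ {tightP A} ab)))) R.tight-G
                     , ends [ v ] R.G R.ends-G
          ... | false = let (L , L↭ , tL , eL) = R.absorb v (∧-true h (cong not ab)) h' in
                     (C ++ p₁ ++ q₁) ++ L
                     , ↭-trans (Permₚ.++⁺ˡ (C ++ p₁ ++ q₁) L↭) (Permₚ.shift v (C ++ p₁ ++ q₁) R.G)
                     , assemble [] L tA' tL , ends [] L eL
          result : Group (suc q) b W bd
          result = record
            { G = G₀ ; b' = R.b' ; rest = R.rest ; |b'| = R.|b'| ; |G| = len
            ; distinct-G = trans (distinct-↭ perm-W) R.distinct-G
            ; tight-G = assemble [] R.G tA' R.tight-G ; ends-G = ends [] R.G R.ends-G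
            ; few-rest = ℚₚ.≤-trans R.few-rest (ℚₚ.≤-trans (*-monoˡ (^ℚ-nonneg q (diff≥0 c₀≤1)) fewA) (ℚₚ.≤-reflexive (e ((1ℚ - c₀) ^ℚ q) (1ℚ - c₀) (∑ Vs (𝟙 ∘ bd)))))
            ; absorb = absorb' }
            where
            e : ∀ x y z → x * (y * z) ≡ y * x * z
            e = solve-∀ ℚ-ring

        group : ∀ q b W bd → length b ≡ s → distinct W ≡ true → length W ℕ.+ q ℕ.* blockLength ℕ.≤ M → Group q b W bd
        group zero b W bd eb dW |W| = record
          { G = [] ; b' = b ; rest = bd ; |b'| = eb ; |G| = ℕ.z≤n ; distinct-G = dW
          ; tight-G = tight-↝ (sym (Lₚ.++-identityʳ b)) (tight-short (suc s) P b (ℕₚ.≤-reflexive (cong suc eb)))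
          ; ends-G = [] , Lₚ.++-identityʳ b ; few-rest = ℚₚ.≤-reflexive (sym (ℚₚ.*-identityˡ _))
          ; absorb = λ v h h' → ⊥-elim (true≢false (trans (sym h) h')) }
        group (suc q) b W bd eb dW |W| = extend (0ℚ ℚ.<? ∑ Vs (𝟙 ∘ bd))
          where
          extend : Dec (0ℚ < ∑ Vs (𝟙 ∘ bd)) → Group (suc q) b W bd
          -- Averaging needs someone to serve; if `bd` is empty, the group ends early with an empty
          -- path.
          extend (no none) = record
            { G = [] ; b' = b ; rest = bd ; |b'| = eb ; |G| = ℕ.z≤n ; distinct-G = dW
            ; tight-G = tight-↝ (sym (Lₚ.++-identityʳ b)) (tight-short (suc s) P b (ℕₚ.≤-reflexive (cong suc eb)))
            ; ends-G = [] , Lₚ.++-identityʳ b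
            ; few-rest = ℚₚ.≤-trans (ℚₚ.≮⇒≥ none) (*-nonneg (^ℚ-nonneg (suc q) (diff≥0 c₀≤1)) (∑𝟙≥0 bd))
            ; absorb = λ v h h' → ⊥-elim (true≢false (trans (sym h) h')) }
          extend (yes some) = Join.result q b W bd A C eA eC tA tC fewA (group q (drop s A) (C ++ A ++ W) (λ v → bd v ∧ not (absorbs A v)) (proj₂ (proj₂ (halves {A} eA))) dC |W₁|)
            where
            absorber = find-absorber W bd dW (ℕₚ.≤-trans (ℕₚ.m≤m+n (length W) (suc q ℕ.* blockLength)) |W|) some
            A = proj₁ absorber
            eA = proj₁ (proj₂ absorber)
            dA = proj₁ (proj₂ (proj₂ absorber))
            tA = proj₁ (proj₂ (proj₂ (proj₂ absorber)))
            fewA = proj₂ (proj₂ (proj₂ (proj₂ absorber)))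
            |A++W| : length (A ++ W) ℕ.≤ M
            |A++W| = ℕₚ.≤-trans (ℕₚ.≤-reflexive (trans (Lₚ.length-++ A) (trans (cong (ℕ._+ length W) eA) (ℕₚ.+-comm (s ℕ.+ s) (length W)))))
              (ℕₚ.≤-trans (ℕₚ.+-monoʳ-≤ (length W) (ℕₚ.≤-trans (ℕₚ.m≤n+m (s ℕ.+ s) ℓ) (ℕₚ.m≤m+n blockLength (q ℕ.* blockLength)))) |W|)
            connector = find-connector b (take s A) (A ++ W) eb (proj₁ (proj₂ (halves {A} eA))) dA |A++W|
            C = proj₁ connector
            eC = proj₁ (proj₂ connector)
            dC = proj₁ (proj₂ (proj₂ connector))
            tC = proj₂ (proj₂ (proj₂ connector))
            |W₁| : length (C ++ A ++ W) ℕ.+ q ℕ.* blockLength ℕ.≤ M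
            |W₁| = subst (ℕ._≤ M) (trans (rearr (length W) ℓ (s ℕ.+ s) (q ℕ.* blockLength)) (cong (ℕ._+ q ℕ.* blockLength)
              (sym (trans (Lₚ.length-++ C) (cong₂ ℕ._+_ eC (trans (Lₚ.length-++ A) (cong (ℕ._+ length W) eA))))))) |W|
              where
              rearr : ∀ w l t r → w ℕ.+ (l ℕ.+ t ℕ.+ r) ≡ l ℕ.+ (t ℕ.+ w) ℕ.+ r
              rearr w l t r = trans (sym (ℕₚ.+-assoc w (l ℕ.+ t) r)) (cong (ℕ._+ r) (trans (ℕₚ.+-comm w (l ℕ.+ t)) (ℕₚ.+-assoc l t w)))

        -- Each group receives exactly one of the g vertices, whichever it is, so a vertex is
        -- declared bad if any single group cannot serve it.
        record Chain (q g : ℕ) (b W : List V) : Set where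
          field
            G b' : List V
            bad : V → Bool
            |b'| : length b' ≡ s
            |G| : length G ℕ.≤ g ℕ.* (q ℕ.* blockLength)
            distinct-G : distinct (G ++ W) ≡ true
            few-bad : ∑ Vs (𝟙 ∘ bad) ≤ℚ fromℕ g * (((1ℚ - c₀) ^ℚ q) * nℚ)
            absorb : ∀ vs → length vs ≡ g → All (λ v → bad v ≡ false) vs →
              ∃ λ L → L ↭ vs ++ G × tightP (b ++ L) ≡ true × EndsWith b' (b ++ L)

        chain : ∀ q g b W → length b ≡ s → distinct W ≡ true → length W ℕ.+ g ℕ.* (q ℕ.* blockLength) ℕ.≤ M → Chain q g b W
        chain q zero b W eb dW |W| = record
          { G = [] ; b' = b ; bad = λ _ → false ; |b'| = eb ; |G| = ℕ.z≤n ; distinct-G = dW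
          ; few-bad = ℚₚ.≤-reflexive (trans (∑-0 Vs) (sym (fromℕ0* (((1ℚ - c₀) ^ℚ q) * nℚ))))
          ; absorb = λ { [] _ _ → [] , ↭-refl , tight-↝ (sym (Lₚ.++-identityʳ b)) (tight-short (suc s) P b (ℕₚ.≤-reflexive (cong suc eb))) , [] , Lₚ.++-identityʳ b } }
        chain q (suc g) b W eb dW |W| = record
          { G = H.G ++ R.G ; b' = R.b' ; bad = λ v → H.rest v ∨ R.bad v ; |b'| = R.|b'|
          ; |G| = subst (ℕ._≤ q ℕ.* blockLength ℕ.+ g ℕ.* (q ℕ.* blockLength)) (sym (Lₚ.length-++ H.G)) (ℕₚ.+-mono-≤ H.|G| R.|G|)
          ; distinct-G = trans (distinct-↭ (↭-trans (Permₚ.++⁺ʳ W (Permₚ.++-comm H.G R.G)) (Perm.↭-reflexive (Lₚ.++-assoc R.G H.G W)))) R.distinct-G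
          ; few-bad = ℚₚ.≤-trans (∑-mono Vs (λ v → or≤ (H.rest v) (R.bad v))) (ℚₚ.≤-trans (ℚₚ.≤-reflexive (∑-+ Vs (𝟙 ∘ H.rest) (𝟙 ∘ R.bad)))
              (ℚₚ.≤-trans (ℚₚ.+-mono-≤ (ℚₚ.≤-trans H.few-rest (ℚₚ.≤-reflexive (cong (((1ℚ - c₀) ^ℚ q) *_) ∑Vs-1))) R.few-bad)
                (ℚₚ.≤-reflexive (trans (e (((1ℚ - c₀) ^ℚ q) * nℚ) (fromℕ g)) (cong (_* (((1ℚ - c₀) ^ℚ q) * nℚ)) (sym (fromℕ-suc g)))))))
          ; absorb = absorb' }
          where
          H : Group q b W (λ _ → true)
          H = group q b W (λ _ → true) eb dW (ℕₚ.≤-trans (ℕₚ.+-monoʳ-≤ (length W) (ℕₚ.m≤m+n (q ℕ.* blockLength) (g ℕ.* (q ℕ.* blockLength)))) |W|)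
          module H = Group H
          |W₁| : length (H.G ++ W) ℕ.+ g ℕ.* (q ℕ.* blockLength) ℕ.≤ M
          |W₁| = ℕₚ.≤-trans (ℕₚ.+-monoˡ-≤ (g ℕ.* (q ℕ.* blockLength)) (ℕₚ.≤-trans (ℕₚ.≤-reflexive (trans (Lₚ.length-++ H.G) (ℕₚ.+-comm (length H.G) (length W))))
            (ℕₚ.+-monoʳ-≤ (length W) H.|G|))) (subst (ℕ._≤ M) (sym (ℕₚ.+-assoc (length W) (q ℕ.* blockLength) (g ℕ.* (q ℕ.* blockLength)))) |W|)
          R : Chain q g H.b' (H.G ++ W)
          R = chain q g H.b' (H.G ++ W) H.|b'| H.distinct-G |W₁|
          module R = Chain R
          e : ∀ x g → x + g * x ≡ (1ℚ + g) * x
          e = solve-∀ ℚ-ring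
          or≤ : ∀ a b → 𝟙 (a ∨ b) ≤ℚ 𝟙 a + 𝟙 b
          or≤ true b = subst (_≤ℚ 1ℚ + 𝟙 b) (ℚₚ.+-identityʳ 1ℚ) (ℚₚ.+-monoʳ-≤ 1ℚ (𝟙≥0 b))
          or≤ false b = ℚₚ.≤-reflexive (sym (ℚₚ.+-identityˡ (𝟙 b)))
          or-false : ∀ {a b} → a ∨ b ≡ false → a ≡ false × b ≡ false
          or-false {false} {false} _ = refl , refl
          absorb' : ∀ vs → length vs ≡ suc g → All (λ v → (H.rest v ∨ R.bad v) ≡ false) vs →
            ∃ λ L → L ↭ vs ++ H.G ++ R.G × tightP (b ++ L) ≡ true × EndsWith R.b' (b ++ L)
          absorb' (v ∷ vs) e (h ∷ hs) =
            let (L₁ , p₁ , t₁ , (U₁ , e₁)) = H.absorb v refl (proj₁ (or-false h))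
                (L₂ , p₂ , t₂ , (U₂ , e₂)) = R.absorb vs (ℕₚ.suc-injective e) (All.map (λ {w} h → proj₂ (or-false {H.rest w} h)) hs)
                shape = trans (sym (Lₚ.++-assoc U₁ H.b' L₂)) (trans (cong (_++ L₂) (sym e₁)) (Lₚ.++-assoc b L₁ L₂))
            in L₁ ++ L₂
             , ↭-trans (Permₚ.++⁺ p₁ p₂) (Perm.prep v (↭-trans (Perm.↭-reflexive (sym (Lₚ.++-assoc H.G vs R.G)))
                 (↭-trans (Permₚ.++⁺ʳ R.G (Permₚ.++-comm H.G vs)) (Perm.↭-reflexive (Lₚ.++-assoc vs H.G R.G)))))
             , tight-↝ shape (tight-glue (suc s) P U₁ H.b' L₂ (ℕₚ.≤-reflexive (cong suc (sym H.|b'|))) (tight-↝ e₁ t₁) t₂)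
             , U₁ ++ U₂ , trans (sym shape) (trans (cong (U₁ ++_) e₂) (sym (Lₚ.++-assoc U₁ U₂ R.b')))

    -- Reaching a fixed target through one of several random chunks

    module Target (κ : ℕ) (P : List V → Bool) (D : Dirac (suc κ) P)
      (Q : List V) (distinct-Q : distinct Q ≡ true) (N' : ℕ) (|Q|+N' : length Q ℕ.+ N' ≡ n)
      (0<n : 0 ℕ.< n) (M : ℕ) (c₀ : ℚ) (0<c₀ : 0ℚ < c₀) (c₀≤1 : c₀ ≤ℚ 1ℚ)
      (2c₀≤conn : 2ℚ * c₀ ≤ℚ connDensity δ (suc κ)) (ℓ≤M : connLength (suc κ) ℕ.≤ M) (M-small : fromℕ (M ℕ.* (M ℕ.+ M)) ≤ℚ c₀ * fromℕ n)
      (e : List (Fin n)) (|e| : length e ≡ suc κ) (bad : Fin n → Bool) where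

      open Sampling Q distinct-Q N' |Q|+N'

      private
        s ℓ : ℕ
        s = suc κ
        ℓ = connLength s

        tightP : List V → Bool
        tightP = tight (suc s) P

      0<nℚ : 0ℚ < nℚ
      0<nℚ = fromℕ-pos 0<n

      N'≤n : N' ℕ.≤ n
      N'≤n = subst (N' ℕ.≤_) |Q|+N' (ℕₚ.m≤n+m N' (length Q))

      ff-growth : ∀ j i → i ℕ.+ j ℕ.≤ N' → ff (i ℕ.+ j) ≤ℚ ff j * (nℚ ^ℚ i)
      ff-growth j zero h = ℚₚ.≤-reflexive (sym (ℚₚ.*-identityʳ (ff j)))
      ff-growth j (suc i) h = ℚₚ.≤-trans (*-mono (ℚₚ.<⇒≤ (ff>0 (i ℕ.+ j) h')) (fromℕ≥0 n) (ff-growth j i h')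
          (fromℕ-mono (ℕₚ.≤-trans (ℕₚ.m∸n≤m N' (i ℕ.+ j)) N'≤n))) (ℚₚ.≤-reflexive (ring (ff j) (nℚ ^ℚ i) nℚ))
        where
        h' = ℕₚ.≤-trans (ℕₚ.n≤1+n _) h
        ring : ∀ a b c → a * b * c ≡ a * (c * b)
        ring = solve-∀ ℚ-ring

      hits : List V → List V → Bool
      hits S c = tightP (S ++ c ++ e)

      -- By `connecting` and `distinct-density` at least c₀ n^ℓ chunks connect S to e and avoid `l`
      -- and `Q`; each of them has probability at least `ω l` / n^ℓ.
      chunk-hit : ∀ S l → length S ≡ s → ℓ ℕ.+ length l ℕ.≤ N' → length (l ++ Q) ℕ.≤ M →
        c₀ * ω l ≤ℚ ∑ⁿ ℓ (λ c → ω (c ++ l) * 𝟙 (hits S c))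
      chunk-hit S l eS h |W| with distinct (l ++ Q) in dl
      ... | false = subst (_≤ℚ ∑ⁿ ℓ (λ c → ω (c ++ l) * 𝟙 (hits S c))) (sym (trans (cong (c₀ *_) (ℚₚ.*-zeroˡ (inv (ff (length l))))) (ℚₚ.*-zeroʳ c₀)))
          (subst (_≤ℚ ∑ⁿ ℓ (λ c → ω (c ++ l) * 𝟙 (hits S c))) (trans (∑ⁿ-const ℓ 0ℚ) (ℚₚ.*-zeroʳ (nℚ ^ℚ ℓ)))
            (∑ⁿ-mono ℓ (λ c ec → *-nonneg (ω≥0 (c ++ l) (subst (ℕ._≤ N') (sym (trans (Lₚ.length-++ c) (cong (ℕ._+ length l) ec))) h)) (𝟙≥0 (hits S c)))))
      ... | true = ℚₚ.≤-trans (ℚₚ.≤-reflexive (sym (trans (cong (i *_) (ring (nℚ ^ℚ ℓ) c₀ (inv (nℚ ^ℚ ℓ))))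
            (trans (cong (λ z → i * (z * c₀)) (*-inv 0<N)) (ring' i c₀)))))
          (ℚₚ.≤-trans (*-monoˡ (inv≥0 0<fl) (*-monoʳ (inv≥0 0<N) (distinct-density 0<n ℓ (l ++ Q) (λ x → 𝟙 (hits S x)) c₀ 1ℚ dl (λ x → 𝟙≥0 (hits S x)) (λ x → 𝟙≤1 (hits S x))
            (ℚₚ.≤-trans (*-monoʳ (nℚ^≥0 ℓ) 2c₀≤conn) (connecting s P D S e eS |e|))
            (subst (_≤ℚ c₀ * nℚ) (sym (ℚₚ.*-identityʳ _)) (ℚₚ.≤-trans (fromℕ-mono (ℕₚ.*-mono-≤ ℓ≤M (ℕₚ.+-mono-≤ ℓ≤M |W|))) M-small)))))
          (ℚₚ.≤-trans (ℚₚ.≤-reflexive (trans (ring'' i (∑ⁿ ℓ (λ c → 𝟙 (distinct (c ++ l ++ Q)) * 𝟙 (hits S c))) (inv (nℚ ^ℚ ℓ))) (sym (∑ⁿ-*ˡ ℓ (i * inv (nℚ ^ℚ ℓ)) (λ c → 𝟙 (distinct (c ++ l ++ Q)) * 𝟙 (hits S c))))))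
            (∑ⁿ-mono ℓ (λ c ec → subst (_≤ℚ ω (c ++ l) * 𝟙 (hits S c)) (ring''' (i * inv (nℚ ^ℚ ℓ)) (𝟙 (distinct (c ++ l ++ Q))) (𝟙 (hits S c)))
              (*-monoʳ (𝟙≥0 (hits S c)) (subst (λ z → 𝟙 (distinct z) * (i * inv (nℚ ^ℚ ℓ)) ≤ℚ ω (c ++ l)) (Lₚ.++-assoc c l Q)
                (*-monoˡ (𝟙≥0 (distinct ((c ++ l) ++ Q))) (subst₂ _≤ℚ_ (inv-mult 0<fl 0<N) (cong (inv ∘ ff) (sym (trans (Lₚ.length-++ c) (cong (ℕ._+ length l) ec))))
                  (inv-anti (ff>0 (ℓ ℕ.+ length l) h) (ff-growth (length l) ℓ h))))))))))
        where
        i = inv (ff (length l))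
        0<fl : 0ℚ < ff (length l)
        0<fl = ff>0 (length l) (ℕₚ.≤-trans (ℕₚ.m≤n+m (length l) ℓ) h)
        0<N : 0ℚ < nℚ ^ℚ ℓ
        0<N = ^ℚ-pos ℓ 0<nℚ
        ring : ∀ N c j → N * c * j ≡ N * j * c
        ring = solve-∀ ℚ-ring
        ring' : ∀ i c → i * (1ℚ * c) ≡ c * (1ℚ * i)
        ring' = solve-∀ ℚ-ring
        ring'' : ∀ i x j → i * (x * j) ≡ i * j * x
        ring'' = solve-∀ ℚ-ring
        ring''' : ∀ k a b → a * k * b ≡ k * (a * b)
        ring''' = solve-∀ ℚ-ring

      someHit : ℕ → List V → List V → Bool
      someHit zero S y = false
      someHit (suc i) S y = hits S (take ℓ y) ∨ someHit i S (drop ℓ y)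

      -- The chunks are exposed one after another, the earlier ones joining `l`; whatever they are,
      -- the next one misses with conditional probability at most 1 - c₀.
      all-miss : ∀ i S l → length S ≡ s → i ℕ.* ℓ ℕ.+ length l ℕ.≤ N' → i ℕ.* ℓ ℕ.+ length (l ++ Q) ℕ.≤ M →
        ∑ⁿ (i ℕ.* ℓ) (λ y → ω (y ++ l) * 𝟙 (not (someHit i S y))) ≤ℚ ((1ℚ - c₀) ^ℚ i) * ω l
      all-miss zero S l eS h |W| = ℚₚ.≤-reflexive (trans (ℚₚ.*-identityʳ (ω l)) (sym (ℚₚ.*-identityˡ (ω l))))
      all-miss (suc i) S l eS h |W| = ℚₚ.≤-trans (ℚₚ.≤-reflexive (trans (∑ⁿ-++ ℓ (i ℕ.* ℓ) (λ y → ω (y ++ l) * 𝟙 (not (someHit (suc i) S y)))) (∑ⁿ-cong ℓ (λ c ec → trans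
          (∑ⁿ-cong (i ℕ.* ℓ) (λ y _ → factor c ec y)) (∑ⁿ-*ˡ (i ℕ.* ℓ) (𝟙 (not (hits S c))) (λ y → ω (y ++ c ++ l) * 𝟙 (not (someHit i S y))))))))
        (ℚₚ.≤-trans (∑ⁿ-mono ℓ (λ c ec → *-monoˡ (𝟙≥0 (not (hits S c))) (all-miss i S (c ++ l) eS (room c ec) (room' c ec))))
        (ℚₚ.≤-trans (ℚₚ.≤-reflexive rewrite-sum) (*-monoˡ' (≤-by (ring₂ (ω l) c₀ (∑ⁿ ℓ (λ c → ω (c ++ l) * 𝟙 (hits S c)))) (diff≥0 (chunk-hit S l eS h₁ h₂))))))
        where
        K = (1ℚ - c₀) ^ℚ i
        0≤K : 0ℚ ≤ℚ K
        0≤K = ^ℚ-nonneg i (diff≥0 c₀≤1)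
        h₁ : ℓ ℕ.+ length l ℕ.≤ N'
        h₁ = ℕₚ.≤-trans (ℕₚ.+-monoˡ-≤ (length l) (ℕₚ.m≤m+n ℓ (i ℕ.* ℓ))) h
        h₂ : length (l ++ Q) ℕ.≤ M
        h₂ = ℕₚ.≤-trans (ℕₚ.m≤n+m (length (l ++ Q)) (ℓ ℕ.+ i ℕ.* ℓ)) |W|
        swap-sum : ∀ i' c x → c ℕ.+ i' ℕ.+ x ≡ i' ℕ.+ (c ℕ.+ x)
        swap-sum i' c x = trans (cong (ℕ._+ x) (ℕₚ.+-comm c i')) (ℕₚ.+-assoc i' c x)
        room : ∀ c → length c ≡ ℓ → i ℕ.* ℓ ℕ.+ length (c ++ l) ℕ.≤ N'
        room c ec = subst (ℕ._≤ N') (trans (swap-sum (i ℕ.* ℓ) ℓ (length l)) (cong (i ℕ.* ℓ ℕ.+_) (sym (trans (Lₚ.length-++ c) (cong (ℕ._+ length l) ec))))) h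
        room' : ∀ c → length c ≡ ℓ → i ℕ.* ℓ ℕ.+ length ((c ++ l) ++ Q) ℕ.≤ M
        room' c ec = subst (ℕ._≤ M) (trans (swap-sum (i ℕ.* ℓ) ℓ (length (l ++ Q))) (cong (i ℕ.* ℓ ℕ.+_)
          (sym (trans (cong length (Lₚ.++-assoc c l Q)) (trans (Lₚ.length-++ c) (cong (ℕ._+ length (l ++ Q)) ec)))))) |W|
        nor : ∀ a b → 𝟙 (not (a ∨ b)) ≡ 𝟙 (not a) * 𝟙 (not b)
        nor true b = sym (ℚₚ.*-zeroˡ (𝟙 (not b)))
        nor false b = sym (ℚₚ.*-identityˡ (𝟙 (not b)))
        ring₁ : ∀ w a b → w * (a * b) ≡ a * (w * b)
        ring₁ = solve-∀ ℚ-ring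
        drop-all : ∀ (U X : List V) → drop (length U) (U ++ X) ≡ X
        drop-all [] X = refl
        drop-all (u ∷ U) X = drop-all U X
        factor : ∀ c → length c ≡ ℓ → ∀ y → ω ((c ++ y) ++ l) * 𝟙 (not (someHit (suc i) S (c ++ y)))
          ≡ 𝟙 (not (hits S c)) * (ω (y ++ c ++ l) * 𝟙 (not (someHit i S y)))
        factor c ec y = trans (cong₂ _*_ (ω-↭ (↭-trans (Permₚ.++⁺ʳ l (Permₚ.++-comm c y)) (Perm.↭-reflexive (Lₚ.++-assoc y c l))))
            (trans (cong₂ (λ a b → 𝟙 (not (hits S a ∨ someHit i S b))) (trans (cong (λ j → take j (c ++ y)) (sym ec)) (take-all c y))
               (trans (cong (λ j → drop j (c ++ y)) (sym ec)) (drop-all c y))) (nor (hits S c) (someHit i S y))))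
          (ring₁ (ω (y ++ c ++ l)) (𝟙 (not (hits S c))) (𝟙 (not (someHit i S y))))
        ring₃ : ∀ h k w → (1ℚ - h) * (k * w) ≡ k * (w - w * h)
        ring₃ = solve-∀ ℚ-ring
        rewrite-sum : ∑ⁿ ℓ (λ c → 𝟙 (not (hits S c)) * (K * ω (c ++ l))) ≡ K * (ω l - ∑ⁿ ℓ (λ c → ω (c ++ l) * 𝟙 (hits S c)))
        rewrite-sum = trans (∑ⁿ-cong ℓ (λ c _ → trans (cong (_* (K * ω (c ++ l))) (𝟙-not (hits S c))) (ring₃ (𝟙 (hits S c)) K (ω (c ++ l)))))
          (trans (∑ⁿ-*ˡ ℓ K (λ c → ω (c ++ l) - ω (c ++ l) * 𝟙 (hits S c))) (cong (K *_) (trans (∑ⁿ-minus ℓ (λ c → ω (c ++ l)) (λ c → ω (c ++ l) * 𝟙 (hits S c)))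
            (cong (λ z → z - ∑ⁿ ℓ (λ c → ω (c ++ l) * 𝟙 (hits S c))) (ω-marginalⁿ ℓ l (subst (ℕ._≤ N') (ℕₚ.+-comm ℓ (length l)) h₁))))))
        ring₂ : ∀ w c x → (1ℚ - c) * w - (w - x) ≡ x - c * w
        ring₂ = solve-∀ ℚ-ring
        ring₄ : ∀ k c w → k * ((1ℚ - c) * w) ≡ (1ℚ - c) * k * w
        ring₄ = solve-∀ ℚ-ring
        *-monoˡ' : ∀ {x} → x ≤ℚ (1ℚ - c₀) * ω l → K * x ≤ℚ ((1ℚ - c₀) ^ℚ suc i) * ω l
        *-monoˡ' p = ℚₚ.≤-trans (*-monoˡ 0≤K p) (ℚₚ.≤-reflexive (ring₄ K c₀ (ω l)))

      module Base (qc : ℕ) (1≤m₀ : 1 ℕ.≤ qc ℕ.* ℓ) (room : qc ℕ.* ℓ ℕ.+ s ℕ.≤ N') (room' : qc ℕ.* ℓ ℕ.+ (s ℕ.+ length Q) ℕ.≤ M) where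

        m₀ : ℕ
        m₀ = qc ℕ.* ℓ

        success : List V → List V → Bool
        success S y = someHit qc S y ∧ all (not ∘ bad) y

        some-bad : ∀ y → 𝟙 (not (all (not ∘ bad) y)) ≤ℚ ∑ y (𝟙 ∘ bad)
        some-bad [] = ℚₚ.≤-refl
        some-bad (v ∷ y) with bad v
        ... | true = subst (_≤ℚ 1ℚ + ∑ y (𝟙 ∘ bad)) (ℚₚ.+-identityʳ 1ℚ) (ℚₚ.+-monoʳ-≤ 1ℚ (∑-nonneg y (λ v → 𝟙≥0 (bad v))))
        ... | false = subst (𝟙 (not (all (not ∘ bad) y)) ≤ℚ_) (sym (ℚₚ.+-identityˡ _)) (some-bad y)

        failure≤ : ∀ S y → 1ℚ - 𝟙 (success S y) ≤ℚ 𝟙 (not (someHit qc S y)) + ∑ y (𝟙 ∘ bad)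
        failure≤ S y = ℚₚ.≤-trans (or (someHit qc S y) (all (not ∘ bad) y)) (ℚₚ.+-monoʳ-≤ (𝟙 (not (someHit qc S y))) (some-bad y))
          where
          or : ∀ a b → 1ℚ - 𝟙 (a ∧ b) ≤ℚ 𝟙 (not a) + 𝟙 (not b)
          or true b = ℚₚ.≤-reflexive (trans (sym (𝟙-not b)) (sym (ℚₚ.+-identityˡ _)))
          or false b = subst (_≤ℚ 1ℚ + 𝟙 (not b)) (ℚₚ.+-identityʳ 1ℚ) (ℚₚ.+-monoʳ-≤ 1ℚ (𝟙≥0 (not b)))

        total-ω : ∑ⁿ s ω ≡ 1ℚ
        total-ω = trans (∑ⁿ-cong s (λ S _ → cong ω (sym (Lₚ.++-identityʳ S)))) (trans (ω-marginalⁿ s [] (ℕₚ.≤-trans (ℕₚ.m≤n+m s m₀) room)) ω-[])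

        -- Union bound: either all chunks miss, or one of the m₀ entries is bad, and each entry
        -- equals a given vertex with probability at most 1 / N'.
        failure : ∑ⁿ s (λ S → ∑ⁿ m₀ (λ y → ω (S ++ y) * (1ℚ - 𝟙 (success S y))))
          ≤ℚ ((1ℚ - c₀) ^ℚ qc) + fromℕ m₀ * (∑ Vs (𝟙 ∘ bad) * inv (fromℕ N'))
        failure = ℚₚ.≤-trans (∑ⁿ-mono s (λ S eS → ℚₚ.≤-trans (∑ⁿ-mono m₀ (λ y ey → ℚₚ.≤-trans (*-monoˡ (ω≥0 (S ++ y) (fits S y eS ey)) (failure≤ S y))
                (ℚₚ.≤-reflexive (trans (cong (_* (𝟙 (not (someHit qc S y)) + ∑ y (𝟙 ∘ bad))) (ω-↭ (Permₚ.++-comm S y))) (ℚₚ.*-distribˡ-+ (ω (y ++ S)) (𝟙 (not (someHit qc S y))) (∑ y (𝟙 ∘ bad)))))))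
              (ℚₚ.≤-trans (ℚₚ.≤-reflexive (∑ⁿ-+ m₀ (λ y → ω (y ++ S) * 𝟙 (not (someHit qc S y))) (λ y → ω (y ++ S) * ∑ y (𝟙 ∘ bad))))
                (ℚₚ.+-mono-≤ (all-miss qc S S eS (subst (λ z → m₀ ℕ.+ z ℕ.≤ N') (sym eS) room)
                   (subst (λ z → m₀ ℕ.+ z ℕ.≤ M) (sym (trans (Lₚ.length-++ S) (cong (ℕ._+ length Q) eS))) room')) (ℚₚ.≤-reflexive (bad-entry S eS))))))
          (ℚₚ.≤-trans (ℚₚ.≤-reflexive (∑ⁿ-+ s (λ S → ((1ℚ - c₀) ^ℚ qc) * ω S) (λ S → fromℕ m₀ * ∑ Vs (λ u → ω (u ∷ S) * 𝟙 (bad u)))))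
            (ℚₚ.+-mono-≤ (ℚₚ.≤-reflexive (trans (∑ⁿ-*ˡ s ((1ℚ - c₀) ^ℚ qc) ω) (trans (cong (((1ℚ - c₀) ^ℚ qc) *_) total-ω) (ℚₚ.*-identityʳ ((1ℚ - c₀) ^ℚ qc)))))
              (ℚₚ.≤-trans (ℚₚ.≤-reflexive (trans (∑ⁿ-*ˡ s (fromℕ m₀) (λ S → ∑ Vs (λ u → ω (u ∷ S) * 𝟙 (bad u)))) (cong (fromℕ m₀ *_) (trans (∑ⁿ-comm-∑ s Vs (λ u S → ω (u ∷ S) * 𝟙 (bad u)))
                 (∑-cong Vs (λ u → ∑ⁿ-*ʳ s (𝟙 (bad u)) (λ S → ω (u ∷ S))))))))
                (*-monoˡ (fromℕ≥0 m₀) (ℚₚ.≤-trans (∑-mono Vs (λ u → *-monoʳ (𝟙≥0 (bad u)) (single u)))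
                  (ℚₚ.≤-reflexive (trans (∑-*ˡ Vs (inv (fromℕ N')) (𝟙 ∘ bad)) (ℚₚ.*-comm (inv (fromℕ N')) (∑ Vs (𝟙 ∘ bad))))))))))
          where
          fits : ∀ S y → length S ≡ s → length y ≡ m₀ → length (S ++ y) ℕ.≤ N'
          fits S y eS ey = subst (ℕ._≤ N') (sym (trans (Lₚ.length-++ S) (trans (cong₂ ℕ._+_ eS ey) (ℕₚ.+-comm s m₀)))) room
          bad-entry : ∀ S → length S ≡ s → ∑ⁿ m₀ (λ y → ω (y ++ S) * ∑ y (𝟙 ∘ bad)) ≡ fromℕ m₀ * ∑ Vs (λ u → ω (u ∷ S) * 𝟙 (bad u))
          bad-entry S eS = go m₀ refl 1≤m₀
            where
            go : ∀ m → m ≡ m₀ → 1 ℕ.≤ m → ∑ⁿ m (λ y → ω (y ++ S) * ∑ y (𝟙 ∘ bad)) ≡ fromℕ m * ∑ Vs (λ u → ω (u ∷ S) * 𝟙 (bad u))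
            go (suc m) eq _ = ω-pick-one m S (𝟙 ∘ bad) (subst (ℕ._≤ N') (trans (ℕₚ.+-comm m₀ s) (cong₂ ℕ._+_ (sym eS) (sym eq))) room)
          single : ∀ u → ∑ⁿ s (λ S → ω (u ∷ S)) ≤ℚ inv (fromℕ N')
          single u = ℚₚ.≤-trans (ℚₚ.≤-reflexive (trans (∑ⁿ-cong s (λ S _ → ω-↭ (Permₚ.++-comm [ u ] S))) (ω-marginalⁿ s [ u ] (ℕₚ.≤-trans (ℕₚ.+-monoˡ-≤ s 1≤m₀) room))))
            (ℚₚ.≤-trans (*-monoʳ (inv≥0 (ff>0 1 1≤N')) (𝟙≤1 (distinct ([ u ] ++ Q)))) (ℚₚ.≤-reflexive (trans (ℚₚ.*-identityˡ _) (cong inv (ℚₚ.*-identityˡ (fromℕ N'))))))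
            where
            1≤N' : 1 ℕ.≤ N'
            1≤N' = ℕₚ.≤-trans 1≤m₀ (ℕₚ.≤-trans (ℕₚ.m≤m+n m₀ s) room)

  -- Closing the cycle

  module Completion (κ : ℕ) (P : List V → Bool) (P-↭ : ∀ {l l'} → l ↭ l' → P l ≡ P l')
    (a G b' : List V) (|a| : length a ≡ suc κ) (|b'| : length b' ≡ suc κ) (bad : V → Bool) (ℓ h : ℕ)
    (absorb : ∀ vs → length vs ≡ h ℕ.+ h → All (λ v → bad v ≡ false) vs →
      ∃ λ L → L ↭ vs ++ G × tight (suc (suc κ)) P (a ++ L) ≡ true × ∃ λ U → a ++ L ≡ U ++ b') where

    private
      s = suc κ
      tightP = tight (suc s) P
      open Walks P
      tight-↝ : ∀ {L L'} → L ≡ L' → tightP L ≡ true → tightP L' ≡ true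
      tight-↝ refl h = h

    Ham : List V → Bool
    Ham X = distinct X ∧ tightP (X ++ take s X)

    -- Between the two walks lie a connecting chunk, the end `a` of the absorbing path, the rest of
    -- that path with 2h vertices absorbed, and the second chunk.
    middle : ℕ
    middle = ℓ ℕ.+ ((s ℕ.+ ((h ℕ.+ h) ℕ.+ length G)) ℕ.+ ℓ)

    shift-length : ∀ x (S : List V) v → length (x ∷ S) ≡ s → length (S ++ [ v ]) ≡ s
    shift-length x S v e = trans (Lₚ.length-++ S) (trans (ℕₚ.+-comm (length S) 1) e)

    walk-tight : ∀ S vs → length S ≡ s → walk S vs ≡ true → tightP (S ++ vs) ≡ true
    walk-tight S [] e h = tight-↝ (sym (Lₚ.++-identityʳ S)) (tight-short (suc s) P S (ℕₚ.≤-reflexive (cong suc e)))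
    walk-tight S@(x ∷ S') (v ∷ vs) e h = let (h₁ , h₂) = ∧-true⁻ {P (v ∷ S)} h in
      tight-shift s P S v vs e (trans (P-↭ (Permₚ.++-comm S [ v ])) h₁) (walk-tight (S' ++ [ v ]) vs (shift-length x S' v e) h₂)

    end-suffix : ∀ S vs → length S ≡ s → ∃ λ U → S ++ vs ≡ U ++ endpoint S vs × length (endpoint S vs) ≡ s
    end-suffix S [] e = [] , Lₚ.++-identityʳ S , e
    end-suffix S@(x ∷ S') (v ∷ vs) e = let (U , p , q) = end-suffix (S' ++ [ v ]) vs (shift-length x S' v e) in
      x ∷ U , cong (x ∷_) (trans (sym (Lₚ.++-assoc S' [ v ] vs)) p) , q

    -- The cyclic order is S, v, c, a, L, reverse c', reverse w, the second walk being read
    -- backwards so that it returns to S. Successive pieces overlap in k - 1 vertices at the end of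
    -- the first walk, at `a`, at `b'` and at the end of the second walk, so four gluings give the
    -- unrolled cycle.
    complete-cycle : ∀ S v w c r c' r' y z → length S ≡ s → walk S v ≡ true → walk (reverse S) w ≡ true →
      y ↭ c ++ r → z ↭ c' ++ r' → length c ≡ ℓ → length c' ≡ ℓ → length r ≡ h → length r' ≡ h →
      All (λ v → bad v ≡ false) r → All (λ v → bad v ≡ false) r' →
      tightP (endpoint S v ++ c ++ a) ≡ true → tightP (endpoint (reverse S) w ++ c' ++ reverse b') ≡ true →
      distinct (((S ++ w ++ z) ++ v ++ y) ++ (G ++ a)) ≡ true →
      ∃ λ x → length x ≡ middle × Ham (S ++ v ++ x ++ reverse w) ≡ true
    complete-cycle S v w c r c' r' y z eS hv hw y↭ z↭ ec ec' er er' gr gr' t₂ t₄ dis = x , |x| , ∧-true dX (tight-↝ final Z₄)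
      where
      A = absorb (r ++ r') (trans (Lₚ.length-++ r) (cong₂ ℕ._+_ er er')) (Allₚ.++⁺ gr gr')
      L = proj₁ A
      L↭ = proj₁ (proj₂ A)
      t₃ = proj₁ (proj₂ (proj₂ A))
      U₃ = proj₁ (proj₂ (proj₂ (proj₂ A)))
      e₃ : a ++ L ≡ U₃ ++ b'
      e₃ = proj₂ (proj₂ (proj₂ (proj₂ A)))
      x = c ++ (a ++ L) ++ reverse c'
      |x| : length x ≡ middle
      |x| = trans (Lₚ.length-++ c) (cong₂ ℕ._+_ ec (trans (Lₚ.length-++ (a ++ L)) (cong₂ ℕ._+_
        (trans (Lₚ.length-++ a) (cong₂ ℕ._+_ |a| (trans (Permₚ.↭-length L↭) (trans (Lₚ.length-++ (r ++ r')) (cong (ℕ._+ length G) (trans (Lₚ.length-++ r) (cong₂ ℕ._+_ er er')))))))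
        (trans (Lₚ.length-reverse c') ec'))))
      rS = reverse S
      E₁ = end-suffix S v eS
      U = proj₁ E₁
      E = endpoint S v
      eU : S ++ v ≡ U ++ E
      eU = proj₁ (proj₂ E₁)
      |E| : length E ≡ s
      |E| = proj₂ (proj₂ E₁)
      erS : length rS ≡ s
      erS = trans (Lₚ.length-reverse S) eS
      E₂ = end-suffix rS w erS
      U' = proj₁ E₂
      E' = endpoint rS w
      eU' : rS ++ w ≡ U' ++ E'
      eU' = proj₁ (proj₂ E₂)
      |rE'| : length (reverse E') ≡ s
      |rE'| = trans (Lₚ.length-reverse E') (proj₂ (proj₂ E₂))
      s≤ : ∀ {l : List V} → length l ≡ s → suc s ℕ.≤ suc (length l)
      s≤ e = ℕₚ.≤-reflexive (cong suc (sym e))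
      rev-w-S : reverse w ++ S ≡ reverse E' ++ reverse U'
      rev-w-S = trans (cong (reverse w ++_) (sym (Lₚ.reverse-involutive S))) (trans (sym (Lₚ.reverse-++ rS w)) (trans (cong reverse eU') (Lₚ.reverse-++ U' E')))
      t₅ : tightP (reverse E' ++ reverse U') ≡ true
      t₅ = tight-↝ (trans (cong reverse eU') (Lₚ.reverse-++ U' E')) (tight-reverse s P P-↭ (rS ++ w) (walk-tight rS w erS hw))
      t₄' : tightP (b' ++ reverse c' ++ reverse E') ≡ true
      t₄' = tight-↝ (trans (Lₚ.reverse-++ E' (c' ++ reverse b')) (trans (cong (_++ reverse E') (trans (Lₚ.reverse-++ c' (reverse b')) (cong (_++ reverse c') (Lₚ.reverse-involutive b'))))
        (Lₚ.++-assoc b' (reverse c') (reverse E')))) (tight-reverse s P P-↭ (E' ++ c' ++ reverse b') t₄)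
      Z₁ : tightP (U ++ E ++ c ++ a) ≡ true
      Z₁ = tight-glue (suc s) P U E (c ++ a) (s≤ {E} |E|) (tight-↝ eU (walk-tight S v eS hv)) t₂
      Z₂ : tightP ((U ++ E ++ c) ++ a ++ L) ≡ true
      Z₂ = tight-glue (suc s) P (U ++ E ++ c) a L (s≤ {a} |a|)
        (tight-↝ (++-group₃ U E c a) Z₁) t₃
      Y = (U ++ E ++ c) ++ U₃
      Z₃ : tightP (Y ++ b' ++ reverse c' ++ reverse E') ≡ true
      Z₃ = tight-glue (suc s) P Y b' (reverse c' ++ reverse E') (s≤ {b'} |b'|)
        (tight-↝ (trans (cong ((U ++ E ++ c) ++_) e₃) (sym (Lₚ.++-assoc (U ++ E ++ c) U₃ b'))) Z₂) t₄'
      Z₄ : tightP ((Y ++ b' ++ reverse c') ++ reverse E' ++ reverse U') ≡ true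
      Z₄ = tight-glue (suc s) P (Y ++ b' ++ reverse c') (reverse E') (reverse U') (s≤ {reverse E'} |rE'|)
        (tight-↝ (++-group₃ Y b' (reverse c') (reverse E')) Z₃) t₅
      X = S ++ v ++ x ++ reverse w
      final : (Y ++ b' ++ reverse c') ++ reverse E' ++ reverse U' ≡ X ++ take s X
      final = trans (cong ((Y ++ b' ++ reverse c') ++_) (sym rev-w-S))
        (trans (regroup-left U E c U₃ b' (reverse c') (reverse w) S)
        (trans (cong₂ (λ p q → p ++ c ++ q ++ reverse c' ++ reverse w ++ S) (sym eU) (sym e₃))
        (trans (regroup-right S v c (a ++ L) (reverse c') (reverse w) S)
          (cong (X ++_) (sym (trans (cong (λ k → take k X) (sym eS)) (take-all S (v ++ x ++ reverse w))))))))
      X↭ : X ↭ ((S ++ w ++ z) ++ v ++ y) ++ (G ++ a)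
      X↭ = ↭-trans (Permₚ.++⁺ˡ S (Permₚ.++⁺ˡ v (Permₚ.++⁺ (Permₚ.++⁺ˡ c (Permₚ.++⁺ (Permₚ.++⁺ˡ a L↭) (Permₚ.↭-reverse c'))) (Permₚ.↭-reverse w))))
        (↭-trans (reorder S v c a r r' G c' (w))
          (Permₚ.++⁺ʳ (G ++ a) (Permₚ.++⁺ (Permₚ.++⁺ˡ S (Permₚ.++⁺ˡ w (↭-sym z↭))) (Permₚ.++⁺ˡ v (↭-sym y↭)))))
      dX : distinct X ≡ true
      dX = trans (distinct-↭ X↭) dis

  -- The count inside one large hypergraph

  module Assembly (κ : ℕ) (δ δ₁ : ℚ) (0<δ : 0ℚ < δ) (0<2δ-1 : 0ℚ < 2ℚ * δ - 1ℚ) (0<δ₁ : 0ℚ < δ₁) (δ₁≤1 : δ₁ ≤ℚ 1ℚ) (K : Constants κ δ δ₁)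
    (P : List V → Bool) (D : Connecting.Dirac δ 0<δ 0<2δ-1 (suc κ) P) where

    open Constants K hiding (few-bad)

    module _ (0<n : 0 ℕ.< n) (M-small : fromℕ (M ℕ.* (M ℕ.+ M)) ≤ℚ c₀ * nℚ) (large : M ℕ.+ (M ℕ.+ (m₀ ℕ.+ m₀)) ℕ.≤ n)
      (dense : (1ℚ - δ) * nℚ ≤ℚ c * (nℚ - fromℕ (M ℕ.+ s) - γ * nℚ)) where

      blockLength : ℕ
      blockLength = ℓ ℕ.+ (s ℕ.+ s)

      parts≤M : ∀ {x} → x ℕ.≤ m₀ ℕ.+ (s ℕ.+ |Q|max) → x ℕ.≤ M
      parts≤M p = ℕₚ.≤-trans (ℕₚ.≤-trans p (ℕₚ.m≤n+m _ blockLength)) M-bound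

      blockLength≤M : blockLength ℕ.≤ M
      blockLength≤M = ℕₚ.≤-trans (ℕₚ.m≤m+n blockLength _) M-bound

      ℓ≤M : ℓ ℕ.≤ M
      ℓ≤M = ℕₚ.≤-trans (ℕₚ.m≤m+n ℓ (s ℕ.+ s)) blockLength≤M

      M≤n : M ℕ.≤ n
      M≤n = ℕₚ.≤-trans (ℕₚ.m≤m+n M _) large

      s≤n : s ℕ.≤ n
      s≤n = ℕₚ.≤-trans (parts≤M (ℕₚ.≤-trans (ℕₚ.m≤m+n s |Q|max) (ℕₚ.m≤n+m _ m₀))) M≤n

      start = distinct-list n s s≤n
      a = proj₁ start
      |a| : length a ≡ s
      |a| = proj₁ (proj₂ start)

      module A = Connecting.Absorbing δ 0<δ 0<2δ-1 κ P D

      C : A.Chain 0<n M c₀ 0<c₀ c₀≤1 2c₀≤absorb 2c₀≤conn blockLength≤M M-small q g a a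
      C = A.chain 0<n M c₀ 0<c₀ c₀≤1 2c₀≤absorb 2c₀≤conn blockLength≤M M-small q g a a |a| (proj₂ (proj₂ start))
        (parts≤M (ℕₚ.≤-trans (ℕₚ.≤-reflexive (trans (cong (ℕ._+ g ℕ.* (q ℕ.* blockLength)) |a|) (ℕₚ.+-comm s _))) (ℕₚ.≤-trans (ℕₚ.m≤n+m |Q|max s) (ℕₚ.m≤n+m _ m₀))))

      open A.Chain C

      Q : List V
      Q = G ++ a

      |Q|≤ : length Q ℕ.≤ |Q|max
      |Q|≤ = ℕₚ.≤-trans (ℕₚ.≤-reflexive (trans (Lₚ.length-++ G) (cong (length G ℕ.+_) |a|))) (ℕₚ.+-monoˡ-≤ s |G|)

      |Q|≤M : length Q ℕ.≤ M
      |Q|≤M = parts≤M (ℕₚ.≤-trans |Q|≤ (ℕₚ.≤-trans (ℕₚ.m≤n+m |Q|max s) (ℕₚ.m≤n+m _ m₀)))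

      N' : ℕ
      N' = n ℕ.∸ length Q

      |Q|+N' : length Q ℕ.+ N' ≡ n
      |Q|+N' = ℕₚ.m+[n∸m]≡n (ℕₚ.≤-trans |Q|≤M M≤n)

      N'-large : M ℕ.+ (m₀ ℕ.+ m₀) ℕ.≤ N'
      N'-large = ℕₚ.+-cancelˡ-≤ M _ _ (ℕₚ.≤-trans large (ℕₚ.≤-trans (ℕₚ.≤-reflexive (sym |Q|+N')) (ℕₚ.+-monoˡ-≤ N' |Q|≤M)))

      open Sampling Q distinct-G N' |Q|+N'

      M≤N' : M ℕ.≤ N'
      M≤N' = ℕₚ.≤-trans (ℕₚ.m≤m+n M _) N'-large

      room : m₀ ℕ.+ s ℕ.≤ N'
      room = ℕₚ.≤-trans (parts≤M (ℕₚ.+-monoʳ-≤ m₀ (ℕₚ.m≤m+n s |Q|max))) M≤N'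

      room' : m₀ ℕ.+ (s ℕ.+ length Q) ℕ.≤ M
      room' = parts≤M (ℕₚ.+-monoʳ-≤ m₀ (ℕₚ.+-monoʳ-≤ s |Q|≤))

      module T₁ = Connecting.Target δ 0<δ 0<2δ-1 κ P D Q distinct-G N' |Q|+N' 0<n M c₀ 0<c₀ c₀≤1 2c₀≤conn ℓ≤M M-small a |a| bad
      module B₁ = T₁.Base (suc q₁) 1≤m₀ room room'
      -- The second walk runs against the orientation of the cycle, so it meets the far end of the
      -- absorbing path in reverse.
      module T₂ = Connecting.Target δ 0<δ 0<2δ-1 κ P D Q distinct-G N' |Q|+N' 0<n M c₀ 0<c₀ c₀≤1 2c₀≤conn ℓ≤M M-small (reverse b') (trans (Lₚ.length-reverse b') |b'|) bad
      module B₂ = T₂.Base (suc q₁) 1≤m₀ room room'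

      0<N' : 0ℚ < fromℕ N'
      0<N' = fromℕ-pos ((ℕₚ.≤-trans 1≤m₀ (ℕₚ.≤-trans (ℕₚ.m≤m+n m₀ s) room)))

      n≤2N' : nℚ * inv (fromℕ N') ≤ℚ 2ℚ
      n≤2N' = ℚₚ.≤-trans (*-monoʳ (inv≥0 0<N') (subst (nℚ ≤ℚ_) (trans (fromℕ-+ N' N') (ring (fromℕ N')))
          (fromℕ-mono {n} {N' ℕ.+ N'} (subst (ℕ._≤ N' ℕ.+ N') |Q|+N' (ℕₚ.+-monoˡ-≤ N' (ℕₚ.≤-trans |Q|≤M M≤N'))))))
        (ℚₚ.≤-reflexive (trans (ℚₚ.*-assoc 2ℚ (fromℕ N') (inv (fromℕ N'))) (trans (cong (2ℚ *_) (*-inv 0<N')) (ℚₚ.*-identityʳ 2ℚ))))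
        where
        ring : ∀ x → x + x ≡ (1ℚ + 1ℚ) * x
        ring = solve-∀ ℚ-ring

      failure≤ : ((1ℚ - c₀) ^ℚ suc q₁) + fromℕ m₀ * (∑ Vs (𝟙 ∘ bad) * inv (fromℕ N')) ≤ℚ 1/16
      failure≤ = ℚₚ.≤-trans (ℚₚ.+-mono-≤ few-misses (ℚₚ.≤-trans (*-monoˡ (fromℕ≥0 m₀) (ℚₚ.≤-trans (*-monoʳ (inv≥0 0<N') few-bad)
          (ℚₚ.≤-trans (ℚₚ.≤-reflexive (ring (fromℕ g) ((1ℚ - c₀) ^ℚ q) nℚ (inv (fromℕ N'))))
            (*-monoˡ (*-nonneg (fromℕ≥0 g) (^ℚ-nonneg q (diff≥0 c₀≤1))) n≤2N')))) (Constants.few-bad K)))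
        (from-yes (1/32 + 1/32 ℚₚ.≤? 1/16))
        where
        ring : ∀ g x n i → g * (x * n) * i ≡ g * x * (n * i)
        ring = solve-∀ ℚ-ring

      0<⅛ : 0ℚ < ⅛
      0<⅛ = from-yes (0ℚ ℚₚ.<? ⅛)

      p-small : ∀ j → 2ℚ * (fromℕ (suc j ℕ.+ m₀) * tailBound (suc j ℕ.+ m₀)) ≤ℚ inv (fromℕ (j ℕ.+ m₀)) - inv (fromℕ (suc j ℕ.+ m₀))
      p-small j = ℚₚ.≤-reflexive (trans (ring (fromℕ (suc j ℕ.+ m₀)) (inv (2ℚ * fromℕ (suc j ℕ.+ m₀))) (inv (fromℕ (j ℕ.+ m₀)) - inv (fromℕ (suc j ℕ.+ m₀))))
        (trans (cong (_* (inv (fromℕ (j ℕ.+ m₀)) - inv (fromℕ (suc j ℕ.+ m₀)))) (*-inv {2ℚ * fromℕ (suc j ℕ.+ m₀)} (*-pos {2ℚ} (+-pos 0<1 0≤1) (fromℕ>0 (j ℕ.+ m₀))))) (ℚₚ.*-identityˡ _)))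
        where
        ring : ∀ m i x → (1ℚ + 1ℚ) * (m * (i * x)) ≡ (1ℚ + 1ℚ) * m * i * x
        ring = solve-∀ ℚ-ring

      open Connecting.Dirac D

      -- The marked vertices are the non-neighbours of `S`, at most (1 - δ) n. The slack of c over 1
      -- - δ compensates for the vertices lost to `Q` and for the s + `tailSize m` that the moment
      -- method exposes.
      tail : ∀ m S → m₀ ℕ.< m → length S ≡ s → κ ℕ.+ (m ℕ.+ m) ℕ.≤ N' →
        ∑ⁿ m (λ y → ω (y ++ S) * 𝟙 (Climb.overfull Q distinct-G N' |Q|+N' κ P P-↭ m₀ d r d≥1 d≤r r+d ⅛ 0<⅛ tailBound m S y)) ≤ℚ tailBound m * ω S
      tail m S m₀<m eS room-m = ℚₚ.≤-trans (Tail.tail-bound (λ v → not (P (v ∷ S))) c (s ℕ.+ tailSize m) 0≤c (ℕₚ.≤-trans (ℕₚ.+-monoʳ-≤ s (tailSize≤m m)) s+m≤N') sparse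
          m (suc (d m)) (tailSize m) θ S (subst (λ z → z ℕ.+ m ℕ.≤ N') (sym eS) s+m≤N') (ℕₚ.≤-reflexive (cong (ℕ._+ tailSize m) eS)) (tailSize≤d m) 0≤θ (tail-ratio m))
        (*-monoʳ (ω≥0 S (ℕₚ.≤-trans (ℕₚ.≤-reflexive eS) (ℕₚ.≤-trans (ℕₚ.m≤m+n s m) s+m≤N'))) (tail-small m m₀<m))
        where
        s+m≤N' : s ℕ.+ m ℕ.≤ N'
        s+m≤N' = ℕₚ.≤-trans (ℕₚ.≤-reflexive (sym (ℕₚ.+-suc κ m))) (ℕₚ.≤-trans (ℕₚ.+-monoʳ-≤ κ (ℕₚ.+-monoˡ-≤ m (ℕₚ.≤-trans (ℕ.s≤s ℕ.z≤n) m₀<m))) room-m)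
        m≤n : m ℕ.≤ n
        m≤n = ℕₚ.≤-trans (ℕₚ.m≤n+m m s) (ℕₚ.≤-trans s+m≤N' (ℕₚ.m∸n≤m n (length Q)))
        non-edges : ∑ Vs (λ v → 𝟙 (not (P (v ∷ S)))) ≤ℚ (1ℚ - δ) * nℚ
        non-edges = ℚₚ.≤-trans (ℚₚ.≤-reflexive (trans (∑-cong Vs (λ v → 𝟙-not (P (v ∷ S)))) (trans (∑-minus Vs (λ _ → 1ℚ) (λ v → 𝟙 (P (v ∷ S)))) (cong (λ z → z - ∑ Vs (λ v → 𝟙 (P (v ∷ S)))) ∑Vs-1))))
          (≤-by (ring nℚ δ (∑ Vs (λ v → 𝟙 (P (v ∷ S))))) (diff≥0 (codegree S eS)))
          where
          ring : ∀ n δ x → (1ℚ - δ) * n - (n - x) ≡ x - δ * n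
          ring = solve-∀ ℚ-ring
        sparse : ∀ i → i ℕ.< s ℕ.+ tailSize m → ∑ Vs (λ v → 𝟙 (not (P (v ∷ S)))) ≤ℚ c * fromℕ (N' ℕ.∸ i)
        sparse i i< = ℚₚ.≤-trans non-edges (ℚₚ.≤-trans dense (*-monoˡ 0≤c (ℚₚ.≤-trans (≤-by (trans (cong (λ z → nℚ - z - (nℚ - fromℕ (M ℕ.+ s) - γ * nℚ)) (trans (fromℕ-+ (length Q) i) refl))
               (trans (ring nℚ (fromℕ (length Q)) (fromℕ i) (fromℕ (M ℕ.+ s)) (γ * nℚ)) refl)) missing)
            (subst (λ z → nℚ - fromℕ (length Q ℕ.+ i) ≤ℚ fromℕ z) (sym (ℕₚ.∸-+-assoc n (length Q) i)) (∸-fromℕ n (length Q ℕ.+ i))))))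
          where
          ring : ∀ n q i M g → n - (q + i) - (n - M - g) ≡ M + g - (q + i)
          ring = solve-∀ ℚ-ring
          ring₂ : ∀ M s t → M + s + t ≡ M + (s + t)
          ring₂ = solve-∀ ℚ-ring
          missing : 0ℚ ≤ℚ fromℕ (M ℕ.+ s) + γ * nℚ - (fromℕ (length Q) + fromℕ i)
          missing = diff≥0 (ℚₚ.≤-trans (ℚₚ.+-mono-≤ (fromℕ-mono |Q|≤M) (ℚₚ.≤-trans (fromℕ-mono (ℕₚ.<⇒≤ i<)) (ℚₚ.≤-trans (ℚₚ.≤-reflexive (fromℕ-+ s (tailSize m)))
              (ℚₚ.+-monoʳ-≤ (fromℕ s) (ℚₚ.≤-trans (tailSize≤γm m) (*-monoˡ 0≤γ (fromℕ-mono m≤n)))))))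
            (ℚₚ.≤-reflexive (trans (sym (ring₂ (fromℕ M) (fromℕ s) (γ * nℚ))) (cong (_+ γ * nℚ) (sym (fromℕ-+ M s))))))

      -- An even split is forced: by `half₁` and `half₂` each side has to fit twice.
      split = balanced (N' ℕ.∸ s)
      m₁ = proj₁ split
      m₂ = proj₁ (proj₂ split)
      m₁+m₂ : m₁ ℕ.+ m₂ ≡ N' ℕ.∸ s
      m₁+m₂ = proj₁ (proj₂ (proj₂ split))
      m₁≤m₂ : m₁ ℕ.≤ m₂
      m₁≤m₂ = proj₁ (proj₂ (proj₂ (proj₂ split)))
      m₂≤1+m₁ : m₂ ℕ.≤ suc m₁
      m₂≤1+m₁ = proj₂ (proj₂ (proj₂ (proj₂ split)))

      s+m₁+m₂ : s ℕ.+ (m₁ ℕ.+ m₂) ≡ N'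
      s+m₁+m₂ = trans (cong (s ℕ.+_) m₁+m₂) (ℕₚ.m+[n∸m]≡n (ℕₚ.≤-trans (ℕₚ.m≤n+m s m₀) room))

      m₀≤m₁ : m₀ ℕ.≤ m₁
      m₀≤m₁ = ℕₚ.≮⇒≥ λ m₁<m₀ → ℕₚ.<⇒≱ {m₁ ℕ.+ m₂} {m₀ ℕ.+ m₀} (ℕₚ.+-mono-<-≤ m₁<m₀ (ℕₚ.≤-trans m₂≤1+m₁ m₁<m₀))
        (ℕₚ.+-cancelˡ-≤ s _ _ (ℕₚ.≤-trans (ℕₚ.+-monoˡ-≤ (m₀ ℕ.+ m₀) (parts≤M (ℕₚ.≤-trans (ℕₚ.m≤m+n s |Q|max) (ℕₚ.m≤n+m _ m₀))))
          (ℕₚ.≤-trans N'-large (ℕₚ.≤-reflexive (sym s+m₁+m₂)))))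

      j₁ j₂ : ℕ
      j₁ = m₁ ℕ.∸ m₀
      j₂ = m₂ ℕ.∸ m₀

      j₁+m₀ : j₁ ℕ.+ m₀ ≡ m₁
      j₁+m₀ = ℕₚ.m∸n+n≡m m₀≤m₁
      j₂+m₀ : j₂ ℕ.+ m₀ ≡ m₂
      j₂+m₀ = ℕₚ.m∸n+n≡m (ℕₚ.≤-trans m₀≤m₁ m₁≤m₂)

      size : s ℕ.+ ((j₁ ℕ.+ m₀) ℕ.+ (j₂ ℕ.+ m₀)) ≡ N'
      size = trans (cong₂ (λ x y → s ℕ.+ (x ℕ.+ y)) j₁+m₀ j₂+m₀) s+m₁+m₂

      half₁ : κ ℕ.+ ((j₁ ℕ.+ m₀) ℕ.+ (j₁ ℕ.+ m₀)) ℕ.≤ N'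
      half₁ = ℕₚ.≤-trans (ℕₚ.≤-reflexive (cong (λ x → κ ℕ.+ (x ℕ.+ x)) j₁+m₀)) (ℕₚ.≤-trans (ℕₚ.+-mono-≤ (ℕₚ.n≤1+n κ) (ℕₚ.+-monoʳ-≤ m₁ m₁≤m₂)) (ℕₚ.≤-reflexive s+m₁+m₂))

      half₂ : κ ℕ.+ ((j₂ ℕ.+ m₀) ℕ.+ (j₂ ℕ.+ m₀)) ℕ.≤ N'
      half₂ = ℕₚ.≤-trans (ℕₚ.≤-reflexive (cong (λ x → κ ℕ.+ (x ℕ.+ x)) j₂+m₀)) (ℕₚ.≤-trans (ℕₚ.+-monoʳ-≤ κ (ℕₚ.+-monoˡ-≤ m₂ m₂≤1+m₁))
        (ℕₚ.≤-reflexive (trans (ℕₚ.+-suc κ (m₁ ℕ.+ m₂)) s+m₁+m₂)))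

      -- Origin of the fractions: 1/8 for lam, 1/16 for the failures and 1/16 for 1 / m₀ add up to
      -- the permitted 1/4.
      small : 2ℚ * (2ℚ * (⅛ + (1/16 + inv (fromℕ m₀)))) ≤ℚ 1ℚ
      small = ℚₚ.≤-trans (*-monoˡ 0≤2 (*-monoˡ 0≤2 (ℚₚ.+-monoʳ-≤ ⅛ (ℚₚ.+-monoʳ-≤ 1/16 m₀-large)))) (from-yes (2ℚ * (2ℚ * (⅛ + (1/16 + 1/16))) ℚₚ.≤? 1ℚ))
        where
        0≤2 : 0ℚ ≤ℚ 2ℚ
        0≤2 = ℚₚ.<⇒≤ (+-pos 0<1 0≤1)

      module Y = Climb.Side.Cycles Q distinct-G N' |Q|+N' κ P P-↭ m₀ d r d≥1 d≤r r+d ⅛ 0<⅛ tailBound 1≤m₀ p-small tail B₁.success B₂.success 1/16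
        (ℚₚ.≤-trans B₁.failure failure≤) (ℚₚ.≤-trans B₂.failure failure≤) j₁ j₂ size half₁ half₂ small

      module Z = Completion κ P P-↭ a G b' |a| |b'| bad ℓ h absorb

      open Walks P

      good-after : ∀ {y c r} → y ↭ c ++ r → All (λ v → bad v ≡ false) y → All (λ v → bad v ≡ false) r
      good-after {c = c} p h = Allₚ.++⁻ʳ c (Permₚ.All-resp-↭ p h)

      all-good : ∀ y → all (not ∘ bad) y ≡ true → All (λ v → bad v ≡ false) y
      all-good [] h = []
      all-good (v ∷ y) h = let (h₁ , h₂) = ∧-true⁻ {not (bad v)} h in
        trans (sym (Boolₚ.not-involutive (bad v))) (cong not h₁) ∷ all-good y h₂

      complete : ∀ S w z v y → length S ≡ s → length w ≡ j₂ → length z ≡ m₀ → length v ≡ j₁ → length y ≡ m₀ →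
        distinct (((S ++ w ++ z) ++ v ++ y) ++ Q) ≡ true → walk S v ∧ B₁.success (endpoint S v) y ≡ true → walk (reverse S) w ∧ B₂.success (endpoint (reverse S) w) z ≡ true →
        ∃ λ x → length x ≡ Z.middle × Z.Ham (S ++ v ++ x ++ reverse w) ≡ true
      complete S w z v y eS ew ez ev ey dis h₁ h₂ =
        let (hv , hs) = ∧-true⁻ {walk S v} h₁
            (hit , good) = ∧-true⁻ {T₁.someHit (suc q₁) (endpoint S v) y} hs
            (hw , hs') = ∧-true⁻ {walk (reverse S) w} h₂
            (hit' , good') = ∧-true⁻ {T₂.someHit (suc q₁) (endpoint (reverse S) w) z} hs'
            (c , r , p , ec , er , hc) = someHit-chunk ℓ (T₁.hits (endpoint S v)) (λ i → T₁.someHit i (endpoint S v)) (λ _ → refl) (λ _ _ → refl) q₁ y ey hit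
            (c' , r' , p' , ec' , er' , hc') = someHit-chunk ℓ (T₂.hits (endpoint (reverse S) w)) (λ i → T₂.someHit i (endpoint (reverse S) w)) (λ _ → refl) (λ _ _ → refl) q₁ z ez hit'
        in Z.complete-cycle S v w c r c' r' y z eS hv hw p p' ec ec' er er' (good-after {y} {c} {r} p (all-good y good)) (good-after {z} {c'} {r'} p' (all-good z good')) hc hc' dis

      module X = Y.Counting Z.middle Z.Ham complete

      lengths : s ℕ.+ (j₁ ℕ.+ (Z.middle ℕ.+ j₂)) ≡ n
      lengths = trans (arith s j₁ j₂ ℓ h (length G)) (trans (cong₂ ℕ._+_ (trans (cong (length G ℕ.+_) (sym |a|)) (sym (Lₚ.length-++ G))) size) |Q|+N')
        where
        arith : ∀ s j₁ j₂ ℓ h G → s ℕ.+ (j₁ ℕ.+ ((ℓ ℕ.+ ((s ℕ.+ ((h ℕ.+ h) ℕ.+ G)) ℕ.+ ℓ)) ℕ.+ j₂)) ≡ (G ℕ.+ s) ℕ.+ (s ℕ.+ ((j₁ ℕ.+ (ℓ ℕ.+ h)) ℕ.+ (j₂ ℕ.+ (ℓ ℕ.+ h))))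
        arith = ℕ-Solver.solve-∀

      ff-! : ∀ i j → i ℕ.+ j ≡ N' → fromℕ (N' !) ≡ ff i * fromℕ (j !)
      ff-! zero j refl = sym (ℚₚ.*-identityˡ _)
      ff-! (suc i) j e = trans (ff-! i (suc j) (trans (ℕₚ.+-suc i j) e)) (trans (cong (ff i *_) (fromℕ-* (suc j) (j !)))
        (trans (sym (ℚₚ.*-assoc (ff i) (fromℕ (suc j)) (fromℕ (j !)))) (cong (λ m → ff i * fromℕ m * fromℕ (j !)) (sym (trans (cong (ℕ._∸ i) (trans (sym e) (sym (ℕₚ.+-suc i j)))) (ℕₚ.m+n∸m≡n i (suc j)))))))

      n!≤ : fromℕ (n !) ≤ℚ ff N' * (nℚ ^ℚ M)
      n!≤ = ℚₚ.≤-trans (subst (λ z → fromℕ (z !) ≤ℚ fromℕ (N' !) * (nℚ ^ℚ length Q)) |Q|+N' (factorial-growth (length Q) N' n (ℕₚ.≤-reflexive |Q|+N')))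
        (subst (λ z → z * (nℚ ^ℚ length Q) ≤ℚ ff N' * (nℚ ^ℚ M)) (sym (trans (ff-! N' 0 (ℕₚ.+-identityʳ N')) (trans (cong (ff N' *_) fromℕ-1) (ℚₚ.*-identityʳ (ff N')))))
          (*-monoˡ (ℚₚ.<⇒≤ (ff>0 N' ℕₚ.≤-refl)) (^ℚ-increasing (fromℕ≥1 0<n) |Q|≤M)))

      coef : ℕ → ℚ
      coef = Climb.Side.coef Q distinct-G N' |Q|+N' κ P P-↭ m₀ d r d≥1 d≤r r+d ⅛ 0<⅛ tailBound 1≤m₀ p-small tail

      -- Each factor m / r(m) is at most 1 / δ₁.
      coef≤ : ∀ j → coef j * (δ₁ ^ℚ j) ≤ℚ 1ℚ
      coef≤ zero = ℚₚ.≤-reflexive (ℚₚ.*-identityˡ 1ℚ)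
      coef≤ (suc j) = ℚₚ.≤-trans (ℚₚ.≤-reflexive (ring (fromℕ m) (inv (fromℕ (r m))) (coef j) δ₁ (δ₁ ^ℚ j)))
        (ℚₚ.≤-trans (*-mono (*-nonneg (*-nonneg (ℚₚ.<⇒≤ 0<δ₁) (fromℕ≥0 m)) (inv≥0 0<r)) 0≤1 (ℚₚ.≤-trans (*-monoʳ (inv≥0 0<r) (r-large m)) (ℚₚ.≤-reflexive (*-inv 0<r))) (coef≤ j))
          (ℚₚ.≤-reflexive (ℚₚ.*-identityˡ 1ℚ)))
        where
        m = suc j ℕ.+ m₀
        0<r : 0ℚ < fromℕ (r m)
        0<r = ℚₚ.<-≤-trans (*-pos 0<δ₁ (fromℕ>0 (j ℕ.+ m₀))) (r-large m)
        ring : ∀ m i c x y → m * i * c * (x * y) ≡ x * m * i * (c * y)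
        ring = solve-∀ ℚ-ring

      -- ⅛ * ⅛ is lam² from `count`; n^(m₀ + m₀) pays for the forgotten end pieces and n^M for
      -- replacing N'! by n!. The walks have j₁ + j₂ ≤ n steps, and δ₁ ≤ 1 allows the exponent n.
      many-cycles : ⅛ * ⅛ * fromℕ (n !) * (δ₁ ^ℚ n) ≤ℚ 2ℚ * (nℚ ^ℚ (m₀ ℕ.+ m₀ ℕ.+ M)) * ∑ⁿ n (𝟙 ∘ Z.Ham)
      many-cycles = ℚₚ.≤-trans (*-mono (*-nonneg (ℚₚ.<⇒≤ (*-pos 0<⅛ 0<⅛)) (fromℕ≥0 (n !))) (^ℚ-nonneg (j₁ ℕ.+ j₂) (ℚₚ.<⇒≤ 0<δ₁))
            (*-monoˡ (ℚₚ.<⇒≤ (*-pos 0<⅛ 0<⅛)) n!≤) (^ℚ-decreasing (ℚₚ.<⇒≤ 0<δ₁) δ₁≤1 j₁+j₂≤n))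
        (ℚₚ.≤-trans (ℚₚ.≤-reflexive (ring₁ ⅛ (ff N') (nℚ ^ℚ M) (δ₁ ^ℚ (j₁ ℕ.+ j₂))))
        (ℚₚ.≤-trans (*-monoʳ (*-nonneg (nℚ^≥0 M) (^ℚ-nonneg (j₁ ℕ.+ j₂) (ℚₚ.<⇒≤ 0<δ₁))) X.count)
        (ℚₚ.≤-trans (ℚₚ.≤-reflexive (trans (cong (λ z → 2ℚ * (coef j₁ * coef j₂) * (N * N * X.orderings) * ((nℚ ^ℚ M) * z)) (^ℚ-+ δ₁ j₁ j₂))
            (ring₂ (coef j₁) (coef j₂) N X.orderings (nℚ ^ℚ M) (δ₁ ^ℚ j₁) (δ₁ ^ℚ j₂))))
          (ℚₚ.≤-trans (*-monoˡ 0≤rest (*-mono (*-nonneg (Y.coef≥0 j₁) (^ℚ-nonneg j₁ (ℚₚ.<⇒≤ 0<δ₁))) 0≤1 (coef≤ j₁) (coef≤ j₂)))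
            (ℚₚ.≤-reflexive (trans (ring₃ N (nℚ ^ℚ M) X.orderings) (cong₂ (λ x y → 2ℚ * x * y) (sym (trans (^ℚ-+ nℚ (m₀ ℕ.+ m₀) M) (cong (_* (nℚ ^ℚ M)) (^ℚ-+ nℚ m₀ m₀))))
              (cong (λ z → ∑ⁿ z (𝟙 ∘ Z.Ham)) lengths))))))))
        where
        N = nℚ ^ℚ m₀
        j₁+j₂≤n : j₁ ℕ.+ j₂ ℕ.≤ n
        j₁+j₂≤n = ℕₚ.≤-trans (ℕₚ.+-mono-≤ (ℕₚ.m∸n≤m m₁ m₀) (ℕₚ.m∸n≤m m₂ m₀)) (ℕₚ.≤-trans (ℕₚ.m≤n+m _ s) (ℕₚ.≤-trans (ℕₚ.≤-reflexive s+m₁+m₂) (ℕₚ.m∸n≤m n (length Q))))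
        0≤rest : 0ℚ ≤ℚ 2ℚ * (N * N * (nℚ ^ℚ M) * X.orderings)
        0≤rest = *-nonneg (ℚₚ.<⇒≤ (+-pos 0<1 0≤1)) (*-nonneg (*-nonneg (*-nonneg (nℚ^≥0 m₀) (nℚ^≥0 m₀)) (nℚ^≥0 M)) (∑ⁿ-nonneg (s ℕ.+ (j₁ ℕ.+ (Z.middle ℕ.+ j₂))) (λ x → 𝟙≥0 (Z.Ham x))))
        ring₁ : ∀ l f N x → l * l * (f * N) * x ≡ l * l * f * (N * x)
        ring₁ = solve-∀ ℚ-ring
        ring₂ : ∀ a b N o M x y → (1ℚ + 1ℚ) * (a * b) * (N * N * o) * (M * (x * y)) ≡ (1ℚ + 1ℚ) * (N * N * M * o) * (a * x * (b * y))
        ring₂ = solve-∀ ℚ-ring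
        ring₃ : ∀ N M o → (1ℚ + 1ℚ) * (N * N * M * o) * (1ℚ * 1ℚ) ≡ (1ℚ + 1ℚ) * (N * N * M) * o
        ring₃ = solve-∀ ℚ-ring

-- Growth estimates

bernoulli : ∀ D {h} → 0ℚ ≤ℚ h → h ≤ℚ 1ℚ → 1ℚ - fromℕ D * h ≤ℚ (1ℚ - h) ^ℚ D
bernoulli zero {h} p q = ℚₚ.≤-reflexive (trans (cong (λ t → 1ℚ - t * h) fromℕ-0) (ring h))
  where
  ring : ∀ h → 1ℚ - 0ℚ * h ≡ 1ℚ
  ring = solve-∀ ℚ-ring
bernoulli (suc D) {h} p q = ℚₚ.≤-trans (≤-by (trans (cong (λ t → (1ℚ - h) * (1ℚ - fromℕ D * h) - (1ℚ - t * h)) (fromℕ-suc D)) (ring (fromℕ D) h)) (*-nonneg (fromℕ≥0 D) (*-nonneg p p)))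
    (*-monoˡ (diff≥0 q) (bernoulli D p q))
  where
  ring : ∀ D h → (1ℚ - h) * (1ℚ - D * h) - (1ℚ - (1ℚ + D) * h) ≡ D * (h * h)
  ring = solve-∀ ℚ-ring

-- The left side is the probability of at most one success in j + 1 independent trials of
-- probability h.
linear-decay : ∀ j {h} → 0ℚ ≤ℚ h → h ≤ℚ 1ℚ → fromℕ (suc j) * ((1ℚ - h) ^ℚ j) * h + ((1ℚ - h) ^ℚ suc j) ≤ℚ 1ℚ
linear-decay zero {h} p q = ℚₚ.≤-reflexive (trans (cong (λ t → t * 1ℚ * h + (1ℚ - h) * 1ℚ) fromℕ-1) (ring h))
  where
  ring : ∀ h → 1ℚ * 1ℚ * h + (1ℚ - h) * 1ℚ ≡ 1ℚ
  ring = solve-∀ ℚ-ring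
linear-decay (suc j) {h} p q = ℚₚ.≤-trans (ℚₚ.≤-reflexive (trans (cong (λ t → t * z' * h + (1ℚ - h) * z') (fromℕ-suc (suc j))) (ring (fromℕ (suc j)) ((1ℚ - h) ^ℚ j) h)))
    (ℚₚ.≤-trans (ℚₚ.+-mono-≤ (*-monoˡ (diff≥0 q) (linear-decay j p q)) (*-monoˡ p (^ℚ-≤1 (suc j) (diff≥0 q) (≤-by (ring′ h) p)))) (ℚₚ.≤-reflexive (ring″ h)))
  where
  z' = (1ℚ - h) ^ℚ suc j
  ring : ∀ t z h → (1ℚ + t) * ((1ℚ - h) * z) * h + (1ℚ - h) * ((1ℚ - h) * z) ≡ (1ℚ - h) * (t * z * h + (1ℚ - h) * z) + h * ((1ℚ - h) * z)
  ring = solve-∀ ℚ-ring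
  ring′ : ∀ h → 1ℚ - (1ℚ - h) ≡ h
  ring′ = solve-∀ ℚ-ring
  ring″ : ∀ h → (1ℚ - h) * 1ℚ + h * 1ℚ ≡ 1ℚ
  ring″ = solve-∀ ℚ-ring

1^ℚ : ∀ j → 1ℚ ^ℚ j ≡ 1ℚ
1^ℚ zero = refl
1^ℚ (suc j) = trans (ℚₚ.*-identityˡ _) (1^ℚ j)

^ℚ-swap : ∀ z a j → (z ^ℚ a) ^ℚ j ≡ (z ^ℚ j) ^ℚ a
^ℚ-swap z zero j = 1^ℚ j
^ℚ-swap z (suc a) j = trans (^ℚ-distrib z (z ^ℚ a) j) (cong ((z ^ℚ j) *_) (^ℚ-swap z a j))

-- If x = (1 − h)^(D+1) up to Bernoulli's inequality, then (j+1)^(D+1) x^j ≤ ((j+1)(1 − h)^j)^(D+1) is bounded.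
decay : ∀ D K x → 0ℚ ≤ℚ K → 0ℚ ≤ℚ x → x < 1ℚ → ∃ λ j₀ → ∀ j → j₀ ℕ.≤ j → K * (fromℕ (suc j) ^ℚ D) * (x ^ℚ j) ≤ℚ 1ℚ
decay D K x 0≤K 0≤x x<1 = j₀ , λ j j₀≤j → *-cancelˡ (fromℕ>0 j) (ℚₚ.≤-trans (bounded j)
    (ℚₚ.≤-trans (proj₂ (archimedean (K * (inv h ^ℚ suc D)))) (ℚₚ.≤-trans (fromℕ-mono (ℕₚ.≤-trans j₀≤j (ℕₚ.n≤1+n j))) (ℚₚ.≤-reflexive (sym (ℚₚ.*-identityʳ _))))))
  where
  i = inv (fromℕ (suc D))
  h = (1ℚ - x) * i
  0<h : 0ℚ < h
  0<h = *-pos (diff>0 x<1) (inv>0 (fromℕ>0 D))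
  i≤1 : i ≤ℚ 1ℚ
  i≤1 = subst (i ≤ℚ_) inv-1 (inv-anti 0<1 (fromℕ≥1 {suc D} (ℕ.s≤s ℕ.z≤n)))
  h≤1 : h ≤ℚ 1ℚ
  h≤1 = ℚₚ.≤-trans (*-mono (diff≥0 (ℚₚ.<⇒≤ x<1)) 0≤1 (≤-by (ring x) 0≤x) i≤1) (ℚₚ.≤-reflexive (ℚₚ.*-identityˡ 1ℚ))
    where
    ring : ∀ x → 1ℚ - (1ℚ - x) ≡ x
    ring = solve-∀ ℚ-ring
  z = 1ℚ - h
  0≤z : 0ℚ ≤ℚ z
  0≤z = diff≥0 h≤1
  x≤z^ : x ≤ℚ z ^ℚ suc D
  x≤z^ = subst (_≤ℚ z ^ℚ suc D) (trans (cong (λ w → 1ℚ - w) (trans (ring (fromℕ (suc D)) (1ℚ - x) i) (trans (cong ((1ℚ - x) *_) (*-inv (fromℕ>0 D))) (ℚₚ.*-identityʳ (1ℚ - x))))) (ring′ x)) (bernoulli (suc D) (ℚₚ.<⇒≤ 0<h) h≤1)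
    where
    ring : ∀ d y i → d * (y * i) ≡ y * (d * i)
    ring = solve-∀ ℚ-ring
    ring′ : ∀ x → 1ℚ - (1ℚ - x) ≡ x
    ring′ = solve-∀ ℚ-ring
  j₀ = proj₁ (archimedean (K * (inv h ^ℚ suc D)))
  linear : ∀ j → fromℕ (suc j) * (z ^ℚ j) ≤ℚ inv h
  linear j = *-cancelˡ 0<h (ℚₚ.≤-trans (≤-by (ring h (fromℕ (suc j) * (z ^ℚ j)) (z ^ℚ suc j)) (^ℚ-nonneg (suc j) 0≤z)) (ℚₚ.≤-trans (linear-decay j (ℚₚ.<⇒≤ 0<h) h≤1) (ℚₚ.≤-reflexive (sym (*-inv 0<h)))))
    where
    ring : ∀ h y w → y * h + w - h * y ≡ w
    ring = solve-∀ ℚ-ring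
  bounded : ∀ j → fromℕ (suc j) * (K * (fromℕ (suc j) ^ℚ D) * (x ^ℚ j)) ≤ℚ K * (inv h ^ℚ suc D)
  bounded j = ℚₚ.≤-trans (ℚₚ.≤-reflexive (ring (fromℕ (suc j)) K (fromℕ (suc j) ^ℚ D) (x ^ℚ j))) (*-monoˡ 0≤K
    (ℚₚ.≤-trans (*-monoˡ (^ℚ-nonneg (suc D) (fromℕ≥0 (suc j))) (^ℚ-mono j 0≤x x≤z^))
      (ℚₚ.≤-trans (ℚₚ.≤-reflexive (trans (cong ((fromℕ (suc j) ^ℚ suc D) *_) (^ℚ-swap z (suc D) j)) (sym (^ℚ-distrib (fromℕ (suc j)) (z ^ℚ j) (suc D)))))
        (^ℚ-mono (suc D) (*-nonneg (fromℕ≥0 (suc j)) (^ℚ-nonneg j 0≤z)) (linear j)))))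
    where
    ring : ∀ y k p q → y * (k * p * q) ≡ k * (y * p * q)
    ring = solve-∀ ℚ-ring

power-decay : ∀ K x → 0ℚ ≤ℚ K → 0ℚ ≤ℚ x → x < 1ℚ → ∃ λ j₀ → ∀ j → j₀ ℕ.≤ j → K * (x ^ℚ j) ≤ℚ 1ℚ
power-decay K x 0≤K 0≤x x<1 = let (j₀ , f) = decay 0 K x 0≤K 0≤x x<1 in j₀ , λ j p → subst (λ k → k * (x ^ℚ j) ≤ℚ 1ℚ) (ℚₚ.*-identityʳ K) (f j p)

floor : ∀ q → 0ℚ ≤ℚ q → ∃ λ k → fromℕ k ≤ℚ q × q < fromℕ (suc k)
floor q 0≤q = let (m , q≤m) = archimedean q in
    search m (ℚₚ.≤-<-trans q≤m (subst₂ _<_ (ℚₚ.+-identityˡ (fromℕ m)) (sym (fromℕ-suc m)) (ℚₚ.+-monoˡ-< (fromℕ m) 0<1)))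
  where
  search : ∀ m → q < fromℕ (suc m) → ∃ λ k → fromℕ k ≤ℚ q × q < fromℕ (suc k)
  search zero q< = zero , subst (_≤ℚ q) (sym fromℕ-0) 0≤q , q<
  search (suc m) q< with q ℚ.<? fromℕ (suc m)
  ... | yes q<′ = search m q<′
  ... | no q≮ = suc m , ℚₚ.≮⇒≥ q≮ , q<

fraction : ∀ a d → fromℕ (suc d) * ((ℤ.+ a) ℚ./ suc d) ≡ fromℕ a
fraction a d = trans (cong (_* ((ℤ.+ a) ℚ./ suc d)) (fromℕ≡toℚ (suc d))) (trans (ℚₚ.toℚᵘ-injective (ℚᵘₚ.≃-trans (ℚₚ.toℚᵘ-homo-* (toℚ (suc d)) ((ℤ.+ a) ℚ./ suc d))
  (ℚᵘₚ.≃-trans (ℚᵘₚ.*-cong (ℚₚ.toℚᵘ-fromℚᵘ (mkℚᵘ (ℤ.+ suc d) 0)) (ℚₚ.toℚᵘ-fromℚᵘ (mkℚᵘ (ℤ.+ a) d)))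
  (ℚᵘₚ.≃-trans (ℚᵘ.*≡* (trans (ℤₚ.*-identityʳ (ℤ.+ suc d ℤ.* ℤ.+ a)) (trans (ℤₚ.*-comm (ℤ.+ suc d) (ℤ.+ a)) (cong (λ e → ℤ.+ a ℤ.* ℤ.+ suc e) (sym (ℕₚ.+-identityʳ d))))))
    (ℚᵘₚ.≃-sym (ℚₚ.toℚᵘ-fromℚᵘ (mkℚᵘ (ℤ.+ a) 0))))))) (sym (fromℕ≡toℚ a)))

interleavedLength≥1 : ∀ s L → 1 ℕ.≤ interleavedLength s L
interleavedLength≥1 s zero = ℕ.s≤s ℕ.z≤n
interleavedLength≥1 s (suc L) = ℕ.s≤s ℕ.z≤n

-- Choice of the constants

record Eventually (R : ℕ → Set) : Set where
  constructor eventually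
  field
    threshold : ℕ
    beyond : ∀ n → threshold ℕ.≤ n → R n

open Eventually public

linear-growth : ∀ {a} X → 0ℚ < a → Eventually (λ n → X ≤ℚ a * fromℕ n)
linear-growth {a} X 0<a = eventually (proj₁ (archimedean (inv a * X))) λ n h → subst (_≤ℚ a * fromℕ n)
  (trans (sym (ℚₚ.*-assoc a (inv a) X)) (trans (cong (_* X) (*-inv 0<a)) (ℚₚ.*-identityˡ X)))
  (*-monoˡ (ℚₚ.<⇒≤ 0<a) (ℚₚ.≤-trans (proj₂ (archimedean (inv a * X))) (fromℕ-mono h)))

module Construct (κ : ℕ) (δ δ₁ : ℚ) (δ≤1 : δ ≤ℚ 1ℚ) (0<2δ-1 : 0ℚ < 2ℚ * δ - 1ℚ) (0<δ : 0ℚ < δ)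
  (1≤2δ₁ : 1ℚ ≤ℚ 2ℚ * δ₁) (δ₁<δ : δ₁ < δ) where

  s ℓ : ℕ
  s = suc κ
  ℓ = connLength s

  -- Of the gap δ − δ₁ = 8e, the codegree deficit c uses 2e and the tail exponent γ uses e.
  e c₁ w c θ : ℚ
  e = (δ - δ₁) * ⅛
  c₁ = (1ℚ - δ) + 8e
    where 8e = (1ℚ + 1ℚ) * ((1ℚ + 1ℚ) * ((1ℚ + 1ℚ) * e))
  w = c₁ - e
  c = (1ℚ - δ) + (1ℚ + 1ℚ) * e
  θ = c * inv w

  0<e : 0ℚ < e
  0<e = *-pos (diff>0 δ₁<δ) (from-yes (0ℚ ℚₚ.<? ⅛))

  0≤1-δ : 0ℚ ≤ℚ 1ℚ - δ
  0≤1-δ = diff≥0 δ≤1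

  c₁≡ : c₁ ≡ 1ℚ - δ₁
  c₁≡ = trans (ring δ δ₁ ⅛) (trans (cong (λ u → (1ℚ - δ) + u * (δ - δ₁)) {(1ℚ + 1ℚ) * ((1ℚ + 1ℚ) * ((1ℚ + 1ℚ) * ⅛))} {1ℚ} refl) (ring′ δ δ₁))
    where
    ring : ∀ δ δ₁ u → (1ℚ - δ) + (1ℚ + 1ℚ) * ((1ℚ + 1ℚ) * ((1ℚ + 1ℚ) * ((δ - δ₁) * u))) ≡ (1ℚ - δ) + ((1ℚ + 1ℚ) * ((1ℚ + 1ℚ) * ((1ℚ + 1ℚ) * u))) * (δ - δ₁)
    ring = solve-∀ ℚ-ring
    ring′ : ∀ δ δ₁ → (1ℚ - δ) + 1ℚ * (δ - δ₁) ≡ 1ℚ - δ₁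
    ring′ = solve-∀ ℚ-ring

  0≤e : 0ℚ ≤ℚ e
  0≤e = ℚₚ.<⇒≤ 0<e

  e≤c₁ : e ≤ℚ c₁
  e≤c₁ = ≤-by (ring (1ℚ - δ) e) (+-nonneg 0≤1-δ (+-nonneg (+-nonneg (+-nonneg 0≤e 0≤e) (+-nonneg 0≤e 0≤e)) (+-nonneg (+-nonneg 0≤e 0≤e) 0≤e)))
    where
    ring : ∀ b e → b + (1ℚ + 1ℚ) * ((1ℚ + 1ℚ) * ((1ℚ + 1ℚ) * e)) - e ≡ b + (((e + e) + (e + e)) + ((e + e) + e))
    ring = solve-∀ ℚ-ring

  0<c₁ : 0ℚ < c₁
  0<c₁ = ℚₚ.<-≤-trans 0<e e≤c₁

  0≤c : 0ℚ ≤ℚ c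
  0≤c = +-nonneg 0≤1-δ (*-nonneg (+-nonneg 0≤1 0≤1) 0≤e)

  c<w : c < w
  c<w = <-by (ring (1ℚ - δ) e) (+-pos (+-pos 0<e 0≤e) (+-nonneg 0≤e (+-nonneg 0≤e 0≤e)))
    where
    ring : ∀ b e → b + (1ℚ + 1ℚ) * ((1ℚ + 1ℚ) * ((1ℚ + 1ℚ) * e)) - e - (b + (1ℚ + 1ℚ) * e) ≡ (e + e) + (e + (e + e))
    ring = solve-∀ ℚ-ring

  0<w : 0ℚ < w
  0<w = ℚₚ.≤-<-trans 0≤c c<w

  0≤θ : 0ℚ ≤ℚ θ
  0≤θ = *-nonneg 0≤c (inv≥0 0<w)

  θw : θ * w ≡ c
  θw = trans (ring c (inv w) w) (trans (cong (c *_) (*-inv 0<w)) (ℚₚ.*-identityʳ c))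
    where
    ring : ∀ c i w → c * i * w ≡ c * (w * i)
    ring = solve-∀ ℚ-ring

  θ<1 : θ < 1ℚ
  θ<1 = ℚₚ.≰⇒> λ 1≤θ → ℚₚ.<-irrefl refl (ℚₚ.<-≤-trans c<w (subst₂ _≤ℚ_ (ℚₚ.*-identityˡ w) θw (*-monoʳ (ℚₚ.<⇒≤ 0<w) 1≤θ)))

  c₁≤½ : c₁ + c₁ ≤ℚ 1ℚ
  c₁≤½ = subst (λ x → x + x ≤ℚ 1ℚ) (sym c₁≡) (≤-by (ring δ₁) (diff≥0 1≤2δ₁))
    where
    ring : ∀ x → 1ℚ - ((1ℚ - x) + (1ℚ - x)) ≡ (1ℚ + 1ℚ) * x - 1ℚ
    ring = solve-∀ ℚ-ring

  c₁≤1 : c₁ ≤ℚ 1ℚ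
  c₁≤1 = ℚₚ.≤-trans (subst (_≤ℚ c₁ + c₁) (ℚₚ.+-identityʳ c₁) (ℚₚ.+-monoʳ-≤ c₁ (ℚₚ.<⇒≤ 0<c₁))) c₁≤½

  c≤1 : c ≤ℚ 1ℚ
  c≤1 = ℚₚ.≤-trans (ℚₚ.<⇒≤ c<w) (ℚₚ.≤-trans (≤-by (ring c₁ e) 0≤e) c₁≤1)
    where
    ring : ∀ c e → c - (c - e) ≡ e
    ring = solve-∀ ℚ-ring

  floor-d : ∀ m → ∃ λ k → fromℕ k ≤ℚ c₁ * fromℕ m × c₁ * fromℕ m < fromℕ (suc k)
  floor-d m = floor (c₁ * fromℕ m) (*-nonneg (ℚₚ.<⇒≤ 0<c₁) (fromℕ≥0 m))

  floor-tail : ∀ m → ∃ λ k → fromℕ k ≤ℚ e * fromℕ m × e * fromℕ m < fromℕ (suc k)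
  floor-tail m = floor (e * fromℕ m) (*-nonneg 0≤e (fromℕ≥0 m))

  -- `d m` is (1 - δ₁) m rounded down, so its successor, the first count regarded as too many,
  -- exceeds (1 - δ₁) m, while `r m` is at least δ₁ m.
  d r tailSize : ℕ → ℕ
  d m = proj₁ (floor-d m)
  r m = m ℕ.∸ d m
  tailSize m = proj₁ (floor-tail m)

  d≤ : ∀ m → fromℕ (d m) ≤ℚ c₁ * fromℕ m
  d≤ m = proj₁ (proj₂ (floor-d m))
  d> : ∀ m → c₁ * fromℕ m < fromℕ (suc (d m))
  d> m = proj₂ (proj₂ (floor-d m))
  tailSize≤ : ∀ m → fromℕ (tailSize m) ≤ℚ e * fromℕ m
  tailSize≤ m = proj₁ (proj₂ (floor-tail m))
  tailSize> : ∀ m → e * fromℕ m < fromℕ (suc (tailSize m))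
  tailSize> m = proj₂ (proj₂ (floor-tail m))

  fromℕ-cancel-< : ∀ {a b} → fromℕ a < fromℕ b → a ℕ.< b
  fromℕ-cancel-< {a} {b} h = ℕₚ.≰⇒> λ b≤a → ℚₚ.<-irrefl refl (ℚₚ.<-≤-trans h (fromℕ-mono b≤a))

  d≤m : ∀ m → d m ℕ.≤ m
  d≤m m = fromℕ-cancel-≤ (ℚₚ.≤-trans (d≤ m) (ℚₚ.≤-trans (*-monoʳ (fromℕ≥0 m) c₁≤1) (ℚₚ.≤-reflexive (ℚₚ.*-identityˡ (fromℕ m)))))

  d≤r : ∀ m → d m ℕ.≤ r m
  d≤r m = ℕₚ.m+n≤o⇒m≤o∸n (d m) (fromℕ-cancel-≤ (ℚₚ.≤-trans (ℚₚ.≤-reflexive (fromℕ-+ (d m) (d m))) (ℚₚ.≤-trans (ℚₚ.+-mono-≤ (d≤ m) (d≤ m))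
    (ℚₚ.≤-trans (ℚₚ.≤-reflexive (sym (ℚₚ.*-distribʳ-+ (fromℕ m) c₁ c₁))) (ℚₚ.≤-trans (*-monoʳ (fromℕ≥0 m) c₁≤½) (ℚₚ.≤-reflexive (ℚₚ.*-identityˡ (fromℕ m))))))))

  r-large : ∀ m → δ₁ * fromℕ m ≤ℚ fromℕ (r m)
  r-large m = ℚₚ.≤-trans (≤-by (ring (fromℕ m) (fromℕ (d m)) δ₁) (diff≥0 (subst (λ x → fromℕ (d m) ≤ℚ x * fromℕ m) c₁≡ (d≤ m)))) (∸-fromℕ m (d m))
    where
    ring : ∀ m d x → m - d - x * m ≡ (1ℚ - x) * m - d
    ring = solve-∀ ℚ-ring

  tailSize≤d : ∀ m → tailSize m ℕ.≤ d m
  tailSize≤d m = ℕₚ.≤-pred (fromℕ-cancel-< {tailSize m} {suc (d m)} (ℚₚ.≤-<-trans (tailSize≤ m) (ℚₚ.≤-<-trans (*-monoʳ (fromℕ≥0 m) e≤c₁) (d> m))))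

  -- θ is the quotient of c and c₁ - e: the threshold `suc (d m)` exceeds c₁ m, and the order of the
  -- moment is at most e m.
  tail-ratio : ∀ m → fromℕ m * c ≤ℚ θ * fromℕ (suc (d m) ℕ.∸ tailSize m)
  tail-ratio m = ℚₚ.≤-trans (ℚₚ.≤-reflexive (trans (cong (fromℕ m *_) (sym θw)) (ring (fromℕ m) θ c₁ e))) (*-monoˡ 0≤θ
      (ℚₚ.≤-trans (≤-by (ring′ (fromℕ (suc (d m))) (fromℕ (tailSize m)) (c₁ * fromℕ m) (e * fromℕ m)) (+-nonneg (diff≥0 (ℚₚ.<⇒≤ (d> m))) (diff≥0 (tailSize≤ m))))
        (∸-fromℕ (suc (d m)) (tailSize m))))
    where
    ring : ∀ m t c e → m * (t * (c - e)) ≡ t * (c * m - e * m)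
    ring = solve-∀ ℚ-ring
    ring′ : ∀ d t x y → d - t - (x - y) ≡ (d - x) + (y - t)
    ring′ = solve-∀ ℚ-ring

  d≥1 : Eventually (λ m → 1 ℕ.≤ d m)
  d≥1 = eventually (threshold G) λ m h → ℕₚ.≤-pred (fromℕ-cancel-< {1} {suc (d m)} (ℚₚ.≤-<-trans (beyond G m h) (d> m)))
    where
    G = linear-growth (fromℕ 1) 0<c₁

  cube : ℚ → ℚ
  cube x = x * (x * (x * 1ℚ))

  -- `tailBound (suc m)` is at least 1 / (2 (m + 1)³), whereas the order of the moment grows
  -- linearly and θ < 1, so the power of θ decays exponentially.
  tail-small : Eventually (λ m → θ ^ℚ tailSize (suc m) ≤ℚ tailBound (suc m))
  tail-small = eventually (suc (threshold G)) λ m h → small m h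
    where
    K = 2ℚ * cube (inv e)
    0≤K : 0ℚ ≤ℚ K
    0≤K = *-nonneg (+-nonneg 0≤1 0≤1) (^ℚ-nonneg 3 (inv≥0 0<e))
    D = decay 3 K θ 0≤K 0≤θ θ<1
    G = linear-growth (fromℕ (proj₁ D)) 0<e
    small : ∀ m → suc (threshold G) ℕ.≤ m → θ ^ℚ tailSize (suc m) ≤ℚ tailBound (suc m)
    small zero ()
    small m@(suc m') h = ℚₚ.≤-trans (*-cancelˡ 0<2m³ (ℚₚ.≤-trans bound (ℚₚ.≤-reflexive (sym unit)))) (*-monoˡ (inv≥0 0<2M)
        (ℚₚ.≤-trans (*-monoʳ (inv≥0 0<M) (inv-anti (fromℕ>0 m') (fromℕ-mono (ℕₚ.n≤1+n m)))) (ℚₚ.≤-reflexive telescope)))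
      where
      M = fromℕ (suc m)
      j = tailSize (suc m)
      0<M : 0ℚ < M
      0<M = fromℕ>0 m
      0<2M : 0ℚ < 2ℚ * M
      0<2M = *-pos {2ℚ} (+-pos 0<1 0≤1) 0<M
      0<2m³ : 0ℚ < 2ℚ * cube M
      0<2m³ = *-pos {2ℚ} (+-pos 0<1 0≤1) (^ℚ-pos 3 0<M)
      M≤ : M ≤ℚ inv e * fromℕ (suc j)
      M≤ = subst (_≤ℚ inv e * fromℕ (suc j)) (trans (sym (ℚₚ.*-assoc (inv e) e M)) (trans (cong (_* M) (trans (ℚₚ.*-comm (inv e) e) (*-inv 0<e))) (ℚₚ.*-identityˡ M)))
        (*-monoˡ (inv≥0 0<e) (ℚₚ.<⇒≤ (tailSize> (suc m))))
      j-large : proj₁ D ℕ.≤ j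
      j-large = ℕₚ.≤-pred (fromℕ-cancel-< {proj₁ D} {suc j} (ℚₚ.≤-<-trans (beyond G (suc m) (ℕₚ.≤-trans (ℕₚ.n≤1+n _) (ℕₚ.≤-trans h (ℕₚ.n≤1+n m)))) (tailSize> (suc m))))
      bound : 2ℚ * cube M * (θ ^ℚ j) ≤ℚ 1ℚ
      bound = ℚₚ.≤-trans (*-monoʳ (^ℚ-nonneg j 0≤θ) (ℚₚ.≤-trans (*-monoˡ (+-nonneg 0≤1 0≤1) (^ℚ-mono 3 (ℚₚ.<⇒≤ 0<M) M≤))
          (ℚₚ.≤-reflexive (trans (cong (2ℚ *_) (^ℚ-distrib (inv e) (fromℕ (suc j)) 3)) (sym (ℚₚ.*-assoc 2ℚ (cube (inv e)) (cube (fromℕ (suc j)))))))))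
        (proj₂ D j j-large)
      unit : 2ℚ * cube M * (inv (2ℚ * M) * (inv M * inv M)) ≡ 1ℚ
      unit = trans (ring M (inv (2ℚ * M)) (inv M)) (trans (cong₂ (λ x y → x * (y * y)) (*-inv 0<2M) (*-inv 0<M)) refl)
        where
        ring : ∀ M a b → (1ℚ + 1ℚ) * (M * (M * (M * 1ℚ))) * (a * (b * b)) ≡ (1ℚ + 1ℚ) * M * a * ((M * b) * (M * b))
        ring = solve-∀ ℚ-ring
      telescope : inv (fromℕ m) * inv M ≡ inv (fromℕ m) - inv M
      telescope = *-cancelˡ-≡ {fromℕ m * M} (*-pos (fromℕ>0 m') 0<M) (trans (ring (fromℕ m) M (inv (fromℕ m)) (inv M))
          (trans (cong₂ _*_ (*-inv (fromℕ>0 m')) (*-inv 0<M)) (sym (trans (ring′ (fromℕ m) M (inv (fromℕ m)) (inv M))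
            (trans (cong₂ (λ x y → x * M - fromℕ m * y) (*-inv (fromℕ>0 m')) (*-inv 0<M)) (trans (cong (λ t → 1ℚ * t - fromℕ m * 1ℚ) (fromℕ-suc m)) (ring″ (fromℕ m))))))))
        where
        ring : ∀ m M a b → m * M * (a * b) ≡ (m * a) * (M * b)
        ring = solve-∀ ℚ-ring
        ring′ : ∀ m M a b → m * M * (a - b) ≡ m * a * M - m * (M * b)
        ring′ = solve-∀ ℚ-ring
        ring″ : ∀ m → 1ℚ * (1ℚ + m) - m * 1ℚ ≡ 1ℚ * 1ℚ
        ring″ = solve-∀ ℚ-ring

⊓-pos : ∀ {x y} → 0ℚ < x → 0ℚ < y → 0ℚ < x ⊓ y
⊓-pos {x} {y} p q with ℚₚ.⊓-sel x y
... | inj₁ e = subst (0ℚ <_) (sym e) p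
... | inj₂ e = subst (0ℚ <_) (sym e) q

≤1/32 : ∀ {x} → fromℕ 32 * x ≤ℚ 1ℚ → x ≤ℚ 1/32
≤1/32 h = *-cancelˡ {fromℕ 32} (fromℕ>0 31) (ℚₚ.≤-trans h (ℚₚ.≤-reflexive (sym (cong (_* 1/32) (fromℕ≡toℚ 32)))))

module Parameters (κ : ℕ) (δ δ₁ : ℚ) (δ≤1 : δ ≤ℚ 1ℚ) (0<2δ-1 : 0ℚ < 2ℚ * δ - 1ℚ) (0<δ : 0ℚ < δ)
  (1≤2δ₁ : 1ℚ ≤ℚ 2ℚ * δ₁) (δ₁<δ : δ₁ < δ) where

  open Construct κ δ δ₁ δ≤1 0<2δ-1 0<δ 1≤2δ₁ δ₁<δ

  -- The ½ reserves half of each density for sequences that repeat an entry or hit forbidden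
  -- vertices.
  densities c₀ : ℚ
  densities = ((2ℚ * δ - 1ℚ) ^ℚ (s ℕ.+ s)) ⊓ connDensity δ s
  c₀ = ½ * (1ℚ ⊓ densities)

  2c₀ : 2ℚ * c₀ ≡ 1ℚ ⊓ densities
  2c₀ = trans (sym (ℚₚ.*-assoc 2ℚ ½ (1ℚ ⊓ densities))) (ℚₚ.*-identityˡ (1ℚ ⊓ densities))

  0<c₀ : 0ℚ < c₀
  0<c₀ = *-pos {½} (from-yes (0ℚ ℚₚ.<? ½)) (⊓-pos 0<1 (⊓-pos (^ℚ-pos (s ℕ.+ s) 0<2δ-1) (Graph.Connecting.connDensity>0 0 δ 0<δ 0<2δ-1 s)))

  2c₀≤1 : 2ℚ * c₀ ≤ℚ 1ℚ
  2c₀≤1 = subst (_≤ℚ 1ℚ) (sym 2c₀) (ℚₚ.p⊓q≤p 1ℚ densities)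

  2c₀≤both : 2ℚ * c₀ ≤ℚ densities
  2c₀≤both = subst (_≤ℚ densities) (sym 2c₀) (ℚₚ.p⊓q≤q 1ℚ densities)

  c₀≤1 : c₀ ≤ℚ 1ℚ
  c₀≤1 = ℚₚ.≤-trans (≤-by (ring c₀) (ℚₚ.<⇒≤ 0<c₀)) 2c₀≤1
    where
    ring : ∀ c → (1ℚ + 1ℚ) * c - c ≡ c
    ring = solve-∀ ℚ-ring

  miss = 1ℚ - c₀

  miss<1 : miss < 1ℚ
  miss<1 = <-by (ring c₀) 0<c₀
    where
    ring : ∀ c → 1ℚ - (1ℚ - c) ≡ c
    ring = solve-∀ ℚ-ring

  misses : ∃ λ j₀ → ∀ j → j₀ ℕ.≤ j → fromℕ 32 * (miss ^ℚ j) ≤ℚ 1ℚ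
  misses = power-decay (fromℕ 32) miss (fromℕ≥0 32) (diff≥0 c₀≤1) miss<1

  -- The order of choice matters: q₁ comes first and fixes m₀ and the number g of vertices to
  -- absorb; only then is q taken so large that g groups leave few bad vertices, and M is formed
  -- last. The 16 in `lower` makes 1 / m₀ at most 1/16.
  lower q₁ m₀ g : ℕ
  lower = threshold d≥1 ℕ.+ (threshold tail-small ℕ.+ 16)
  q₁ = lower ℕ.+ proj₁ misses
  m₀ = suc q₁ ℕ.* ℓ
  g = q₁ ℕ.* ℓ ℕ.+ q₁ ℕ.* ℓ

  lower≤m₀ : lower ℕ.≤ m₀
  lower≤m₀ = ℕₚ.≤-trans (ℕₚ.m≤m+n lower (proj₁ misses)) (ℕₚ.≤-trans (ℕₚ.n≤1+n q₁)
    (ℕₚ.≤-trans (ℕₚ.≤-reflexive (sym (ℕₚ.*-identityʳ (suc q₁)))) (ℕₚ.*-monoʳ-≤ (suc q₁) (interleavedLength≥1 κ (connLength κ)))))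

  16≤m₀ : 16 ℕ.≤ m₀
  16≤m₀ = ℕₚ.≤-trans (ℕₚ.≤-trans (ℕₚ.m≤n+m 16 (threshold tail-small)) (ℕₚ.m≤n+m _ (threshold d≥1))) lower≤m₀

  bads : ∃ λ j₀ → ∀ j → j₀ ℕ.≤ j → fromℕ 32 * (fromℕ m₀ * (fromℕ g * 2ℚ)) * (miss ^ℚ j) ≤ℚ 1ℚ
  bads = power-decay (fromℕ 32 * (fromℕ m₀ * (fromℕ g * 2ℚ))) miss (*-nonneg (fromℕ≥0 32) (*-nonneg (fromℕ≥0 m₀) (*-nonneg (fromℕ≥0 g) (from-yes (0ℚ ℚₚ.≤? 2ℚ))))) (diff≥0 c₀≤1) miss<1

  constants : Constants κ δ δ₁
  constants = record
    { c₀ = c₀ ; 0<c₀ = 0<c₀ ; c₀≤1 = c₀≤1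
    ; 2c₀≤absorb = ℚₚ.≤-trans 2c₀≤both (ℚₚ.p⊓q≤p ((2ℚ * δ - 1ℚ) ^ℚ (s ℕ.+ s)) (connDensity δ s))
    ; 2c₀≤conn = ℚₚ.≤-trans 2c₀≤both (ℚₚ.p⊓q≤q ((2ℚ * δ - 1ℚ) ^ℚ (s ℕ.+ s)) (connDensity δ s))
    ; q₁ = q₁ ; q = proj₁ bads
    ; 1≤m₀ = ℕₚ.≤-trans (ℕ.s≤s ℕ.z≤n) 16≤m₀
    ; m₀-large = ℚₚ.≤-trans (inv-anti {fromℕ 16} (fromℕ>0 15) (fromℕ-mono 16≤m₀)) (ℚₚ.≤-reflexive (sym (inv-unique {fromℕ 16} {1/16} (fromℕ>0 15) (cong (_* 1/16) (fromℕ≡toℚ 16)))))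
    ; few-misses = ≤1/32 (proj₂ misses (suc q₁) (ℕₚ.≤-trans (ℕₚ.m≤n+m (proj₁ misses) lower) (ℕₚ.n≤1+n q₁)))
    ; few-bad = ≤1/32 (ℚₚ.≤-trans (ℚₚ.≤-reflexive (ring (fromℕ 32) (fromℕ m₀) (fromℕ g) (miss ^ℚ proj₁ bads))) (proj₂ bads (proj₁ bads) ℕₚ.≤-refl))
    ; d = d ; r = r ; tailSize = tailSize
    ; d≥1 = λ m h → beyond d≥1 m (ℕₚ.≤-trans (ℕₚ.≤-trans (ℕₚ.m≤m+n (threshold d≥1) _) lower≤m₀) (ℕₚ.<⇒≤ h))
    ; d≤r = λ m _ → d≤r m
    ; r+d = λ m _ → ℕₚ.m∸n+n≡m (d≤m m)
    ; r-large = r-large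
    ; c = c ; γ = e ; θ = θ ; 0≤c = 0≤c ; 0≤γ = 0≤e ; 0≤θ = 0≤θ
    ; tailSize≤γm = tailSize≤
    ; tailSize≤m = λ m → ℕₚ.≤-trans (tailSize≤d m) (d≤m m)
    ; tailSize≤d = λ m → ℕₚ.≤-trans (tailSize≤d m) (ℕₚ.n≤1+n (d m))
    ; tail-ratio = tail-ratio
    ; tail-small = tail-small′
    ; M = ℓ ℕ.+ (s ℕ.+ s) ℕ.+ (m₀ ℕ.+ (s ℕ.+ (g ℕ.* (proj₁ bads ℕ.* (ℓ ℕ.+ (s ℕ.+ s))) ℕ.+ s)))
    ; M-bound = ℕₚ.≤-refl
    }
    where
    ring : ∀ k m g x → k * (m * (g * x * (1ℚ + 1ℚ))) ≡ k * (m * (g * (1ℚ + 1ℚ))) * x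
    ring = solve-∀ ℚ-ring
    tail-small′ : ∀ m → m₀ ℕ.< m → θ ^ℚ tailSize m ≤ℚ tailBound m
    tail-small′ (suc m) h = beyond tail-small m (ℕₚ.≤-trans (ℕₚ.≤-trans (ℕₚ.m≤m+n (threshold tail-small) 16) (ℕₚ.≤-trans (ℕₚ.m≤n+m _ (threshold d≥1)) lower≤m₀)) (ℕₚ.≤-pred h))

  dense : ∀ X → 0ℚ ≤ℚ X → Eventually (λ n → (1ℚ - δ) * fromℕ n ≤ℚ c * (fromℕ n - X - e * fromℕ n))
  dense X 0≤X = eventually (threshold G) λ n h → ≤-by (ring (1ℚ - δ) e (fromℕ n) X)
      (+-nonneg (diff≥0 (beyond G n h)) (+-nonneg (*-nonneg (diff≥0 c≤1) 0≤X) (*-nonneg (diff≥0 c≤1) (*-nonneg 0≤e (fromℕ≥0 n)))))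
    where
    G = linear-growth X 0<e
    ring : ∀ b e n X → (b + (1ℚ + 1ℚ) * e) * (n - X - e * n) - b * n
      ≡ (e * n - X) + ((1ℚ - (b + (1ℚ + 1ℚ) * e)) * X + (1ℚ - (b + (1ℚ + 1ℚ) * e)) * (e * n))
    ring = solve-∀ ℚ-ring

-- Conclusion: from walks with density δ₁ to the bound with δ - ε

between : ∀ {a b c} → a < c → b < c → ∃ λ x → a < x × b < x × x < c
between {a} {b} p q with ℚₚ.≤-total a b
... | inj₁ a≤b = let (x , l , u) = ℚₚ.<-dense q in x , ℚₚ.≤-<-trans a≤b l , l , u
... | inj₂ b≤a = let (x , l , u) = ℚₚ.<-dense p in x , l , ℚₚ.≤-<-trans b≤a l , u

degree-fromℕ : ∀ {k n} s δ (G : Hypergraph k n) → ((S : Subset n) → ∣ S ∣ ≡ s → δ * toℚ n ≤ℚ toℚ (degree G S)) →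
  (S : Subset n) → ∣ S ∣ ≡ s → δ * fromℕ n ≤ℚ fromℕ (degree G S)
degree-fromℕ {n = n} s δ G h S e = subst₂ (λ a b → δ * a ≤ℚ b) (sym (fromℕ≡toℚ n)) (sym (fromℕ≡toℚ (degree G S))) (h S e)

theorem1p7 : (k : ℕ) → 2 ≤ k → (δ : ℚ) → ½ < δ →
    (ε : ℚ) → 0ℚ < ε → ε < δ →
    Σ ℕ (λ n₀ → (n : ℕ) → n₀ ≤ n → (G : Hypergraph k n) →
    ((S : Subset n) → ∣ S ∣ ≡ k ∸ 1 → δ * toℚ n ≤ℚ toℚ (degree G S)) →
    ((δ - ε) ^ℚ n) * toℚ (n !) ≤ℚ numTightHamCycles G)
theorem1p7 (suc (suc κ)) (ℕ.s≤s (ℕ.s≤s ℕ.z≤n)) δ ½<δ ε 0<ε ε<δ with δ ℚ.≤? 1ℚ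
-- No degree exceeds n, so for δ > 1 the degree condition fails as soon as a (k - 1)-set exists.
... | no δ≰1 = suc (suc κ) , λ n n₀≤n G h → ⊥-elim (δ≰1 (minDegree≤1 {s = suc κ} G δ (ℕₚ.≤-trans (ℕₚ.n≤1+n (suc κ)) n₀≤n) (ℕₚ.≤-trans (ℕ.s≤s ℕ.z≤n) n₀≤n) (degree-fromℕ (suc κ) δ G h)))
... | yes δ≤1 = n₀ , λ n n₀≤n G h → subst (λ t → ((δ - ε) ^ℚ n) * t ≤ℚ numTightHamCycles G) (fromℕ≡toℚ (n !)) (bound n n₀≤n G (degree-fromℕ (suc κ) δ G h))
  where
  choice = between ½<δ (<-by {δ - ε} {δ} (ring δ ε) 0<ε)
    where
    ring : ∀ d e → d - (d - e) ≡ e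
    ring = solve-∀ ℚ-ring
  δ₁ = proj₁ choice
  ½<δ₁ : ½ < δ₁
  ½<δ₁ = proj₁ (proj₂ choice)
  δ-ε<δ₁ : δ - ε < δ₁
  δ-ε<δ₁ = proj₁ (proj₂ (proj₂ choice))
  δ₁<δ : δ₁ < δ
  δ₁<δ = proj₂ (proj₂ (proj₂ choice))
  0<½ : 0ℚ < ½
  0<½ = from-yes (0ℚ ℚₚ.<? ½)
  0<δ = ℚₚ.<-trans 0<½ ½<δ
  0<δ₁ = ℚₚ.<-trans 0<½ ½<δ₁
  double : ∀ {x} → ½ < x → 1ℚ < 2ℚ * x
  double {x} h = subst₂ _<_ refl (ring x) (ℚₚ.+-mono-< h h)
    where
    ring : ∀ x → x + x ≡ (1ℚ + 1ℚ) * x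
    ring = solve-∀ ℚ-ring
  0<2δ-1 : 0ℚ < 2ℚ * δ - 1ℚ
  0<2δ-1 = diff>0 (double ½<δ)
  δ₁≤1 : δ₁ ≤ℚ 1ℚ
  δ₁≤1 = ℚₚ.≤-trans (ℚₚ.<⇒≤ δ₁<δ) δ≤1
  module C = Parameters κ δ δ₁ δ≤1 0<2δ-1 0<δ (ℚₚ.<⇒≤ (double ½<δ₁)) δ₁<δ
  K = C.constants
  M = Constants.M K
  m₀ = Constants.m₀ K
  E = m₀ ℕ.+ m₀ ℕ.+ M
  k = suc (suc κ)
  -- The polynomial losses are absorbed by the ratio x = (δ − ε) / δ₁ < 1.
  x = (δ - ε) * inv δ₁
  0≤x : 0ℚ ≤ℚ x
  0≤x = *-nonneg (diff≥0 (ℚₚ.<⇒≤ ε<δ)) (inv≥0 0<δ₁)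
  xδ₁ : x * δ₁ ≡ δ - ε
  xδ₁ = trans (ring (δ - ε) (inv δ₁) δ₁) (trans (cong ((δ - ε) *_) (*-inv 0<δ₁)) (ℚₚ.*-identityʳ (δ - ε)))
    where
    ring : ∀ a i b → a * i * b ≡ a * (b * i)
    ring = solve-∀ ℚ-ring
  x<1 : x < 1ℚ
  x<1 = ℚₚ.≰⇒> λ 1≤x → ℚₚ.<-irrefl refl (ℚₚ.<-≤-trans δ-ε<δ₁ (subst₂ _≤ℚ_ (ℚₚ.*-identityˡ δ₁) xδ₁ (*-monoʳ (ℚₚ.<⇒≤ 0<δ₁) 1≤x)))
  -- 256 = 2 · 2 · 64: a cycle has 2n orderings, `many-cycles` has a factor 2, and 64 is the
  -- reciprocal of ⅛ * ⅛. The n in 2n raises the exponent to E + 1.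
  E₁ = decay (suc E) (fromℕ 256) x (fromℕ≥0 256) 0≤x x<1
  E₂ = linear-growth (fromℕ (M ℕ.* (M ℕ.+ M))) (Constants.0<c₀ K)
  E₃ = C.dense (fromℕ (M ℕ.+ suc κ)) (fromℕ≥0 (M ℕ.+ suc κ))
  n₀ : ℕ
  n₀ = proj₁ E₁ ℕ.+ (threshold E₂ ℕ.+ (threshold E₃ ℕ.+ (M ℕ.+ (M ℕ.+ (m₀ ℕ.+ m₀)) ℕ.+ k)))
  bound : (n : ℕ) → n₀ ℕ.≤ n → (G : Hypergraph k n) → ((S : Subset n) → ∣ S ∣ ≡ suc κ → δ * fromℕ n ≤ℚ fromℕ (degree G S)) →
    ((δ - ε) ^ℚ n) * fromℕ (n !) ≤ℚ numTightHamCycles G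
  bound zero n₀≤n G h = ⊥-elim (ℕₚ.1+n≰n (ℕₚ.≤-trans (ℕₚ.≤-trans (ℕ.s≤s ℕ.z≤n) (ℕₚ.≤-trans (ℕₚ.m≤n+m k (M ℕ.+ (M ℕ.+ (m₀ ℕ.+ m₀)))) (ℕₚ.≤-trans (ℕₚ.m≤n+m _ (threshold E₃)) (ℕₚ.≤-trans (ℕₚ.m≤n+m _ (threshold E₂)) (ℕₚ.m≤n+m _ (proj₁ E₁)))))) n₀≤n))
  bound n@(suc n-1) n₀≤n G h = *-cancelˡ {fromℕ (2 ℕ.* n)} (fromℕ>0 (n-1 ℕ.+ (n ℕ.+ 0))) (ℚₚ.≤-trans chain′ (ℚₚ.≤-trans (orderings-bound G k≤n) (ℚₚ.≤-reflexive (sym (fraction (numTightOrderings G) (n-1 ℕ.+ (n ℕ.+ 0)))))))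
    where
    rest₃ : threshold E₃ ℕ.+ (M ℕ.+ (M ℕ.+ (m₀ ℕ.+ m₀)) ℕ.+ k) ℕ.≤ n
    rest₃ = ℕₚ.≤-trans (ℕₚ.≤-trans (ℕₚ.m≤n+m _ (threshold E₂)) (ℕₚ.m≤n+m _ (proj₁ E₁))) n₀≤n
    rest₄ : M ℕ.+ (M ℕ.+ (m₀ ℕ.+ m₀)) ℕ.+ k ℕ.≤ n
    rest₄ = ℕₚ.≤-trans (ℕₚ.m≤n+m _ (threshold E₃)) rest₃
    k≤n : k ℕ.≤ n
    k≤n = ℕₚ.≤-trans (ℕₚ.m≤n+m k (M ℕ.+ (M ℕ.+ (m₀ ℕ.+ m₀)))) rest₄
    D : Graph.Connecting.Dirac n δ 0<δ 0<2δ-1 (suc κ) (edge G)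
    D = record { P-↭ = edge-↭ G ; codegree = edge-degree G δ δ≤1 h }
    O : ℚ
    O = Sequences.∑ⁿ n n (𝟙 ∘ hamiltonian G)
    0≤O : 0ℚ ≤ℚ O
    0≤O = Sequences.∑ⁿ-nonneg n n (λ X → 𝟙≥0 (hamiltonian G X))
    N = fromℕ n
    t = fromℕ (n !)
    many : ⅛ * ⅛ * t * (δ₁ ^ℚ n) ≤ℚ 2ℚ * (N ^ℚ E) * O
    many = Graph.Assembly.many-cycles n κ δ δ₁ 0<δ 0<2δ-1 0<δ₁ δ₁≤1 K (edge G) D (ℕ.s≤s ℕ.z≤n) (beyond E₂ n (ℕₚ.≤-trans (ℕₚ.≤-trans (ℕₚ.m≤m+n (threshold E₂) _) (ℕₚ.m≤n+m _ (proj₁ E₁))) n₀≤n))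
      (ℕₚ.≤-trans (ℕₚ.m≤m+n _ k) rest₄) (beyond E₃ n (ℕₚ.≤-trans (ℕₚ.m≤m+n (threshold E₃) _) rest₃))
    absorbed : fromℕ 256 * (N ^ℚ suc E) * (x ^ℚ n) ≤ℚ 1ℚ
    absorbed = ℚₚ.≤-trans (*-monoʳ (^ℚ-nonneg n 0≤x) (*-monoˡ (fromℕ≥0 256) (^ℚ-mono (suc E) (fromℕ≥0 n) (fromℕ-mono (ℕₚ.n≤1+n n)))))
      (proj₂ E₁ n (ℕₚ.≤-trans (ℕₚ.m≤m+n (proj₁ E₁) _) n₀≤n))
    chain′ : fromℕ (2 ℕ.* n) * (((δ - ε) ^ℚ n) * t) ≤ℚ O
    chain′ = ℚₚ.≤-trans (ℚₚ.≤-reflexive (trans (cong₂ (λ u v → u * (v * t)) (trans (fromℕ-* 2 n) (cong (_* fromℕ n) (fromℕ≡toℚ 2))) (trans (cong (_^ℚ n) (sym xδ₁)) (^ℚ-distrib x δ₁ n)))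
        (ring₁ (fromℕ 64) ⅛ N (x ^ℚ n) (δ₁ ^ℚ n) t (cong (_* (⅛ * ⅛)) (fromℕ≡toℚ 64)))))
      (ℚₚ.≤-trans (*-monoˡ (*-nonneg (*-nonneg (*-nonneg {2ℚ} (from-yes (0ℚ ℚₚ.≤? 2ℚ)) (fromℕ≥0 n)) (fromℕ≥0 64)) (^ℚ-nonneg n 0≤x)) many)
        (ℚₚ.≤-trans (ℚₚ.≤-reflexive (ring₂ (fromℕ 64) (fromℕ 256) N (x ^ℚ n) (N ^ℚ E) O (trans (cong (λ s → 2ℚ * (2ℚ * s)) (fromℕ≡toℚ 64)) (sym (fromℕ≡toℚ 256))))) (ℚₚ.≤-trans (*-monoʳ 0≤O absorbed) (ℚₚ.≤-reflexive (ℚₚ.*-identityˡ O)))))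
      where
      ring₁ : ∀ s e N x d t → s * (e * e) ≡ 1ℚ → 2ℚ * N * ((x * d) * t) ≡ 2ℚ * N * s * x * (e * e * t * d)
      ring₁ s e N x d t h = trans (ring N x d t) (trans (cong (λ u → u * ((1ℚ + 1ℚ) * N * x * (t * d))) (sym h)) (ring′ s e N x d t))
        where
        ring : ∀ N x d t → (1ℚ + 1ℚ) * N * ((x * d) * t) ≡ 1ℚ * ((1ℚ + 1ℚ) * N * x * (t * d))
        ring = solve-∀ ℚ-ring
        ring′ : ∀ s e N x d t → s * (e * e) * ((1ℚ + 1ℚ) * N * x * (t * d)) ≡ (1ℚ + 1ℚ) * N * s * x * (e * e * t * d)
        ring′ = solve-∀ ℚ-ring
      ring₂ : ∀ s b N x y O → 2ℚ * (2ℚ * s) ≡ b → 2ℚ * N * s * x * (2ℚ * y * O) ≡ b * (N * y) * x * O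
      ring₂ s b N x y O refl = ring N s x y O
        where
        ring : ∀ N s x y O → (1ℚ + 1ℚ) * N * s * x * ((1ℚ + 1ℚ) * y * O) ≡ (1ℚ + 1ℚ) * ((1ℚ + 1ℚ) * s) * (N * y) * x * O
        ring = solve-∀ ℚ-ring
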